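{- Let $k\ge1$. Let $G_{k,k}(l,m,n)$ be the number of lattice paths (as described in the context) with major index $n$ satisfying the special $(k,k)$-conditions, whose sum of relative heights of peaks is $m$ and whose full lower even peak parity index is $l$. Let $T_{k,k}(l,m,n)$ be the number of overpartitions of $n$ counted by $\overline{B}_{k,k}(n)$ which have $m$ parts and whose full lower even cluster parity index is $l$. Then $G_{k,k}(l,m,n)=T_{k,k}(l,m,n)$ for all $l,m,n\ge0$, and \[ \sum_{l,m,n\ge0}G_{k,k}(l,m,n)y^lx^mq^n=\sum_{N_1\geq\cdots\geq N_{k-1}\geq0} \frac{q^{\frac{(N_1+1)N_1}{2}+N_2^2+\cdots+N_{k-1}^2}(-q)_{N_1-1}(1+q^{N_k})\,x^{N_1+\cdots+N_{k-1}}\,(-yq)_{n_1}(-yq)_{n_2}\cdots(-yq)_{n_{k-1}}}{(q^2;q^2)_{n_1}\cdots(q^2;q^2)_{n_{k-1}}}, \] where $N_k=0$ and $n_i=N_i-N_{i+1}$ for $1\le i\le k-1$.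
   Context: Notation: $(a;q)_n=\prod_{i=0}^{n-1}(1-aq^i)$, $(a)_n=(a;q)_n$; for negative $n$, $(a;q)_n=(a;q)_\infty/(aq^n;q)_\infty$ (so $(-q)_{ -1}=1/2$). Lattice paths: paths in the first quadrant starting on the $y$-axis and ending on the $x$-axis, using unit steps NE $(x,y)\to(x+1,y+1)$, SE $(x,y)\to(x+1,y-1)$, N $(x,y-1)\to(x,y)$, and E $(x,0)\to(x+1,0)$ (E steps only at height $0$). Height = $y$-coordinate, weight = $x$-coordinate. A peak is a vertex preceded by an NE step (NESE peak) or an N step (NSE peak) and followed by an SE step. Paths are empty or end with an SE step; as stated in the paper, if the leftmost peak is an NSE peak, the path must start with an NE step, except when it starts at $(0,0)$ with an E step. Major index = sum of weights of peaks. Special $(k,a)$-conditions: start at height $k-a$, all heights $<k$. The relative height of a peak $(x,y)$ is the largest integer $h$ for which there are two vertices $(x',y-h)$ and $(x'',y-h)$ with $x'\le x<x''$ such that between them there is no peak of height $>y$ and every peak of height $y$ has abscissa $\ge x$. $W(x)$ is the number of NSE peaks with weight $\le x$. A peak of relative height $r$ and weight $x$ is even if $x-r-W(x)$ is odd, odd otherwise. The lower even $r$-peak parity index of a path is the number of parity changes in the sequence of parities of the peaks of relative height $r$ read from left to right, where the sequence is preceded by "even" if the path's leftmost peak is an NSE peak and by "odd" otherwise. The full lower even peak parity index of a path satisfying the special $(k,k)$-conditions is the sum over $r=1,\dots,k-1$ of its lower even $r$-peak parity indices. Overpartitions: non-increasing sequences of positive integers where the first occurrence of each integer may be overlined. $\overline{B}_{k,k}(n)$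 counts overpartitions $\lambda_1+\cdots+\lambda_s$ of $n$ in which $1$ occurs as a non-overlined part at most $k-1$ times and $\lambda_j-\lambda_{j+k-1}\ge1$ if $\lambda_j$ is overlined, $\ge2$ otherwise. $V_\lambda(l)$ is the number of overlined parts $\le l$. Gordon marking: assign positive integer marks to the parts in the order $\overline1<1<\overline2<2<\cdots$, each mark as small as possible subject to: if $\overline{j+1}$ is not a part, then all parts $j,\overline j,j+1$ receive different marks; if $\overline{j+1}$ is a part, then the smallest mark assigned to a part $j$ or $\overline j$ may be used as the mark of $j+1$ or $\overline{j+1}$. An $r$-cluster is a sub-partition $\lambda_{i_1}\le\cdots\le\lambda_{i_r}$ with $\lambda_{i_j}$ $j$-marked, $\lambda_{i_{j+1}}-\lambda_{i_j}\le1$, and no $(r+1)$-marked part equal to $\lambda_{i_r}$ or $\lambda_{i_r}+1$. The (left) cluster decomposition partitions the parts into clusters by decomposing from left (smallest) to right, making each cluster as long as possible, each part in exactly one cluster. For an $r$-cluster whose smallest ($1$-marked) part is $l$, its parity is the opposite of the parity of (number of even parts in the cluster) $-V_\lambda(l)$. The lower even $r$-cluster parity index is the number of parity changes in the left-to-right sequence of parities of $r$-clusters, preceded by "even" if the first cluster contains an overlined part and by "odd" otherwise; the full lower even cluster parity index is the sum over $r=1,\dots,k-1$.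
   Formalization: Lattice paths are corrected: every N step must be followed at once by an SE step, and if the leftmost peak is an NSE peak the path must start with an E step (starting with NE is not allowed); as literally described, the claim fails for k ≥ 3. -}

module Defs where

open import Data.Nat using (ℕ; zero; suc; _+_; _*_; _∸_; _≤_; _≡ᵇ_; _<ᵇ_; _≤ᵇ_; _⊓_)
open import Data.Nat.DivMod using (_/_; _%_)
open import Data.Bool using (Bool; true; false; _∧_; _∨_; not; if_then_else_; _xor_; T)
open import Data.Nat.ListAction using (sum)
open import Data.List using (List; []; _∷_; [_]; _++_; map; foldr; length; upTo;
  filterᵇ; findᵇ; drop; concatMap)
open import Data.Bool.ListAction using (any; all)
open import Data.List.Relation.Unary.Unique.Propositional using (Unique)
open import Data.List.Membership.Propositional using (_∈_)
open import Data.Maybe using (Maybe; just; nothing)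
open import Data.Product using (_×_; _,_; proj₁; proj₂)
open import Data.Integer using (ℤ; +_; _-_; ∣_∣)
open import Relation.Binary.PropositionalEquality using (_≡_)

record HasCount {A : Set} (P : A → Set) (c : ℕ) : Set where
  field
    elems    : List A
    distinct : Unique elems
    sound    : ∀ {a} → a ∈ elems → P a
    complete : ∀ {a} → P a → a ∈ elems
    size     : length elems ≡ c

oddℤ : ℤ → Bool
oddℤ z = (∣ z ∣ % 2) ≡ᵇ 1

-- number of parity changes in a sequence of parities (true = even,
-- false = odd) which is preceded by the parity b
changes : Bool → List Bool → ℕ
changes b []       = 0
changes b (c ∷ cs) = (if b xor c then 1 else 0) + changes c cs

oneTo : ℕ → List ℕ
oneTo n = map suc (upTo n)

count : {A : Set} → (A → Bool) → List A → ℕ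
count p xs = length (filterᵇ p xs)

data Step : Set where
  NE SE N E : Step

isSE : Step → Bool
isSE SE = true
isSE _  = false

isN : Step → Bool
isN N = true
isN _ = false

isE : Step → Bool
isE E = true
isE _ = false

isUp : Step → Bool
isUp NE = true
isUp N  = true
isUp _  = false

startsWithSE : List Step → Bool
startsWithSE (SE ∷ _) = true
startsWithSE _        = false

startsWithE : List Step → Bool
startsWithE (E ∷ _) = true
startsWithE _       = false

emptyOrEndsSE : List Step → Bool
emptyOrEndsSE []              = true
emptyOrEndsSE (s ∷ [])        = isSE s
emptyOrEndsSE (_ ∷ t ∷ r)     = emptyOrEndsSE (t ∷ r)

walkOK : ℕ → ℕ → List Step → Bool
walkOK k y       []       = y ≡ᵇ 0
walkOK k y       (NE ∷ s) = (suc y <ᵇ k) ∧ walkOK k (suc y) s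
walkOK k zero    (SE ∷ s) = false
walkOK k (suc y) (SE ∷ s) = walkOK k y s
walkOK k y       (N ∷ s)  = (suc y <ᵇ k) ∧ startsWithSE s ∧ walkOK k (suc y) s
walkOK k y       (E ∷ s)  = (y ≡ᵇ 0) ∧ walkOK k y s

move : Step → ℕ × ℕ → ℕ × ℕ
move NE (x , y) = (suc x , suc y)
move SE (x , y) = (suc x , y ∸ 1)
move N  (x , y) = (x , suc y)
move E  (x , y) = (suc x , y)

record Vertex : Set where
  constructor vtx
  field
    vidx vx vy : ℕ
open Vertex public

verticesFrom : ℕ → ℕ × ℕ → List Step → List Vertex
verticesFrom i (x , y) []      = [ vtx i x y ]
verticesFrom i (x , y) (s ∷ r) = vtx i x y ∷ verticesFrom (suc i) (move s (x , y)) r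

-- all paths start on the y-axis; under the special (k,k)-conditions the
-- starting height is k - k = 0, i.e. the path starts at (0,0)
vertices : List Step → List Vertex
vertices = verticesFrom 0 (0 , 0)

record Peak : Set where
  constructor peak
  field
    pidx wt ht : ℕ
    nse        : Bool
open Peak public

peaksFrom : ℕ → ℕ × ℕ → List Step → List Peak
peaksFrom i v []                    = []
peaksFrom i v (s ∷ [])              = []
peaksFrom i v (s ∷ rest@(t ∷ r)) =
  if isUp s ∧ isSE t
  then peak (suc i) (proj₁ (move s v)) (proj₂ (move s v)) (isN s)
       ∷ peaksFrom (suc i) (move s v) rest
  else peaksFrom (suc i) (move s v) rest

peaks : List Step → List Peak
peaks = peaksFrom 0 (0 , 0)

validPathKK : ℕ → List Step → Bool
validPathKK k p =
  walkOK k 0 p ∧ emptyOrEndsSE p ∧ leftmostRule (peaks p)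
  where
  leftmostRule : List Peak → Bool
  leftmostRule []      = true
  leftmostRule (q ∷ _) = not (nse q) ∨ startsWithE p

majorIndex : List Step → ℕ
majorIndex p = sum (map wt (peaks p))

relGood : List Step → Peak → ℕ → Bool
relGood p q h =
  (h ≤ᵇ ht q) ∧
  any (λ a → (vidx a ≤ᵇ pidx q) ∧ (vy a ≡ᵇ (ht q ∸ h)) ∧ (vx a ≤ᵇ wt q) ∧
    any (λ b → (pidx q ≤ᵇ vidx b) ∧ (vy b ≡ᵇ (ht q ∸ h)) ∧ (wt q <ᵇ vx b) ∧
      all (λ q' → not ((vidx a <ᵇ pidx q') ∧ (pidx q' <ᵇ vidx b))
                  ∨ (ht q' <ᵇ ht q)
                  ∨ ((ht q' ≡ᵇ ht q) ∧ (wt q ≤ᵇ wt q')))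
          (peaks p))
      (vertices p))
    (vertices p)

largest : (ℕ → Bool) → ℕ → ℕ
largest P zero    = 0
largest P (suc n) = if P (suc n) then suc n else largest P n

-- relative height of a peak (it is at most the height of the peak,
-- since vertices have non-negative height)
relHeight : List Step → Peak → ℕ
relHeight p q = largest (relGood p q) (ht q)

sumRelHeights : List Step → ℕ
sumRelHeights p = sum (map (relHeight p) (peaks p))

Wcount : List Step → ℕ → ℕ
Wcount p x = count (λ q → nse q ∧ (wt q ≤ᵇ x)) (peaks p)

peakEven : List Step → Peak → Bool
peakEven p q = oddℤ ((+ wt q) - (+ relHeight p q) - (+ Wcount p (wt q)))

pathStartParity : List Step → Bool
pathStartParity p with peaks p
... | []      = false
... | (q ∷ _) = nse q

pathRIndex : List Step → ℕ → ℕ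
pathRIndex p r =
  changes (pathStartParity p)
          (map (peakEven p) (filterᵇ (λ q → relHeight p q ≡ᵇ r) (peaks p)))

pathFullIndex : ℕ → List Step → ℕ
pathFullIndex k p = sum (map (pathRIndex p) (oneTo (k ∸ 1)))

GPath : ℕ → ℕ → ℕ → ℕ → List Step → Set
GPath k l m n p =
  T (validPathKK k p) × majorIndex p ≡ n × sumRelHeights p ≡ m × pathFullIndex k p ≡ l

Part : Set
Part = ℕ × Bool

val : Part → ℕ
val = proj₁

ovl : Part → Bool
ovl = proj₂

-- an overpartition λ₁ ≥ λ₂ ≥ … is stored as the list [λ₁, λ₂, …]:
-- positive parts, non-increasing, and among equal values only the first
-- occurrence may be overlined
ovpOK : List Part → Bool
ovpOK []                 = true
ovpOK (p ∷ [])           = 1 ≤ᵇ val p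
ovpOK (p ∷ rest@(q ∷ r)) =
  (1 ≤ᵇ val p) ∧ ((val q <ᵇ val p) ∨ ((val q ≡ᵇ val p) ∧ not (ovl q))) ∧ ovpOK rest

IsOverpartitionOf : ℕ → List Part → Set
IsOverpartitionOf n λs = T (ovpOK λs) × sum (map val λs) ≡ n

diffOK : ℕ → List Part → Bool
diffOK k []        = true
diffOK k (p ∷ r)   = headCond (drop (k ∸ 1) (p ∷ r)) ∧ diffOK k r
  where
  headCond : List Part → Bool
  headCond []      = true
  headCond (q ∷ _) = (val q + (if ovl p then 1 else 2)) ≤ᵇ val p

inBkk : ℕ → List Part → Bool
inBkk k λs = (count (λ p → (val p ≡ᵇ 1) ∧ not (ovl p)) λs ≤ᵇ (k ∸ 1)) ∧ diffOK k λs

-- parts tagged with their position in the list (to distinguish copies)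
record MPart : Set where
  constructor mpart
  field
    tag  : ℕ
    mval : ℕ
    movl : Bool
    mark : ℕ
open MPart public

tagParts : ℕ → List Part → List MPart
tagParts i []      = []
tagParts i (p ∷ r) = mpart i (val p) (ovl p) 0 ∷ tagParts (suc i) r

before : MPart → MPart → Bool
before p q = (mval p <ᵇ mval q) ∨ ((mval p ≡ᵇ mval q) ∧ movl p ∧ not (movl q))

insertOrd : MPart → List MPart → List MPart
insertOrd x []       = [ x ]
insertOrd x (y ∷ ys) = if before x y then x ∷ y ∷ ys else y ∷ insertOrd x ys

increasing : List Part → List MPart
increasing λs = foldr insertOrd [] (tagParts 0 λs)

elemᵇ : ℕ → List ℕ → Bool
elemᵇ m = any (λ x → x ≡ᵇ m)

leastFree : List ℕ → ℕ
leastFree fs = go (suc (length fs)) 1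
  where
  go : ℕ → ℕ → ℕ
  go zero    c = c
  go (suc f) c = if elemᵇ c fs then go f (suc c) else c

removeOne : ℕ → List ℕ → List ℕ
removeOne m []       = []
removeOne m (x ∷ xs) = if x ≡ᵇ m then xs else x ∷ removeOne m xs

dropMin : List ℕ → List ℕ
dropMin []       = []
dropMin (x ∷ xs) = removeOne (foldr _⊓_ x xs) (x ∷ xs)

markOne : List Part → List MPart → MPart → MPart
markOne λs done x = mpart (tag x) (mval x) (movl x) (leastFree forbidden)
  where
  v : ℕ
  v = mval x
  hasBar : Bool
  hasBar = any (λ p → (val p ≡ᵇ v) ∧ ovl p) λs
  same prev : List ℕ
  same = map mark (filterᵇ (λ d → mval d ≡ᵇ v) done)
  prev = map mark (filterᵇ (λ d → suc (mval d) ≡ᵇ v) done)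
  forbidden : List ℕ
  forbidden = same ++ (if hasBar then dropMin prev else prev)

markAll : List Part → List MPart → List MPart → List MPart
markAll λs done []       = done
markAll λs done (x ∷ xs) = markAll λs (done ++ [ markOne λs done x ]) xs

gordon : List Part → List MPart
gordon λs = markAll λs [] (increasing λs)

removeTag : ℕ → List MPart → List MPart
removeTag t []       = []
removeTag t (x ∷ xs) = if tag x ≡ᵇ t then xs else x ∷ removeTag t xs

-- extend a cluster whose current length is r and whose last part has
-- value v by (r+1)-marked parts of value v or v+1, as long as possible
-- (always taking the leftmost, i.e. smallest, candidate).
-- Returns the added parts and the remaining parts.
extend : ℕ → ℕ → ℕ → List MPart → List MPart × List MPart
extend zero    r v rem = ([] , rem)
extend (suc f) r v rem with findᵇ (λ q → (mark q ≡ᵇ suc r) ∧ ((mval q ≡ᵇ v) ∨ (mval q ≡ᵇ suc v))) rem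
... | nothing = ([] , rem)
... | just q with extend f (suc r) (mval q) (removeTag (tag q) rem)
...   | (more , rem') = (q ∷ more , rem')

decomp : ℕ → List MPart → List (List MPart)
decomp zero    rem = []
decomp (suc f) rem with findᵇ (λ q → mark q ≡ᵇ 1) rem
... | nothing = []
... | just q with extend (length rem) 1 (mval q) (removeTag (tag q) rem)
...   | (more , rem') = (q ∷ more) ∷ decomp f rem'

clusters : List Part → List (List MPart)
clusters λs = decomp (length λs) (gordon λs)

Vcount : List Part → ℕ → ℕ
Vcount λs l = count (λ p → ovl p ∧ (val p ≤ᵇ l)) λs

isEvenℕ : ℕ → Bool
isEvenℕ a = (a % 2) ≡ᵇ 0

clusterEven : List Part → List MPart → Bool
clusterEven λs []      = false
clusterEven λs (q ∷ c) =
  oddℤ ((+ count (λ x → isEvenℕ (mval x)) (q ∷ c)) - (+ Vcount λs (mval q)))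

clusterStartParity : List (List MPart) → Bool
clusterStartParity []      = false
clusterStartParity (c ∷ _) = any movl c

clusterRIndex : List Part → ℕ → ℕ
clusterRIndex λs r =
  changes (clusterStartParity (clusters λs))
          (map (clusterEven λs) (filterᵇ (λ c → length c ≡ᵇ r) (clusters λs)))

clusterFullIndex : ℕ → List Part → ℕ
clusterFullIndex k λs = sum (map (clusterRIndex λs) (oneTo (k ∸ 1)))

TOvp : ℕ → ℕ → ℕ → ℕ → List Part → Set
TOvp k l m n λs =
  IsOverpartitionOf n λs × T (inBkk k λs) × length λs ≡ m × clusterFullIndex k λs ≡ l

-- Formal power series in y and q with coefficients in ℕ:
-- S a b = coefficient of y^a q^b

Series : Set
Series = ℕ → ℕ → ℕ

sumTo : ℕ → (ℕ → ℕ) → ℕ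
sumTo n f = sum (map f (upTo (suc n)))

_⊕_ : Series → Series → Series
(f ⊕ g) a b = f a b + g a b

_⊛_ : Series → Series → Series
(f ⊛ g) a b = sumTo a (λ i → sumTo b (λ j → f i j * g (a ∸ i) (b ∸ j)))

mono : ℕ → ℕ → Series
mono i j a b = if (a ≡ᵇ i) ∧ (b ≡ᵇ j) then 1 else 0

one : Series
one = mono 0 0

prodS : List Series → Series
prodS = foldr _⊛_ one

-- 1 / (1 - q^{2(j+1)}) = Σ_{c ≥ 0} q^{2(j+1)c}
invOneMinusQ2 : ℕ → Series
invOneMinusQ2 j zero    b = if (b % (2 * suc j)) ≡ᵇ 0 then 1 else 0
invOneMinusQ2 j (suc a) b = 0

negYQPoch : ℕ → Series
negYQPoch n = prodS (map (λ i → one ⊕ mono 1 i) (oneTo n))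

negQPoch : ℕ → Series
negQPoch n = prodS (map (λ i → one ⊕ mono 0 i) (oneTo n))

invQ2Poch : ℕ → Series
invQ2Poch n = prodS (map invOneMinusQ2 (upTo n))

-- (-q)_{N₁-1} (1 + q^{N_k}) with N_k = 0, i.e. (-q)_{N₁-1} · (1 + q⁰);
-- for N₁ = 0 this is (-q)_{-1} · 2 = (1/2) · 2 = 1.
leadFactor : ℕ → Series
leadFactor zero    = one
leadFactor (suc j) = negQPoch j ⊛ (one ⊕ mono 0 0)

headOr0 : List ℕ → ℕ
headOr0 []      = 0
headOr0 (x ∷ _) = x

diffs : List ℕ → List ℕ
diffs []                 = []
diffs (a ∷ [])           = []
diffs (a ∷ rest@(b ∷ r)) = (a ∸ b) ∷ diffs rest

-- the summand for (N₁,…,N_{k-1}), with the factor x^{N₁+⋯+N_{k-1}}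
-- removed (it is accounted for in rhsCoef)
rhsTerm : List ℕ → Series
rhsTerm Ns =
  mono 0 ((suc N₁ * N₁) / 2 + sum (map (λ a → a * a) (drop 1 Ns)))
  ⊛ (leadFactor N₁
  ⊛ (prodS (map negYQPoch ns)
  ⊛ prodS (map invQ2Poch ns)))
  where
  Ns' : List ℕ              -- N₁, …, N_{k-1}, N_k = 0
  Ns' = Ns ++ [ 0 ]
  N₁ : ℕ
  N₁ = headOr0 Ns'
  ns : List ℕ
  ns = diffs Ns'

listsUpTo : ℕ → ℕ → List (List ℕ)
listsUpTo zero    b = [ [] ]
listsUpTo (suc n) b = concatMap (λ x → map (x ∷_) (listsUpTo n b)) (upTo (suc b))

nonIncreasing : List ℕ → Bool
nonIncreasing []                 = true
nonIncreasing (a ∷ [])           = true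
nonIncreasing (a ∷ rest@(b ∷ r)) = (b ≤ᵇ a) ∧ nonIncreasing rest

-- coefficient of y^l x^m q^n in the right-hand side: the sum over all
-- N₁ ≥ ⋯ ≥ N_{k-1} ≥ 0 with N₁ + ⋯ + N_{k-1} = m (such N_i are ≤ m)
rhsCoef : ℕ → ℕ → ℕ → ℕ → ℕ
rhsCoef k l m n =
  sum (map (λ Ns → rhsTerm Ns l n)
           (filterᵇ (λ Ns → nonIncreasing Ns ∧ (sum Ns ≡ᵇ m)) (listsUpTo (k ∸ 1) m)))

{-# OPTIONS --safe #-}
-- Both families are in bijection with k - 1 lists of gaps, the r-th one of
-- length n_r, together with a list of N_1 bits. A list of n gaps is weighted by
-- the sum of its partial sums, and y counts the odd gaps, which gives (-yq)_n /
-- (q^2; q^2)_n; the bits give (-q)_{N_1 - 1} and the choice of the first of them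
-- the factor 2.
--
-- Paths. Making the N steps NE steps (the bits remember which they were) leaves
-- a path that arises from the empty one by alternately raising all peaks, which
-- adds 1 to the relative heights, and inserting peaks of relative height 1 at
-- the given gaps; consecutive peaks of the same relative height then differ in
-- parity exactly if the gap between them is odd.
--
-- Overpartitions. An overpartition is a sequence of sites, the v-th one holding
-- the parts v. Of the 1-marked parts the overlined ones give the bits. The last
-- overline can be removed by moving a part to the next site from its site and
-- from every second one after it, until one of these is empty; this preserves
-- the sequences of cluster parities. In an ordinary partition the
-- (k - 1)-clusters are the adjacent sites with k - 1 parts in total; these are
-- deleted from the left, the gaps counting the places to which a pair could be
-- moved, and one continues with k - 2.
module Submission where

open import Defs using (HasCount; GPath; TOvp; rhsCoef; val)
open import Data.Bool using (Bool; true; false; _∧_; not; if_then_else_; T; _xor_; _∨_)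
open import Data.Bool.ListAction using (any; all)
open import Data.Bool.Properties using (T-∧; T?; not-involutive; T-∨; xor-comm; not-distribˡ-xor; not-distribʳ-xor; xor-assoc; xor-same; ∨-identityʳ; ∧-zeroʳ; ∨-assoc; ∨-zeroʳ; xor-identityʳ)
open import Data.Empty using (⊥-elim; ⊥)
open import Data.List using (List; []; _∷_; _++_; map; length; upTo; cartesianProduct; reverse; _∷ʳ_; applyUpTo; [_]; zipWith; filterᵇ; drop; _ʳ++_; replicate; foldr; zip; findᵇ)
open import Data.List.Properties using (length-map; length-++; map-∘; unfold-reverse; length-reverse; reverse-involutive; map-cong; map-++; reverse-injective; map-id; ∷-injective; map-applyUpTo; map-upTo; ++-assoc; ++-identityʳ; ∷ʳ-injective; ++-cancelʳ; length-filter; length-replicate)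
open import Data.List.Relation.Unary.All as All using (All; []; _∷_)
open import Data.Maybe as Maybe using (Maybe; just; nothing)
open import Data.Nat using (ℕ; zero; suc; _+_; _*_; _∸_; _≤_; s≤s; _≡ᵇ_; z≤n; _<_; _⊔_; _⊓_; _≤ᵇ_; _<ᵇ_; _%_)
open import Data.Nat.ListAction using (sum)
open import Data.Nat.ListAction.Properties using (sum-++)
open import Data.Nat.Properties
open import Data.Nat.Solver using (module +-*-Solver)
open import Data.Product using (Σ; _×_; _,_; proj₁; proj₂; ∃)
open import Data.Sum using (_⊎_; inj₁; inj₂; [_,_]′)
open import Data.Unit using (⊤; tt)
open import Function using (_∘_; id; case_of_; Equivalence)
open import Relation.Binary.PropositionalEquality using (_≡_; _≢_; refl; sym; trans; cong; cong₂; subst)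

-- Cluster parities are compared one mark at a time: a level consists of the sites with the current
-- mark, and the rest of each site and the open clusters are the input of the next level. Removing
-- an overline and deleting a pair displace marks by a site at some levels. Each is treated as a
-- simulation, whose relation lists the possible local discrepancies; the same parities come out, up
-- to that of the deleted pair. Undoing a removal requires a condition on the whole tail (`moves`),
-- so the first bit could not be chosen freely. The overline of the first nonempty site is toggled
-- in place instead, which flips all cluster parities together with the starting parity, as the
-- initial E step does for a path; hence the first bit is free in `cost`. The squares come from
-- packing: with all gaps 0 the peaks or pairs of one kind stand in front, two places apart, and
-- push the others along; a unit of a gap adds one for its object and for each later one. The
-- triangular number replaces N_1^2 because `cost` charges for the unmarked positions, not the
-- marked ones.

-- Counting by bijections, and generating functions in y and q

module Counting where
  open import Defs
  open import Data.Nat.DivMod using (_/_; _%_; m*n/n≡m; m≡m%n+[m/n]*n)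
  open import Data.Nat.Divisibility using (divides; n∣m⇒m%n≡0)
  open import Algebra.Properties.CommutativeSemigroup +-commutativeSemigroup using (x∙yz≈y∙xz)
  open import Data.List.Relation.Unary.Unique.Propositional using (Unique)
  open import Data.List.Relation.Unary.AllPairs using ([]; _∷_)
  import Data.List.Relation.Unary.All.Properties as All
  import Data.List.Relation.Unary.Unique.Propositional.Properties as Unique
  open import Data.List.Relation.Unary.Any using (here; there)
  open import Data.List.Relation.Binary.Pointwise using (Pointwise; []; _∷_)
  open import Data.List.Membership.Propositional using (_∈_)
  open import Data.List.Membership.Propositional.Properties
  open import Relation.Nullary using (¬_)

  open HasCount

  private
    variable
      A B X : Set
      c d : ℕ

  -- The bijection is a relation, total and injective in both directions on the elements of `P` and
  -- `Q`, because overpartitions are tied to their codes by an inductive relation rather than a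
  -- function.
  HasCount-transfer : {P : A → Set} {Q : B → Set} (R : A → B → Set) →
    (∀ {a} → P a → ∃ λ b → Q b × R a b) →
    (∀ {b} → Q b → ∃ λ a → P a × R a b) →
    (∀ {a a' b} → R a b → R a' b → P a → P a' → a ≡ a') →
    (∀ {a b b'} → R a b → R a b' → Q b → Q b' → b ≡ b') →
    HasCount P c → HasCount Q c
  HasCount-transfer {A = A} {B = B} {c = c} {P = P} {Q = Q} R fwd bwd injl injr h =
    let ys , |ys| , u , f , g = go (elems h) (sound h) (distinct h) in record
    { elems = ys ; distinct = u
    ; sound = λ y∈ → proj₁ (proj₂ (proj₂ (f y∈)))
    ; complete = λ q → let a , p , r = bwd q ; y , y∈ , r' , q' = g (complete h p)
                       in subst (_∈ ys) (injr r' r q' q) y∈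
    ; size = trans |ys| (size h) }
    where
    go : ∀ xs → (∀ {a} → a ∈ xs → P a) → Unique xs → Σ (List B) λ ys →
      length ys ≡ length xs × Unique ys
      × (∀ {y} → y ∈ ys → ∃ λ x → x ∈ xs × Q y × R x y)
      × (∀ {x} → x ∈ xs → ∃ λ y → y ∈ ys × R x y × Q y)
    go [] _ _ = [] , refl , [] , (λ ()) , λ ()
    go (x ∷ xs) p (x∉ ∷ u) with go xs (p ∘ there) u | fwd (p (here refl))
    ... | ys , l , uy , f , g | y , qy , r =
      y ∷ ys , cong suc l , All.tabulate fresh ∷ uy , f' , g'
      where
      fresh : ∀ {y'} → y' ∈ ys → y ≢ y'
      fresh y'∈ refl with f y'∈
      ... | x' , x'∈ , _ , r' = All.lookup x∉ x'∈ (injl r r' (p (here refl)) (p (there x'∈)))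
      f' : ∀ {y'} → y' ∈ y ∷ ys → _
      f' (here refl) = x , here refl , qy , r
      f' (there i) with f i
      ... | x' , x'∈ , qr = x' , there x'∈ , qr
      g' : ∀ {x'} → x' ∈ x ∷ xs → _
      g' (here refl) = y , here refl , r , qy
      g' (there i) with g i
      ... | y' , y'∈ , rq = y' , there y'∈ , rq

  HasCount-map : {P : A → Set} {Q : B → Set} (f : A → B) →
    (∀ {a} → P a → Q (f a)) →
    (∀ {b} → Q b → ∃ λ a → P a × f a ≡ b) →
    (∀ {a a'} → f a ≡ f a' → P a → P a' → a ≡ a') →
    HasCount P c → HasCount Q c
  HasCount-map f pq sur inj = HasCount-transfer (λ a b → f a ≡ b)
    (λ p → f _ , pq p , refl) sur (λ r r' → inj (trans r (sym r')))
    (λ r r' _ _ → trans (sym r) r')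

  HasCount-⇔ : {P Q : A → Set} → (∀ {a} → P a → Q a) → (∀ {a} → Q a → P a) → HasCount P c → HasCount Q c
  HasCount-⇔ f g = HasCount-map id f (λ q → _ , g q , refl) (λ e _ _ → e)

  HasCount-∅ : {P : A → Set} → (∀ {a} → ¬ P a) → HasCount P 0
  HasCount-∅ n = record { elems = [] ; distinct = [] ; sound = λ () ; complete = λ p → ⊥-elim (n p) ; size = refl }

  HasCount-unit : (a : A) → HasCount (λ x → x ≡ a) 1
  HasCount-unit a = record { elems = a ∷ [] ; distinct = [] ∷ [] ; sound = λ { (here e) → e }
                           ; complete = here ; size = refl }

  HasCount-⊎ : {P Q : A → Set} → HasCount P c → HasCount Q d → (∀ {a} → P a → ¬ Q a) → HasCount (λ a → P a ⊎ Q a) (c + d)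
  HasCount-⊎ h k dis = record
    { elems = elems h ++ elems k
    ; distinct = Unique.++⁺ (distinct h) (distinct k) (λ (i , j) → dis (sound h i) (sound k j))
    ; sound = λ i → go (∈-++⁻ (elems h) i)
    ; complete = λ { (inj₁ p) → ∈-++⁺ˡ (complete h p) ; (inj₂ q) → ∈-++⁺ʳ (elems h) (complete k q) }
    ; size = trans (length-++ (elems h)) (cong₂ _+_ (size h) (size k)) }
    where
    go : ∀ {a} → a ∈ elems h ⊎ a ∈ elems k → _
    go (inj₁ i) = inj₁ (sound h i)
    go (inj₂ i) = inj₂ (sound k i)

  HasCount-× : {P : A → Set} {Q : B → Set} → HasCount P c → HasCount Q d → HasCount (λ (ab : A × B) → P (proj₁ ab) × Q (proj₂ ab)) (c * d)
  HasCount-× h k = record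
    { elems = cartesianProduct (elems h) (elems k)
    ; distinct = Unique.cartesianProduct⁺ (distinct h) (distinct k)
    ; sound = λ i → let i₁ , i₂ = ∈-cartesianProduct⁻ (elems h) (elems k) i in sound h i₁ , sound k i₂
    ; complete = λ (p , q) → ∈-cartesianProduct⁺ (complete h p) (complete k q)
    ; size = trans (len (elems h) (elems k)) (cong₂ _*_ (size h) (size k)) }
    where
    len : ∀ {A B : Set} (xs : List A) (ys : List B) → length (cartesianProduct xs ys) ≡ length xs * length ys
    len [] ys = refl
    len (x ∷ xs) ys = trans (length-++ (map (x ,_) ys)) (cong₂ _+_ (length-map (x ,_) ys) (len xs ys))

  HasCount-Σ : {P : X → A → Set} {c : X → ℕ} (I : List X) → Unique I → (∀ {i} → i ∈ I → HasCount (P i) (c i)) →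
    HasCount (λ (ix : X × A) → proj₁ ix ∈ I × P (proj₁ ix) (proj₂ ix)) (sum (map c I))
  HasCount-Σ [] _ _ = HasCount-∅ λ ()
  HasCount-Σ {X = X} {A = A} {P = P} {c = c} (i ∷ I) (i∉ ∷ u) h =
    HasCount-⇔ (λ { (inj₁ (refl , p)) → here refl , p ; (inj₂ (k , p)) → there k , p })
      (λ { (here refl , p) → inj₁ (refl , p) ; (there k , p) → inj₂ (k , p) })
      (HasCount-⊎ {P = λ (ix : X × A) → proj₁ ix ≡ i × P i (proj₂ ix)}
        (HasCount-map (i ,_) (refl ,_) (λ { {_ , a} (refl , p) → a , p , refl }) (λ { refl _ _ → refl }) (h (here refl)))
        (HasCount-Σ I u (h ∘ there))
        (λ { (refl , _) (k , _) → All.lookup i∉ k refl }))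

  -- `Enum P y q S` says that S is the generating function of the elements
  -- satisfying P, with y and q as exponents.
  Enum : (A → Set) → (A → ℕ) → (A → ℕ) → Series → Set
  Enum P y q S = ∀ a b → HasCount (λ x → P x × y x ≡ a × q x ≡ b) (S a b)

  private
    sumTo-Σ : {P : ℕ → A → Set} {c : ℕ → ℕ} (n : ℕ) → (∀ {i} → i ≤ n → HasCount (P i) (c i)) →
      HasCount (λ (ix : ℕ × A) → proj₁ ix ≤ n × P (proj₁ ix) (proj₂ ix)) (sumTo n c)
    sumTo-Σ n h = HasCount-⇔ (λ (i , p) → ≤-pred (∈-upTo⁻ i) , p) (λ (i , p) → ∈-upTo⁺ (s≤s i) , p)
      (HasCount-Σ (upTo (suc n)) (Unique.upTo⁺ (suc n)) (λ i → h (≤-pred (∈-upTo⁻ i))))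

  -- The indices of the convolution are the statistics of the left component, so forgetting them is
  -- a bijection.
  Enum-⊛ : {P : A → Set} {Q : B → Set} {y q : A → ℕ} {y' q' : B → ℕ} {S T : Series} →
    Enum P y q S → Enum Q y' q' T →
    Enum (λ (ab : A × B) → P (proj₁ ab) × Q (proj₂ ab))
      (λ (a , b) → y a + y' b) (λ (a , b) → q a + q' b) (S ⊛ T)
  Enum-⊛ {A = A} {B = B} {P = P} {Q} {y} {q} {y'} {q'} e f m n =
    HasCount-map {A = ℕ × ℕ × A × B} (proj₂ ∘ proj₂)
      (λ { {i , j , a , b} (i≤ , j≤ , (p , ya , qa) , (p' , yb , qb)) → (p , p')
         , trans (cong₂ _+_ ya yb) (m+[n∸m]≡n i≤) , trans (cong₂ _+_ qa qb) (m+[n∸m]≡n j≤) })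
      (λ { {a , b} ((p , p') , refl , refl) → (y a , q a , a , b) ,
         (m≤m+n (y a) (y' b) , m≤m+n (q a) (q' b) , (p , refl , refl) , (p' , sym (m+n∸m≡n (y a) (y' b)) , sym (m+n∸m≡n (q a) (q' b)))) , refl })
      (λ { refl (_ , _ , (_ , refl , refl) , _) (_ , _ , (_ , refl , refl) , _) → refl })
      (sumTo-Σ m λ {i} _ → sumTo-Σ n λ {j} _ → HasCount-× (e i j) (f (m ∸ i) (n ∸ j)))

  HasCount-T : ∀ b (a : A) → HasCount (λ x → x ≡ a × T b) (if b then 1 else 0)
  HasCount-T true a = HasCount-⇔ (λ e → e , tt) proj₁ (HasCount-unit a)
  HasCount-T false a = HasCount-∅ proj₂

  Enum-single : ∀ (a : A) {y q : A → ℕ} → Enum (λ x → x ≡ a) y q (mono (y a) (q a))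
  Enum-single a {y} {q} m n = HasCount-⇔
    (λ { (refl , t) → let u , v = Equivalence.to T-∧ t in refl , sym (≡ᵇ⇒≡ m _ u) , sym (≡ᵇ⇒≡ n _ v) })
    (λ { (refl , refl , refl) → refl , Equivalence.from T-∧ (≡⇒≡ᵇ m m refl , ≡⇒≡ᵇ n n refl) })
    (HasCount-T ((m ≡ᵇ y a) ∧ (n ≡ᵇ q a)) a)

  Enum-⊕ : {P Q : A → Set} {y q : A → ℕ} {S T : Series} → (∀ {a} → P a → ¬ Q a) →
    Enum P y q S → Enum Q y q T → Enum (λ a → P a ⊎ Q a) y q (S ⊕ T)
  Enum-⊕ dis e f m n = HasCount-⇔
    (λ { (inj₁ (p , r)) → inj₁ p , r ; (inj₂ (p , r)) → inj₂ p , r })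
    (λ { (inj₁ p , r) → inj₁ (p , r) ; (inj₂ p , r) → inj₂ (p , r) })
    (HasCount-⊎ (e m n) (f m n) (λ (p , _) (p' , _) → dis p p'))

  Enum-map : {P : A → Set} {Q : B → Set} {y q : A → ℕ} {y' q' : B → ℕ} {S : Series} (f : A → B) →
    (∀ {a} → P a → Q (f a) × y' (f a) ≡ y a × q' (f a) ≡ q a) →
    (∀ {b} → Q b → ∃ λ a → P a × f a ≡ b) →
    (∀ {a a'} → f a ≡ f a' → P a → P a' → a ≡ a') →
    Enum P y q S → Enum Q y' q' S
  Enum-map {A = A} {B = B} {P = P} {y = y} {q} {y'} {q'} f pq sur inj e m n = HasCount-map f
    (λ { (p , refl , refl) → pq p })
    (λ { (q , refl , refl) → let a , p , r = sur q in a , (p , lem p r) , r })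
    (λ r (p , _) (p' , _) → inj r p p')
    (e m n)
    where
    lem : ∀ {a b} → P a → f a ≡ b → y a ≡ y' b × q a ≡ q' b
    lem p refl = let _ , u , v = pq p in sym u , sym v

  Enum-⇔ : {P Q : A → Set} {y q y' q' : A → ℕ} {S : Series} →
    (∀ {a} → P a → Q a × y' a ≡ y a × q' a ≡ q a) → (∀ {a} → Q a → P a) → Enum P y q S → Enum Q y' q' S
  Enum-⇔ f g = Enum-map id f (λ q → _ , g q , refl) (λ e _ _ → e)

  sumOver : (X → A → ℕ) → List X → List A → ℕ
  sumOver f [] _ = 0
  sumOver f (_ ∷ _) [] = 0
  sumOver f (i ∷ is) (x ∷ xs) = f i x + sumOver f is xs

  Enum-prodS : {P : X → A → Set} {y q : X → A → ℕ} {S : X → Series} →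
    (∀ i → Enum (P i) (y i) (q i) (S i)) → ∀ is →
    Enum (Pointwise P is) (sumOver y is) (sumOver q is) (prodS (map S is))
  Enum-prodS e [] = Enum-⇔ (λ { refl → [] , refl , refl }) (λ { [] → refl }) (Enum-single [] {λ _ → 0} {λ _ → 0})
  Enum-prodS e (i ∷ is) = Enum-map (λ (x , xs) → x ∷ xs) (λ (p , ps) → p ∷ ps , refl , refl)
    (λ { (p ∷ ps) → _ , (p , ps) , refl }) (λ { refl _ _ → refl }) (Enum-⊛ (e i) (Enum-prodS e is))

  -- Σ (k + position from the right) · entry, positions starting from 1
  weightFrom : ℕ → List ℕ → ℕ
  weightFrom k [] = 0
  weightFrom k (x ∷ xs) = (k + suc (length xs)) * x + weightFrom k xs

  weight : List ℕ → ℕ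
  weight = weightFrom 0

  weightFrom-∷ʳ : ∀ k xs x → weightFrom k (xs ∷ʳ x) ≡ suc k * x + weightFrom (suc k) xs
  weightFrom-∷ʳ k [] x rewrite +-comm k 1 = refl
  weightFrom-∷ʳ k (y ∷ xs) x rewrite weightFrom-∷ʳ k xs x | length-++ xs {x ∷ []} | +-comm (length xs) 1
    | +-suc k (suc (length xs)) = x∙yz≈y∙xz (suc (k + suc (length xs)) * y) (suc k * x) _

  module _ {y v : A → ℕ} {S : ℕ → Series} where

    private
      sumOver-upFrom : ∀ (f : ℕ → ℕ) k → (∀ i → f i ≡ k + i) → ∀ xs →
        sumOver (λ j x → suc j * v x) (applyUpTo f (length xs)) xs ≡ weightFrom k (map v (reverse xs))
      sumOver-upFrom f k h [] = refl
      sumOver-upFrom f k h (x ∷ xs)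
        rewrite unfold-reverse x xs | map-++ v (reverse xs) (x ∷ []) | weightFrom-∷ʳ k (map v (reverse xs)) (v x)
        | h 0 | +-identityʳ k = cong (suc k * v x +_) (sumOver-upFrom (f ∘ suc) (suc k) (λ i → trans (h (suc i)) (+-suc k i)) xs)

      sumOver-const : ∀ (f : ℕ → ℕ) xs → sumOver (λ _ → y) (applyUpTo f (length xs)) xs ≡ sum (map y xs)
      sumOver-const f [] = refl
      sumOver-const f (x ∷ xs) = cong (y x +_) (sumOver-const (f ∘ suc) xs)

      ofLength : ∀ (f : ℕ → ℕ) n {xs : List A} → length xs ≡ n → Pointwise (λ _ _ → ⊤) (applyUpTo f n) xs
      ofLength f zero {[]} _ = []
      ofLength f (suc n) {x ∷ xs} e = tt ∷ ofLength (f ∘ suc) n (suc-injective e)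

      lengthOf : ∀ (f : ℕ → ℕ) n {xs : List A} → Pointwise (λ _ _ → ⊤) (applyUpTo f n) xs → length xs ≡ n
      lengthOf f zero [] = refl
      lengthOf f (suc n) (_ ∷ p) = cong suc (lengthOf (f ∘ suc) n p)

      sum-reverse : ∀ xs → sum (map y (reverse xs)) ≡ sum (map y xs)
      sum-reverse [] = refl
      sum-reverse (x ∷ xs) rewrite unfold-reverse x xs | map-++ y (reverse xs) (x ∷ [])
        | sum-++ (map y (reverse xs)) (y x ∷ []) | sum-reverse xs | +-identityʳ (y x) = +-comm (sum (map y xs)) (y x)

    -- The j-th factor of the product belongs to position j + 1 from the left, while `weight` counts
    -- positions from the right; hence the reversal.
    Enum-weight : (∀ j → Enum (λ _ → ⊤) y (λ x → suc j * v x) (S j)) → ∀ n →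
      Enum (λ xs → length xs ≡ n) (λ xs → sum (map y xs)) (λ xs → weight (map v xs)) (prodS (map S (upTo n)))
    Enum-weight e n = Enum-map reverse
      (λ {xs} p → let l = lengthOf id n p in trans (length-reverse xs) l
        , trans (sum-reverse xs) (sym (subst (λ m → sumOver _ (applyUpTo id m) xs ≡ _) l (sumOver-const id xs)))
        , sym (subst (λ m → sumOver _ (applyUpTo id m) xs ≡ _) l (sumOver-upFrom id 0 (λ _ → refl) xs)))
      (λ {xs} l → reverse xs , ofLength id n (trans (length-reverse xs) l) , reverse-involutive xs)
      (λ r _ _ → reverse-injective r)
      (Enum-prodS e (upTo n))

  bit : Bool → ℕ
  bit true = 1
  bit false = 0

  odd : ℕ → Bool
  odd zero = false
  odd (suc n) = not (odd n)

  private
    Enum-Bool : ∀ {y q} {S T} → Enum (λ x → x ≡ false) y q S → Enum (λ x → x ≡ true) y q T → Enum (λ (_ : Bool) → ⊤) y q (S ⊕ T)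
    Enum-Bool e f = Enum-⇔ (λ _ → tt , refl , refl) (λ { {false} _ → inj₁ refl ; {true} _ → inj₂ refl })
      (Enum-⊕ (λ { refl () }) e f)

    Enum-oneBit : ∀ i j → Enum (λ (_ : Bool) → ⊤) (λ b → i * bit b) (λ b → suc j * bit b) (one ⊕ mono i (suc j))
    Enum-oneBit i j = Enum-⇔ (λ { {false} _ → tt , *-zeroʳ i , *-zeroʳ j ; {true} _ → tt , *-identityʳ i , cong suc (*-identityʳ j) }) (λ _ → tt)
      (Enum-Bool {λ b → if b then i else 0} {λ b → if b then suc j else 0} (Enum-single false) (Enum-single true))

  Enum-negYQPoch : ∀ n → Enum (λ bs → length bs ≡ n) (λ bs → sum (map bit bs)) (λ bs → weight (map bit bs)) (negYQPoch n)
  Enum-negYQPoch n = subst (λ l → Enum (λ bs → length bs ≡ n) (λ bs → sum (map bit bs)) (λ bs → weight (map bit bs)) (prodS l)) (map-∘ (upTo n))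
    (Enum-⇔ (λ {bs} p → p , cong sum (map-cong (λ b → sym (*-identityˡ (bit b))) bs) , refl) id
      (Enum-weight (Enum-oneBit 1) n))

  Enum-negQPoch : ∀ n → Enum (λ bs → length bs ≡ n) (λ _ → 0) (λ bs → weight (map bit bs)) (negQPoch n)
  Enum-negQPoch n = subst (λ l → Enum (λ bs → length bs ≡ n) (λ _ → 0) (λ bs → weight (map bit bs)) (prodS l)) (map-∘ (upTo n))
    (Enum-⇔ (λ {bs} p → p , sym (zeros bs) , refl) id (Enum-weight (Enum-oneBit 0) n))
    where
    zeros : (bs : List Bool) → sum (map (λ b → 0 * bit b) bs) ≡ 0
    zeros [] = refl
    zeros (_ ∷ bs) = zeros bs

  Enum-invQ2Poch : ∀ n → Enum (λ cs → length cs ≡ n) (λ _ → 0) (λ cs → weight (map (2 *_) cs)) (invQ2Poch n)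
  Enum-invQ2Poch n = Enum-⇔ (λ {cs} p → p , sym (zeros cs) , refl) id (Enum-weight {y = λ _ → 0} geom n)
    where
    zeros : (cs : List ℕ) → sum (map (λ _ → 0) cs) ≡ 0
    zeros [] = refl
    zeros (_ ∷ cs) = zeros cs
    assoc : ∀ j c → c * (2 * suc j) ≡ suc j * (2 * c)
    assoc j c = trans (*-comm c (2 * suc j)) (trans (cong (_* c) (*-comm 2 (suc j))) (*-assoc (suc j) 2 c))
    geom : ∀ j → Enum (λ _ → ⊤) (λ _ → 0) (λ c → suc j * (2 * c)) (invOneMinusQ2 j)
    geom j (suc a) b = HasCount-∅ λ { (_ , () , _) }
    geom j zero b = HasCount-⇔
      (λ { {c} (refl , t) → tt , refl , trans (sym (assoc j c)) (sym (m/n*n t)) })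
      (λ { {c} (_ , _ , refl) → trans (sym (m*n/n≡m c (2 * suc j))) (cong (_/ (2 * suc j)) (assoc j c))
           , ≡⇒≡ᵇ _ 0 (n∣m⇒m%n≡0 b _ (divides c (sym (assoc j c)))) })
      (HasCount-T (b % (2 * suc j) ≡ᵇ 0) (b / (2 * suc j)))
      where
      m/n*n : T (b % (2 * suc j) ≡ᵇ 0) → b ≡ b / (2 * suc j) * (2 * suc j)
      m/n*n t = trans (m≡m%n+[m/n]*n b (2 * suc j)) (cong (_+ b / (2 * suc j) * (2 * suc j)) (≡ᵇ⇒≡ _ 0 t))

-- The right-hand side as a count of bits and gap lists

module Models where
  open import Defs
  open Counting
  open import Data.Nat.DivMod using (_/_)
  open import Data.List.Relation.Unary.Unique.Propositional using (Unique)
  open import Data.List.Relation.Unary.AllPairs using ([]; _∷_)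
  import Data.List.Relation.Unary.All.Properties as All
  import Data.List.Relation.Unary.AllPairs.Properties as AllPairs
  import Data.List.Relation.Unary.AllPairs as AllPairs
  import Data.List.Relation.Unary.Unique.Propositional.Properties as Unique
  open import Data.List.Relation.Unary.Any using (here)
  open import Data.List.Relation.Binary.Pointwise using (Pointwise; []; _∷_)
  open import Data.List.Membership.Propositional using (_∈_)
  open import Data.List.Membership.Propositional.Properties
  open import Algebra.Properties.CommutativeSemigroup +-commutativeSemigroup using (interchange)

  private
    variable
      n : ℕ

  half : ℕ → ℕ
  half 0 = 0
  half 1 = 0
  half (suc (suc n)) = suc (half n)

  glue : Bool → ℕ → ℕ
  glue d c = bit d + 2 * c

  private
    glue-suc : ∀ d c → glue d (suc c) ≡ suc (suc (glue d c))
    glue-suc d c rewrite +-suc c (c + 0) | +-suc (bit d) (suc (c + (c + 0))) | +-suc (bit d) (c + (c + 0)) = refl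

  odd-glue : ∀ d c → odd (glue d c) ≡ d
  odd-glue false zero = refl
  odd-glue true zero = refl
  odd-glue d (suc c) rewrite glue-suc d c | not-involutive (odd (glue d c)) = odd-glue d c

  half-glue : ∀ d c → half (glue d c) ≡ c
  half-glue false zero = refl
  half-glue true zero = refl
  half-glue d (suc c) rewrite glue-suc d c = cong suc (half-glue d c)

  glue-odd-half : ∀ n → glue (odd n) (half n) ≡ n
  glue-odd-half 0 = refl
  glue-odd-half 1 = refl
  glue-odd-half (suc (suc n)) rewrite not-involutive (odd n) | glue-suc (odd n) (half n) = cong (suc ∘ suc) (glue-odd-half n)

  oddCount : List ℕ → ℕ
  oddCount g = sum (map (bit ∘ odd) g)

  private
    glues : List Bool → List ℕ → List ℕ
    glues = zipWith glue

    length-glues : ∀ ds cs → length ds ≡ n → length cs ≡ n → length (glues ds cs) ≡ n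
    length-glues [] _ refl _ = refl
    length-glues (_ ∷ ds) (_ ∷ cs) refl e = cong suc (length-glues ds cs refl (suc-injective e))

    map-odd-glues : ∀ ds cs → length ds ≡ n → length cs ≡ n → map odd (glues ds cs) ≡ ds
    map-odd-glues [] _ _ _ = refl
    map-odd-glues (d ∷ ds) (c ∷ cs) refl e = cong₂ _∷_ (odd-glue d c) (map-odd-glues ds cs refl (suc-injective e))

    map-half-glues : ∀ ds cs → length ds ≡ n → length cs ≡ n → map half (glues ds cs) ≡ cs
    map-half-glues [] [] _ _ = refl
    map-half-glues (d ∷ ds) (c ∷ cs) refl e = cong₂ _∷_ (half-glue d c) (map-half-glues ds cs refl (suc-injective e))
    map-half-glues [] (_ ∷ _) refl ()

    oddCount-glues : ∀ ds cs → length ds ≡ n → length cs ≡ n → oddCount (glues ds cs) ≡ sum (map bit ds)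
    oddCount-glues ds cs p q = cong sum (trans (map-∘ (glues ds cs)) (cong (map bit) (map-odd-glues ds cs p q)))

    weight-glues : ∀ ds cs → length ds ≡ n → length cs ≡ n →
      weight (glues ds cs) ≡ weight (map bit ds) + weight (map (2 *_) cs)
    weight-glues [] [] _ _ = refl
    weight-glues [] (_ ∷ _) refl ()
    weight-glues (d ∷ ds) (c ∷ cs) refl e
      rewrite length-glues ds cs refl (suc-injective e) | length-map bit ds | length-map (2 *_) cs
      | suc-injective e | weight-glues ds cs refl (suc-injective e)
      | *-distribˡ-+ (suc (length ds)) (bit d) (2 * c) = interchange (suc (length ds) * bit d) _ _ _

    glues-surjective : ∀ g → glues (map odd g) (map half g) ≡ g
    glues-surjective [] = refl
    glues-surjective (x ∷ g) = cong₂ _∷_ (glue-odd-half x) (glues-surjective g)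

    Lengths : List ℕ → List (List ℕ) → Set
    Lengths = Pointwise (λ n g → length g ≡ n)

  -- A gap is a bit plus twice a number (`glue`). The weight is linear, so the bits account for the
  -- numerators, with y recording the odd gaps, and the halves for the denominators.
  Enum-gaps : ∀ ns → Enum (Lengths ns) (λ gs → sum (map oddCount gs)) (λ gs → sum (map weight gs))
                          (prodS (map negYQPoch ns) ⊛ prodS (map invQ2Poch ns))
  Enum-gaps ns = Enum-map (λ (dss , css) → zipWith glues dss css)
    (λ (p , q) → stats p q) (λ {gs} p → _ , sur p) inj
    (Enum-⊛ (Enum-prodS Enum-negYQPoch ns) (Enum-prodS Enum-invQ2Poch ns))
    where
    stats : ∀ {ns dss css} → Pointwise (λ n ds → length ds ≡ n) ns dss → Pointwise (λ n cs → length cs ≡ n) ns css →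
      Lengths ns (zipWith glues dss css)
      × sum (map oddCount (zipWith glues dss css)) ≡ sumOver (λ _ ds → sum (map bit ds)) ns dss + sumOver (λ _ _ → 0) ns css
      × sum (map weight (zipWith glues dss css)) ≡ sumOver (λ _ ds → weight (map bit ds)) ns dss + sumOver (λ _ cs → weight (map (2 *_) cs)) ns css
    stats [] [] = [] , refl , refl
    stats {dss = ds ∷ _} {cs ∷ _} (p ∷ ps) (q ∷ qs) with stats ps qs
    ... | l , y , w = length-glues ds cs p q ∷ l
      , trans (cong₂ _+_ (oddCount-glues ds cs p q) y) (sym (+-assoc (sum (map bit ds)) _ _))
      , trans (cong₂ _+_ (weight-glues ds cs p q) w) (interchange (weight (map bit ds)) _ _ _)
    sur : ∀ {ns gs} → Lengths ns gs →
      (Pointwise (λ n ds → length ds ≡ n) ns (map (map odd) gs) × Pointwise (λ n cs → length cs ≡ n) ns (map (map half) gs))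
      × zipWith glues (map (map odd) gs) (map (map half) gs) ≡ gs
    sur [] = ([] , []) , refl
    sur {gs = g ∷ gs} (l ∷ ls) with sur ls
    ... | (p , q) , e = (trans (length-map odd g) l ∷ p , trans (length-map half g) l ∷ q) , cong₂ _∷_ (glues-surjective g) e
    recover : ∀ {ns dss css} → Pointwise (λ n ds → length ds ≡ n) ns dss → Pointwise (λ n cs → length cs ≡ n) ns css →
      (map (map odd) (zipWith glues dss css) , map (map half) (zipWith glues dss css)) ≡ (dss , css)
    recover [] [] = refl
    recover {dss = ds ∷ _} {cs ∷ _} (p ∷ ps) (q ∷ qs) with recover ps qs
    ... | e = cong₂ _,_ (cong₂ _∷_ (map-odd-glues ds cs p q) (cong proj₁ e)) (cong₂ _∷_ (map-half-glues ds cs p q) (cong proj₂ e))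
    inj : ∀ {a a'} → zipWith glues (proj₁ a) (proj₂ a) ≡ zipWith glues (proj₁ a') (proj₂ a') → _ → _ → a ≡ a'
    inj r (p , q) (p' , q') = trans (sym (recover p q)) (trans (cong (λ z → map (map odd) z , map (map half) z) r) (recover p' q'))

  -- A mark on the first peak or cluster is free; unmarked later ones cost
  -- their position from the right.
  cost : List Bool → ℕ
  cost [] = 0
  cost (_ ∷ t) = weight (map (bit ∘ not) t)

  -- `cost` charges the unmarked positions and `negQPoch` the bits that are true, so all bits but
  -- the first are negated.
  Enum-lead : ∀ N → Enum (λ β → length β ≡ N) (λ _ → 0) cost (leadFactor N)
  Enum-lead zero = Enum-⇔ (λ { refl → refl , refl , refl }) (λ { {[]} _ → refl }) (Enum-single [] {λ _ → 0} {λ _ → 0})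
  Enum-lead (suc j) = Enum-map {y' = λ _ → 0} {q' = cost} (λ (t , b) → b ∷ map not t)
    (λ {(t , b)} (p , _) → cong suc (trans (length-map not t) p) , refl
       , trans (cong weight (trans (sym (map-∘ t)) (map-cong (λ b → cong bit (not-involutive b)) t))) (sym (+-identityʳ _)))
    (λ { {[]} () ; {b ∷ t} p → (map not t , b) , (trans (length-map not t) (suc-injective p) , tt) , cong (b ∷_) (nots t) })
    (λ {(t , b)} {(t' , b')} r _ _ → lem r)
    (Enum-⊛ (Enum-negQPoch j) two)
    where
    nots : ∀ t → map not (map not t) ≡ t
    nots t = trans (sym (map-∘ t)) (trans (map-cong not-involutive t) (map-id t))
    lem : ∀ {t t' b b'} → b ∷ map not t ≡ b' ∷ map not t' → (t , b) ≡ (t' , b')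
    lem {t} {t'} r with ∷-injective r
    ... | refl , e = cong (_, _) (trans (sym (nots t)) (trans (cong (map not) e) (nots t')))
    two : Enum (λ (_ : Bool) → ⊤) (λ _ → 0) (λ _ → 0) (one ⊕ mono 0 0)
    two = Enum-⇔ (λ _ → tt , refl , refl) (λ { {false} _ → inj₁ refl ; {true} _ → inj₂ refl })
      (Enum-⊕ (λ { refl () }) (Enum-single false {λ _ → 0} {λ _ → 0}) (Enum-single true {λ _ → 0} {λ _ → 0}))

  -- N₁ ≥ N₂ ≥ … from the gap lists, whose lengths are n₁, n₂, …
  tails : List (List ℕ) → List ℕ
  tails [] = []
  tails (g ∷ gs) = length g + headOr0 (tails gs) ∷ tails gs

  base : List ℕ → ℕ
  base Ns = (suc (headOr0 Ns) * headOr0 Ns) / 2 + sum (map (λ a → a * a) (drop 1 Ns))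

  Model : Set
  Model = List Bool × List (List ℕ)

  IsModel : (K l m n : ℕ) → Model → Set
  IsModel K l m n (β , gs) = length gs ≡ K × length β ≡ headOr0 (tails gs)
    × sum (map oddCount gs) ≡ l × sum (tails gs) ≡ m
    × base (tails gs) + (cost β + sum (map weight gs)) ≡ n

  private
    headOr0-++0 : ∀ Ns → headOr0 (Ns ++ [ 0 ]) ≡ headOr0 Ns
    headOr0-++0 [] = refl
    headOr0-++0 (_ ∷ _) = refl

    HasCount-rhsTerm : ∀ Ns l n → HasCount
      (λ ((β , gs) : Model) → (length β ≡ headOr0 Ns × Lengths (diffs (Ns ++ [ 0 ])) gs)
         × sum (map oddCount gs) ≡ l × base Ns + (cost β + sum (map weight gs)) ≡ n)
      (rhsTerm Ns l n)
    HasCount-rhsTerm Ns l n with headOr0 (Ns ++ [ 0 ]) | headOr0-++0 Ns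
    ... | _ | refl = HasCount-map proj₂ (λ { ((refl , p) , yq) → p , yq }) (λ (p , yq) → (tt , _) , ((refl , p) , yq) , refl)
      (λ { {tt , _} {tt , _} refl _ _ → refl })
      -- The power of q in front enters as a single element of that weight.
      (Enum-⊛ (Enum-single tt {λ _ → 0} {λ _ → base Ns}) (Enum-⊛ (Enum-lead (headOr0 Ns)) (Enum-gaps (diffs (Ns ++ [ 0 ])))) l n)

    nonIncreasing-∷ : ∀ a Ns → headOr0 Ns ≤ a → T (nonIncreasing Ns) → T (nonIncreasing (a ∷ Ns))
    nonIncreasing-∷ a [] _ _ = tt
    nonIncreasing-∷ a (b ∷ r) le t = Equivalence.from T-∧ (≤⇒≤ᵇ le , t)

    tails-nonIncreasing : ∀ gs → T (nonIncreasing (tails gs))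
    tails-nonIncreasing [] = tt
    tails-nonIncreasing (g ∷ gs) = nonIncreasing-∷ _ (tails gs) (m≤n+m _ (length g)) (tails-nonIncreasing gs)

    diffs-∷ : ∀ a Ns → diffs ((a ∷ Ns) ++ [ 0 ]) ≡ a ∸ headOr0 Ns ∷ diffs (Ns ++ [ 0 ])
    diffs-∷ a [] = refl
    diffs-∷ a (_ ∷ _) = refl

    Lengths-tails : ∀ gs → Lengths (diffs (tails gs ++ [ 0 ])) gs
    Lengths-tails [] = []
    Lengths-tails (g ∷ gs) rewrite diffs-∷ (length g + headOr0 (tails gs)) (tails gs) =
      sym (m+n∸n≡m (length g) (headOr0 (tails gs))) ∷ Lengths-tails gs

    tails-Lengths : ∀ Ns gs → T (nonIncreasing Ns) → Lengths (diffs (Ns ++ [ 0 ])) gs → tails gs ≡ Ns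
    tails-Lengths [] [] _ _ = refl
    tails-Lengths (a ∷ Ns) gs t p rewrite diffs-∷ a Ns with p
    ... | e ∷ ps with tails-Lengths Ns _ (tail a Ns t) ps
      where
      tail : ∀ a Ns → T (nonIncreasing (a ∷ Ns)) → T (nonIncreasing Ns)
      tail a [] _ = tt
      tail a (b ∷ r) t = proj₂ (Equivalence.to T-∧ t)
    ... | eq rewrite eq = cong (_∷ Ns) (trans (cong (_+ _) e) (m∸n+n≡m (head≤ a Ns t)))
      where
      head≤ : ∀ a Ns → T (nonIncreasing (a ∷ Ns)) → headOr0 Ns ≤ a
      head≤ a [] _ = z≤n
      head≤ a (b ∷ r) t = ≤ᵇ⇒≤ b a (proj₁ (Equivalence.to T-∧ t))

    ∈-listsUpTo⁺ : ∀ K b {Ns} → length Ns ≡ K → All (_≤ b) Ns → Ns ∈ listsUpTo K b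
    ∈-listsUpTo⁺ zero b {[]} _ _ = here refl
    ∈-listsUpTo⁺ (suc K) b {x ∷ Ns} e (le ∷ les) =
      ∈-concat⁺′ (∈-map⁺ (x ∷_) (∈-listsUpTo⁺ K b (suc-injective e) les)) (∈-map⁺ _ (∈-upTo⁺ (s≤s le)))

    length-listsUpTo : ∀ K b {Ns} → Ns ∈ listsUpTo K b → length Ns ≡ K
    length-listsUpTo zero b (here refl) = refl
    length-listsUpTo (suc K) b i with ∈-concat⁻′ (map (λ x → map (x ∷_) (listsUpTo K b)) (upTo (suc b))) i
    ... | ys , j , k with ∈-map⁻ _ k
    ... | x , _ , refl with ∈-map⁻ (x ∷_) j
    ... | ys , h , refl = cong suc (length-listsUpTo K b h)

    listsUpTo-Unique : ∀ K b → Unique (listsUpTo K b)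
    listsUpTo-Unique zero b = [] ∷ []
    listsUpTo-Unique (suc K) b = Unique.concat⁺
      (All.map⁺ (All.universal (λ x → Unique.map⁺ (λ { refl → refl }) (listsUpTo-Unique K b)) (upTo (suc b))))
      (AllPairs.map⁺ (AllPairs.map (λ { {x} {y} x≢y (i , j) → disj x≢y i j }) (Unique.upTo⁺ (suc b))))
      where
      disj : ∀ {x y} → x ≢ y → ∀ {v} → v ∈ map (x ∷_) (listsUpTo K b) → v ∈ map (y ∷_) (listsUpTo K b) → _
      disj {x} {y} x≢y i j with ∈-map⁻ (x ∷_) i | ∈-map⁻ (y ∷_) j
      ... | _ , _ , refl | _ , _ , refl = x≢y refl

    entries≤sum : ∀ Ns → All (_≤ sum Ns) Ns
    entries≤sum [] = []
    entries≤sum (x ∷ Ns) = m≤m+n x (sum Ns) ∷ All.map (λ le → ≤-trans le (m≤n+m (sum Ns) x)) (entries≤sum Ns)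

    length-tails : ∀ gs → length (tails gs) ≡ length gs
    length-tails [] = refl
    length-tails (_ ∷ gs) = cong suc (length-tails gs)

  -- The summation index is recovered as `tails gs`, so it can be forgotten. As the index is
  -- non-increasing, the truncated differences in `diffs` determine it.
  HasCount-Model : ∀ K l m n → HasCount (IsModel K l m n) (rhsCoef (suc K) l m n)
  HasCount-Model K l m n = HasCount-map {P = Indexed} {Q = IsModel K l m n} proj₂ (λ {a} → fwd {a}) (λ {b} → bwd {b}) (λ {a} {a'} → inj {a} {a'})
    (HasCount-Σ (filterᵇ P (listsUpTo K m)) (Unique.filter⁺ (T? ∘ P) (listsUpTo-Unique K m)) (λ {Ns} _ → HasCount-rhsTerm Ns l n))
    where
    P : List ℕ → Bool
    P Ns = nonIncreasing Ns ∧ (sum Ns ≡ᵇ m)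
    Indexed : List ℕ × Model → Set
    Indexed (Ns , β , gs) = Ns ∈ filterᵇ P (listsUpTo K m)
      × (length β ≡ headOr0 Ns × Lengths (diffs (Ns ++ [ 0 ])) gs)
      × sum (map oddCount gs) ≡ l × base Ns + (cost β + sum (map weight gs)) ≡ n
    ∈P : ∀ {Ns} → Ns ∈ filterᵇ P (listsUpTo K m) → length Ns ≡ K × T (nonIncreasing Ns) × sum Ns ≡ m
    ∈P i with ∈-filter⁻ (T? ∘ P) {xs = listsUpTo K m} i
    ... | j , t with Equivalence.to T-∧ t
    ... | ni , s = length-listsUpTo K m j , ni , ≡ᵇ⇒≡ _ m s
    fwd : ∀ {a} → Indexed a → IsModel K l m n (proj₂ a)
    fwd {Ns , β , gs} (i , (lβ , lg) , y , q) with ∈P i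
    ... | lN , ni , s with tails-Lengths Ns gs ni lg
    ... | refl = trans (sym (length-tails gs)) lN , lβ , y , s , q
    bwd : ∀ {b} → IsModel K l m n b → ∃ λ a → Indexed a × proj₂ a ≡ b
    bwd {β , gs} (lg , lβ , y , s , q) = (tails gs , β , gs)
      , (∈-filter⁺ (T? ∘ P) (∈-listsUpTo⁺ K m (trans (length-tails gs) lg) (subst (λ m → All (_≤ m) (tails gs)) s (entries≤sum (tails gs))))
           (Equivalence.from T-∧ (tails-nonIncreasing gs , ≡⇒≡ᵇ _ m s))
        , (lβ , Lengths-tails gs) , y , q) , refl
    inj : ∀ {a a'} → proj₂ a ≡ proj₂ a' → Indexed a → Indexed a' → a ≡ a'
    inj {Ns , β , gs} {Ns' , _} refl (i , (_ , lg) , _) (i' , (_ , lg') , _) =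
      cong (_, β , gs) (trans (sym (tails-Lengths Ns gs (proj₁ (proj₂ (∈P i))) lg)) (tails-Lengths Ns' gs (proj₁ (proj₂ (∈P i'))) lg'))

-- Words of tokens, built by raising and inserting peaks

module PathWords where
  open import Defs
  open Counting
  open Models
  open import Algebra.Properties.CommutativeSemigroup +-commutativeSemigroup using (x∙yz≈y∙xz)

  -- A path with its N steps lengthened to NE steps, cut into peaks Λ (an up
  -- and a down step), the remaining up and down steps U, D, and E steps O.
  data Token : Set where
    Λ U D O : Token

  Word : Set
  Word = List Token

  private
    variable
      b : Bool
      d k y : ℕ
      g : List ℕ
      P Q w q : Word

  -- Walking away from a peak at depth d below it: the largest depth reached
  -- before the walk meets the height of the peak (to the left) or exceeds it
  -- (to the right).
  ld : ℕ → Word → ℕ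
  ld d [] = d
  ld d (U ∷ w) = ld (suc d) w
  ld d (O ∷ w) = d
  ld (suc (suc d)) (Λ ∷ w) = ld (suc (suc d)) w
  ld (suc (suc d)) (D ∷ w) = suc (suc d) ⊔ ld (suc d) w
  ld d (Λ ∷ w) = d
  ld d (D ∷ w) = d

  rd : ℕ → Word → ℕ
  rd d [] = d
  rd d (D ∷ w) = rd (suc d) w
  rd d (O ∷ w) = d
  rd zero (_ ∷ w) = zero
  rd (suc d) (Λ ∷ w) = rd (suc d) w
  rd (suc d) (U ∷ w) = suc d ⊔ rd d w

  d≤ld : ∀ d w → d ≤ ld d w
  d≤ld d [] = ≤-refl
  d≤ld d (U ∷ w) = ≤-trans (n≤1+n d) (d≤ld (suc d) w)
  d≤ld d (O ∷ w) = ≤-refl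
  d≤ld zero (Λ ∷ w) = z≤n
  d≤ld (suc zero) (Λ ∷ w) = ≤-refl
  d≤ld (suc (suc d)) (Λ ∷ w) = d≤ld (suc (suc d)) w
  d≤ld zero (D ∷ w) = z≤n
  d≤ld (suc zero) (D ∷ w) = ≤-refl
  d≤ld (suc (suc d)) (D ∷ w) = m≤m⊔n _ (ld (suc d) w)

  d≤rd : ∀ d w → d ≤ rd d w
  d≤rd d [] = ≤-refl
  d≤rd d (D ∷ w) = ≤-trans (n≤1+n d) (d≤rd (suc d) w)
  d≤rd d (O ∷ w) = ≤-refl
  d≤rd zero (Λ ∷ w) = z≤n
  d≤rd zero (U ∷ w) = z≤n
  d≤rd (suc d) (Λ ∷ w) = d≤rd (suc d) w
  d≤rd (suc d) (U ∷ w) = m≤m⊔n _ (rd d w)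

  -- Relative heights of the peaks of a word, after a reversed prefix, with the
  -- parities of weight + relative height; the Bool is the parity of the weight
  -- reached so far.
  pk : Bool → Word → Word → List (ℕ × Bool)
  pk o pre [] = []
  pk o pre (Λ ∷ w) = (ld 1 pre ⊓ rd 1 w , not o xor odd (ld 1 pre ⊓ rd 1 w)) ∷ pk o (Λ ∷ pre) w
  pk o pre (U ∷ w) = pk (not o) (U ∷ pre) w
  pk o pre (D ∷ w) = pk (not o) (D ∷ pre) w
  pk o pre (O ∷ w) = pk (not o) (O ∷ pre) w

  npeaks : Word → ℕ
  npeaks [] = 0
  npeaks (Λ ∷ w) = suc (npeaks w)
  npeaks (U ∷ w) = npeaks w
  npeaks (D ∷ w) = npeaks w
  npeaks (O ∷ w) = npeaks w

  weights : ℕ → Word → ℕ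
  weights x [] = 0
  weights x (Λ ∷ w) = suc x + weights (suc (suc x)) w
  weights x (U ∷ w) = weights (suc x) w
  weights x (D ∷ w) = weights (suc x) w
  weights x (O ∷ w) = weights (suc x) w

  -- A gap counts the tokens other than peaks that the new peak lets pass; behind the end of `Q`
  -- these are new `O`s. A peak of `Q` is passed for free, because inserting before or after it
  -- gives the same word (`ins-Λ`).
  ins : List ℕ → Word → Word
  ins [] Q = Q
  ins (zero ∷ g) Q = Λ ∷ ins g Q
  ins (suc f ∷ g) [] = O ∷ ins (f ∷ g) []
  ins (suc f ∷ g) (Λ ∷ Q) = Λ ∷ ins (suc f ∷ g) Q
  ins (suc f ∷ g) (U ∷ Q) = U ∷ ins (f ∷ g) Q
  ins (suc f ∷ g) (D ∷ Q) = D ∷ ins (f ∷ g) Q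
  ins (suc f ∷ g) (O ∷ Q) = O ∷ ins (f ∷ g) Q

  up : Word → Word
  up [] = []
  up (Λ ∷ P) = U ∷ Λ ∷ D ∷ up P
  up (U ∷ P) = U ∷ up P
  up (D ∷ P) = D ∷ up P
  up (O ∷ P) = O ∷ up P

  ins-Λ : ∀ g Q → ins g (Λ ∷ Q) ≡ Λ ∷ ins g Q
  ins-Λ [] Q = refl
  ins-Λ (zero ∷ g) Q = cong (Λ ∷_) (ins-Λ g Q)
  ins-Λ (suc f ∷ g) Q = refl

  -- The words in which every peak stands between U and D; the Bool tells
  -- whether the preceding token is U.
  data Raised : Bool → Word → Set where
    []  : Raised false []
    Λ∷_ : Raised false Q → Raised true (Λ ∷ Q)
    U∷_ : Raised true Q → Raised b (U ∷ Q)
    D∷_ : Raised false Q → Raised false (D ∷ Q)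
    O∷_ : Raised false Q → Raised false (O ∷ Q)

  rd0-ins : ∀ g → Raised true Q → rd 0 (ins g Q) ≡ 0
  rd0-ins [] (Λ∷ r) = refl
  rd0-ins [] (U∷ r) = refl
  rd0-ins (zero ∷ g) r = refl
  rd0-ins (suc f ∷ g) (Λ∷ r) = refl
  rd0-ins (suc f ∷ g) (U∷ r) = refl

  -- At positive depth an inserted peak does not exceed the height of reference. At depth 0, reached
  -- by a `U`, the walk stops in either case, because the token after a `U` of a raised word is `Λ`
  -- or `U`.
  rd-ins : ∀ d g → Raised b Q → rd (suc d) (ins g Q) ≡ rd (suc d) Q
  rd-ins d [] r = refl
  rd-ins d (zero ∷ g) r = rd-ins d g r
  rd-ins d (suc f ∷ g) [] = refl
  rd-ins d (suc f ∷ g) (Λ∷ r) = rd-ins d (suc f ∷ g) r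
  rd-ins zero (suc f ∷ g) (U∷ r) = cong (1 ⊔_) (trans (rd0-ins (f ∷ g) r) (sym (rd0-ins [] r)))
  rd-ins (suc d) (suc f ∷ g) (U∷ r) = cong (suc (suc d) ⊔_) (rd-ins d (f ∷ g) r)
  rd-ins d (suc f ∷ g) (D∷ r) = rd-ins (suc d) (f ∷ g) r
  rd-ins d (suc f ∷ g) (O∷ r) = refl

  -- Reversed prefixes of ins g Q over those of Q.
  data Inserted : Bool → Word → Word → Set where
    []  : Inserted false [] []
    Λ∷_ : Inserted true w q → Inserted false (Λ ∷ w) (Λ ∷ q)
    U∷_ : Inserted b w q → Inserted true (U ∷ w) (U ∷ q)
    D∷_ : Inserted false w q → Inserted false (D ∷ w) (D ∷ q)
    O∷_ : Inserted false w q → Inserted false (O ∷ w) (O ∷ q)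
    +Λ∷_ : Inserted b w q → Inserted b (Λ ∷ w) q

  ld1-inserted : Inserted false w q → ld 1 w ≡ 1
  ld1-inserted [] = refl
  ld1-inserted (Λ∷ r) = refl
  ld1-inserted (D∷ r) = refl
  ld1-inserted (O∷ r) = refl
  ld1-inserted (+Λ∷ r) = refl

  ld1-original : Inserted false w q → ld 1 q ≡ 1
  ld1-original [] = refl
  ld1-original (Λ∷ r) = refl
  ld1-original (D∷ r) = refl
  ld1-original (O∷ r) = refl
  ld1-original (+Λ∷ r) = ld1-original r

  -- At depth 2 or more an inserted peak stays below the height of reference. When a `D` leads the
  -- walk back to depth 1, the next token is not a `U`, and the walk stops there in both words.
  ld-inserted : ∀ d → Inserted b w q → ld (suc (suc d)) w ≡ ld (suc (suc d)) q
  ld-inserted d [] = refl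
  ld-inserted d (Λ∷ r) = ld-inserted d r
  ld-inserted d (U∷ r) = ld-inserted (suc d) r
  ld-inserted zero (D∷ r) = cong (2 ⊔_) (trans (ld1-inserted r) (sym (ld1-original r)))
  ld-inserted (suc d) (D∷ r) = cong (suc (suc (suc d)) ⊔_) (ld-inserted d r)
  ld-inserted d (O∷ r) = refl
  ld-inserted d (+Λ∷ r) = ld-inserted d r

  -- How insertion turns the heights and parities `L` of the old peaks into `L'`: `keep` is an old
  -- peak, `new` an inserted one, `skip` another token, which changes the parity `o` of the
  -- position. A new peak has weight one more than the position and relative height 1, so the sum
  -- has parity `o`.
  data Mix : Bool → List ℕ → List (ℕ × Bool) → List (ℕ × Bool) → Set where
    done : ∀ {o} → Mix o [] [] []
    skip[] : ∀ {o L L'} → Mix (not o) [] L L' → Mix o [] L L'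
    new  : ∀ {o L L'} → Mix o g L L' → Mix o (0 ∷ g) L ((1 , o) ∷ L')
    skip : ∀ {o f L L'} → Mix (not o) (f ∷ g) L L' → Mix o (suc f ∷ g) L L'
    keep : ∀ {o z L L'} → Mix o g L L' → Mix o g (z ∷ L) (z ∷ L')

  private
    pk-new : ∀ {o pre} g Q → ld 1 pre ⊓ rd 1 (ins g Q) ≡ 1 → ∀ {L L'} → Mix o g L L' →
      Mix o (0 ∷ g) L ((ld 1 pre ⊓ rd 1 (ins g Q) , not o xor odd (ld 1 pre ⊓ rd 1 (ins g Q))) ∷ L')
    pk-new {o} {pre} g Q e m rewrite e = subst (λ p → Mix o (0 ∷ g) _ ((1 , p) ∷ _)) (lem o) (new m)
      where
      lem : ∀ o → o ≡ not o xor true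
      lem true = refl
      lem false = refl

    1⊓ : ∀ {n m} → n ≡ 1 → 1 ≤ m → n ⊓ m ≡ 1
    1⊓ {m = suc m} refl (s≤s z≤n) = refl

    -- After a token other than `U` the walk to the left stops at depth 1; after a `U` the next old
    -- token is again `U`, which stops the walk to the right.
    new-height : ∀ {b w q} g → Inserted b w q → Raised b Q → (∀ {Q'} → Q ≢ Λ ∷ Q') → ld 1 w ⊓ rd 1 (ins g Q) ≡ 1
    new-height {Q = Q} {b = false} g i r n = 1⊓ (ld1-inserted i) (d≤rd 1 (ins g Q))
    new-height {b = true} g i (Λ∷ r) n = ⊥-elim (n refl)
    new-height {Q = U ∷ Q} {b = true} {w = w} g i (U∷ r) n =
      trans (⊓-comm (ld 1 w) _) (1⊓ (trans (rd-ins {b = true} 0 g (U∷ r)) (cong (1 ⊔_) (rd0-ins [] r))) (d≤ld 1 w))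

  -- While a peak of Q is next, nothing has been inserted since the preceding U.
  Fresh : Word → Word → Set
  Fresh w (Λ ∷ Q) = ∃ λ w' → w ≡ U ∷ w'
  Fresh w Q = ⊤

  private
    fresh-U : ∀ Q → Fresh (U ∷ w) Q
    fresh-U [] = tt
    fresh-U (Λ ∷ Q) = _ , refl
    fresh-U (U ∷ Q) = tt
    fresh-U (D ∷ Q) = tt
    fresh-U (O ∷ Q) = tt

    fresh-≢ : ∀ Q → (∀ {Q'} → Q ≢ Λ ∷ Q') → Fresh w Q
    fresh-≢ [] n = tt
    fresh-≢ (Λ ∷ Q) n = ⊥-elim (n refl)
    fresh-≢ (U ∷ Q) n = tt
    fresh-≢ (D ∷ Q) n = tt
    fresh-≢ (O ∷ Q) n = tt

    raised-≢ : Raised false Q → ∀ {Q'} → Q ≢ Λ ∷ Q'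
    raised-≢ () refl

  -- An old peak is preceded by a `U`, so its walk to the left is at depth 2 before it can meet an
  -- inserted peak; `Fresh` ensures that nothing was put between them. To the right, `rd-ins`
  -- applies at once.
  pk-ins : ∀ o g → Inserted b w q → Raised b Q → Fresh w Q → Mix o g (pk o q Q) (pk o w (ins g Q))
  pk-ins-new : ∀ o g → Inserted b w q → Raised b Q → (∀ {Q'} → Q ≢ Λ ∷ Q') →
    Mix o (0 ∷ g) (pk o q Q) (pk o w (ins (0 ∷ g) Q))
  pk-ins o g (+Λ∷ i) (Λ∷ r) (_ , ())
  pk-ins {w = U ∷ w} {U ∷ q} {Λ ∷ Q} o g (U∷ i) (Λ∷ r) f
    rewrite ins-Λ g Q | ld-inserted 0 i | rd-ins 0 g r = keep (pk-ins o g (Λ∷ U∷ i) r (fresh-≢ Q (raised-≢ r)))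
  pk-ins o [] i [] f = done
  pk-ins o [] i (U∷_ {Q} r) f = skip[] (pk-ins (not o) [] (U∷ i) r (fresh-U Q))
  pk-ins o [] i (D∷_ {Q} r) f = skip[] (pk-ins (not o) [] (D∷ i) r (fresh-≢ Q (raised-≢ r)))
  pk-ins o [] i (O∷_ {Q} r) f = skip[] (pk-ins (not o) [] (O∷ i) r (fresh-≢ Q (raised-≢ r)))
  pk-ins o (zero ∷ g) i [] f = pk-ins-new o g i [] λ ()
  pk-ins o (zero ∷ g) i (U∷ r) f = pk-ins-new o g i (U∷ r) λ ()
  pk-ins o (zero ∷ g) i (D∷ r) f = pk-ins-new o g i (D∷ r) λ ()
  pk-ins o (zero ∷ g) i (O∷ r) f = pk-ins-new o g i (O∷ r) λ ()
  pk-ins o (suc x ∷ g) i [] f = skip (pk-ins (not o) (x ∷ g) (O∷ i) [] tt)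
  pk-ins o (suc x ∷ g) i (U∷_ {Q} r) f = skip (pk-ins (not o) (x ∷ g) (U∷ i) r (fresh-U Q))
  pk-ins o (suc x ∷ g) i (D∷_ {Q} r) f = skip (pk-ins (not o) (x ∷ g) (D∷ i) r (fresh-≢ Q (raised-≢ r)))
  pk-ins o (suc x ∷ g) i (O∷_ {Q} r) f = skip (pk-ins (not o) (x ∷ g) (O∷ i) r (fresh-≢ Q (raised-≢ r)))
  pk-ins-new {w = w} {Q = Q} o g i r n = pk-new {pre = w} g Q (new-height g i r n) (pk-ins o g (+Λ∷ i) r (fresh-≢ Q n))

  data UpStart : Word → Set where
    Λ : UpStart (Λ ∷ w)
    U : UpStart (U ∷ w)

  -- The conditions make the word of a path unique: a `U` is followed by an up token, since with a
  -- down step it would be a peak, and no path ends with an E step. Only peaks carry the height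
  -- bound, because a run of `U`s ends in a peak.
  data Walk (k : ℕ) : ℕ → Word → Set where
    []  : Walk k 0 []
    Λ : suc y < k → Walk k y w → Walk k y (Λ ∷ w)
    U : UpStart w → Walk k (suc y) w → Walk k y (U ∷ w)
    D : Walk k y w → Walk k (suc y) (D ∷ w)
    O : w ≢ [] → Walk k 0 w → Walk k 0 (O ∷ w)

  raised-up : Walk k y P → Raised false (up P)
  raised-up-start : UpStart P → Walk k y P → Raised b (up P)
  raised-up [] = []
  raised-up (Λ h p) = U∷ Λ∷ D∷ raised-up p
  raised-up (U s p) = U∷ raised-up-start s p
  raised-up (D p) = D∷ raised-up p
  raised-up (O _ p) = O∷ raised-up p
  raised-up-start Λ (Λ _ p) = U∷ Λ∷ D∷ raised-up p
  raised-up-start U (U s p) = U∷ raised-up-start s p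

  -- Reversed prefixes of up P over those of P.
  data Lifted : Bool → Word → Word → Set where
    []  : Lifted false [] []
    Λ∷_ : Lifted b w q → Lifted false (D ∷ Λ ∷ U ∷ w) (Λ ∷ q)
    U∷_ : Lifted b w q → Lifted true (U ∷ w) (U ∷ q)
    D∷_ : Lifted false w q → Lifted false (D ∷ w) (D ∷ q)
    O∷_ : Lifted false w q → Lifted false (O ∷ w) (O ∷ q)

  -- The obstacles are raised together with the peak, so the walk stops at the same place, one unit
  -- deeper; passing over a raised peak does not change the maximum. `rd-up` is the counterpart to
  -- the right.
  ld-lifted : ∀ d → Lifted b w q → ld (suc (suc d)) w ≡ suc (ld (suc d) q)
  ld-lifted d [] = refl
  ld-lifted zero (Λ∷ r) = refl
  ld-lifted (suc d) (Λ∷_ {w = w} r) = trans (m≤n⇒m⊔n≡n (d≤ld (suc (suc (suc d))) w)) (ld-lifted (suc d) r)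
  ld-lifted d (U∷ r) = ld-lifted (suc d) r
  ld-lifted zero (D∷ r) = cong (2 ⊔_) (ld1 r)
    where
    ld1 : Lifted false w q → ld 1 w ≡ 1
    ld1 [] = refl
    ld1 (Λ∷ r) = refl
    ld1 (D∷ r) = refl
    ld1 (O∷ r) = refl
  ld-lifted (suc d) (D∷ r) = cong (suc (suc (suc d)) ⊔_) (ld-lifted d r)
  ld-lifted d (O∷ r) = refl

  rd-up : ∀ d → Walk k y P → rd (suc (suc d)) (up P) ≡ suc (rd (suc d) P)
  rd-up d [] = refl
  rd-up d (Λ {w = w} _ p) = trans (m≤n⇒m⊔n≡n (d≤rd (suc (suc d)) (up w))) (rd-up d p)
  rd-up zero (U {w = w} s p) = cong₂ _⊔_ refl (trans (rd1 s p) (cong suc (sym (rd0 s))))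
    where
    rd0 : UpStart P → rd 0 P ≡ 0
    rd0 Λ = refl
    rd0 U = refl
    rd0-up : UpStart P → rd 0 (up P) ≡ 0
    rd0-up Λ = refl
    rd0-up U = refl
    rd1 : UpStart P → Walk k y P → rd 1 (up P) ≡ 1
    rd1 Λ _ = refl
    rd1 U (U s p) = cong (1 ⊔_) (rd0-up s)
  rd-up (suc d) (U s p) = cong (suc (suc (suc d)) ⊔_) (rd-up d p)
  rd-up d (D p) = rd-up (suc d) p
  rd-up d (O _ p) = refl

  lift : ℕ × Bool → ℕ × Bool
  lift (r , p) = suc r , p

  -- Raising shifts a peak by one for its own `U` and by two for each earlier peak, and adds one to
  -- its relative height. The parity of the sum is unchanged.
  pk-up : ∀ o → Lifted b w q → Walk k y P → (b ≡ true → UpStart P) → pk o w (up P) ≡ map lift (pk o q P)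
  pk-up o l [] f = refl
  pk-up {w = w} {q = q} o l (Λ {w = P} _ p) f rewrite not-involutive o | ld-lifted 0 l | rd-up 0 p =
    cong₂ _∷_ (cong (_ ,_) (par o _)) (pk-up o (Λ∷ l) p λ ())
    where
    par : ∀ o x → o xor not x ≡ not o xor x
    par true x = not-involutive x
    par false x = refl
  pk-up o l (U s p) f = pk-up (not o) (U∷ l) p λ _ → s
  pk-up {false} o l (D p) f = pk-up (not o) (D∷ l) p λ ()
  pk-up {true} o l (D p) f with f refl
  ... | ()
  pk-up {false} o l (O _ p) f = pk-up (not o) (O∷ l) p λ ()
  pk-up {true} o l (O _ p) f with f refl
  ... | ()

  npeaks-up : ∀ P → npeaks (up P) ≡ npeaks P
  npeaks-up [] = refl
  npeaks-up (Λ ∷ P) = cong suc (npeaks-up P)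
  npeaks-up (U ∷ P) = npeaks-up P
  npeaks-up (D ∷ P) = npeaks-up P
  npeaks-up (O ∷ P) = npeaks-up P

  npeaks-ins : ∀ g Q → npeaks (ins g Q) ≡ length g + npeaks Q
  npeaks-ins [] Q = refl
  npeaks-ins (zero ∷ g) Q = cong suc (npeaks-ins g Q)
  npeaks-ins (suc f ∷ g) [] = npeaks-ins (f ∷ g) []
  npeaks-ins (suc f ∷ g) (Λ ∷ Q) = trans (cong suc (npeaks-ins (suc f ∷ g) Q)) (cong suc (sym (+-suc (length g) (npeaks Q))))
  npeaks-ins (suc f ∷ g) (U ∷ Q) = npeaks-ins (f ∷ g) Q
  npeaks-ins (suc f ∷ g) (D ∷ Q) = npeaks-ins (f ∷ g) Q
  npeaks-ins (suc f ∷ g) (O ∷ Q) = npeaks-ins (f ∷ g) Q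

  length-pk : ∀ o pre w → length (pk o pre w) ≡ npeaks w
  length-pk o pre [] = refl
  length-pk o pre (Λ ∷ w) = cong suc (length-pk o (Λ ∷ pre) w)
  length-pk o pre (U ∷ w) = length-pk (not o) (U ∷ pre) w
  length-pk o pre (D ∷ w) = length-pk (not o) (D ∷ pre) w
  length-pk o pre (O ∷ w) = length-pk (not o) (O ∷ pre) w

  weights-suc : ∀ x w → weights (suc x) w ≡ npeaks w + weights x w
  weights-suc x [] = refl
  weights-suc x (Λ ∷ w) rewrite weights-suc (suc (suc x)) w =
    solve 3 (λ x a b → con 2 :+ x :+ (a :+ b) := con 1 :+ a :+ (con 1 :+ x :+ b)) refl x (npeaks w) (weights (suc (suc x)) w)
    where open +-*-Solver
  weights-suc x (U ∷ w) = weights-suc (suc x) w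
  weights-suc x (D ∷ w) = weights-suc (suc x) w
  weights-suc x (O ∷ w) = weights-suc (suc x) w

  -- The peak with i peaks before it moves by 2i + 1, and the first odd numbers add up to a square.
  weights-up : ∀ x P → weights x (up P) ≡ weights x P + npeaks P * npeaks P
  weights-up x [] = refl
  weights-up x (Λ ∷ P) rewrite weights-up (4 + x) P | weights-suc (3 + x) P | weights-suc (2 + x) P =
    solve 3 (λ x n w → con 2 :+ x :+ (n :+ (n :+ w) :+ n :* n) := con 1 :+ x :+ w :+ (con 1 :+ n) :* (con 1 :+ n)) refl
      x (npeaks P) (weights (2 + x) P)
    where open +-*-Solver
  weights-up x (U ∷ P) = weights-up (suc x) P
  weights-up x (D ∷ P) = weights-up (suc x) P
  weights-up x (O ∷ P) = weights-up (suc x) P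

  private
    shift : ∀ w m n x v → w + 2 * (suc m * n) + suc m * suc m + suc m * suc x + v
      ≡ w + 2 * (suc m * n) + suc m * suc m + suc m * x + (suc m + v)
    shift = solve 5 (λ w m n x v →
      w :+ con 2 :* ((con 1 :+ m) :* n) :+ (con 1 :+ m) :* (con 1 :+ m) :+ (con 1 :+ m) :* (con 1 :+ x) :+ v
      := w :+ con 2 :* ((con 1 :+ m) :* n) :+ (con 1 :+ m) :* (con 1 :+ m) :+ (con 1 :+ m) :* x :+ (con 1 :+ m :+ v)) refl
      where open +-*-Solver

    weight-suc : ∀ f g → weight (suc f ∷ g) ≡ suc (length g) + weight (f ∷ g)
    weight-suc f g = trans (cong (_+ weight g) (*-suc (suc (length g)) f)) (+-assoc (suc (length g)) (suc (length g) * f) (weight g))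

  -- With all gaps 0 the j new peaks have weights x + 1, x + 3, and so on, in total j x + j^2, and
  -- push each old one by 2j. Letting a token pass moves the new peak and all later new ones by one;
  -- letting an old peak pass exchanges two units of weight.
  weights-ins : ∀ x g Q → weights x (ins g Q)
    ≡ weights x Q + 2 * (length g * npeaks Q) + length g * length g + length g * x + weight g
  weights-ins x [] Q = solve 1 (λ w → w := w :+ con 0 :+ con 0 :+ con 0 :+ con 0) refl (weights x Q)
    where open +-*-Solver
  weights-ins x (zero ∷ g) Q rewrite weights-ins (suc (suc x)) g Q | weights-suc (suc x) Q | weights-suc x Q
    | *-zeroʳ (length g) =
    solve 5 (λ x w m n v → con 1 :+ x :+ (n :+ (n :+ w) :+ con 2 :* (m :* n) :+ m :* m :+ m :* (con 2 :+ x) :+ v)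
      := w :+ con 2 :* ((con 1 :+ m) :* n) :+ (con 1 :+ m) :* (con 1 :+ m) :+ (con 1 :+ m) :* x :+ v) refl
      x (weights x Q) (length g) (npeaks Q) (weight g)
    where open +-*-Solver
  weights-ins x (suc f ∷ g) [] rewrite weights-ins (suc x) (f ∷ g) [] | weight-suc f g =
    shift 0 (length g) 0 x (weight (f ∷ g))
  weights-ins x (suc f ∷ g) (Λ ∷ Q) rewrite weights-ins (suc (suc x)) (suc f ∷ g) Q | weights-suc (suc x) Q | weights-suc x Q =
    solve 5 (λ x w m n v → con 1 :+ x :+ (w :+ con 2 :* ((con 1 :+ m) :* n) :+ (con 1 :+ m) :* (con 1 :+ m) :+ (con 1 :+ m) :* (con 2 :+ x) :+ v)
      := con 1 :+ x :+ w :+ con 2 :* ((con 1 :+ m) :* (con 1 :+ n)) :+ (con 1 :+ m) :* (con 1 :+ m) :+ (con 1 :+ m) :* x :+ v) refl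
      x (npeaks Q + (npeaks Q + weights x Q)) (length g) (npeaks Q) (weight (suc f ∷ g))
    where open +-*-Solver
  weights-ins x (suc f ∷ g) (U ∷ Q) rewrite weights-ins (suc x) (f ∷ g) Q | weight-suc f g = shift (weights (suc x) Q) (length g) (npeaks Q) x (weight (f ∷ g))
  weights-ins x (suc f ∷ g) (D ∷ Q) rewrite weights-ins (suc x) (f ∷ g) Q | weight-suc f g = shift (weights (suc x) Q) (length g) (npeaks Q) x (weight (f ∷ g))
  weights-ins x (suc f ∷ g) (O ∷ Q) rewrite weights-ins (suc x) (f ∷ g) Q | weight-suc f g = shift (weights (suc x) Q) (length g) (npeaks Q) x (weight (f ∷ g))

  words : List (List ℕ) → Word
  words [] = []
  words (g ∷ gs) = ins g (up (words gs))

  walk<-start : UpStart w → Walk k y w → suc y < k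
  walk<-start Λ (Λ h _) = h
  walk<-start U (U s p) = <-trans (n<1+n _) (walk<-start s p)

  walk-up : Walk k y P → Walk (suc k) y (up P)
  walk-up [] = []
  walk-up (Λ h p) = U Λ (Λ (s≤s h) (D (walk-up p)))
  walk-up (U s p) = U (start s) (walk-up p)
    where
    start : UpStart P → UpStart (up P)
    start Λ = U
    start U = U
  walk-up (D p) = D (walk-up p)
  walk-up (O n p) = O (n ∘ up≢[] _) (walk-up p)
    where
    up≢[] : ∀ P → up P ≡ [] → P ≡ []
    up≢[] [] _ = refl
    up≢[] (Λ ∷ P) ()
    up≢[] (U ∷ P) ()
    up≢[] (D ∷ P) ()
    up≢[] (O ∷ P) ()

  ins-start : ∀ g → UpStart Q → UpStart (ins g Q)
  ins-start [] s = s
  ins-start (zero ∷ g) s = Λ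
  ins-start (suc f ∷ g) Λ = Λ
  ins-start (suc f ∷ g) U = U

  ins≢[] : ∀ f g Q → ins (f ∷ g) Q ≢ []
  ins≢[] zero g Q ()
  ins≢[] (suc f) g [] ()
  ins≢[] (suc f) g (Λ ∷ Q) ()
  ins≢[] (suc f) g (U ∷ Q) ()
  ins≢[] (suc f) g (D ∷ Q) ()
  ins≢[] (suc f) g (O ∷ Q) ()

  walk-ins : ∀ g → y < k → Walk (suc k) y Q → Walk (suc k) y (ins g Q)
  walk-ins [] h p = p
  walk-ins (zero ∷ g) h p = Λ (s≤s h) (walk-ins g h p)
  walk-ins (suc f ∷ g) h [] = O (ins≢[] f g []) (walk-ins (f ∷ g) h [])
  walk-ins (suc f ∷ g) h (Λ h' p) = Λ h' (walk-ins (suc f ∷ g) h p)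
  walk-ins (suc f ∷ g) h (U s p) = U (ins-start (f ∷ g) s) (walk-ins (f ∷ g) (≤-pred (walk<-start s p)) p)
  walk-ins (suc f ∷ g) h (D p) = D (walk-ins (f ∷ g) (<-trans (n<1+n _) h) p)
  walk-ins (suc f ∷ g) h (O n p) = O (ins≢[] f g _) (walk-ins (f ∷ g) h p)

  walk-words : ∀ gs → Walk (suc (length gs)) 0 (words gs)
  walk-words [] = []
  walk-words (g ∷ gs) = walk-ins g (s≤s z≤n) (walk-up (walk-words gs))

  -- Decoding a word into its gap lists

  bump : List ℕ → List ℕ
  bump [] = []
  bump (f ∷ g) = suc f ∷ g

  -- E steps at the end are dropped.
  O∷'_ : Word → Word
  O∷' [] = []
  O∷' (t ∷ w) = O ∷ t ∷ w

  -- The second function decodes what follows a U that belongs to up P.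
  decode decodeU : Word → List ℕ × Word
  decode [] = [] , []
  decode (Λ ∷ w) = let g , P = decode w in 0 ∷ g , P
  decode (U ∷ w) = let g , P = decodeU w in bump g , P
  decode (D ∷ w) = let g , P = decode w in bump g , D ∷ P
  decode (O ∷ w) = let g , P = decode w in bump g , O∷' P
  decodeU (Λ ∷ D ∷ w) = let g , P = decode w in bump g , Λ ∷ P
  decodeU (Λ ∷ w) = let g , P = decodeU w in 0 ∷ g , P
  decodeU (U ∷ w) = let g , P = decodeU w in bump g , U ∷ P
  decodeU _ = [] , []

  up⁻ : Word → Word
  up⁻ (Λ ∷ P) = Λ ∷ D ∷ up P
  up⁻ (U ∷ P) = up P
  up⁻ _ = []

  private
    up-start : UpStart P → up P ≡ U ∷ up⁻ P
    up-start Λ = refl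
    up-start U = refl

    bump-D : ∀ g Q → ins (bump g) (D ∷ Q) ≡ D ∷ ins g Q
    bump-D [] Q = refl
    bump-D (_ ∷ g) Q = refl

    bump-U : ∀ g Q → ins (bump g) (U ∷ Q) ≡ U ∷ ins g Q
    bump-U [] Q = refl
    bump-U (_ ∷ g) Q = refl

    bump-O : ∀ g P w → ins g (up P) ≡ w → w ≢ [] → ins (bump g) (up (O∷' P)) ≡ O ∷ w
    bump-O [] [] w refl n = ⊥-elim (n refl)
    bump-O (f ∷ g) [] w refl n = refl
    bump-O [] (_ ∷ P) w refl n = refl
    bump-O (f ∷ g) (_ ∷ P) w refl n = refl

    walk-O∷' : Walk k 0 P → Walk k 0 (O∷' P)
    walk-O∷' {P = []} p = []
    walk-O∷' {P = t ∷ P} p = O (λ ()) p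

  -- Every `U` and `D` comes from the raised word. In the run of peaks after a `U`, the last one is
  -- old if a `D` follows, and none is old if another `U` follows. The `O`s behind the end of the
  -- raised word were appended by `ins`, hence `O∷'_`.
  decode-sound : Walk (suc k) y w → let g , P = decode w in Walk k y P × ins g (up P) ≡ w
  decodeU-sound : UpStart w → Walk (suc k) (suc y) w →
    let g , P = decodeU w in UpStart P × Walk k y P × ins g (up⁻ P) ≡ w
  decode-sound [] = [] , refl
  decode-sound (Λ h p) with decode-sound p
  ... | p' , e = p' , cong (Λ ∷_) e
  decode-sound (U {w = w} s p) with decodeU-sound s p
  ... | s' , p' , e rewrite up-start s' = p' , trans (bump-U (proj₁ (decodeU w)) _) (cong (U ∷_) e)
  decode-sound (D {w = w} p) with decode-sound p
  ... | p' , e = D p' , trans (bump-D (proj₁ (decode w)) _) (cong (D ∷_) e)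
  decode-sound (O {w = w} n p) with decode-sound p
  ... | p' , e = walk-O∷' p' , bump-O (proj₁ (decode w)) _ w e n
  decodeU-sound {w = Λ ∷ D ∷ w} Λ (Λ h (D p)) with decode-sound p
  ... | p' , e = Λ , Λ (≤-pred h) p' , (begin
    ins (bump g₁) (Λ ∷ D ∷ up P₁) ≡⟨ ins-Λ (bump g₁) (D ∷ up P₁) ⟩
    Λ ∷ ins (bump g₁) (D ∷ up P₁) ≡⟨ cong (Λ ∷_) (bump-D g₁ (up P₁)) ⟩
    Λ ∷ D ∷ ins g₁ (up P₁)        ≡⟨ cong (λ w → Λ ∷ D ∷ w) e ⟩
    Λ ∷ D ∷ w                     ∎)
    where
    open Relation.Binary.PropositionalEquality.≡-Reasoning
    g₁ = proj₁ (decode w)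
    P₁ = proj₂ (decode w)
  decodeU-sound {w = Λ ∷ Λ ∷ w} Λ (Λ h p) with decodeU-sound Λ p
  ... | s , p' , e = s , p' , cong (Λ ∷_) e
  decodeU-sound {w = Λ ∷ U ∷ w} Λ (Λ h p) with decodeU-sound U p
  ... | s , p' , e = s , p' , cong (Λ ∷_) e
  decodeU-sound {w = U ∷ w} U (U s p) with decodeU-sound s p
  ... | s' , p' , e = U , U s' p' , trans (cong (ins (bump g₁)) (up-start s')) (trans (bump-U g₁ _) (cong (U ∷_) e))
    where g₁ = proj₁ (decodeU w)

  decodeU-Λ : UpStart w → decodeU (Λ ∷ w) ≡ (0 ∷ proj₁ (decodeU w) , proj₂ (decodeU w))
  decodeU-Λ Λ = refl
  decodeU-Λ U = refl

  up⁻-start : UpStart P → Walk k y P → UpStart (up⁻ P)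
  up⁻-start Λ p = Λ
  up⁻-start U (U s p) rewrite up-start s = U

  decode-ins : ∀ g → Walk k y P → decode (ins g (up P)) ≡ (g , P)
  decodeU-ins : ∀ g → UpStart P → Walk k y P → decodeU (ins g (up⁻ P)) ≡ (g , P)
  decode-ins [] [] = refl
  decode-ins [] (Λ h p) rewrite decode-ins [] p = refl
  decode-ins [] (U s p) rewrite decodeU-ins [] U (U s p) = refl
  decode-ins [] (D p) rewrite decode-ins [] p = refl
  decode-ins [] (O {w = []} n p) = ⊥-elim (n refl)
  decode-ins [] (O {w = _ ∷ _} n p) rewrite decode-ins [] p = refl
  decode-ins (zero ∷ g) p rewrite decode-ins g p = refl
  decode-ins (suc f ∷ g) [] rewrite decode-ins {k = 0} (f ∷ g) [] = refl
  decode-ins (suc f ∷ g) (Λ h p) rewrite decodeU-ins (f ∷ g) Λ (Λ h p) = refl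
  decode-ins (suc f ∷ g) (U s p) rewrite decodeU-ins (f ∷ g) U (U s p) = refl
  decode-ins (suc f ∷ g) (D p) rewrite decode-ins (f ∷ g) p = refl
  decode-ins (suc f ∷ g) (O {w = []} n p) = ⊥-elim (n refl)
  decode-ins (suc f ∷ g) (O {w = _ ∷ _} n p) rewrite decode-ins (f ∷ g) p = refl
  decodeU-ins (zero ∷ g) s p = trans (decodeU-Λ (ins-start g (up⁻-start s p)))
    (cong (λ (g , P) → 0 ∷ g , P) (decodeU-ins g s p))
  decodeU-ins [] Λ (Λ h p) rewrite decode-ins [] p = refl
  decodeU-ins (suc f ∷ g) Λ (Λ h p) rewrite decode-ins (f ∷ g) p = refl
  decodeU-ins [] U (U s p) rewrite up-start s | decodeU-ins [] s p = refl
  decodeU-ins (suc f ∷ g) U (U s p) rewrite up-start s | decodeU-ins (f ∷ g) s p = refl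

  decodes : ℕ → Word → List (List ℕ)
  decodes zero w = []
  decodes (suc K) w = let g , P = decode w in g ∷ decodes K P

  length-decodes : ∀ K w → length (decodes K w) ≡ K
  length-decodes zero w = refl
  length-decodes (suc K) w = cong suc (length-decodes K _)

  -- For K = 0 no peak fits under the height bound, and a word without peaks has only `O`s, which
  -- may not stand at the end.
  words-decodes : ∀ K → Walk (suc K) 0 w → words (decodes K w) ≡ w
  words-decodes zero [] = refl
  words-decodes zero (Λ (s≤s ()) _)
  words-decodes zero (U s p) with walk<-start s p
  ... | s≤s ()
  words-decodes zero (O n p) with words-decodes zero p
  ... | refl = ⊥-elim (n refl)
  words-decodes (suc K) p with decode-sound p
  ... | p' , e = trans (cong (λ P → ins _ (up P)) (words-decodes K p')) e

  decodes-words : ∀ gs → decodes (length gs) (words gs) ≡ gs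
  decodes-words [] = refl
  decodes-words (g ∷ gs) rewrite decode-ins g (walk-words gs) = cong (g ∷_) (decodes-words gs)

  -- Statistics of the word built from gap lists

  npeaks-words : ∀ gs → npeaks (words gs) ≡ headOr0 (tails gs)
  npeaks-words [] = refl
  npeaks-words (g ∷ gs) rewrite npeaks-ins g (up (words gs)) | npeaks-up (words gs) = cong (length g +_) (npeaks-words gs)

  weights-words : ∀ gs → weights 0 (words gs) ≡ sum (map (λ a → a * a) (tails gs)) + sum (map weight gs)
  weights-words [] = refl
  weights-words (g ∷ gs)
    rewrite weights-ins 0 g (up (words gs)) | weights-up 0 (words gs) | npeaks-up (words gs) | npeaks-words gs | weights-words gs =
    solve 5 (λ s v n m t → s :+ v :+ n :* n :+ con 2 :* (m :* n) :+ m :* m :+ m :* con 0 :+ t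
      := (m :+ n) :* (m :+ n) :+ s :+ (t :+ v)) refl
      (sum (map (λ a → a * a) (tails gs))) (sum (map weight gs)) (headOr0 (tails gs)) (length g) (weight g)
    where open +-*-Solver

  peaksOf : Word → List (ℕ × Bool)
  peaksOf = pk false []

  peaksOf-words : ∀ g gs → Mix false g (map lift (peaksOf (words gs))) (peaksOf (words (g ∷ gs)))
  peaksOf-words g gs = subst (λ L → Mix false g L (peaksOf (words (g ∷ gs)))) (pk-up false [] (walk-words gs) λ ())
    (pk-ins false g [] (raised-up (walk-words gs)) (fresh-≢ (up (words gs)) (raised-≢ (raised-up (walk-words gs)))))

  mix-sum : ∀ {o L L'} → Mix o g L L' → sum (map proj₁ L') ≡ length g + sum (map proj₁ L)
  mix-sum done = refl
  mix-sum (skip[] m) = mix-sum m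
  mix-sum (new m) = cong suc (mix-sum m)
  mix-sum (skip m) = mix-sum m
  mix-sum {g = g} (keep {z = z} {L} m) = trans (cong (proj₁ z +_) (mix-sum m)) (x∙yz≈y∙xz (proj₁ z) (length g) _)

  heights-words : ∀ gs → sum (map proj₁ (peaksOf (words gs))) ≡ sum (tails gs)
  heights-words [] = refl
  heights-words (g ∷ gs) = trans (mix-sum (peaksOf-words g gs)) (trans (cong (length g +_)
    (trans (lifts (peaksOf (words gs))) (cong₂ _+_ (trans (length-pk false [] (words gs)) (npeaks-words gs)) (heights-words gs))))
    (sym (+-assoc (length g) _ _)))
    where
    lifts : ∀ L → sum (map proj₁ (map lift L)) ≡ length L + sum (map proj₁ L)
    lifts [] = refl
    lifts ((r , _) ∷ L) = cong suc (trans (cong (r +_) (lifts L)) (x∙yz≈y∙xz r (length L) _))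

  select : ℕ → List (ℕ × Bool) → List Bool
  select r L = map proj₂ (filterᵇ (λ z → proj₁ z ≡ᵇ r) L)

  select-keep : ∀ r z {L L'} → select r L ≡ select r L' → select r (z ∷ L) ≡ select r (z ∷ L')
  select-keep r z e with proj₁ z ≡ᵇ r
  ... | true = cong (proj₂ z ∷_) e
  ... | false = e

  mix-select : ∀ {o L L'} r → Mix o g L L' → select (suc (suc r)) L' ≡ select (suc (suc r)) L
  mix-select r done = refl
  mix-select r (skip[] m) = mix-select r m
  mix-select r (new m) = mix-select r m
  mix-select r (skip m) = mix-select r m
  mix-select r (keep {z = z} m) = select-keep (suc (suc r)) z (mix-select r m)

  -- Parities along the partial sums of the gaps.
  data Parities : Bool → List ℕ → List Bool → Set where
    []  : ∀ {o} → Parities o [] []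
    _∷_ : ∀ {o f g x xs} → x ≡ o xor odd f → Parities x g xs → Parities o (f ∷ g) (x ∷ xs)

  parities-changes : ∀ {o xs} → Parities o g xs → changes o xs ≡ oddCount g
  parities-changes [] = refl
  parities-changes (_∷_ {o} {f} refl p) = cong₂ _+_ (lem o (odd f)) (parities-changes p)
    where
    lem : ∀ a b → (if a xor (a xor b) then 1 else 0) ≡ bit b
    lem true true = refl
    lem true false = refl
    lem false true = refl
    lem false false = refl

  -- The old peaks have been raised, so the entries of height 1 are the new ones; their positions
  -- advance by the gaps.
  mix-new : ∀ {o L L'} → select 1 L ≡ [] → Mix o g L L' → Parities o g (select 1 L')
  mix-new e done = []
  mix-new e (skip[] m) with mix-new e m
  ... | q = lem q
    where
    lem : ∀ {o xs} → Parities (not o) [] xs → Parities o [] xs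
    lem [] = []
  mix-new {o = o} e (new m) = xor-false o ∷ mix-new e m
    where
    xor-false : ∀ o → o ≡ o xor false
    xor-false true = refl
    xor-false false = refl
  mix-new e (skip m) = lem (mix-new e m)
    where
    not-xor : ∀ a b → not a xor b ≡ a xor not b
    not-xor true b = sym (not-involutive b)
    not-xor false b = refl
    lem : ∀ {o f g xs} → Parities (not o) (f ∷ g) xs → Parities o (suc f ∷ g) xs
    lem {o} {f} (e ∷ p) = trans e (not-xor o (odd f)) ∷ p
  mix-new e (keep {z = z} m) with proj₁ z ≡ᵇ 1
  mix-new () (keep m) | true
  ... | false = mix-new e m

  sumIndices : List (ℕ × Bool) → ℕ → ℕ
  sumIndices L K = sum (map (λ r → changes false (select r L)) (oneTo K))

  oneTo-suc : ∀ K → oneTo (suc K) ≡ 1 ∷ map suc (oneTo K)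
  oneTo-suc K = cong (1 ∷_) (trans (map-applyUpTo suc suc K) (trans (sym (map-upTo (suc ∘ suc) K)) (map-∘ (upTo K))))

  -- Index 1 sees only the peaks inserted last; index r + 1 is index r of the word before raising.
  indices-words : ∀ gs → sumIndices (peaksOf (words gs)) (length gs) ≡ sum (map oddCount gs)
  indices-words [] = refl
  indices-words (g ∷ gs) = trans (cong (λ l → sum (map index l)) (oneTo-suc (length gs))) (cong₂ _+_
    (parities-changes (mix-new (none (words gs)) (peaksOf-words g gs)))
    (trans (cong sum (trans (sym (map-∘ (oneTo (length gs)))) (trans (sym (map-∘ (upTo (length gs))))
        (trans (map-cong (λ r → cong (changes false) (trans (mix-select r (peaksOf-words g gs)) (lifts r (peaksOf (words gs))))) (upTo (length gs)))
          (map-∘ (upTo (length gs)))))))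
      (indices-words gs)))
    where
    index : ℕ → ℕ
    index r = changes false (select r (peaksOf (words (g ∷ gs))))
    lifts : ∀ r L → select (suc (suc r)) (map lift L) ≡ select (suc r) L
    lifts r [] = refl
    lifts r (z ∷ L) with proj₁ z ≡ᵇ suc r
    ... | true = cong (proj₂ z ∷_) (lifts r L)
    ... | false = lifts r L
    positive : ∀ pre w → 1 ≤ ld 1 pre ⊓ rd 1 w
    positive pre w = ⊓-glb (d≤ld 1 pre) (d≤rd 1 w)
    none' : ∀ o pre w → select 1 (map lift (pk o pre w)) ≡ []
    none' o pre [] = refl
    none' o pre (Λ ∷ w) with ld 1 pre ⊓ rd 1 w | positive pre w
    ... | suc _ | _ = none' o (Λ ∷ pre) w
    none' o pre (U ∷ w) = none' (not o) (U ∷ pre) w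
    none' o pre (D ∷ w) = none' (not o) (D ∷ pre) w
    none' o pre (O ∷ w) = none' (not o) (O ∷ pre) w
    none : ∀ w → select 1 (map lift (peaksOf w)) ≡ []
    none w = none' false [] w

-- The relative height of a peak as the smaller of two depths

module RelativeHeights where
  open import Defs
  import Data.List.Relation.Unary.All.Properties as All
  open import Data.List.Relation.Unary.Any using (here; there)
  import Data.List.Relation.Unary.Any.Properties as Any
  open import Data.List.Membership.Propositional using (_∈_; find; lose)
  open import Relation.Nullary using (yes; no)

  private
    variable
      d h y z Y : ℕ
      s t : Step
      pre suf : List Step
      a : Vertex
      r : Peak

  -- A path is viewed as a reversed prefix and a suffix.
  at : List Step → ℕ × ℕ
  at [] = 0 , 0
  at (s ∷ pre) = move s (at pre)

  data Reach : List Step → ℕ → Set where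
    []  : Reach [] 0
    NE∷_ : Reach pre y → Reach (NE ∷ pre) (suc y)
    N∷_  : Reach pre y → Reach (N ∷ pre) (suc y)
    SE∷_ : Reach pre (suc y) → Reach (SE ∷ pre) y
    E∷_  : Reach pre 0 → Reach (E ∷ pre) 0

  data Descend : ℕ → List Step → Set where
    []  : Descend 0 []
    NE∷_ : Descend (suc y) suf → Descend y (NE ∷ suf)
    N∷_  : Descend (suc y) suf → Descend y (N ∷ suf)
    SE∷_ : Descend y suf → Descend (suc y) (SE ∷ suf)
    E∷_  : Descend 0 suf → Descend 0 (E ∷ suf)

  reach-at : Reach pre y → proj₂ (at pre) ≡ y
  reach-at [] = refl
  reach-at (NE∷ p) = cong suc (reach-at p)
  reach-at (N∷ p) = cong suc (reach-at p)
  reach-at (SE∷ p) = cong (_∸ 1) (reach-at p)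
  reach-at (E∷ p) = reach-at p

  vertexAt : List Step → Vertex
  vertexAt pre = vtx (length pre) (proj₁ (at pre)) (proj₂ (at pre))

  peakAt : Step → List Step → Peak
  peakAt s pre = peak (suc (length pre)) (proj₁ (at (s ∷ pre))) (proj₂ (at (s ∷ pre))) (isN s)

  data VertexL : List Step → Vertex → Set where
    here  : VertexL pre (vertexAt pre)
    there : VertexL pre a → VertexL (s ∷ pre) a

  data VertexR : List Step → List Step → Vertex → Set where
    here  : VertexR pre suf (vertexAt pre)
    there : VertexR (s ∷ pre) suf a → VertexR pre (s ∷ suf) a

  -- Peaks up to the end of the prefix; the first argument is the next step.
  data PeakL : Step → List Step → Peak → Set where
    here  : T (isUp s) → PeakL SE (s ∷ pre) (peakAt s pre)
    there : PeakL s pre r → PeakL t (s ∷ pre) r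

  data PeakR : List Step → List Step → Peak → Set where
    here  : T (isUp s) → PeakR pre (s ∷ SE ∷ suf) (peakAt s pre)
    there : PeakR (s ∷ pre) suf r → PeakR pre (s ∷ suf) r

  ∈⇒VertexR : ∀ pre suf → a ∈ verticesFrom (length pre) (at pre) suf → VertexR pre suf a
  ∈⇒VertexR pre [] (here refl) = here
  ∈⇒VertexR pre (s ∷ suf) (here refl) = here
  ∈⇒VertexR pre (s ∷ suf) (there i) = there (∈⇒VertexR (s ∷ pre) suf i)

  VertexR⇒∈ : ∀ pre suf → VertexR pre suf a → a ∈ verticesFrom (length pre) (at pre) suf
  VertexR⇒∈ pre [] here = here refl
  VertexR⇒∈ pre (s ∷ suf) here = here refl
  VertexR⇒∈ pre (s ∷ suf) (there v) = there (VertexR⇒∈ (s ∷ pre) suf v)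

  private
    castʳ : ∀ {m n o} → n ≡ o → m ≤ n → m ≤ o
    castʳ refl p = p

    castˡ : ∀ {m n o} → m ≡ n → m ≤ o → n ≤ o
    castˡ refl p = p

    castˡ< : ∀ {m n o} → m ≡ n → m < o → n < o
    castˡ< refl p = p

    ∈-if : ∀ {A : Set} {x y : A} {xs} b → x ∈ (if b then y ∷ xs else xs) → (T b × x ≡ y) ⊎ x ∈ xs
    ∈-if true (here e) = inj₁ (tt , e)
    ∈-if true (there i) = inj₂ i
    ∈-if false i = inj₂ i

    peakR-here : ∀ {s t} → T (isUp s ∧ isSE t) → PeakR pre (s ∷ t ∷ suf) (peakAt s pre)
    peakR-here {s = s} {SE} u = here (proj₁ (Equivalence.to T-∧ u))
    peakR-here {s = s} {NE} u with () ← proj₂ (Equivalence.to (T-∧ {isUp s}) u)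
    peakR-here {s = s} {N} u with () ← proj₂ (Equivalence.to (T-∧ {isUp s}) u)
    peakR-here {s = s} {E} u with () ← proj₂ (Equivalence.to (T-∧ {isUp s}) u)

  ∈⇒PeakR : ∀ pre suf → r ∈ peaksFrom (length pre) (at pre) suf → PeakR pre suf r
  ∈⇒PeakR pre (s ∷ t ∷ suf) i = [ (λ { (u , refl) → peakR-here u }) , there ∘ ∈⇒PeakR (s ∷ pre) (t ∷ suf) ]′
    (∈-if (isUp s ∧ isSE t) i)

  PeakR⇒∈ : ∀ pre suf → PeakR pre suf r → r ∈ peaksFrom (length pre) (at pre) suf
  PeakR⇒∈ pre (s ∷ SE ∷ suf) (here u) with isUp s
  ... | true = here refl
  PeakR⇒∈ pre (s ∷ t ∷ suf) (there k) = skip (isUp s ∧ isSE t) (PeakR⇒∈ (s ∷ pre) (t ∷ suf) k)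
    where
    skip : ∀ {A : Set} {x y : A} {xs} b → x ∈ xs → x ∈ (if b then y ∷ xs else xs)
    skip true i = there i
    skip false i = i
  PeakR⇒∈ pre (s ∷ []) (there ())

  VertexR-split : ∀ pre → VertexR [] (pre ʳ++ suf) a → VertexL pre a ⊎ VertexR pre suf a
  VertexR-split [] v = inj₂ v
  VertexR-split (s ∷ pre) v with VertexR-split pre v
  ... | inj₁ l = inj₁ (there l)
  ... | inj₂ here = inj₁ (there here)
  ... | inj₂ (there v') = inj₂ v'

  VertexR-join : ∀ pre → VertexL pre a ⊎ VertexR pre suf a → VertexR [] (pre ʳ++ suf) a
  VertexR-join [] (inj₁ here) = here
  VertexR-join [] (inj₂ v) = v
  VertexR-join (s ∷ pre) (inj₁ here) = VertexR-join pre (inj₂ (there here))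
  VertexR-join (s ∷ pre) (inj₁ (there l)) = VertexR-join pre (inj₁ l)
  VertexR-join (s ∷ pre) (inj₂ v) = VertexR-join pre (inj₂ (there v))

  PeakR-split : ∀ pre → PeakR [] (pre ʳ++ (t ∷ suf)) r → PeakL t pre r ⊎ PeakR pre (t ∷ suf) r
  PeakR-split [] k = inj₂ k
  PeakR-split (s ∷ pre) k with PeakR-split pre k
  ... | inj₁ l = inj₁ (there l)
  ... | inj₂ (here u) = inj₁ (here u)
  ... | inj₂ (there k') = inj₂ k'

  PeakR-join : ∀ pre → PeakL t pre r ⊎ PeakR pre (t ∷ suf) r → PeakR [] (pre ʳ++ (t ∷ suf)) r
  PeakR-join [] (inj₂ k) = k
  PeakR-join (s ∷ pre) (inj₁ (here u)) = PeakR-join pre (inj₂ (here u))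
  PeakR-join (s ∷ pre) (inj₁ (there l)) = PeakR-join pre (inj₁ l)
  PeakR-join (s ∷ pre) (inj₂ k) = PeakR-join pre (inj₂ (there k))

  x≤move : ∀ s p → proj₁ p ≤ proj₁ (move s p)
  x≤move NE p = n≤1+n _
  x≤move SE p = n≤1+n _
  x≤move N p = ≤-refl
  x≤move E p = n≤1+n _

  VertexL-≤ : VertexL pre a → vidx a ≤ length pre × vx a ≤ proj₁ (at pre)
  VertexL-≤ here = ≤-refl , ≤-refl
  VertexL-≤ (there {s = s} l) with VertexL-≤ l
  ... | i , x = m≤n⇒m≤1+n i , ≤-trans x (x≤move s _)

  VertexR-≥ : VertexR pre suf a → length pre ≤ vidx a × proj₁ (at pre) ≤ vx a
  VertexR-≥ here = ≤-refl , ≤-refl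
  VertexR-≥ (there {s = s} v) with VertexR-≥ v
  ... | i , x = ≤-trans (n≤1+n _) i , ≤-trans (x≤move s _) x

  PeakL-≤ : PeakL t pre r → pidx r ≤ length pre × wt r ≤ proj₁ (at pre)
  PeakL-≤ (here u) = ≤-refl , ≤-refl
  PeakL-≤ (there {s = s} l) with PeakL-≤ l
  ... | i , x = m≤n⇒m≤1+n i , ≤-trans x (x≤move s _)

  PeakL-< : t ≢ SE → PeakL t pre r → wt r < proj₁ (at pre)
  PeakL-< n (here u) = ⊥-elim (n refl)
  PeakL-< n (there {s = NE} l) = m≤n⇒m≤1+n (PeakL-< (λ ()) l)
  PeakL-< n (there {s = SE} l) = s≤s (proj₂ (PeakL-≤ l))
  PeakL-< n (there {s = N} l) = PeakL-< (λ ()) l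
  PeakL-< n (there {s = E} l) = m≤n⇒m≤1+n (PeakL-< (λ ()) l)

  PeakR-> : PeakR pre suf r → length pre < pidx r × proj₁ (at pre) ≤ wt r
  PeakR-> (here {s = s} u) = ≤-refl , x≤move s _
  PeakR-> (there {s = s} k) with PeakR-> k
  ... | i , x = ≤-trans (n≤1+n _) i , ≤-trans (x≤move s _) x

  -- `ld` for steps: the walk to the left stops before the height of the peak recurs. In accordance
  -- with the tie rule, the walk of `rightDepth` may return to that height but not exceed it.
  leftDepth : ℕ → List Step → ℕ
  leftDepth d [] = d
  leftDepth d (NE ∷ p) = leftDepth (suc d) p
  leftDepth d (N ∷ p) = leftDepth (suc d) p
  leftDepth d (E ∷ p) = d
  leftDepth (suc (suc d)) (SE ∷ p) = suc (suc d) ⊔ leftDepth (suc d) p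
  leftDepth d (SE ∷ p) = d

  rightDepth : ℕ → List Step → ℕ
  rightDepth d [] = d
  rightDepth d (SE ∷ s) = rightDepth (suc d) s
  rightDepth d (E ∷ s) = d
  rightDepth zero (_ ∷ s) = zero
  rightDepth (suc d) (NE ∷ s) = suc d ⊔ rightDepth d s
  rightDepth (suc d) (N ∷ s) = suc d ⊔ rightDepth d s

  d≤leftDepth : ∀ d p → d ≤ leftDepth d p
  d≤leftDepth d [] = ≤-refl
  d≤leftDepth d (NE ∷ p) = ≤-trans (n≤1+n d) (d≤leftDepth (suc d) p)
  d≤leftDepth d (N ∷ p) = ≤-trans (n≤1+n d) (d≤leftDepth (suc d) p)
  d≤leftDepth d (E ∷ p) = ≤-refl
  d≤leftDepth zero (SE ∷ p) = z≤n
  d≤leftDepth (suc zero) (SE ∷ p) = ≤-refl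
  d≤leftDepth (suc (suc d)) (SE ∷ p) = m≤m⊔n _ (leftDepth (suc d) p)

  d≤rightDepth : ∀ d p → d ≤ rightDepth d p
  d≤rightDepth d [] = ≤-refl
  d≤rightDepth d (SE ∷ p) = ≤-trans (n≤1+n d) (d≤rightDepth (suc d) p)
  d≤rightDepth d (E ∷ p) = ≤-refl
  d≤rightDepth zero (NE ∷ p) = z≤n
  d≤rightDepth zero (N ∷ p) = z≤n
  d≤rightDepth (suc d) (NE ∷ p) = m≤m⊔n _ (rightDepth d p)
  d≤rightDepth (suc d) (N ∷ p) = m≤m⊔n _ (rightDepth d p)

  leftDepth-≤ : Reach pre y → leftDepth d pre ≤ y + d
  leftDepth-≤ [] = ≤-refl
  leftDepth-≤ {d = d} (NE∷_ {y = y} p) = castʳ (+-suc y d) (leftDepth-≤ p)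
  leftDepth-≤ {d = d} (N∷_ {y = y} p) = castʳ (+-suc y d) (leftDepth-≤ p)
  leftDepth-≤ {d = zero} (SE∷ p) = z≤n
  leftDepth-≤ {d = suc zero} (SE∷_ {y = y} p) = m≤n+m 1 y
  leftDepth-≤ {d = suc (suc d)} (SE∷_ {y = y} p) = ⊔-lub (m≤n+m _ y) (castʳ (sym (+-suc y (suc d))) (leftDepth-≤ p))
  leftDepth-≤ (E∷ p) = ≤-refl

  private
    same-depth : Reach pre y → y + d ≡ Y → proj₂ (at pre) + h ≡ Y → h ≡ d
    same-depth {y = y} {d} {h = h} p e e' = +-cancelˡ-≡ y h d (trans (cong (_+ h) (sym (reach-at p))) (trans e' (sym e)))

    -- To the left of a SE step the path only climbs along SE steps until an up step appears, and
    -- this one ends in a peak of height at least `Y`.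
    blockedL : Reach pre z → Y ≤ z → 1 ≤ Y → VertexL pre a → vy a < Y →
      ∃ λ r → PeakL SE pre r × vidx a < pidx r × Y ≤ ht r
    blockedL p Y≤ 1≤ here lt = ⊥-elim (<⇒≱ lt (castʳ (sym (reach-at p)) Y≤))
    blockedL q@(NE∷ p) Y≤ 1≤ (there l) lt = _ , here tt , s≤s (proj₁ (VertexL-≤ l)) , castʳ (sym (reach-at q)) Y≤
    blockedL q@(N∷ p) Y≤ 1≤ (there l) lt = _ , here tt , s≤s (proj₁ (VertexL-≤ l)) , castʳ (sym (reach-at q)) Y≤
    blockedL (SE∷ p) Y≤ 1≤ (there l) lt with blockedL p (m≤n⇒m≤1+n Y≤) 1≤ l lt
    ... | r , k , rest = r , there k , rest
    blockedL (E∷ p) Y≤ 1≤ (there l) lt = ⊥-elim (<⇒≱ 1≤ Y≤)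

    blockedR : T (isUp s) → Reach (s ∷ pre) z → Descend z suf → Y < z → VertexR (s ∷ pre) suf a → vy a ≤ Y →
      ∃ λ r → PeakR pre (s ∷ suf) r × pidx r < vidx a × Y < ht r
    blockedR u p _ lt here le = ⊥-elim (<⇒≱ lt (castˡ (reach-at p) le))
    blockedR u p (SE∷ g) lt (there v) le = _ , here u , proj₁ (VertexR-≥ v) , castʳ (sym (reach-at p)) lt
    blockedR u p (NE∷ g) lt (there v) le with blockedR tt (NE∷ p) g (m≤n⇒m≤1+n lt) v le
    ... | r , k , rest = r , there k , rest
    blockedR u p (N∷ g) lt (there v) le with blockedR tt (N∷ p) g (m≤n⇒m≤1+n lt) v le
    ... | r , k , rest = r , there k , rest

  ClearL : ℕ → Step → List Step → Vertex → Set
  ClearL Y t pre a = ∀ {r} → PeakL t pre r → vidx a < pidx r → ht r < Y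

  ClearR : ℕ → List Step → List Step → Vertex → Set
  ClearR Y pre suf a = ∀ {r} → PeakR pre suf r → pidx r < vidx a → ht r ≤ Y

  -- If the walk stops before it reaches `a`, then either at an E step, where the depth is all of
  -- `Y`, or where a SE step leads back to height `Y`; there `blockedL` gives a forbidden peak in
  -- between.
  leftDepth-upper : Reach pre y → y + suc d ≡ Y → VertexL pre a → vy a + h ≡ Y → 1 ≤ h →
    ClearL Y t pre a → h ≤ leftDepth (suc d) pre
  leftDepth-upper {pre = pre} p e here e' 1≤ c = subst (_≤ leftDepth _ pre) (sym (same-depth p e e')) (d≤leftDepth _ pre)
  leftDepth-upper (NE∷ p) e (there l) e' 1≤ c = leftDepth-upper p (trans (+-suc _ _) e) l e' 1≤ (c ∘ there)
  leftDepth-upper (N∷ p) e (there l) e' 1≤ c = leftDepth-upper p (trans (+-suc _ _) e) l e' 1≤ (c ∘ there)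
  leftDepth-upper {d = suc d} (SE∷_ {y = y} p) e (there l) e' 1≤ c =
    ≤-trans (leftDepth-upper p (trans (sym (+-suc y (suc d))) e) l e' 1≤ (c ∘ there)) (m≤n⊔m (suc (suc d)) _)
  leftDepth-upper {d = zero} {a = a} {h} (SE∷_ {y = y} p) e (there l) refl 1≤ c with
    blockedL p (≤-reflexive (trans (sym e) (+-comm y 1))) (≤-trans 1≤ (m≤n+m h (vy a))) l (m<m+n (vy a) 1≤)
  ... | r , k , i , Y≤ = ⊥-elim (<⇒≱ (c (there k) i) Y≤)
  leftDepth-upper {a = a} {h} (E∷ p) e (there l) e' 1≤ c = subst (h ≤_) (trans e' (sym e)) (m≤n+m h (vy a))

  -- The depth changes by at most one per step, so every depth up to the maximum is attained. The
  -- peaks passed are lower than `Y`, as the depth stays positive.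
  leftDepth-lower : Reach pre y → y + suc d ≡ Y → suc d ≤ h → h ≤ leftDepth (suc d) pre →
    ∃ λ a → VertexL pre a × vy a + h ≡ Y × ClearL Y t pre a
  leftDepth-lower {d = d} {h = h} p e d≤ h≤ with h ≟ suc d
  leftDepth-lower {pre = pre} p e d≤ h≤ | yes refl =
    vertexAt pre , here , trans (cong (_+ _) (reach-at p)) e , λ k i → ⊥-elim (<⇒≱ i (proj₁ (PeakL-≤ k)))
  leftDepth-lower [] e d≤ h≤ | no n = ⊥-elim (n (≤-antisym h≤ d≤))
  leftDepth-lower {t = t} q@(NE∷_ {y = y} p) refl d≤ h≤ | no n
    with leftDepth-lower {t = NE} p (+-suc y _) (≤∧≢⇒< d≤ (n ∘ sym)) h≤
  ... | a , l , e' , c = a , there l , e' , λ { (here u) i → castˡ< (sym (reach-at q)) (m<m+n (suc y) (s≤s z≤n)) ; (there k) i → c k i }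
  leftDepth-lower {t = t} q@(N∷_ {y = y} p) refl d≤ h≤ | no n
    with leftDepth-lower {t = N} p (+-suc y _) (≤∧≢⇒< d≤ (n ∘ sym)) h≤
  ... | a , l , e' , c = a , there l , e' , λ { (here u) i → castˡ< (sym (reach-at q)) (m<m+n (suc y) (s≤s z≤n)) ; (there k) i → c k i }
  leftDepth-lower {d = zero} (SE∷ p) e d≤ h≤ | no n = ⊥-elim (n (≤-antisym h≤ d≤))
  leftDepth-lower {pre = SE ∷ pre} {d = suc d} {h = h} {t} (SE∷_ {y = y} p) e d≤ h≤ | no n with leftDepth (suc d) pre in eq
  ... | D with ≤-total D (suc (suc d))
  ... | inj₁ D≤ = ⊥-elim (n (≤-antisym (subst (h ≤_) (m≥n⇒m⊔n≡m D≤) h≤) d≤))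
  ... | inj₂ ≤D with leftDepth-lower {h = h} {t = SE} p (trans (sym (+-suc y (suc d))) e) (≤-trans (n≤1+n _) d≤) (subst (h ≤_) (trans (m≤n⇒m⊔n≡n ≤D) (sym eq)) h≤)
  ... | a , l , e' , c = a , there l , e' , λ { (here ()) i ; (there k) i → c k i }
  leftDepth-lower (E∷ p) e d≤ h≤ | no n = ⊥-elim (n (≤-antisym h≤ d≤))

  rightDepth-upper : Reach pre y → Descend y suf → y + d ≡ Y → VertexR pre suf a → vy a + h ≡ Y → 1 ≤ h →
    ClearR Y pre suf a → h ≤ rightDepth d suf
  rightDepth-upper {suf = suf} p g e here e' 1≤ c = subst (_≤ rightDepth _ suf) (sym (same-depth p e e')) (d≤rightDepth _ suf)
  rightDepth-upper p (SE∷ g) e (there v) e' 1≤ c = rightDepth-upper (SE∷ p) g (trans (+-suc _ _) e) v e' 1≤ (c ∘ there)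
  rightDepth-upper {d = suc d} p (NE∷_ {y = y} g) e (there v) e' 1≤ c =
    ≤-trans (rightDepth-upper (NE∷ p) g (trans (sym (+-suc y d)) e) v e' 1≤ (c ∘ there)) (m≤n⊔m (suc d) _)
  rightDepth-upper {d = suc d} p (N∷_ {y = y} g) e (there v) e' 1≤ c =
    ≤-trans (rightDepth-upper (N∷ p) g (trans (sym (+-suc y d)) e) v e' 1≤ (c ∘ there)) (m≤n⊔m (suc d) _)
  rightDepth-upper {d = zero} {a = a} {h = h} p (NE∷_ {y = y} g) refl (there v) e' 1≤ c with
    blockedR tt (NE∷ p) g (s≤s (≤-reflexive (+-identityʳ y))) v (subst (vy a ≤_) e' (m≤m+n (vy a) h))
  ... | r , k , i , Y< = ⊥-elim (<⇒≱ Y< (c k i))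
  rightDepth-upper {d = zero} {a = a} {h = h} p (N∷_ {y = y} g) refl (there v) e' 1≤ c with
    blockedR tt (N∷ p) g (s≤s (≤-reflexive (+-identityʳ y))) v (subst (vy a ≤_) e' (m≤m+n (vy a) h))
  ... | r , k , i , Y< = ⊥-elim (<⇒≱ Y< (c k i))
  rightDepth-upper {a = a} {h = h} p (E∷ g) e (there v) e' 1≤ c = subst (h ≤_) (trans e' (sym e)) (m≤n+m h (vy a))

  rightDepth-lower : Reach pre y → Descend y suf → y + d ≡ Y → d ≤ h → h ≤ rightDepth d suf →
    ∃ λ a → VertexR pre suf a × vy a + h ≡ Y × ClearR Y pre suf a
  rightDepth-lower {d = d} {h = h} p g e d≤ h≤ with h ≟ d
  rightDepth-lower {pre = pre} p g e d≤ h≤ | yes refl =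
    vertexAt pre , here , trans (cong (_+ _) (reach-at p)) e , λ k i → ⊥-elim (<⇒≱ i (<⇒≤ (proj₁ (PeakR-> k))))
  rightDepth-lower p [] e d≤ h≤ | no n = ⊥-elim (n (≤-antisym h≤ d≤))
  rightDepth-lower p (E∷ g) e d≤ h≤ | no n = ⊥-elim (n (≤-antisym h≤ d≤))
  rightDepth-lower p (SE∷_ {y = y} g) refl d≤ h≤ | no n with rightDepth-lower (SE∷ p) g (+-suc y _) (≤∧≢⇒< d≤ (n ∘ sym)) h≤
  ... | a , v , e' , c = a , there v , e' , λ { (here ()) i ; (there k) i → c k i }
  rightDepth-lower {d = zero} p (NE∷ g) e d≤ h≤ | no n = ⊥-elim (n (≤-antisym h≤ d≤))
  rightDepth-lower {d = zero} p (N∷ g) e d≤ h≤ | no n = ⊥-elim (n (≤-antisym h≤ d≤))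
  rightDepth-lower {suf = NE ∷ suf} {d = suc d} {h = h} p (NE∷_ {y = y} g) refl d≤ h≤ | no n with rightDepth d suf in eq
  ... | D with ≤-total D (suc d)
  ... | inj₁ D≤ = ⊥-elim (n (≤-antisym (subst (h ≤_) (m≥n⇒m⊔n≡m D≤) h≤) d≤))
  ... | inj₂ ≤D with rightDepth-lower {h = h} (NE∷ p) g (sym (+-suc y d)) (≤-trans (n≤1+n _) d≤) (subst (h ≤_) (trans (m≤n⇒m⊔n≡n ≤D) (sym eq)) h≤)
  ... | a , v , e' , c = a , there v , e' , λ { (here u) i → castˡ (sym (reach-at (NE∷ p))) (subst (suc y ≤_) (sym (+-suc y d)) (s≤s (m≤m+n y d))) ; (there k) i → c k i }
  rightDepth-lower {suf = N ∷ suf} {d = suc d} {h = h} p (N∷_ {y = y} g) refl d≤ h≤ | no n with rightDepth d suf in eq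
  ... | D with ≤-total D (suc d)
  ... | inj₁ D≤ = ⊥-elim (n (≤-antisym (subst (h ≤_) (m≥n⇒m⊔n≡m D≤) h≤) d≤))
  ... | inj₂ ≤D with rightDepth-lower {h = h} (N∷ p) g (sym (+-suc y d)) (≤-trans (n≤1+n _) d≤) (subst (h ≤_) (trans (m≤n⇒m⊔n≡n ≤D) (sym eq)) h≤)
  ... | a , v , e' , c = a , there v , e' , λ { (here u) i → castˡ (sym (reach-at (N∷ p))) (subst (suc y ≤_) (sym (+-suc y d)) (s≤s (m≤m+n y d))) ; (there k) i → c k i }

  private
    guard⁻ : ∀ a b {c} → T (not (a ∧ b) ∨ c) → T a → T b → T c
    guard⁻ true true t _ _ = t

    guard⁺ : ∀ a b {c} → (T a → T b → T c) → T (not (a ∧ b) ∨ c)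
    guard⁺ true true f = f tt tt
    guard⁺ true false f = tt
    guard⁺ false b f = tt

    ∧⁻ : ∀ {a b} → T (a ∧ b) → T a × T b
    ∧⁻ = Equivalence.to T-∧

    ∧⁺ : ∀ {a b} → T a → T b → T (a ∧ b)
    ∧⁺ p q = Equivalence.from T-∧ (p , q)

    any⁻ : ∀ {A : Set} (P : A → Bool) xs → T (any P xs) → ∃ λ x → x ∈ xs × T (P x)
    any⁻ P xs t = find (Any.any⁻ P xs t)

    any⁺ : ∀ {A : Set} (P : A → Bool) {x xs} → x ∈ xs → T (P x) → T (any P xs)
    any⁺ P i t = Any.any⁺ P (lose i t)

  private
    reach-pred : T (isUp s) → Reach (s ∷ pre) Y → ∃ λ y → y + 1 ≡ Y × Reach pre y
    reach-pred u (NE∷_ {y = y} p) = y , +-comm y 1 , p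
    reach-pred u (N∷_ {y = y} p) = y , +-comm y 1 , p

    descend-pred : Descend Y (SE ∷ suf) → ∃ λ y → y + 1 ≡ Y × Descend y suf × (Reach pre Y → Reach (SE ∷ pre) y)
    descend-pred (SE∷_ {y = y} g) = y , +-comm y 1 , g , SE∷_

  module _ {s : Step} {pre suf : List Step} {Y : ℕ} (u : T (isUp s)) (p↑ : Reach (s ∷ pre) Y) (p↓ : Descend Y (SE ∷ suf)) where

    private
      p : List Step
      p = (s ∷ pre) ʳ++ (SE ∷ suf)

      q : Peak
      q = peakAt s pre

      htq : ht q ≡ Y
      htq = reach-at p↑

      ∈vertices : VertexL (s ∷ pre) a ⊎ VertexR (s ∷ pre) (SE ∷ suf) a → a ∈ vertices p
      ∈vertices v = VertexR⇒∈ [] p (VertexR-join (s ∷ pre) v)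

      ∈peaks : PeakL SE (s ∷ pre) r ⊎ PeakR (s ∷ pre) (SE ∷ suf) r → r ∈ peaks p
      ∈peaks k = PeakR⇒∈ [] p (PeakR-join (s ∷ pre) k)

      peaks∈ : r ∈ peaks p → (r ≡ q ⊎ PeakL s pre r) ⊎ PeakR (s ∷ pre) (SE ∷ suf) r
      peaks∈ i with PeakR-split (s ∷ pre) (∈⇒PeakR [] p i)
      ... | inj₁ (here _) = inj₁ (inj₁ refl)
      ... | inj₁ (there k) = inj₁ (inj₂ k)
      ... | inj₂ k = inj₂ k

      s≢SE : s ≢ SE
      s≢SE refl = u

      minus⁻ : ∀ {v} → h ≤ Y → T (v ≡ᵇ (ht q ∸ h)) → v + h ≡ Y
      minus⁻ {h = h} {v} h≤ t = trans (cong (_+ h) (trans (≡ᵇ⇒≡ v _ t) (cong (_∸ h) htq))) (m∸n+n≡m h≤)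

      minus⁺ : ∀ {v} → v + h ≡ Y → T (v ≡ᵇ (ht q ∸ h))
      minus⁺ {h = h} {v} e = ≡⇒≡ᵇ v _ (trans (sym (m+n∸n≡m v h)) (cong (_∸ h) (trans e (sym htq))))

      before-q : VertexL (s ∷ pre) a → ht q ∸ h ≡ vy a → 1 ≤ h → h ≤ Y → VertexL pre a
      before-q here e 1≤ h≤ = ⊥-elim (<⇒≢ (∸-monoʳ-< {o = 0} 1≤ (castʳ (sym htq) h≤)) e)
      before-q (there l) _ _ _ = l

      inner : Vertex → Vertex → Peak → Bool
      inner a b q' = not ((vidx a <ᵇ pidx q') ∧ (pidx q' <ᵇ vidx b)) ∨ (ht q' <ᵇ ht q)
        ∨ ((ht q' ≡ᵇ ht q) ∧ (wt q ≤ᵇ wt q'))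

      goodB : ℕ → Vertex → Vertex → Bool
      goodB h a b = (pidx q ≤ᵇ vidx b) ∧ (vy b ≡ᵇ (ht q ∸ h)) ∧ (wt q <ᵇ vx b) ∧ all (inner a b) (peaks p)

      goodA : ℕ → Vertex → Bool
      goodA h a = (vidx a ≤ᵇ pidx q) ∧ (vy a ≡ᵇ (ht q ∸ h)) ∧ (vx a ≤ᵇ wt q) ∧ any (goodB h a) (vertices p)

    relGood⁻ : 1 ≤ h → T (relGood p q h) → h ≤ leftDepth 1 pre ⊓ rightDepth 1 suf
    relGood⁻ {h = h} 1≤ t with ∧⁻ {h ≤ᵇ ht q} t
    ... | h≤ , t₁ with any⁻ _ (vertices p) t₁
    ... | a , a∈ , t₂ with ∧⁻ {vidx a ≤ᵇ pidx q} t₂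
    ... | ai , t₃ with ∧⁻ {vy a ≡ᵇ (ht q ∸ h)} t₃
    ... | ay , t₄ with ∧⁻ {vx a ≤ᵇ wt q} t₄
    ... | ax , t₅ with any⁻ _ (vertices p) t₅
    ... | b , b∈ , t₆ with ∧⁻ {pidx q ≤ᵇ vidx b} t₆
    ... | bi , t₇ with ∧⁻ {vy b ≡ᵇ (ht q ∸ h)} t₇
    ... | by , t₈ with ∧⁻ {wt q <ᵇ vx b} t₈
    ... | bx , t₉ = ⊓-glb left right
      where
      h≤Y : h ≤ Y
      h≤Y = castʳ htq (≤ᵇ⇒≤ h (ht q) h≤)
      clear : r ∈ peaks p → T (inner a b r)
      clear = All.lookup (All.all⁺ _ (peaks p) t₉)
      b↓ : VertexR (s ∷ pre) (SE ∷ suf) b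
      b↓ with VertexR-split (s ∷ pre) (∈⇒VertexR [] p b∈)
      ... | inj₂ v = v
      ... | inj₁ l = ⊥-elim (<⇒≱ (<ᵇ⇒< (wt q) (vx b) bx) (proj₂ (VertexL-≤ l)))
      b↓′ : VertexR (SE ∷ s ∷ pre) suf b
      b↓′ with b↓
      ... | there v = v
      ... | here = ⊥-elim (<⇒≱ (<ᵇ⇒< (wt q) (vx b) bx) ≤-refl)
      i<b : pidx q < vidx b
      i<b = proj₁ (VertexR-≥ b↓′)
      a↑ : VertexL (s ∷ pre) a
      a↑ with VertexR-split (s ∷ pre) (∈⇒VertexR [] p a∈)
      ... | inj₁ l = l
      ... | inj₂ here = here
      ... | inj₂ (there v) = ⊥-elim (<⇒≱ (proj₁ (VertexR-≥ v)) (≤ᵇ⇒≤ (vidx a) (pidx q) ai))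
      a↑′ : VertexL pre a
      a↑′ = before-q a↑ (sym (≡ᵇ⇒≡ (vy a) _ ay)) 1≤ h≤Y
      a<i : vidx a < pidx q
      a<i = s≤s (proj₁ (VertexL-≤ a↑′))
      clearL : ClearL Y s pre a
      clearL {r} k i with Equivalence.to T-∨ (guard⁻ (vidx a <ᵇ pidx r) (pidx r <ᵇ vidx b) (clear (∈peaks (inj₁ (there k))))
        (<⇒<ᵇ i) (<⇒<ᵇ (≤-<-trans (m≤n⇒m≤1+n (proj₁ (PeakL-≤ k))) i<b)))
      ... | inj₁ lt = castʳ htq (<ᵇ⇒< (ht r) (ht q) lt)
      -- A peak to the left has strictly smaller weight even if an N step ends in `q`, since a SE
      -- step lies between them; so a tie in height is impossible.
      ... | inj₂ e = ⊥-elim (<⇒≱ (<-≤-trans (PeakL-< s≢SE k) (x≤move s _)) (≤ᵇ⇒≤ (wt q) (wt r) (proj₂ (∧⁻ {ht r ≡ᵇ ht q} e))))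
      clearR : ClearR Y (SE ∷ s ∷ pre) suf b
      clearR {r} k i with Equivalence.to T-∨ (guard⁻ (vidx a <ᵇ pidx r) (pidx r <ᵇ vidx b) (clear (∈peaks (inj₂ (there k))))
        (<⇒<ᵇ (<-trans a<i (<-trans (n<1+n _) (proj₁ (PeakR-> k))))) (<⇒<ᵇ i))
      ... | inj₁ lt = castʳ htq (<⇒≤ (<ᵇ⇒< (ht r) (ht q) lt))
      ... | inj₂ e = ≤-reflexive (trans (≡ᵇ⇒≡ (ht r) (ht q) (proj₁ (∧⁻ e))) htq)
      left : h ≤ leftDepth 1 pre
      left with reach-pred u p↑
      ... | y , eY , pp = leftDepth-upper pp eY a↑′ (minus⁻ h≤Y ay) 1≤ clearL
      right : h ≤ rightDepth 1 suf
      right with descend-pred p↓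
      ... | y , eY , g , r = rightDepth-upper (r p↑) g eY b↓′ (minus⁻ h≤Y by) 1≤ clearR

    relGood⁺ : 1 ≤ h → h ≤ leftDepth 1 pre ⊓ rightDepth 1 suf → T (relGood p q h)
    relGood⁺ {h = h} 1≤ h≤ with reach-pred u p↑ | descend-pred p↓
    ... | y , eY , pp | y' , eY' , g , r' with leftDepth-lower {t = s} pp eY 1≤ (≤-trans h≤ (m⊓n≤m _ _))
       | rightDepth-lower (r' p↑) g eY' 1≤ (≤-trans h≤ (m⊓n≤n (leftDepth 1 pre) _))
    ... | a , l , ea , ca | b , v , eb , cb =
      ∧⁺ {h ≤ᵇ ht q} (≤⇒≤ᵇ (castʳ (sym htq) (castʳ ea (m≤n+m h (vy a)))))
        (any⁺ (goodA h) (∈vertices (inj₁ (there l)))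
          (∧⁺ {vidx a ≤ᵇ pidx q} (≤⇒≤ᵇ (m≤n⇒m≤1+n (proj₁ (VertexL-≤ l)))) (∧⁺ {vy a ≡ᵇ (ht q ∸ h)} (minus⁺ {v = vy a} ea)
            (∧⁺ {vx a ≤ᵇ wt q} (≤⇒≤ᵇ (≤-trans (proj₂ (VertexL-≤ l)) (x≤move s _)))
              (any⁺ (goodB h a) (∈vertices (inj₂ (there v)))
                (∧⁺ {pidx q ≤ᵇ vidx b} (≤⇒≤ᵇ (≤-trans (n≤1+n _) (proj₁ (VertexR-≥ v))))
                  (∧⁺ {vy b ≡ᵇ (ht q ∸ h)} (minus⁺ {v = vy b} eb) (∧⁺ {wt q <ᵇ vx b} (<⇒<ᵇ (proj₂ (VertexR-≥ v)))
                    (All.all⁻ (inner a b) (All.tabulate clear))))))))))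
      where
      clear : r ∈ peaks p → T (inner a b r)
      clear {r} i = guard⁺ (vidx a <ᵇ pidx r) (pidx r <ᵇ vidx b) go
        where
        tie : ht r ≤ ht q → wt q ≤ wt r → T ((ht r <ᵇ ht q) ∨ ((ht r ≡ᵇ ht q) ∧ (wt q ≤ᵇ wt r)))
        tie hr wr with m≤n⇒m<n∨m≡n hr
        ... | inj₁ lt = Equivalence.from T-∨ (inj₁ (<⇒<ᵇ lt))
        ... | inj₂ e = Equivalence.from (T-∨ {ht r <ᵇ ht q}) (inj₂ (∧⁺ (≡⇒≡ᵇ (ht r) _ e) (≤⇒≤ᵇ wr)))
        go : T (vidx a <ᵇ pidx r) → T (pidx r <ᵇ vidx b) → T ((ht r <ᵇ ht q) ∨ ((ht r ≡ᵇ ht q) ∧ (wt q ≤ᵇ wt r)))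
        go i₁ i₂ with peaks∈ i
        ... | inj₁ (inj₁ refl) = tie ≤-refl ≤-refl
        ... | inj₁ (inj₂ k) = Equivalence.from T-∨ (inj₁ (<⇒<ᵇ (castʳ (sym htq) (ca k (<ᵇ⇒< (vidx a) _ i₁)))))
        ... | inj₂ (there k) = tie (castʳ (sym htq) (cb k (<ᵇ⇒< _ (vidx b) i₂))) (≤-trans (n≤1+n _) (proj₂ (PeakR-> k)))

    -- The positive h that satisfy `relGood` are those up to the minimum of the depths, so the
    -- downward search ends there.
    relHeight-depths : relHeight p q ≡ leftDepth 1 pre ⊓ rightDepth 1 suf
    relHeight-depths = go (ht q) bound (λ 1≤ → relGood⁻ 1≤) relGood⁺
      where
      bound : leftDepth 1 pre ⊓ rightDepth 1 suf ≤ ht q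
      bound with reach-pred u p↑
      ... | y , eY , pp = ≤-trans (m⊓n≤m _ _) (castʳ (trans eY (sym htq)) (leftDepth-≤ pp))
      go : ∀ {m P} n → m ≤ n → (∀ {h} → 1 ≤ h → T (P h) → h ≤ m) → (∀ {h} → 1 ≤ h → h ≤ m → T (P h)) → largest P n ≡ m
      go zero le f g = sym (n≤0⇒n≡0 le)
      go {P = P} (suc n) le f g with P (suc n) in eq
      ... | true = ≤-antisym (f (s≤s z≤n) (subst T (sym eq) tt)) le
      ... | false with m≤n⇒m<n∨m≡n le
      ... | inj₁ (s≤s lt) = go n lt f g
      ... | inj₂ refl = ⊥-elim (subst T eq (g (s≤s z≤n) ≤-refl))

-- Parities of sums and of integer differences

module Parity where
  open import Defs
  open Counting
  open import Data.Nat.DivMod using ([m+n]%n≡m%n)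
  open import Data.Integer as ℤ using (ℤ; +_; -[1+_]; ∣_∣; _⊖_)
  import Data.Integer.Properties as ℤ

  odd-% : ∀ n → (n % 2 ≡ᵇ 1) ≡ odd n
  odd-% 0 = refl
  odd-% 1 = refl
  odd-% (suc (suc n)) = trans (cong (_≡ᵇ 1) (trans (cong (_% 2) (+-comm 2 n)) ([m+n]%n≡m%n n 2)))
    (trans (odd-% n) (sym (not-involutive (odd n))))

  isEvenℕ-odd : ∀ n → isEvenℕ n ≡ not (odd n)
  isEvenℕ-odd 0 = refl
  isEvenℕ-odd 1 = refl
  isEvenℕ-odd (suc (suc n)) = trans (cong (_≡ᵇ 0) (trans (cong (_% 2) (+-comm 2 n)) ([m+n]%n≡m%n n 2)))
    (trans (isEvenℕ-odd n) (cong not (sym (not-involutive (odd n)))))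

  odd-+ : ∀ m n → odd (m + n) ≡ odd m xor odd n
  odd-+ zero n = refl
  odd-+ (suc m) n = trans (cong not (odd-+ m n)) (not-distribˡ-xor (odd m) (odd n))

  private
    odd-⊖ : ∀ m n → odd ∣ m ⊖ n ∣ ≡ odd m xor odd n
    odd-⊖ zero zero = refl
    odd-⊖ zero (suc n) = refl
    odd-⊖ (suc m) zero = sym (trans (xor-comm (odd (suc m)) false) refl)
    odd-⊖ (suc m) (suc n) = trans (cong (λ i → odd ∣ i ∣) (ℤ.[1+m]⊖[1+n]≡m⊖n m n))
      (trans (odd-⊖ m n) (trans (sym (not-involutive (odd m xor odd n)))
        (trans (cong not (not-distribˡ-xor (odd m) (odd n))) (not-distribʳ-xor (not (odd m)) (odd n)))))

    odd-+ℤ : ∀ i j → odd ∣ i ℤ.+ j ∣ ≡ odd ∣ i ∣ xor odd ∣ j ∣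
    odd-+ℤ (+ m) (+ n) = odd-+ m n
    odd-+ℤ (+ m) -[1+ n ] = odd-⊖ m (suc n)
    odd-+ℤ -[1+ m ] (+ n) = trans (odd-⊖ n (suc m)) (xor-comm (odd n) (odd (suc m)))
    odd-+ℤ -[1+ m ] -[1+ n ] = trans (not-involutive (odd (m + n))) (trans (odd-+ m n)
      (trans (sym (not-involutive _)) (trans (cong not (not-distribˡ-xor (odd m) (odd n))) (not-distribʳ-xor (not (odd m)) (odd n)))))

  oddℤ-minus : ∀ i n → oddℤ (i ℤ.- + n) ≡ odd ∣ i ∣ xor odd n
  oddℤ-minus i n = trans (odd-% ∣ i ℤ.- + n ∣) (trans (odd-+ℤ i (ℤ.- + n)) (cong (λ m → odd ∣ i ∣ xor odd m) (ℤ.∣-i∣≡∣i∣ (+ n))))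

  odd-minus : ∀ i n → odd ∣ i ℤ.- + n ∣ ≡ odd ∣ i ∣ xor odd n
  odd-minus i n = trans (odd-+ℤ i (ℤ.- + n)) (cong (λ m → odd ∣ i ∣ xor odd m) (ℤ.∣-i∣≡∣i∣ (+ n)))

-- Lattice paths from words and marks

module Paths where
  open import Defs
  open Counting
  open Models
  open PathWords
  open RelativeHeights
  open Parity
  open import Data.Nat.DivMod using (_/_; m*n/n≡m)
  open import Data.Integer as ℤ using ()
  open import Algebra.Properties.CommutativeSemigroup +-commutativeSemigroup using (x∙yz≈y∙xz)

  private
    variable
      d k y Y : ℕ
      s : Step
      β : List Bool
      pre : List Step
      w q : Word

  upStep : Bool → Step
  upStep true = N
  upStep false = NE

  firstUp : List Bool → Step
  firstUp [] = NE
  firstUp (b ∷ β) = upStep b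

  steps : List Bool → Word → List Step
  steps β [] = []
  steps β (Λ ∷ w) = firstUp β ∷ SE ∷ steps (drop 1 β) w
  steps β (U ∷ w) = NE ∷ steps β w
  steps β (D ∷ w) = SE ∷ steps β w
  steps β (O ∷ w) = E ∷ steps β w

  unmark : List Step → Word × List Bool
  unmark [] = [] , []
  unmark (NE ∷ SE ∷ p) = let w , β = unmark p in Λ ∷ w , false ∷ β
  unmark (N ∷ SE ∷ p) = let w , β = unmark p in Λ ∷ w , true ∷ β
  unmark (NE ∷ p) = let w , β = unmark p in U ∷ w , β
  unmark (N ∷ p) = let w , β = unmark p in U ∷ w , β
  unmark (SE ∷ p) = let w , β = unmark p in D ∷ w , β
  unmark (E ∷ p) = let w , β = unmark p in O ∷ w , β

  unmark-steps : ∀ β → Walk k y w → length β ≡ npeaks w → unmark (steps β w) ≡ (w , β)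
  unmark-steps [] [] e = refl
  unmark-steps (true ∷ β) (Λ _ p) e rewrite unmark-steps β p (suc-injective e) = refl
  unmark-steps (false ∷ β) (Λ _ p) e rewrite unmark-steps β p (suc-injective e) = refl
  unmark-steps β (U {w = U ∷ w} _ p) e rewrite unmark-steps β p e = refl
  unmark-steps (true ∷ β) (U {w = Λ ∷ w} _ p) e = cong (λ (w , β) → U ∷ w , β) (unmark-steps (true ∷ β) p e)
  unmark-steps (false ∷ β) (U {w = Λ ∷ w} _ p) e = cong (λ (w , β) → U ∷ w , β) (unmark-steps (false ∷ β) p e)
  unmark-steps β (D p) e rewrite unmark-steps β p e = refl
  unmark-steps β (O _ p) e rewrite unmark-steps β p e = refl

  private
    steps-start : ∀ β w → UpStart w → ∃ λ s → ∃ λ p → T (isUp s) × steps β w ≡ s ∷ p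
    steps-start [] (Λ ∷ w) _ = _ , _ , tt , refl
    steps-start (true ∷ β) (Λ ∷ w) _ = _ , _ , tt , refl
    steps-start (false ∷ β) (Λ ∷ w) _ = _ , _ , tt , refl
    steps-start β (U ∷ w) _ = _ , _ , tt , refl

    start-steps : ∀ β w {s p} → T (isUp s) → steps β w ≡ s ∷ p → UpStart w
    start-steps β (Λ ∷ w) u e = Λ
    start-steps β (U ∷ w) u e = U
    start-steps β (D ∷ w) () refl
    start-steps β (O ∷ w) () refl

  descend-steps : ∀ β → Walk k y w → Descend y (steps β w)
  descend-steps β [] = []
  descend-steps [] (Λ _ p) = NE∷ SE∷ descend-steps [] p
  descend-steps (true ∷ β) (Λ _ p) = N∷ SE∷ descend-steps β p
  descend-steps (false ∷ β) (Λ _ p) = NE∷ SE∷ descend-steps β p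
  descend-steps β (U _ p) = NE∷ descend-steps β p
  descend-steps β (D p) = SE∷ descend-steps β p
  descend-steps β (O _ p) = E∷ descend-steps β p

  walkOK-steps : ∀ β → Walk k y w → T (walkOK k y (steps β w))
  walkOK-steps β [] = tt
  walkOK-steps [] (Λ h p) = Equivalence.from T-∧ (<⇒<ᵇ h , walkOK-steps [] p)
  walkOK-steps (true ∷ β) (Λ h p) = Equivalence.from T-∧ (<⇒<ᵇ h , walkOK-steps β p)
  walkOK-steps (false ∷ β) (Λ h p) = Equivalence.from T-∧ (<⇒<ᵇ h , walkOK-steps β p)
  walkOK-steps β (U s p) = Equivalence.from T-∧ (<⇒<ᵇ (<-trans (n<1+n _) (walk<-start s p)) , walkOK-steps β p)
  walkOK-steps β (D p) = walkOK-steps β p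
  walkOK-steps β (O _ p) = walkOK-steps β p

  private
    ends-∷ : ∀ s p → p ≢ [] → emptyOrEndsSE (s ∷ p) ≡ emptyOrEndsSE p
    ends-∷ s [] n = ⊥-elim (n refl)
    ends-∷ s (_ ∷ _) n = refl

    ends-SE : ∀ p → T (emptyOrEndsSE p) → T (emptyOrEndsSE (SE ∷ p))
    ends-SE [] t = tt
    ends-SE (_ ∷ _) t = t

    ends-tail : ∀ s p → T (emptyOrEndsSE (s ∷ p)) → T (emptyOrEndsSE p)
    ends-tail s [] t = tt
    ends-tail s (_ ∷ _) t = t

  ends-steps : ∀ β → Walk k y w → T (emptyOrEndsSE (steps β w))
  ends-steps β [] = tt
  ends-steps [] (Λ {w = w} _ p) = ends-SE (steps [] w) (ends-steps [] p)
  ends-steps (_ ∷ β) (Λ {w = w} _ p) = ends-SE (steps β w) (ends-steps β p)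
  ends-steps β (U {w = w} s p) with steps β w | steps-start β w s | ends-steps β p
  ... | _ | _ , _ , _ , refl | t = t
  ends-steps β (D {w = w} p) = ends-SE (steps β w) (ends-steps β p)
  ends-steps β (O {w = w} n p) = subst T (sym (ends-∷ E (steps β w) (steps≢[] w n))) (ends-steps β p)
    where
    steps≢[] : ∀ w → w ≢ [] → steps β w ≢ []
    steps≢[] [] n _ = n refl
    steps≢[] (Λ ∷ w) n ()
    steps≢[] (U ∷ w) n ()
    steps≢[] (D ∷ w) n ()
    steps≢[] (O ∷ w) n ()

  -- `walkOK` demands SE after N, so every N step belongs to a token `Λ`; the final SE step yields
  -- the condition of `Walk` on trailing `O`s.
  unmark-sound : ∀ p → T (walkOK k y p) → T (emptyOrEndsSE p) →
    let w , β = unmark p in Walk k y w × length β ≡ npeaks w × steps β w ≡ p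
  unmark-sound {y = zero} [] _ _ = [] , refl , refl
  unmark-sound {y = suc y} (SE ∷ p) t e with unmark-sound p t (ends-tail SE p e)
  ... | q , l , m = D q , l , cong (SE ∷_) m
  unmark-sound {y = zero} (E ∷ []) t ()
  unmark-sound {y = zero} (E ∷ p@(_ ∷ _)) t e with unmark-sound p t e
  ... | q , l , m = O (λ z → ∷≢[] (trans (sym m) (cong (steps (proj₂ (unmark p))) z))) q , l , cong (E ∷_) m
    where
    ∷≢[] : ∀ {a : Step} {p : List Step} → a ∷ p ≢ []
    ∷≢[] ()
  unmark-sound {k = k} {y} (NE ∷ SE ∷ p) t e with Equivalence.to (T-∧ {suc y <ᵇ k}) t
  ... | h , t' with unmark-sound p t' (ends-tail SE p e)
  ... | q , l , m = Λ (<ᵇ⇒< _ k h) q , cong suc l , cong (λ p → NE ∷ SE ∷ p) m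
  unmark-sound {k = k} {y} (N ∷ SE ∷ p) t e with Equivalence.to (T-∧ {suc y <ᵇ k}) t
  ... | h , t' with unmark-sound p t' (ends-tail SE p e)
  ... | q , l , m = Λ (<ᵇ⇒< _ k h) q , cong suc l , cong (λ p → N ∷ SE ∷ p) m
  unmark-sound {k = k} {y} (NE ∷ p@(NE ∷ _)) t e with unmark-sound p (proj₂ (Equivalence.to (T-∧ {suc y <ᵇ k}) t)) e
  ... | q , l , m = U (start-steps _ _ tt m) q , l , cong (NE ∷_) m
  unmark-sound {k = k} {y} (NE ∷ p@(N ∷ _)) t e with unmark-sound p (proj₂ (Equivalence.to (T-∧ {suc y <ᵇ k}) t)) e
  ... | q , l , m = U (start-steps _ _ tt m) q , l , cong (NE ∷_) m
  unmark-sound {k = k} {y} (NE ∷ E ∷ p) t e with () ← proj₂ (Equivalence.to (T-∧ {suc y <ᵇ k}) t)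
  unmark-sound {k = k} {y} (N ∷ NE ∷ p) t e with () ← proj₂ (Equivalence.to (T-∧ {suc y <ᵇ k}) t)
  unmark-sound {k = k} {y} (N ∷ N ∷ p) t e with () ← proj₂ (Equivalence.to (T-∧ {suc y <ᵇ k}) t)
  unmark-sound {k = k} {y} (N ∷ E ∷ p) t e with () ← proj₂ (Equivalence.to (T-∧ {suc y <ᵇ k}) t)

  -- The reversed steps of a marked prefix over its reversed tokens.
  data Marked : List Step → Word → Set where
    []  : Marked [] []
    Λ∷_ : ∀ {b} → Marked pre q → Marked (SE ∷ upStep b ∷ pre) (Λ ∷ q)
    U∷_ : Marked pre q → Marked (NE ∷ pre) (U ∷ q)
    D∷_ : Marked pre q → Marked (SE ∷ pre) (D ∷ q)
    O∷_ : Marked pre q → Marked (E ∷ pre) (O ∷ q)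

  leftDepth-ld : ∀ d → Marked pre q → leftDepth d pre ≡ ld d q
  leftDepth-ld d [] = refl
  leftDepth-ld zero (Λ∷ m) = refl
  leftDepth-ld (suc zero) (Λ∷ m) = refl
  leftDepth-ld (suc (suc d)) (Λ∷_ {pre = pre} {b = false} m) = trans (m≤n⇒m⊔n≡n (d≤leftDepth (suc (suc d)) pre)) (leftDepth-ld (suc (suc d)) m)
  leftDepth-ld (suc (suc d)) (Λ∷_ {pre = pre} {b = true} m) = trans (m≤n⇒m⊔n≡n (d≤leftDepth (suc (suc d)) pre)) (leftDepth-ld (suc (suc d)) m)
  leftDepth-ld d (U∷ m) = leftDepth-ld (suc d) m
  leftDepth-ld zero (D∷ m) = refl
  leftDepth-ld (suc zero) (D∷ m) = refl
  leftDepth-ld (suc (suc d)) (D∷ m) = cong (suc (suc d) ⊔_) (leftDepth-ld (suc d) m)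
  leftDepth-ld d (O∷ m) = refl

  rightDepth-rd : ∀ d β w → rightDepth d (steps β w) ≡ rd d w
  rightDepth-rd d β [] = refl
  rightDepth-rd zero [] (Λ ∷ w) = refl
  rightDepth-rd zero (true ∷ β) (Λ ∷ w) = refl
  rightDepth-rd zero (false ∷ β) (Λ ∷ w) = refl
  rightDepth-rd (suc d) [] (Λ ∷ w) = trans (m≤n⇒m⊔n≡n (d≤rightDepth (suc d) (steps [] w))) (rightDepth-rd (suc d) [] w)
  rightDepth-rd (suc d) (true ∷ β) (Λ ∷ w) = trans (m≤n⇒m⊔n≡n (d≤rightDepth (suc d) (steps β w))) (rightDepth-rd (suc d) β w)
  rightDepth-rd (suc d) (false ∷ β) (Λ ∷ w) = trans (m≤n⇒m⊔n≡n (d≤rightDepth (suc d) (steps β w))) (rightDepth-rd (suc d) β w)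
  rightDepth-rd zero β (U ∷ w) = refl
  rightDepth-rd (suc d) β (U ∷ w) = cong (suc d ⊔_) (rightDepth-rd d β w)
  rightDepth-rd d β (D ∷ w) = rightDepth-rd (suc d) β w
  rightDepth-rd d β (O ∷ w) = refl

  peakList : List Step → List Bool → Word → List Peak
  peakList pre β [] = []
  peakList pre β (Λ ∷ w) = peakAt (firstUp β) pre ∷ peakList (SE ∷ firstUp β ∷ pre) (drop 1 β) w
  peakList pre β (U ∷ w) = peakList (NE ∷ pre) β w
  peakList pre β (D ∷ w) = peakList (SE ∷ pre) β w
  peakList pre β (O ∷ w) = peakList (E ∷ pre) β w

  private
    peaksFrom-flat : ∀ {s} i v p → isUp s ≡ false → peaksFrom i v (s ∷ p) ≡ peaksFrom (suc i) (move s v) p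
    peaksFrom-flat i v [] e = refl
    peaksFrom-flat i v (t ∷ p) e rewrite e = refl

  peaks-steps : ∀ pre β → Walk k y w → length β ≡ npeaks w → peaksFrom (length pre) (at pre) (steps β w) ≡ peakList pre β w
  peaks-steps pre β [] e = refl
  peaks-steps pre (true ∷ β) (Λ {w = w} _ p) e = cong (_ ∷_) (trans (peaksFrom-flat _ _ (steps β w) refl) (peaks-steps (SE ∷ N ∷ pre) β p (suc-injective e)))
  peaks-steps pre (false ∷ β) (Λ {w = w} _ p) e = cong (_ ∷_) (trans (peaksFrom-flat _ _ (steps β w) refl) (peaks-steps (SE ∷ NE ∷ pre) β p (suc-injective e)))
  peaks-steps pre β (U {w = w} s p) e with steps β w | steps-start β w s | peaks-steps (NE ∷ pre) β p e
  ... | NE ∷ _ | _ , _ , _ , refl | r = r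
  ... | N ∷ _ | _ , _ , _ , refl | r = r
  peaks-steps pre β (D {w = w} p) e = trans (peaksFrom-flat _ _ (steps β w) refl) (peaks-steps (SE ∷ pre) β p e)
  peaks-steps pre β (O {w = w} _ p) e = trans (peaksFrom-flat _ _ (steps β w) refl) (peaks-steps (E ∷ pre) β p e)

  nse-peakList : ∀ pre β w → length β ≡ npeaks w → map nse (peakList pre β w) ≡ β
  nse-peakList pre [] [] e = refl
  nse-peakList pre (true ∷ β) (Λ ∷ w) e = cong (true ∷_) (nse-peakList _ β w (suc-injective e))
  nse-peakList pre (false ∷ β) (Λ ∷ w) e = cong (false ∷_) (nse-peakList _ β w (suc-injective e))
  nse-peakList pre β (U ∷ w) e = nse-peakList _ β w e
  nse-peakList pre β (D ∷ w) e = nse-peakList _ β w e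
  nse-peakList pre β (O ∷ w) e = nse-peakList _ β w e

  -- An N step in place of NE takes one unit from the weight of its own peak and of every later one,
  -- in total the position of its mark from the right.
  weights-peakList : ∀ pre β w → length β ≡ npeaks w →
    sum (map wt (peakList pre β w)) + weight (map bit β) ≡ weights (proj₁ (at pre)) w
  weights-peakList pre [] [] e = refl
  weights-peakList pre (true ∷ β) (Λ ∷ w) e
    rewrite weights-suc (suc (proj₁ (at pre))) w | sym (suc-injective e) | sym (weights-peakList (SE ∷ N ∷ pre) β w (suc-injective e))
    | length-map bit β | *-identityʳ (length β) =
    solve 4 (λ x s l v → x :+ s :+ (con 1 :+ l :+ v) := con 1 :+ x :+ (l :+ (s :+ v))) refl
      (proj₁ (at pre)) (sum (map wt (peakList (SE ∷ N ∷ pre) β w))) (length β) (weight (map bit β))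
    where open +-*-Solver
  weights-peakList pre (false ∷ β) (Λ ∷ w) e
    rewrite sym (weights-peakList (SE ∷ NE ∷ pre) β w (suc-injective e))
    | *-zeroʳ (length (map bit β)) = +-assoc (suc (proj₁ (at pre))) _ (weight (map bit β))
  weights-peakList pre β (U ∷ w) e = weights-peakList _ β w e
  weights-peakList pre β (D ∷ w) e = weights-peakList _ β w e
  weights-peakList pre β (O ∷ w) e = weights-peakList _ β w e

  peakList-≥ : ∀ pre β w → All (λ r → proj₁ (at pre) ≤ wt r) (peakList pre β w)
  peakList-≥ pre β [] = []
  peakList-≥ pre [] (Λ ∷ w) = n≤1+n _ ∷ All.map (≤-trans (m≤n+m _ 2)) (peakList-≥ (SE ∷ NE ∷ pre) [] w)
  peakList-≥ pre (true ∷ β) (Λ ∷ w) = ≤-refl ∷ All.map (≤-trans (n≤1+n _)) (peakList-≥ (SE ∷ N ∷ pre) β w)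
  peakList-≥ pre (false ∷ β) (Λ ∷ w) = n≤1+n _ ∷ All.map (≤-trans (m≤n+m _ 2)) (peakList-≥ (SE ∷ NE ∷ pre) β w)
  peakList-≥ pre β (U ∷ w) = All.map (≤-trans (n≤1+n _)) (peakList-≥ (NE ∷ pre) β w)
  peakList-≥ pre β (D ∷ w) = All.map (≤-trans (n≤1+n _)) (peakList-≥ (SE ∷ pre) β w)
  peakList-≥ pre β (O ∷ w) = All.map (≤-trans (n≤1+n _)) (peakList-≥ (E ∷ pre) β w)

  nseUpTo : ℕ → List Peak → ℕ
  nseUpTo x = count (λ r → nse r ∧ (wt r ≤ᵇ x))

  private
    nseUpTo-none : ∀ x L → All (λ r → x < wt r) L → nseUpTo x L ≡ 0
    nseUpTo-none x [] [] = refl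
    nseUpTo-none x (r ∷ L) (lt ∷ a) with nse r
    ... | false = nseUpTo-none x L a
    ... | true with wt r ≤ᵇ x in eq
    ... | false = nseUpTo-none x L a
    ... | true = ⊥-elim (<⇒≱ lt (≤ᵇ⇒≤ (wt r) x (subst T (sym eq) tt)))

    nseUpTo-∷ : ∀ x r L → wt r ≤ x → nseUpTo x (r ∷ L) ≡ bit (nse r) + nseUpTo x L
    nseUpTo-∷ x r L le with nse r
    ... | false = refl
    ... | true with wt r ≤ᵇ x | ≤⇒≤ᵇ le
    ... | true | _ = refl

  reach-upStep : ∀ b → Reach pre y → Reach (upStep b ∷ pre) (suc y)
  reach-upStep true r = N∷ r
  reach-upStep false r = NE∷ r

  private
    isUp-upStep : ∀ b → T (isUp (upStep b))
    isUp-upStep true = tt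
    isUp-upStep false = tt

    isN-upStep : ∀ b → isN (upStep b) ≡ b
    isN-upStep true = refl
    isN-upStep false = refl

    x-upStep : ∀ b v → proj₁ (move (upStep b) v) + bit b ≡ suc (proj₁ v)
    x-upStep true v = +-comm (proj₁ v) 1
    x-upStep false v = +-identityʳ _

  -- Each N step leaves the path one unit behind its word, and `W` counts these steps, that of the
  -- present peak included. Hence x + W is the position in the word, and x - r - W has the parity of
  -- the weight in the word plus r. The hypothesis on `Wcount` splits off the marks already passed.
  peaks-pk : ∀ p o W β → Marked pre q → Reach pre y → Walk k y w → length β ≡ npeaks w → p ≡ pre ʳ++ steps β w →
    (∀ x → proj₁ (at pre) ≤ x → Wcount p x ≡ W + nseUpTo x (peakList pre β w)) → odd (proj₁ (at pre) + W) ≡ o →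
    map (λ r → relHeight p r , peakEven p r) (peakList pre β w) ≡ pk o q w
  peaks-pk p o W β m r [] e ep H eo = refl
  peaks-pk p o W β m r (U _ w) e ep H eo = peaks-pk p (not o) W β (U∷ m) (NE∷ r) w e ep (λ x le → H x (≤-trans (n≤1+n _) le)) (cong not eo)
  peaks-pk p o W β m r (D w) e ep H eo = peaks-pk p (not o) W β (D∷ m) (SE∷ r) w e ep (λ x le → H x (≤-trans (n≤1+n _) le)) (cong not eo)
  peaks-pk p o W β m r (O _ w) e ep H eo = peaks-pk p (not o) W β (O∷ m) (E∷ r) w e ep (λ x le → H x (≤-trans (n≤1+n _) le)) (cong not eo)
  peaks-pk {pre = pre} {q} {w = Λ ∷ w'} p o W (b ∷ β) m r (Λ {w = w} h v) e refl H eo = cong₂ _∷_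
    (cong₂ _,_ eh (trans parity (cong (λ z → not o xor odd z) eh)))
    (peaks-pk p o (W + bit b) β (Λ∷_ {b = b} m) (SE∷ reach-upStep b r) v (suc-injective e) refl H' (trans (cong odd (trans (cong suc (cong (X +_) (+-comm W (bit b))))
       (trans (cong suc (sym (+-assoc X (bit b) W))) (cong (λ z → suc (z + W)) (x-upStep b (at pre)))))) (trans (not-involutive _) eo)))
    where
    r₁ : Peak
    r₁ = peakAt (upStep b) pre
    X : ℕ
    X = wt r₁
    L : List Peak
    L = peakList (SE ∷ upStep b ∷ pre) β w
    eh : relHeight p r₁ ≡ ld 1 q ⊓ rd 1 w
    eh = trans (relHeight-depths {suf = steps β w} (isUp-upStep b) (reach-upStep b r) (SE∷ descend-steps β v))
      (cong₂ _⊓_ (leftDepth-ld 1 m) (rightDepth-rd 1 β w))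
    X≥ : proj₁ (at pre) ≤ X
    X≥ = x≤move (upStep b) (at pre)
    H' : ∀ x → suc X ≤ x → Wcount p x ≡ W + bit b + nseUpTo x L
    H' x le = trans (H x (≤-trans X≥ (≤-trans (n≤1+n X) le)))
      (trans (cong (W +_) (trans (nseUpTo-∷ x r₁ L (≤-trans (n≤1+n X) le)) (cong (λ c → bit c + nseUpTo x L) (isN-upStep b)))) (sym (+-assoc W (bit b) _)))
    W₁ : Wcount p X ≡ W + bit b
    W₁ = trans (H X X≥) (cong (W +_) (trans (nseUpTo-∷ X r₁ L ≤-refl)
      (trans (cong₂ _+_ (cong bit (isN-upStep b)) (nseUpTo-none X L (peakList-≥ (SE ∷ upStep b ∷ pre) β w))) (+-identityʳ (bit b)))))
    parity : peakEven p r₁ ≡ not o xor odd (relHeight p r₁)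
    parity = trans (oddℤ-minus (ℤ.+ X ℤ.- ℤ.+ relHeight p r₁) (Wcount p X)) (trans (cong₂ _xor_ (odd-minus (ℤ.+ X) (relHeight p r₁)) (cong odd W₁))
      (trans (swap (odd X) (odd (relHeight p r₁)) (odd (W + bit b))) (cong (_xor odd (relHeight p r₁)) (trans (sym (odd-+ X (W + bit b)))
        (trans (cong odd (trans (cong (X +_) (+-comm W (bit b))) (trans (sym (+-assoc X (bit b) W)) (cong (_+ W) (x-upStep b (at pre)))))) (cong not eo))))))
      where
      swap : ∀ a b c → (a xor b) xor c ≡ (a xor c) xor b
      swap a b c = trans (xor-assoc a b c) (trans (cong (a xor_) (xor-comm b c)) (sym (xor-assoc a c b)))

  firstMark : List Bool → Bool
  firstMark [] = false
  firstMark (b ∷ _) = b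

  pathStartParity-nse : ∀ p → pathStartParity p ≡ firstMark (map nse (peaks p))
  pathStartParity-nse p with peaks p
  ... | [] = refl
  ... | _ ∷ _ = refl

  select-map : ∀ {A : Set} (f : A → ℕ) (g : A → Bool) r xs →
    map g (filterᵇ (λ x → f x ≡ᵇ r) xs) ≡ select r (map (λ x → f x , g x) xs)
  select-map f g r [] = refl
  select-map f g r (x ∷ xs) with f x ≡ᵇ r
  ... | true = cong (g x ∷_) (select-map f g r xs)
  ... | false = select-map f g r xs

  validPathKK⁺ : ∀ k p → T (walkOK k 0 p) → T (emptyOrEndsSE p) →
    (firstMark (map nse (peaks p)) ≡ true → T (startsWithE p)) → T (validPathKK k p)
  validPathKK⁺ k p w e f with peaks p
  ... | [] = Equivalence.from T-∧ (w , Equivalence.from T-∧ (e , tt))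
  ... | r ∷ _ = Equivalence.from T-∧ (w , Equivalence.from T-∧ (e , rule (nse r) f))
    where
    rule : ∀ b {c} → (b ≡ true → T c) → T (not b ∨ c)
    rule true f = f refl
    rule false f = tt

  validPathKK⁻ : ∀ k p → T (validPathKK k p) → T (walkOK k 0 p) × T (emptyOrEndsSE p) ×
    (firstMark (map nse (peaks p)) ≡ true → T (startsWithE p))
  validPathKK⁻ k p t with peaks p
  ... | [] = let w , et = Equivalence.to (T-∧ {walkOK k 0 p}) t in w , proj₁ (Equivalence.to (T-∧ {emptyOrEndsSE p}) et) , λ ()
  ... | r ∷ _ = let w , et = Equivalence.to (T-∧ {walkOK k 0 p}) t ; e , l = Equivalence.to (T-∧ {emptyOrEndsSE p}) et in
    w , e , rule (nse r) l
    where
    rule : ∀ b {c} → T (not b ∨ c) → b ≡ true → T c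
    rule true t refl = t

  module _ (β : List Bool) (w : Word) (wk : Walk k 0 w) (e : length β ≡ npeaks w) where
    private
      p : List Step
      p = steps β w

    peaks-steps₀ : peaks p ≡ peakList [] β w
    peaks-steps₀ = peaks-steps [] β wk e

    relHeights-steps : map (λ r → relHeight p r , peakEven p r) (peaks p) ≡ pk false [] w
    relHeights-steps = trans (cong (map _) peaks-steps₀)
      (peaks-pk p false 0 β [] [] wk e refl (λ x _ → cong (nseUpTo x) peaks-steps₀) refl)

    majorIndex-steps : majorIndex p + weight (map bit β) ≡ weights 0 w
    majorIndex-steps = trans (cong (λ L → sum (map wt L) + weight (map bit β)) peaks-steps₀) (weights-peakList [] β w e)

    sumRelHeights-steps : sumRelHeights p ≡ sum (map proj₁ (pk false [] w))
    sumRelHeights-steps = cong sum (trans (map-∘ (peaks p)) (cong (map proj₁) relHeights-steps))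

    nse-steps : map nse (peaks p) ≡ β
    nse-steps = trans (cong (map nse) peaks-steps₀) (nse-peakList [] β w e)

    pathRIndex-steps : ∀ r → pathRIndex p r ≡ changes (firstMark β) (select r (pk false [] w))
    pathRIndex-steps r = cong₂ changes (trans (pathStartParity-nse p) (cong firstMark nse-steps))
      (trans (select-map (relHeight p) (peakEven p) r (peaks p)) (cong (select r) relHeights-steps))

  flip : ℕ × Bool → ℕ × Bool
  flip (r , b) = r , not b

  ld-O : ∀ d pre → ld d (pre ++ [ O ]) ≡ ld d pre
  ld-O d [] = refl
  ld-O d (U ∷ pre) = ld-O (suc d) pre
  ld-O d (O ∷ pre) = refl
  ld-O zero (Λ ∷ pre) = refl
  ld-O (suc zero) (Λ ∷ pre) = refl
  ld-O (suc (suc d)) (Λ ∷ pre) = ld-O (suc (suc d)) pre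
  ld-O zero (D ∷ pre) = refl
  ld-O (suc zero) (D ∷ pre) = refl
  ld-O (suc (suc d)) (D ∷ pre) = cong (suc (suc d) ⊔_) (ld-O (suc d) pre)

  -- A walk to the left stops at an initial `O` just as it does at the start of the path, so only
  -- the parities of the positions change.
  pk-O : ∀ o pre w → pk (not o) (pre ++ [ O ]) w ≡ map flip (pk o pre w)
  pk-O o pre [] = refl
  pk-O o pre (Λ ∷ w) rewrite ld-O 1 pre = cong₂ _∷_ (cong (_ ,_) (sym (not-distribˡ-xor (not o) _))) (pk-O o (Λ ∷ pre) w)
  pk-O o pre (U ∷ w) = pk-O (not o) (U ∷ pre) w
  pk-O o pre (D ∷ w) = pk-O (not o) (D ∷ pre) w
  pk-O o pre (O ∷ w) = pk-O (not o) (O ∷ pre) w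

  select-flip : ∀ r L → select r (map flip L) ≡ map not (select r L)
  select-flip r [] = refl
  select-flip r (z ∷ L) with proj₁ z ≡ᵇ r
  ... | true = cong (_ ∷_) (select-flip r L)
  ... | false = select-flip r L

  changes-not : ∀ b xs → changes (not b) (map not xs) ≡ changes b xs
  changes-not b [] = refl
  changes-not b (x ∷ xs) = cong₂ _+_ (cong (λ z → if z then 1 else 0) (not-xor-not b x)) (changes-not x xs)
    where
    not-xor-not : ∀ a b → not a xor not b ≡ a xor b
    not-xor-not true b = refl
    not-xor-not false b = not-involutive b

  -- A marked first peak comes with an initial E step, which flips the
  -- parities of all peaks and of the starting parity.
  lead : List Bool → Word → Word
  lead (true ∷ _) w = O ∷ w
  lead _ w = w

  toPath : Model → List Step
  toPath (β , gs) = steps β (lead β (words gs))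

  triangle : ℕ → ℕ
  triangle zero = 0
  triangle (suc n) = suc n + triangle n

  private
    triangle*2 : ∀ n → triangle n * 2 ≡ suc n * n
    triangle*2 zero = refl
    triangle*2 (suc n) = trans (*-distribʳ-+ 2 (suc n) (triangle n)) (trans (cong (suc n * 2 +_) (triangle*2 n))
      (solve 1 (λ n → (con 1 :+ n) :* con 2 :+ (con 1 :+ n) :* n := (con 2 :+ n) :* (con 1 :+ n)) refl n))
      where open +-*-Solver

    triangle-/ : ∀ n → (suc n * n) / 2 ≡ triangle n
    triangle-/ n = trans (cong (_/ 2) (sym (triangle*2 n))) (m*n/n≡m (triangle n) 2)

    triangle-square : ∀ n → triangle (suc n) + triangle n ≡ suc n * suc n
    triangle-square n = trans (solve 2 (λ n t → con 1 :+ n :+ t :+ t := con 1 :+ n :+ t :* con 2) refl n (triangle n))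
      (trans (cong (suc n +_) (triangle*2 n)) (solve 1 (λ n → con 1 :+ n :+ (con 1 :+ n) :* n := (con 1 :+ n) :* (con 1 :+ n)) refl n))
      where open +-*-Solver

    weight-bits : ∀ t → weight (map (bit ∘ not) t) + weight (map bit t) ≡ triangle (length t)
    weight-bits [] = refl
    weight-bits (true ∷ t) rewrite length-map (bit ∘ not) t | length-map bit t | *-zeroʳ (length t) | *-identityʳ (length t) | sym (weight-bits t) =
      x∙yz≈y∙xz (weight (map (bit ∘ not) t)) (suc (length t)) _
    weight-bits (false ∷ t) rewrite length-map (bit ∘ not) t | length-map bit t | *-zeroʳ (length t) | *-identityʳ (length t) | sym (weight-bits t) =
      +-assoc (suc (length t)) _ _

  -- The later marks have the positions 1 to N_1 - 1, whose sum is the difference of N_1^2 and N_1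
  -- (N_1 + 1) / 2. Taking the marked positions from N_1^2 thus leaves the triangular number and the
  -- unmarked positions.
  base-cost : ∀ β Ns V → length β ≡ headOr0 Ns →
    base Ns + (cost β + V) + weight (map bit (drop 1 β)) ≡ sum (map (λ a → a * a) Ns) + V
  base-cost [] [] V e = +-identityʳ V
  base-cost [] (.0 ∷ Ns) V refl = +-identityʳ _
  base-cost (b ∷ t) (.(suc (length t)) ∷ Ns) V refl rewrite triangle-/ (suc (length t)) = trans
    (solve 5 (λ τ s c v w → τ :+ s :+ (c :+ v) :+ w := τ :+ (c :+ w) :+ s :+ v) refl
      (triangle (suc (length t))) (sum (map (λ a → a * a) Ns)) (weight (map (bit ∘ not) t)) V (weight (map bit t)))
    (cong (λ z → z + sum (map (λ a → a * a) Ns) + V) (trans (cong (triangle (suc (length t)) +_) (weight-bits t)) (triangle-square (length t))))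
    where open +-*-Solver

  module _ (β : List Bool) (gs : List (List ℕ)) (e : length β ≡ headOr0 (tails gs)) where
    private
      ws : Word
      ws = words gs

      e' : length β ≡ npeaks ws
      e' = trans e (sym (npeaks-words gs))

    lead-walk : Walk (suc (length gs)) 0 (lead β ws)
    lead-walk = go β e'
      where
      go : ∀ β → length β ≡ npeaks ws → Walk (suc (length gs)) 0 (lead β ws)
      go [] _ = walk-words gs
      go (false ∷ β) _ = walk-words gs
      go (true ∷ β) e = O (λ z → 1+n≢0 (trans e (cong npeaks z))) (walk-words gs)

    lead-npeaks : length β ≡ npeaks (lead β ws)
    lead-npeaks = trans e' (go β)
      where
      go : ∀ β → npeaks ws ≡ npeaks (lead β ws)
      go [] = refl
      go (false ∷ β) = refl
      go (true ∷ β) = refl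

    toPath-valid : T (validPathKK (suc (length gs)) (toPath (β , gs)))
    toPath-valid = validPathKK⁺ _ _ (walkOK-steps β lead-walk) (ends-steps β lead-walk)
      (λ f → go β (trans (sym (cong firstMark (nse-steps β _ lead-walk lead-npeaks))) f))
      where
      go : ∀ β → firstMark β ≡ true → T (startsWithE (steps β (lead β ws)))
      go (true ∷ β) refl = tt

    private
      -- The initial E step adds one to each of the N_1 weights, which is what the N step of the
      -- first peak takes away.
      lead-weights : ∀ β → length β ≡ npeaks ws → ∀ {S} → S + weight (map bit β) ≡ weights 0 (lead β ws) →
        S + weight (map bit (drop 1 β)) ≡ weights 0 ws
      lead-weights [] _ h = h
      lead-weights (false ∷ β) _ {S} h rewrite *-zeroʳ (length (map bit β)) = h
      lead-weights (true ∷ β) e {S} h rewrite weights-suc 0 ws | sym e | length-map bit β | *-identityʳ (length β) =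
        +-cancelˡ-≡ (suc (length β)) _ _ (trans (x∙yz≈y∙xz (suc (length β)) S _) h)

      lead-pk : ∀ β r → changes (firstMark β) (select r (pk false [] (lead β ws))) ≡ changes false (select r (peaksOf ws))
      lead-pk [] r = refl
      lead-pk (false ∷ β) r = refl
      lead-pk (true ∷ β) r = trans (cong (changes true ∘ select r) (pk-O false [] ws))
        (trans (cong (changes true) (select-flip r (peaksOf ws))) (changes-not false (select r (peaksOf ws))))

      lead-heights : ∀ β → sum (map proj₁ (pk false [] (lead β ws))) ≡ sum (map proj₁ (peaksOf ws))
      lead-heights [] = refl
      lead-heights (false ∷ β) = refl
      lead-heights (true ∷ β) = cong sum (trans (cong (map proj₁) (pk-O false [] ws)) (sym (map-∘ (peaksOf ws))))

    toPath-majorIndex : majorIndex (toPath (β , gs)) ≡ base (tails gs) + (cost β + sum (map weight gs))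
    toPath-majorIndex = +-cancelʳ-≡ (weight (map bit (drop 1 β))) _ _ (trans
      (lead-weights β e' (majorIndex-steps β _ lead-walk lead-npeaks))
      (trans (weights-words gs) (sym (base-cost β (tails gs) (sum (map weight gs)) e))))

    toPath-sumRelHeights : sumRelHeights (toPath (β , gs)) ≡ sum (tails gs)
    toPath-sumRelHeights = trans (sumRelHeights-steps β _ lead-walk lead-npeaks) (trans (lead-heights β) (heights-words gs))

    toPath-fullIndex : pathFullIndex (suc (length gs)) (toPath (β , gs)) ≡ sum (map oddCount gs)
    toPath-fullIndex = trans
      (cong sum (map-cong (λ r → trans (pathRIndex-steps β _ lead-walk lead-npeaks r) (lead-pk β r)) (oneTo (length gs))))
      (indices-words gs)

  HasCount-GPath : ∀ K l m n → HasCount (GPath (suc K) l m n) (rhsCoef (suc K) l m n)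
  HasCount-GPath K l m n = HasCount-map {P = IsModel K l m n} {Q = GPath (suc K) l m n} toPath
    (λ { {β , gs} (refl , e , refl , refl , refl) → toPath-valid β gs e , toPath-majorIndex β gs e , toPath-sumRelHeights β gs e , toPath-fullIndex β gs e })
    (λ {p} → sur p) (λ {a} {a'} → inj a a')
    (HasCount-Model K l m n)
    where
    Fits : Model → Set
    Fits (β , gs) = length gs ≡ K × length β ≡ headOr0 (tails gs)
    unlead : ∀ β β' {w w' : Word} → β ≡ β' → lead β w ≡ lead β' w' → w ≡ w'
    unlead [] _ refl e = e
    unlead (false ∷ _) _ refl e = e
    unlead (true ∷ _) _ refl refl = refl
    inj : ∀ a a' → toPath a ≡ toPath a' → IsModel K l m n a → IsModel K l m n a' → a ≡ a'
    inj (β , gs) (β' , gs') eq (refl , e , _) (e₁ , e' , _) with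
      trans (sym (unmark-steps β (lead-walk β gs e) (lead-npeaks β gs e))) (trans (cong unmark eq) (unmark-steps β' (lead-walk β' gs' e') (lead-npeaks β' gs' e')))
    ... | q = cong₂ _,_ (cong proj₂ q) (trans (sym (decodes-words gs)) (trans (cong₂ decodes (sym e₁) (unlead β β' (cong proj₂ q) (cong proj₁ q))) (decodes-words gs')))
    model : ∀ p β w → Walk (suc K) 0 w → length β ≡ npeaks w → steps β (lead β w) ≡ p → ∃ λ a → Fits a × toPath a ≡ p
    model p β w wk e ep with decodes K w | words-decodes K wk | length-decodes K w
    ... | gs | refl | lg = (β , gs) , (lg , trans e (npeaks-words gs)) , ep
    preimage : ∀ p → T (validPathKK (suc K) p) → ∃ λ a → Fits a × toPath a ≡ p
    preimage p t with validPathKK⁻ (suc K) p t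
    ... | t₁ , t₂ , rule with unmark p | unmark-sound {y = 0} p t₁ t₂
    ... | w , β | wk , e , refl with nse-steps β w wk e
    preimage _ t | _ | w , [] | wk , e , refl | _ = model _ [] w wk e refl
    preimage _ t | _ | w , false ∷ β | wk , e , refl | _ = model _ (false ∷ β) w wk e refl
    preimage _ t | _ , _ , rule | w , true ∷ β | wk , e , refl | nm with w | wk | rule (cong firstMark nm)
    -- A path whose leftmost peak is marked starts with E; `lead` puts this step back.
    ... | O ∷ w' | O _ wk' | _ = model _ (true ∷ β) w' wk' e refl
    ... | Λ ∷ w' | _ | ()
    sur : ∀ p → GPath (suc K) l m n p → ∃ λ a → IsModel K l m n a × toPath a ≡ p
    sur p (t , refl , refl , refl) with preimage p t
    ... | (β , gs) , (refl , e) , refl = (β , gs)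
      , (refl , e , sym (toPath-fullIndex β gs e) , sym (toPath-sumRelHeights β gs e) , sym (toPath-majorIndex β gs e)) , refl

-- Marks level by level, and removing the last overline

module Cells where

  -- The v-th site holds the parts v: whether one is overlined, and how many.
  Site : Set
  Site = Bool × ℕ

  -- Does a site receive the least free mark, given whether the previous site
  -- has it, and what remains of the site for the larger marks? An overlined
  -- part allows the mark to be reused.
  peel : Bool → Bool → ℕ → Bool × Site
  peel cov o zero = false , false , 0
  peel false o (suc zero) = true , false , 0
  peel false o (suc (suc c)) = true , o , suc c
  peel true true (suc c) = true , false , c
  peel true false (suc c) = false , false , suc c

  -- For an r-marked part at the site, the parity of the chain of parts marked
  -- 1, …, r ending in it; and the rest of the site.
  Cell : Set
  Cell = Maybe Bool × Site

  ends : Maybe Bool → List Bool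
  ends (just x) = [ x ]
  ends nothing = []

  -- A mark at this site (second argument) continues the chain pending from the
  -- previous site or else the one of this site. Result: the parity of a chain
  -- that ends, the new entry, the chain left pending.
  link : Bool → Bool → Maybe Bool → Maybe Bool → List Bool × Maybe Bool × Maybe Bool
  link ev false p a = ends p , nothing , a
  link ev true (just x) a = [] , just (ev xor x) , a
  link ev true nothing (just x) = [] , just (ev xor x) , nothing
  link ev true nothing nothing = [] , just ev , nothing

  -- One level of the marking: `ev` tells whether the site is even, `cov` whether the previous site
  -- has the current mark. The parities returned are those of the chains that this mark does not
  -- extend.
  step : Bool → Maybe Bool → Bool → List Cell → List Bool × List Cell
  step ev p cov [] = ends p , []
  step ev p cov ((a , o , c) ∷ cs) =
    let b , r = peel cov o c
        E , a' , p' = link ev b p a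
        E' , cs' = step (not ev) p' b cs
    in E ++ E' , (a' , r) ∷ cs'

  -- The entry of a new chain includes the parity of the number of overlined parts up to its site,
  -- which `V` accumulates.
  start : Bool → Bool → Bool → List Site → List Cell
  start ev V cov [] = []
  start ev V cov ((o , c) ∷ s) =
    let b , r = peel cov o c
    in ((if b then just (ev xor (o xor V)) else nothing) , r) ∷ start (not ev) (o xor V) b s

  -- The r-th list consists of the parities of the r-clusters, from left to right. The first site is
  -- 1, an odd number, hence the first `false`.
  levels : ℕ → List Cell → List (List Bool)
  levels zero cs = []
  levels (suc n) cs = let E , cs' = step false nothing false cs in E ∷ levels n cs'

  -- The sites that lose a part are those that have mark 1 when nothing is overlined: the first
  -- nonempty one, then every second one, beginning anew after an empty site.
  plus : List ℕ → List ℕ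
  plus [] = []
  plus (zero ∷ c) = zero ∷ plus c
  plus (suc a ∷ []) = a ∷ 1 ∷ []
  plus (suc a ∷ b ∷ c) = a ∷ suc b ∷ plus c

  plain : List ℕ → List Site
  plain = map (false ,_)

  private
    variable
      cs cs' : List Cell
      cov cov' X z z' : Bool
      a⁻ p : Maybe Bool

  empty : Cell → Bool
  empty (nothing , _ , zero) = true
  empty _ = false

  -- How the cells of a site sequence change when its last overline is removed
  -- by `plus`. Beyond the overlined site the parts of some sites, two apart,
  -- lose their largest movable part to the next site: at a level where
  -- that part has a larger mark than the level, the entries stay in place with
  -- flipped parity (Run); once the level is its mark or larger, the entry has moved
  -- with unchanged parity (Switched). The indices of Idle describe the previous
  -- cell.
  data Idle : Maybe Bool → Bool → List Cell → List Cell → Set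
  data Run (X : Bool) : List Cell → List Cell → Set
  data Switched (X : Bool) : List Cell → List Cell → Set

  data Idle where
    []   : Idle a⁻ z [] []
    same : ∀ x → Idle (proj₁ x) (empty x) cs cs' → Idle a⁻ z (x ∷ cs) (x ∷ cs')
    run  : Run X cs cs' → Idle nothing true cs cs'
    flagged : ∀ {a b} → Run X cs cs' →
      Idle nothing z ((just X , true , suc a) ∷ (nothing , false , b) ∷ cs)
                     ((just (not X) , false , a) ∷ (nothing , false , suc b) ∷ cs')
    switched : ∀ {x y} → (a⁻ ≡ nothing → x ≡ 0) → Switched X cs cs' →
      Idle a⁻ z ((just X , false , x) ∷ (nothing , false , y) ∷ cs)
                ((nothing , false , x) ∷ (just X , false , y) ∷ cs')

  data Run X where
    []   : Run X [] []
    done : Idle nothing true cs cs' → Run X ((nothing , false , 0) ∷ cs) ((nothing , false , 0) ∷ cs')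
    move : ∀ {a b} → Run X cs cs' →
      Run X ((just X , false , suc a) ∷ (nothing , false , b) ∷ cs)
            ((just (not X) , false , a) ∷ (nothing , false , suc b) ∷ cs')
    switch : ∀ {y} → Switched X cs cs' →
      Run X ((just X , false , 0) ∷ (nothing , false , y) ∷ cs)
            ((nothing , false , 0) ∷ (just X , false , y) ∷ cs')

  data Switched X where
    []   : Switched X [] []
    done : Idle nothing true cs cs' → Switched X ((nothing , false , 0) ∷ cs) ((nothing , false , 0) ∷ cs')
    move : ∀ {x y} → Switched X cs cs' →
      Switched X ((just X , false , x) ∷ (nothing , false , y) ∷ cs)
                 ((nothing , false , x) ∷ (just X , false , y) ∷ cs')

  -- The pending chain, given whether the previous site received the current
  -- mark and the entry of the previous cell.
  data State : Maybe Bool → Bool → Maybe Bool → Set where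
    none    : State nothing cov nothing
    pending : ∀ {x} → State (just x) cov (just x)
    used    : ∀ {x} → State nothing true (just x)

  state-link : ∀ ev b p a → State (proj₂ (proj₂ (link ev b p a))) b a
  state-link ev false p (just x) = pending
  state-link ev false p nothing = none
  state-link ev true (just x) (just y) = pending
  state-link ev true (just x) nothing = none
  state-link ev true nothing (just x) = used
  state-link ev true nothing nothing = none

  peel-covered : ∀ c → peel true false c ≡ (false , false , c)
  peel-covered zero = refl
  peel-covered (suc c) = refl

  peel-free : ∀ c → peel false false (suc c) ≡ (true , false , c)
  peel-free zero = refl
  peel-free (suc c) = refl

  xor-notʳ : ∀ a b → a xor not b ≡ not (a xor b)
  xor-notʳ true b = refl
  xor-notʳ false b = refl

  not-xor-not : ∀ a b → not a xor not b ≡ a xor b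
  not-xor-not true b = refl
  not-xor-not false b = not-involutive b

  private
    -- In the second sequence the chain stands one site later. It is still pending (`owed`) when the
    -- first sequence has already reported its end; it is `paid` if the current mark has extended
    -- it, which covers the next site.
    data Debt (X : Bool) : Maybe Bool → Bool → Set where
      owed : Debt X (just X) cov
      paid : Debt X nothing true

  empty-next : ∀ ev x → empty x ≡ true →
    let a , o , c = x ; b , r = peel cov o c ; _ , a' , _ = link ev b p a in b ≡ false × empty (a' , r) ≡ true
  empty-next ev (nothing , o , zero) e = refl , refl

  step-idle : ∀ ev → Idle a⁻ z cs cs' → State p cov a⁻ → (z ≡ true → cov ≡ false) →
    ∀ a' z' → (z ≡ true → z' ≡ true) → (a' ≡ nothing → cov ≡ false) → (cov ≡ false → a' ≡ nothing) →
    let E , ds = step ev p cov cs ; E' , ds' = step ev p cov cs' in E ≡ E' × Idle a' z' ds ds'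
  -- While the part to be moved has a larger mark, both chains continue at the same site and stay
  -- opposite. At the level of its mark the second chain continues one site later, and the changed
  -- evenness of this part cancels the difference; this is `switch`.
  step-run : ∀ ev → Run X cs cs' →
    let E , ds = step ev nothing false cs ; E' , ds' = step ev nothing false cs' in E ≡ E' × Run (ev xor X) ds ds'
  step-run-switched : ∀ ev → Run X cs cs' →
    let E , ds = step ev nothing false cs ; E' , ds' = step ev nothing true cs' in E ≡ E' × Switched (ev xor X) ds ds'
  step-switched : ∀ ev → Switched X cs cs' → Debt X p cov →
    let E , ds = step ev nothing cov cs ; E' , ds' = step ev p cov cs' in ends p ++ E ≡ E' × (∀ a' z' → Idle a' z' ds ds')
  -- The second site of a pair of Switched, when the first one receives no mark.
  step-switched₂ : ∀ ev y → Switched X cs cs' →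
    let E , ds = step ev (just X) false ((nothing , false , y) ∷ cs)
        E' , ds' = step ev nothing false ((just X , false , y) ∷ cs')
    in E ≡ E' × (∀ a' z' → Idle a' z' ds ds')

  step-idle ev [] st hz a' z' zz h h' = refl , []
  step-idle {p = p} {cov} ev (same x@(a , o , c) i) st hz a' z' zz h h' with step-idle (not ev) i
      (state-link ev (proj₁ (peel cov o c)) p a) (λ e → proj₁ (empty-next {cov} {p} ev x e))
      (proj₁ (proj₂ (link ev (proj₁ (peel cov o c)) p a))) (empty (proj₁ (proj₂ (link ev (proj₁ (peel cov o c)) p a)) , proj₂ (peel cov o c)))
      (λ e → proj₂ (empty-next {cov} {p} ev x e)) (entry⁻ ev (proj₁ (peel cov o c)) p a) (entry⁺ ev (proj₁ (peel cov o c)) p a)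
    where
    entry⁻ : ∀ ev b p a → proj₁ (proj₂ (link ev b p a)) ≡ nothing → b ≡ false
    entry⁻ ev false p a e = refl
    entry⁻ ev true (just _) a ()
    entry⁻ ev true nothing (just _) ()
    entry⁻ ev true nothing nothing ()
    entry⁺ : ∀ ev b p a → b ≡ false → proj₁ (proj₂ (link ev b p a)) ≡ nothing
    entry⁺ ev false p a e = refl
  ... | e , i' = cong (proj₁ (link ev (proj₁ (peel cov o c)) p a) ++_) e , same _ i'
  step-idle ev (run r) none hz a' z' zz h h' with hz refl
  ... | refl rewrite h' refl | zz refl with step-run ev r
  ... | e , r' = e , run r'
  step-idle {cov = false} ev (flagged {X = X} {a = suc a} {b} r) none hz a' z' zz h h'
    rewrite peel-covered b | peel-free a | xor-notʳ ev X | h' refl with step-run (not (not ev)) r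
  ... | e , r' rewrite not-involutive ev = e , flagged r'
  step-idle {cov = false} ev (flagged {X = X} {a = zero} {b} r) none hz a' z' zz h h'
    rewrite peel-covered b | peel-free b | not-xor-not ev X with step-run-switched (not (not ev)) r
  ... | e , r' rewrite not-involutive ev = e , switched (λ _ → refl) r'
  step-idle {cov = true} ev (flagged {X = X} {a = a} {b} r) none hz a' z' zz h h'
    rewrite peel-covered b | peel-covered a | peel-free b | not-xor-not ev X with step-run-switched (not (not ev)) r
  ... | e , r' rewrite not-involutive ev = e , switched (λ n → case (h n) of λ ()) r'
  step-idle {p = p} {cov = true} ev (switched {x = x} {y} h₀ s) st hz a' z' zz h h' rewrite peel-covered x
    with step-switched₂ (not ev) y s
  ... | e , i = cong (ends p ++_) e , same _ (i _ _)
  step-idle {p = p} {cov = false} ev (switched {x = zero} {y} h₀ s) st hz a' z' zz h h'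
    with step-switched₂ (not ev) y s
  ... | e , i = cong (ends p ++_) e , same _ (i _ _)
  step-idle {cov = false} ev (switched {x = suc x} {y} h₀ s) none hz a' z' zz h h' = case (h₀ refl) of λ ()
  step-idle {cov = false} ev (switched {X = X} {x = suc x} {y} h₀ s) pending hz a' z' zz h h' rewrite peel-free x | peel-covered y
    with step-switched (not (not ev)) s (owed {X} {false})
  ... | e , i = e , same _ (same _ (i _ _))
  step-run ev [] = refl , []
  step-run ev (done i) with step-idle (not ev) i none (λ _ → refl) nothing true (λ _ → refl) (λ _ → refl) (λ _ → refl)
  ... | e , i' = e , done i'
  step-run {X} ev (move {a = suc a} {b} r) rewrite peel-covered b | peel-free a | xor-notʳ ev X
    with step-run (not (not ev)) r
  ... | e , r' rewrite not-involutive ev = e , move r'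
  step-run {X} ev (move {a = zero} {b} r) rewrite peel-covered b | peel-free b | not-xor-not ev X
    with step-run-switched (not (not ev)) r
  ... | e , r' rewrite not-involutive ev = e , switch r'
  step-run ev (switch {y = y} s) with step-switched₂ (not ev) y s
  ... | e , i = e , done (i _ _)
  step-run-switched ev [] = refl , []
  step-run-switched ev (done i) with step-idle (not ev) i none (λ _ → refl) nothing true (λ _ → refl) (λ _ → refl) (λ _ → refl)
  ... | e , i' = e , done i'
  step-run-switched {X} ev (move {a = a} {b} r) rewrite peel-free a | peel-covered b | peel-covered a | peel-free b | not-xor-not ev X
    with step-run-switched (not (not ev)) r
  ... | e , r' rewrite not-involutive ev = e , move r'
  step-run-switched ev (switch {y = y} s) with step-switched₂ (not ev) y s
  ... | e , i = e , done (i _ _)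
  step-switched ev [] owed = refl , λ a' z' → []
  step-switched ev [] paid = refl , λ a' z' → []
  step-switched {p = p} ev (done i) d with step-idle (not ev) i none (λ _ → refl) nothing true (λ _ → refl) (λ _ → refl) (λ _ → refl)
  ... | e , i' = cong (ends p ++_) e , λ a' z' → same _ i'
  step-switched {X} ev (move {x = suc x} {y} s) (owed {cov = false}) rewrite peel-free x | peel-covered y
    with step-switched (not (not ev)) s (owed {X} {false})
  ... | e , i = e , λ a' z' → same _ (same _ (i _ _))
  step-switched ev (move {x = zero} {y} s) (owed {cov = false}) with step-switched₂ (not ev) y s
  ... | e , i = cong (_ ∷_) e , λ a' z' → same _ (i _ _)
  step-switched ev (move {x = x} {y} s) (owed {cov = true}) rewrite peel-covered x with step-switched₂ (not ev) y s
  ... | e , i = cong (_ ∷_) e , λ a' z' → same _ (i _ _)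
  step-switched ev (move {x = x} {y} s) paid rewrite peel-covered x with step-switched₂ (not ev) y s
  ... | e , i = e , λ a' z' → same _ (i _ _)
  step-switched₂ ev zero s with step-switched (not ev) s (owed {cov = false})
  ... | e , i = e , λ a' z' → same _ (i _ _)
  step-switched₂ ev (suc y) s rewrite peel-free y with step-switched (not ev) s paid
  ... | e , i = e , λ a' z' → same _ (i _ _)

  levels-idle : ∀ n → Idle nothing true cs cs' → levels n cs ≡ levels n cs'
  levels-idle zero i = refl
  levels-idle (suc n) i with step-idle false i none (λ _ → refl) nothing true (λ _ → refl) (λ _ → refl) (λ _ → refl)
  ... | e , i' = cong₂ _∷_ e (levels-idle n i')

  private
    shifted : ∀ ev V → not ev xor V ≡ ev xor not V
    shifted true V = sym (not-involutive V)
    shifted false V = refl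

    unshifted : ∀ ev V → ev xor V ≡ not (ev xor not V)
    unshifted ev V = trans (cong (ev xor_) (sym (not-involutive V))) (xor-notʳ ev (not V))

  -- Without the overline the count `V` changes its parity, and a part that moves to the next site
  -- changes its evenness. So entries that stay are flipped, and entries that move are not.
  start-run : ∀ ev V c → Run (ev xor not V) (start ev (not V) false (plain (c ++ [ 0 ]))) (start ev V false (plain (plus (c ++ [ 0 ]))))
  start-switched : ∀ ev V c → Switched (ev xor not V) (start ev (not V) false (plain (c ++ [ 0 ]))) (start ev V true (plain (plus (c ++ [ 0 ]))))
  start-run ev V [] = done []
  start-run ev V (zero ∷ c) = done (run (start-run (not ev) V c))
  start-run ev V (suc zero ∷ []) rewrite shifted ev V = switch []
  start-run ev V (suc (suc a) ∷ []) rewrite peel-free a | unshifted ev V = move []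
  start-run ev V (suc zero ∷ b ∷ c) with start-switched (not (not ev)) V c
  ... | r rewrite not-involutive ev | peel-covered b | peel-free b | shifted ev V = switch r
  start-run ev V (suc (suc a) ∷ b ∷ c) with start-run (not (not ev)) V c
  ... | r rewrite not-involutive ev | peel-free a | peel-covered b | unshifted ev V = move r
  start-switched ev V [] = done []
  start-switched ev V (zero ∷ c) = done (run (start-run (not ev) V c))
  start-switched ev V (suc a ∷ []) rewrite peel-free a | peel-covered a | shifted ev V = move []
  start-switched ev V (suc a ∷ b ∷ c) with start-switched (not (not ev)) V c
  ... | r rewrite not-involutive ev | peel-free a | peel-covered b | peel-covered a | peel-free b | shifted ev V = move r

  start-flagged : ∀ ev V cov a c → (cov ≡ false → a⁻ ≡ nothing) → (a⁻ ≡ nothing → cov ≡ false) →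
    Idle a⁻ z (start ev V cov ((true , suc a) ∷ plain (c ++ [ 0 ]))) (start ev V cov (plain (plus (suc a ∷ c ++ [ 0 ]))))
  start-flagged ev V true a [] h h' rewrite peel-covered a | shifted ev V = switched (λ n → case (h' n) of λ ()) []
  start-flagged ev V true a (b ∷ c) h h' with start-switched (not (not ev)) V c
  ... | r rewrite not-involutive ev | peel-covered b | peel-covered a | peel-free b | shifted ev V = switched (λ n → case (h' n) of λ ()) r
  start-flagged ev V false zero [] h h' rewrite shifted ev V = switched (λ _ → refl) []
  start-flagged ev V false zero (b ∷ c) h h' with start-switched (not (not ev)) V c
  ... | r rewrite not-involutive ev | peel-covered b | peel-free b | shifted ev V = switched (λ _ → refl) r
  start-flagged ev V false (suc a) [] h h' rewrite h refl | peel-free a | unshifted ev V = flagged []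
  start-flagged ev V false (suc a) (b ∷ c) h h' with start-run (not (not ev)) V c
  ... | r rewrite h refl | not-involutive ev | peel-free a | peel-covered b | unshifted ev V = flagged r

  start-unflag : ∀ s ev V cov a c → (cov ≡ false → a⁻ ≡ nothing) → (a⁻ ≡ nothing → cov ≡ false) →
    Idle a⁻ z (start ev V cov (s ++ (true , suc a) ∷ plain (c ++ [ 0 ]))) (start ev V cov (s ++ plain (plus (suc a ∷ c ++ [ 0 ]))))
  start-unflag [] ev V cov a c h h' = start-flagged ev V cov a c h h'
  start-unflag ((o , n) ∷ s) ev V cov a c h h' = same _ (start-unflag s (not ev) (o xor V) _ a c (entry⁺ (proj₁ (peel cov o n))) (entry⁻ (proj₁ (peel cov o n))))
    where
    entry⁺ : ∀ b {x : Bool} → b ≡ false → (if b then just x else nothing) ≡ nothing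
    entry⁺ false _ = refl
    entry⁻ : ∀ b {x : Bool} → (if b then just x else nothing) ≡ nothing → b ≡ false
    entry⁻ false _ = refl

  parities : ℕ → List Site → List (List Bool)
  parities n s = levels n (start false false false s)

  levels-snoc : ∀ n cs → levels n (cs ++ [ nothing , false , 0 ]) ≡ levels n cs
  levels-snoc zero cs = refl
  levels-snoc (suc n) cs with step false nothing false cs | step false nothing false (cs ++ [ nothing , false , 0 ]) | step-snoc false nothing false cs
    where
    step-snoc : ∀ ev p cov cs → step ev p cov (cs ++ [ nothing , false , 0 ])
      ≡ (proj₁ (step ev p cov cs) , proj₂ (step ev p cov cs) ++ [ nothing , false , 0 ])
    step-snoc ev p cov [] = cong (_, _) (++-identityʳ (ends p))
    step-snoc ev p cov ((a , o , c) ∷ cs) rewrite step-snoc (not ev) (proj₂ (proj₂ (link ev (proj₁ (peel cov o c)) p a))) (proj₁ (peel cov o c)) cs = refl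
  ... | E , ds | _ | refl = cong (E ∷_) (levels-snoc n ds)

  parities-snoc : ∀ n s → parities n (s ++ [ false , 0 ]) ≡ parities n s
  parities-snoc n s = trans (cong (levels n) (start-snoc false false false s)) (levels-snoc n (start false false false s))
    where
    start-snoc : ∀ ev V cov s → start ev V cov (s ++ [ false , 0 ]) ≡ start ev V cov s ++ [ nothing , false , 0 ]
    start-snoc ev V cov [] = refl
    start-snoc ev V cov ((o , c) ∷ s) = cong (_ ∷_) (start-snoc (not ev) (o xor V) (proj₁ (peel cov o c)) s)

  plus-snoc : ∀ c → plus (c ++ [ 0 ]) ≡ plus c ⊎ plus (c ++ [ 0 ]) ≡ plus c ++ [ 0 ]
  plus-snoc [] = inj₂ refl
  plus-snoc (zero ∷ c) with plus-snoc c
  ... | inj₁ e = inj₁ (cong (0 ∷_) e)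
  ... | inj₂ e = inj₂ (cong (0 ∷_) e)
  plus-snoc (suc a ∷ []) = inj₁ refl
  plus-snoc (suc a ∷ b ∷ c) with plus-snoc c
  ... | inj₁ e = inj₁ (cong (λ d → a ∷ suc b ∷ d) e)
  ... | inj₂ e = inj₂ (cong (λ d → a ∷ suc b ∷ d) e)

  -- `Idle` compares sequences of equal length, but `plus` may need one more site; an empty site at
  -- the end, which has no effect on parities, makes room for it.
  parities-unflag : ∀ n s a c → parities n (s ++ (true , suc a) ∷ plain c) ≡ parities n (s ++ plain (plus (suc a ∷ c)))
  parities-unflag n s a c = begin
    parities n (s ++ (true , suc a) ∷ plain c)                      ≡⟨ parities-snoc n _ ⟨
    parities n ((s ++ (true , suc a) ∷ plain c) ++ [ false , 0 ])   ≡⟨ cong (parities n) (trans (++-assoc s _ _) (cong (λ t → s ++ (true , suc a) ∷ t) (sym (map-++ (false ,_) c [ 0 ])))) ⟩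
    parities n (s ++ (true , suc a) ∷ plain (c ++ [ 0 ]))           ≡⟨ levels-idle n (start-unflag s false false false a c (λ _ → refl) (λ _ → refl)) ⟩
    parities n (s ++ plain (plus (suc a ∷ c ++ [ 0 ])))             ≡⟨ drop-zero (plus-snoc (suc a ∷ c)) ⟩
    parities n (s ++ plain (plus (suc a ∷ c)))                      ∎
    where
    open Relation.Binary.PropositionalEquality.≡-Reasoning
    drop-zero : ∀ {d d'} → d' ≡ d ⊎ d' ≡ d ++ [ 0 ] → parities n (s ++ plain d') ≡ parities n (s ++ plain d)
    drop-zero (inj₁ refl) = refl
    drop-zero {d} (inj₂ refl) = trans (cong (parities n) (trans (cong (s ++_) (map-++ (false ,_) d [ 0 ])) (sym (++-assoc s _ _)))) (parities-snoc n (s ++ plain d))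

-- Deleting the first adjacent pair with the maximal number of parts

module PairDeletion where
  open Cells

  private
    variable
      cs cs' : List Cell
      cov ev t : Bool
      a a⁻ a⁼ f⁻ f⁼ p : Maybe Bool
      r r⁻ s⁻ x x' k : ℕ

  xor-cancel : ∀ a b → a xor (a xor b) ≡ b
  xor-cancel true b = not-involutive b
  xor-cancel false b = refl

  -- Cells of a sequence without overlines, after two cells with entries a⁼, a⁻
  -- and remaining multiplicity r⁻ of the second. The last condition: a mark
  -- recurring two sites later starts the same parity, provided that
  -- the site between them has larger marks.
  data Regular : Maybe Bool → Maybe Bool → ℕ → List Cell → Set where
    []   : Regular a⁼ a⁻ r⁻ []
    cons : (∀ {e} → a⁻ ≡ just e → a ≡ nothing) →
           (∀ {n} → r ≡ suc n → a ≡ nothing → ∃ λ e → a⁻ ≡ just e) →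
           (∀ {e e' n} → a⁼ ≡ just e → a ≡ just e' → r⁻ ≡ suc n → e ≡ e') →
           Regular a⁻ a r cs → Regular a⁼ a⁻ r⁻ ((a , false , r) ∷ cs)

  data Entered : Bool → Maybe Bool → Set where
    marked : ∀ {e} → Entered true (just e)
    unmarked  : Entered false nothing

  private
    just≢ : ∀ {e : Bool} {A : Set} → nothing ≡ just e → A
    just≢ ()

    resume : ∀ (a : Maybe Bool) {u} → a⁻ ≡ nothing → (a ≡ nothing → ∃ λ e → a⁻ ≡ just e) → (∀ {e'} → a ≡ just e' → u ≡ e') → a ≡ just u
    resume nothing e f q = just≢ (trans (sym e) (proj₂ (f refl)))
    resume (just v) e f q = cong just (sym (q refl))

    just-inj : ∀ {e e' : Bool} → just e ≡ just e' → e ≡ e'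
    just-inj refl = refl

  -- f⁼, f⁻, s⁻ describe the two previous cells one level further.
  regular-step : ∀ ev p cov → Regular a⁼ a⁻ r⁻ cs → State p cov a⁻ → Entered cov f⁻ →
    (∀ {e n} → f⁼ ≡ just e → s⁻ ≡ suc n →
       p ≡ just (ev xor e) ⊎ (p ≡ nothing × a⁻ ≡ nothing × a⁼ ≡ just (ev xor e) × ∃ λ m → r⁻ ≡ suc m)) →
    (∀ {e} → f⁻ ≡ just e →
       p ≡ nothing × (a⁻ ≡ just (not ev xor e) ⊎ (a⁼ ≡ just (not ev xor e) × a⁻ ≡ nothing × ∃ λ m → r⁻ ≡ suc m))) →
    Regular f⁼ f⁻ s⁻ (proj₂ (step ev p cov cs))
  regular-step ev p cov [] st en M N = []
  regular-step {a⁻ = a⁻} ev p true (cons {a = a} {r = r} gap fine eq ok) st (marked {e₀}) M N rewrite peel-covered r =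
    cons (λ _ → refl) (λ _ _ → _ , refl) (λ _ ())
      (regular-step (not ev) a false ok (state-link ev false p a) unmarked M' λ ())
    where
    M' : ∀ {e n} → just e₀ ≡ just e → r ≡ suc n →
      a ≡ just (not ev xor e) ⊎ (a ≡ nothing × a ≡ nothing × a⁻ ≡ just (not ev xor e) × ∃ λ m → r ≡ suc m)
    M' {e} refl er with N refl
    ... | _ , inj₁ ea⁻ = inj₂ (gap ea⁻ , gap ea⁻ , ea⁻ , _ , er)
    ... | _ , inj₂ (ea⁼ , ea⁻ , m , er⁻) = inj₁ (resume a ea⁻ (fine er) λ ea → eq ea⁼ ea er⁻)
  regular-step ev p false (cons {a = a} {r = zero} gap fine eq ok) st unmarked M N =
    cons (λ _ → refl) (λ ()) (λ _ ()) (regular-step (not ev) a false ok (state-link ev false p a) unmarked (λ _ ()) λ ())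
  regular-step ev .(just _) false (cons {a = a} {r = suc r} gap fine eq ok) (pending {x = x}) unmarked M N rewrite peel-free r | gap refl =
    cons (λ ()) (λ _ ()) eq' (regular-step (not ev) nothing true ok none marked (λ ())
      λ { refl → refl , inj₂ (cong just (sym (trans (cong (_xor (ev xor x)) (not-involutive ev)) (xor-cancel ev x))) , refl , _ , refl) })
    where
    eq' : ∀ {e e' n} → _ ≡ just e → just (ev xor x) ≡ just e' → _ ≡ suc n → e ≡ e'
    eq' {e} ef refl es with M ef es
    ... | inj₁ q = trans (sym (xor-cancel ev e)) (cong (ev xor_) (sym (just-inj q)))
  regular-step ev .nothing false (cons {a = nothing} {r = suc r} gap fine eq ok) none unmarked M N = case (fine refl refl) of λ ()
  regular-step ev .nothing false (cons {a = just v} {r = suc r} gap fine eq ok) none unmarked M N rewrite peel-free r =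
    cons (λ ()) (λ _ ()) eq' (regular-step (not ev) nothing true ok used marked (λ ())
      λ { refl → refl , inj₁ (cong just (sym (trans (cong (_xor (ev xor v)) (not-involutive ev)) (xor-cancel ev v)))) })
    where
    eq' : ∀ {e e' n} → _ ≡ just e → just (ev xor v) ≡ just e' → _ ≡ suc n → e ≡ e'
    eq' {e} ef refl es with M ef es
    ... | inj₂ (_ , _ , ea⁼ , _ , er⁻) = trans (sym (xor-cancel ev e)) (cong (ev xor_) (eq ea⁼ refl er⁻))

  regular-step₀ : Regular nothing nothing 0 cs → Regular nothing nothing 0 (proj₂ (step false nothing false cs))
  regular-step₀ ok = regular-step false nothing false ok none unmarked (λ ()) λ ()

  regular-start : ∀ ev cov c → Entered cov f⁻ → (∀ {e} → f⁼ ≡ just e → e ≡ ev) → (∀ {e} → f⁻ ≡ just e → e ≡ not ev) →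
    Regular f⁼ f⁻ s⁻ (start ev false cov (plain c))
  regular-start ev cov [] en h h' = []
  regular-start ev true (r ∷ c) marked h h' rewrite peel-covered r =
    cons (λ _ → refl) (λ _ _ → _ , refl) (λ _ ()) (regular-start (not ev) false c unmarked h' λ ())
  regular-start ev false (zero ∷ c) unmarked h h' =
    cons (λ _ → refl) (λ ()) (λ _ ()) (regular-start (not ev) false c unmarked (λ ()) λ ())
  regular-start ev false (suc r ∷ c) unmarked h h' rewrite peel-free r =
    cons (λ ()) (λ _ ()) (λ { ef refl _ → trans (h ef) (sym (xor-false ev)) })
      (regular-start (not ev) true c marked (λ ()) λ { refl → trans (xor-false ev) (sym (not-involutive ev)) })
    where
    xor-false : ∀ a → a xor false ≡ a
    xor-false true = refl
    xor-false false = refl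

  -- Adjacent sites hold at most k parts that have not received their mark.
  data Bound (k : ℕ) : ℕ → List Cell → Set where
    []  : Bound k x []
    _∷_ : x + r ≤ k → Bound k r cs → Bound k x ((a , false , r) ∷ cs)

  -- Multiplicities of a cell now and one level further.
  data Peeled : Bool → ℕ → ℕ → Set where
    marked : Peeled true (suc x) x
    unmarked  : Peeled false x x

  peeled : ∀ cov r → let b , _ , r' = peel cov false r in Peeled b r r'
  peeled cov zero = unmarked
  peeled true (suc r) = unmarked
  peeled false (suc r) rewrite peel-free r = marked

  private
    peel-plain : ∀ cov r → let _ , o , _ = peel cov false r in o ≡ false
    peel-plain cov zero = refl
    peel-plain true (suc r) = refl
    peel-plain false (suc r) rewrite peel-free r = refl

    drop-bound : ∀ cov → Peeled cov x x' → x + r ≤ suc k → x' ≤ k → let _ , _ , r' = peel cov false r in x' + r' ≤ k × r' ≤ k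
    drop-bound {x' = x'} {r = zero} cov pe le lx = subst (_≤ _) (sym (+-identityʳ x')) lx , z≤n
    drop-bound {r = suc r} true marked (s≤s le) lx = le , ≤-trans (m≤n+m (suc r) _) le
    drop-bound {x = x} {r = suc r} {k} false unmarked le lx rewrite peel-free r =
      ≤-pred (subst (_≤ suc k) (+-suc x r) le) , ≤-trans (m≤n+m r x) (≤-pred (subst (_≤ suc k) (+-suc x r) le))

  bound-step : ∀ ev p → Bound (suc k) x cs → Peeled cov x x' → x' ≤ k → Bound k x' (proj₂ (step ev p cov cs))
  bound-step ev p [] pe lx = []
  bound-step {cov = cov} ev p (_∷_ {r = r} {a = a} le b) pe lx with peel cov false r | peel-plain cov r | peeled cov r | drop-bound cov pe le lx
  ... | b' , o , r' | refl | pe' | le' , lr = le' ∷ bound-step (not ev) _ b pe' lr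

  data Bounded (k : ℕ) : ℕ → List ℕ → Set where
    []  : Bounded k x []
    _∷_ : ∀ {c} → x + r ≤ k → Bounded k r c → Bounded k x (r ∷ c)

  bound-start : ∀ ev {c} → Bounded (suc k) x c → Peeled cov x x' → x' ≤ k → Bound k x' (start ev false cov (plain c))
  bound-start ev [] pe lx = []
  bound-start {cov = cov} ev (_∷_ {r = r} le b) pe lx with peel cov false r | peel-plain cov r | peeled cov r | drop-bound cov pe le lx
  ... | b' , o , r' | refl | pe' | le' , lr = le' ∷ bound-start (not ev) b pe' lr

  private
    alternating₁ : ∀ e y m n → (e xor y) xor (m xor n) ≡ y xor ((e xor m) xor n)
    alternating₁ true true true n = refl
    alternating₁ true true false n = sym (not-involutive n)
    alternating₁ true false true n = not-involutive n
    alternating₁ true false false n = refl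
    alternating₁ false y m n = refl

    alternating₂ : ∀ e y m n → (e xor y) xor (m xor n) ≡ y xor (m xor (e xor n))
    alternating₂ true true true n = sym (trans (not-involutive (not n)) refl)
    alternating₂ true true false n = sym (not-involutive n)
    alternating₂ true false true n = refl
    alternating₂ true false false n = refl
    alternating₂ false y m n = refl

  times : ℕ → Bool → Bool
  times zero e = false
  times (suc n) e = e xor times n e

  data Head (n : ℕ) : List Cell → Set where
    []  : Head n []
    _∷_ : r ≤ n → (cs : List Cell) → Head n ((a , false , r) ∷ cs)

  -- The cell is not yet at the pair to be deleted: together with its predecessor it has fewer than
  -- K parts without mark. For K = 0 all marks have been given and the pair shows only as an entry,
  -- so there must be none.
  Quiet : ℕ → ℕ → Maybe Bool → ℕ → Set
  Quiet zero x a r = a ≡ nothing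
  Quiet (suc k) x a r = x + r ≤ k

  Below : ℕ → ℕ → Set
  Below zero x = x ≤ x
  Below (suc k) x = x ≤ k

  -- The second list arises from the first by deleting the first two adjacent
  -- sites that hold K parts without mark; t is the parity that the chain of
  -- marks in these sites will get. The indices before the lists are the
  -- parity of the position, the entry and the multiplicity of the previous cell.
  data Delete (K : ℕ) (t : Bool) : Bool → Maybe Bool → ℕ → List Cell → List Cell → Set where
    same   : Quiet K x a r → Delete K t (not ev) a r cs cs' → Delete K t ev a⁻ x ((a , false , r) ∷ cs) ((a , false , r) ∷ cs')
    first  : ∀ {m n y} → m + n ≡ K → y xor (times m ev xor times n (not ev)) ≡ t → m ≡ 0 ⊎ x ≤ n → Head m cs →
      Delete K t ev nothing x ((just y , false , m) ∷ (nothing , false , n) ∷ cs) cs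
    second : ∀ {m n y} → m + n ≡ K → y xor (times m ev xor times n (not ev)) ≡ t → m ≡ 0 ⊎ x ≤ n → Head m cs → (a⁻ ≡ nothing → m ≡ 0) →
      Delete K t ev a⁻ x ((nothing , false , m) ∷ (just y , false , n) ∷ cs) cs

  private
    head-free : ∀ {m} ev p → Head (suc m) cs → Head m (proj₂ (step ev p false cs))
    head-free ev p [] = []
    head-free ev p (_∷_ {zero} le cs) = z≤n ∷ _
    head-free ev p (_∷_ {suc r} le cs) rewrite peel-free r = ≤-pred le ∷ _

    head-covered : ∀ {m} ev p → Head m cs → Head m (proj₂ (step ev p true cs))
    head-covered ev p [] = []
    head-covered ev p (_∷_ {r} le cs) rewrite peel-covered r = le ∷ _

    head-zero : ∀ ev p cov → Head 0 cs → Head 0 (proj₂ (step ev p cov cs))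
    head-zero ev p cov [] = []
    head-zero ev p cov (z≤n ∷ cs) = z≤n ∷ _

    -- Nothing continues a pending chain at a covered site or at an empty one.
    emit-covered : ∀ {m} ev p → Head m cs →
      step ev p true cs ≡ (ends p ++ proj₁ (step ev nothing true cs) , proj₂ (step ev nothing true cs))
    emit-covered ev p [] = cong (_, _) (sym (++-identityʳ (ends p)))
    emit-covered ev p (_∷_ {r} le cs) rewrite peel-covered r = refl

    emit-zero : ∀ ev p cov → Head 0 cs →
      step ev p cov cs ≡ (ends p ++ proj₁ (step ev nothing true cs) , proj₂ (step ev nothing true cs))
    emit-zero ev p cov [] = cong (_, _) (sym (++-identityʳ (ends p)))
    emit-zero ev p cov (z≤n ∷ cs) = refl

    quiet-step : ∀ ev b' cov → Peeled cov x x' → Below k x' → x + r ≤ k → let b , _ , r' = peel cov false r in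
      Quiet k x' (proj₁ (proj₂ (link ev b b' a))) r' × Below k r'
    quiet-step {k = suc k} ev b' cov pe lx le = drop-bound cov pe le lx
    quiet-step {x = x} {k = zero} {r = zero} ev b' cov pe lx le = refl , ≤-refl
    quiet-step {x = x} {k = zero} {r = suc r} ev b' cov pe lx le = case (trans (sym (+-suc x r)) (n≤0⇒n≡0 le)) of λ ()

  entered-link : ∀ ev b p a → Entered b (proj₁ (proj₂ (link ev b p a)))
  entered-link ev false p a = unmarked
  entered-link ev true (just x) a = marked
  entered-link ev true nothing (just x) = marked
  entered-link ev true nothing nothing = marked

  private

    -- A covered pair has a second site to be marked.
    second-suc : ∀ {m n} → m + n ≡ suc k → Peeled true x x' → m ≡ 0 ⊎ x ≤ n →
      ∃ λ n' → n ≡ suc n' × m + n' ≡ k × (m ≡ 0 ⊎ x' ≤ n')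
    second-suc {n = suc n'} e marked (inj₁ refl) = n' , refl , suc-injective e , inj₁ refl
    second-suc {m = m} {n = suc n'} e marked (inj₂ (s≤s le)) = n' , refl , suc-injective (trans (sym (+-suc m n')) e) , inj₂ le

  -- The pair gives the current mark to exactly one of its sites and passes on the coverage that it
  -- received: a covered pair marks its second site, an uncovered one its first. If the first site
  -- is empty, the second one is marked, but then the next site is empty as well. So the rest
  -- evolves as if the pair were absent.
  delete-step : ∀ ev p cov → Regular a⁼ a⁻ x cs → Delete (suc k) t ev a⁻ x cs cs' → State p cov a⁻ →
    ∀ {a'} → Entered cov a' → Peeled cov x x' → Below k x' →
    let E , ds = step ev p cov cs ; E' , ds' = step ev p cov cs' in E ≡ E' × Delete k t ev a' x' ds ds'
  delete-step ev p cov (cons gap fine eq ok) (same {a = a} {r = r} qu d) st en pe lx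
    with peel cov false r | peel-plain cov r | peeled cov r | quiet-step {a = a} ev p cov pe lx qu
  ... | b , o , r' | refl | pe' | qu' , lr
    with delete-step (not ev) _ b ok d (state-link ev b p a) (entered-link ev b p a) pe' lr
  ... | e , d' = cong (proj₁ (link ev b p a) ++_) e , same qu' d'
  delete-step {cs = _ ∷ _ ∷ cs} ev p true ok (first {m = m} {n} {y} e et le hd) none marked pe lx with second-suc e pe le
  ... | n' , refl , e' , le' rewrite peel-covered m | peel-free n' | not-involutive ev =
    refl , second e' (trans (alternating₂ (not ev) y (times m ev) (times n' (not ev))) et) le' (head-covered ev nothing hd) λ ()
  delete-step {cs = _ ∷ _ ∷ cs} ev p false ok (first {m = zero} {suc n} {y} e et le hd) none unmarked pe lx
    rewrite peel-free n | not-involutive ev | emit-zero ev nothing false hd =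
    refl , second (suc-injective e) (trans (alternating₂ (not ev) y false (times n (not ev))) et) (inj₁ refl) (head-zero ev nothing true hd) λ _ → refl
  delete-step ev p false ok (first {m = suc m} {n} {y} e et (inj₂ le) hd) none unmarked unmarked lx rewrite peel-free m | peel-covered n | not-involutive ev =
    refl , first (suc-injective e) (trans (alternating₁ ev y (times m ev) (times n (not ev))) et) (inj₂ le) (head-free ev nothing hd)
  delete-step ev p cov ok (second {m = zero} {suc n} {y} e et le hd h) st en pe lx
    rewrite peel-free n | not-involutive ev | emit-zero ev p cov hd =
    refl , second (suc-injective e) (trans (alternating₂ (not ev) y false (times n (not ev))) et) (inj₁ refl) (head-zero ev nothing true hd) λ _ → refl
  delete-step ev p cov ok (second {m = suc m} e et le hd h) none en pe lx = case (h refl) of λ ()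
  delete-step ev p true ok (second {m = suc m} {n} {y} e et le hd h) st marked pe lx with second-suc e pe le
  ... | n' , refl , e' , le' rewrite peel-free n' | not-involutive ev | emit-covered ev p hd =
    refl , second e' (trans (alternating₂ (not ev) y (times (suc m) ev) (times n' (not ev))) et) le' (head-covered ev nothing hd) λ ()
  -- The mark at the first site of the pair extends the chain `z` pending before it, while `y` is
  -- left for the rest. By regularity both have the same parity, so they may exchange roles.
  delete-step ev p false (cons _ _ _ (cons _ _ eq _)) (second {m = suc m} {n} {y} e et (inj₂ le) hd h) (pending {x = z}) unmarked unmarked lx
    with eq refl refl refl
  ... | refl rewrite peel-free m | peel-covered n | not-involutive ev =
    refl , first (suc-injective e) (trans (alternating₁ ev y (times m ev) (times n (not ev))) et) (inj₂ le) (head-free ev (just z) hd)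

  data HeadF (n : ℕ) : List ℕ → Set where
    []  : HeadF n []
    _∷_ : r ≤ n → (c : List ℕ) → HeadF n (r ∷ c)

  private
    variable
      c c' : List ℕ

  data DeleteF (k : ℕ) (t : Bool) : Bool → ℕ → List ℕ → List ℕ → Set where
    same : x + r ≤ k → DeleteF k t (not ev) r c c' → DeleteF k t ev x (r ∷ c) (r ∷ c')
    pair : ∀ {m n} → m + n ≡ suc k → times m ev xor times n (not ev) ≡ t → m ≡ 0 ⊎ x ≤ n → HeadF m c → DeleteF k t ev x (m ∷ n ∷ c) c

  private
    startF-free : ∀ {m} ev → HeadF (suc m) c → Head m (start ev false false (plain c))
    startF-free ev [] = []
    startF-free ev (_∷_ {zero} le c) = z≤n ∷ _
    startF-free ev (_∷_ {suc r} le c) rewrite peel-free r = ≤-pred le ∷ _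

    startF-covered : ∀ {m} ev → HeadF m c → Head m (start ev false true (plain c))
    startF-covered ev [] = []
    startF-covered ev (_∷_ {r} le c) rewrite peel-covered r = le ∷ _

    startF-zero : ∀ ev → HeadF 0 c → start ev false false (plain c) ≡ start ev false true (plain c)
    startF-zero ev [] = refl
    startF-zero ev (z≤n ∷ c) = refl

    quiet-start : ∀ e cov → Peeled cov x x' → Below k x' → x + r ≤ k → let b , _ , r' = peel cov false r in
      Quiet k x' (if b then just e else nothing) r' × Below k r'
    quiet-start {k = suc k} e cov pe lx le with drop-bound cov pe le lx
    ... | le' , lr = le' , lr
    quiet-start {x = x} {k = zero} {r = zero} e cov pe lx le = refl , ≤-refl
    quiet-start {x = x} {k = zero} {r = suc r} e cov pe lx le = case (trans (sym (+-suc x r)) (n≤0⇒n≡0 le)) of λ ()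

    entered-start : ∀ {e : Bool} b → Entered b (if b then just e else nothing)
    entered-start true = marked
    entered-start false = unmarked

  delete-start : ∀ ev cov → DeleteF k t ev x c c' → Entered cov a⁻ → Peeled cov x x' → Below k x' →
    Delete k t ev a⁻ x' (start ev false cov (plain c)) (start ev false cov (plain c'))
  delete-start ev cov (same {r = r} le d) en pe lx with peel cov false r | peel-plain cov r | peeled cov r | quiet-start {r = r} (ev xor false) cov pe lx le
  ... | b , o , r' | refl | pe' | qu' , lr = same qu' (delete-start (not ev) b d (entered-start b) pe' lr)
  delete-start ev true (pair {m = m} {n} e et le hd) marked pe lx with second-suc e pe le
  ... | n' , refl , e' , le' rewrite peel-covered m | peel-free n' | not-involutive ev =
    second e' (trans (alternating₂ (not ev) false (times m ev) (times n' (not ev))) et) le' (startF-covered ev hd) λ ()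
  delete-start ev false (pair {m = zero} {suc n} e et le hd) unmarked pe lx
    rewrite peel-free n | not-involutive ev | startF-zero ev hd =
    second (suc-injective e) (trans (alternating₂ (not ev) false false (times n (not ev))) et) (inj₁ refl) (startF-covered ev hd) λ _ → refl
  delete-start ev false (pair {m = suc m} {n} e et (inj₂ le) hd) unmarked unmarked lx rewrite peel-free m | peel-covered n | not-involutive ev =
    first (suc-injective e) (trans (alternating₁ ev false (times m ev) (times n (not ev))) et) (inj₂ le) (startF-free ev hd)

  entries : List Cell → List Bool
  entries [] = []
  entries ((a , _) ∷ cs) = ends a ++ entries cs

  step-exhausted : ∀ ev p cov → Bound 0 x cs → proj₁ (step ev p cov cs) ≡ ends p ++ entries cs
  step-exhausted ev p cov [] = sym (++-identityʳ (ends p))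
  step-exhausted {x = x} ev p cov (_∷_ {r = r} {a = a} le b) with refl ← n≤0⇒n≡0 (≤-trans (m≤n+m r x) le) =
    cong (ends p ++_) (step-exhausted (not ev) a false b)

  delete-entries : Delete 0 t ev a⁻ x cs cs' → entries cs ≡ t ∷ entries cs'
  delete-entries (same refl d) = delete-entries d
  delete-entries (first {m = zero} {zero} {y} e et le hd) = cong (_∷ _) (trans (sym (xor-false y)) et)
    where
    xor-false : ∀ a → a xor false ≡ a
    xor-false true = refl
    xor-false false = refl
  delete-entries (second {m = zero} {zero} {y} e et le hd h) = cong (_∷ _) (trans (sym (xor-false y)) et)
    where
    xor-false : ∀ a → a xor false ≡ a
    xor-false true = refl
    xor-false false = refl

  -- The earlier levels agree by `delete-step`. At the last one all chains end, and as no cell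
  -- before the pair then has an entry, `t` comes first.
  levels-delete : ∀ k → Regular nothing nothing 0 cs → Delete k t false nothing 0 cs cs' → Bound k 0 cs → Bound k 0 cs' →
    ∃ λ L → ∃ λ E → levels (suc k) cs ≡ L ++ [ t ∷ E ] × levels (suc k) cs' ≡ L ++ [ E ]
  levels-delete {cs' = cs'} zero ok d b b' = [] , entries cs'
    , cong [_] (trans (step-exhausted false nothing false b) (delete-entries d))
    , cong [_] (step-exhausted false nothing false b')
  levels-delete {cs = cs} {cs' = cs'} (suc k) ok d b b' with delete-step false nothing false ok d none unmarked unmarked (below k)
    where
    below : ∀ k → Below k 0
    below zero = z≤n
    below (suc k) = z≤n
  ... | e , d' with levels-delete k (regular-step₀ ok) d' (bound-step false nothing b unmarked z≤n) (bound-step false nothing b' unmarked z≤n)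
  ... | L , E , q , q' = proj₁ (step false nothing false cs) ∷ L , E , cong (_ ∷_) q , cong₂ _∷_ (sym e) q'

  parities-delete : DeleteF k t false 0 c c' → Bounded (suc k) 0 c → Bounded (suc k) 0 c' →
    ∃ λ L → ∃ λ E → parities (suc k) (plain c) ≡ L ++ [ t ∷ E ] × parities (suc k) (plain c') ≡ L ++ [ E ]
  parities-delete {k = k} {c = c} d b b' = levels-delete k (regular-start false false c unmarked (λ ()) λ ()) (delete-start false false d unmarked unmarked (below k))
    (bound-start false b unmarked z≤n) (bound-start false b' unmarked z≤n)
    where
    below : ∀ k → Below k 0
    below zero = z≤n
    below (suc k) = z≤n

  data Blank : List Cell → Set where
    []  : Blank []
    _∷_ : (o : Bool) → Blank cs → Blank ((nothing , o , 0) ∷ cs)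

  blank-step : ∀ ev cov → Blank cs → let E , ds = step ev nothing cov cs in E ≡ [] × Blank ds
  blank-step ev cov [] = refl , []
  blank-step ev cov (o ∷ b) with blank-step (not ev) false b
  ... | e , b' = e , false ∷ b'

  bound-blank : ∀ ev p cov → Bound 0 x cs → Blank (proj₂ (step ev p cov cs))
  bound-blank ev p cov [] = []
  bound-blank {x = x} ev p cov (_∷_ {r = r} le b) with refl ← n≤0⇒n≡0 (≤-trans (m≤n+m r x) le) = false ∷ bound-blank (not ev) _ false b

  levels-blank : Bound k 0 cs → levels (suc (suc k)) cs ≡ levels (suc k) cs ++ [ [] ]
  levels-blank {k = zero} {cs = cs} b = cong (λ E → proj₁ (step false nothing false cs) ∷ E ∷ []) (proj₁ (blank-step false false (bound-blank false nothing false b)))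
  levels-blank {k = suc k} {cs = cs} b = cong (proj₁ (step false nothing false cs) ∷_) (levels-blank (bound-step false nothing b unmarked z≤n))

  -- There is no largest mark when all adjacent pairs have fewer parts.
  parities-bounded : Bounded k 0 c → parities (suc k) (plain c) ≡ parities k (plain c) ++ [ [] ]
  parities-bounded {k = zero} b = cong (λ E → E ∷ []) (proj₁ (blank-step false false (zeros false b)))
    where
    zeros : ∀ ev → Bounded 0 x c → Blank (start ev false false (plain c))
    zeros ev [] = []
    zeros {x = x} ev (_∷_ {r = r} le b) with refl ← n≤0⇒n≡0 (≤-trans (m≤n+m r x) le) = false ∷ zeros (not ev) b
  parities-bounded {k = suc k} b = levels-blank (bound-start false b unmarked z≤n)

-- Deleting all maximal pairs: gaps, inverse and parities

module GreedyDeletion where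
  open import Defs using (headOr0)
  open Counting
  open PathWords using (Parities; []; _∷_)
  open Parity
  open Cells
  open PairDeletion
  open import Relation.Nullary using (yes; no)

  private
    variable
      m n p x y : ℕ
      c g l l' Q : List ℕ

  addHead : ℕ → List ℕ → List ℕ
  addHead d [] = []
  addHead d (f ∷ g) = d + f ∷ g

  infixr 5 _∷'_

  -- Zeros at the end are dropped.
  _∷'_ : ℕ → List ℕ → List ℕ
  zero ∷' [] = []
  zero ∷' (r ∷ c) = zero ∷ r ∷ c
  suc m ∷' c = suc m ∷ c

  -- Normal p l: the list l, preceded by p, ends with a nonzero entry and one
  -- padding zero (which is p if l is empty).
  data Normal : ℕ → List ℕ → Set where
    []   : Normal 0 []
    zero : Normal (suc p) (0 ∷ [])
    cons : Normal m (n ∷ c) → Normal p (m ∷ n ∷ c)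

  normal-any : Normal p (m ∷ n ∷ c) → Normal x (m ∷ n ∷ c)
  normal-any (cons nm) = cons nm

  head-∷' : ∀ m Q → headOr0 (m ∷' Q) ≡ m
  head-∷' zero [] = refl
  head-∷' zero (_ ∷ _) = refl
  head-∷' (suc m) Q = refl

  ∷'-injective : ∀ m Q m' Q' → m ∷' Q ≡ m' ∷' Q' → m ≡ m' × Q ≡ Q'
  ∷'-injective zero [] zero [] e = refl , refl
  ∷'-injective zero (r ∷ c) zero (.r ∷ .c) refl = refl , refl
  ∷'-injective zero (r ∷ c) (suc m') Q' ()
  ∷'-injective (suc m) Q (suc .m) .Q refl = refl , refl
  ∷'-injective zero [] (suc m') Q' ()
  ∷'-injective zero [] zero (_ ∷ _) ()
  ∷'-injective (suc m) Q zero [] ()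
  ∷'-injective (suc m) Q zero (_ ∷ _) ()

  addHead-injective : ∀ d g g' → addHead d g ≡ addHead d g' → g ≡ g'
  addHead-injective d [] [] e = refl
  addHead-injective d (f ∷ g) (f' ∷ g') e with ∷-injective e
  ... | e₁ , refl = cong (_∷ g) (+-cancelˡ-≡ d f f' e₁)

  length-addHead : ∀ d g → length (addHead d g) ≡ length g
  length-addHead d [] = refl
  length-addHead d (_ ∷ g) = refl

  addHead-+ : ∀ d d' g → addHead d (addHead d' g) ≡ addHead (d + d') g
  addHead-+ d d' [] = refl
  addHead-+ d d' (f ∷ g) = cong (_∷ g) (sym (+-assoc d d' f))

  module _ (k : ℕ) where

    private
      K : ℕ
      K = suc k

    -- Out x l g Q: scanning l after an entry x, the adjacent pairs with sum K
    -- are deleted, leaving Q. The gaps g count the positions at which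
    -- a pair could be inserted, there being K - r - s between adjacent entries r, s.
    data Out : ℕ → List ℕ → List ℕ → List ℕ → Set where
      []   : Out x [] [] []
      zero : Out x (0 ∷ []) [] []
      pair : m + n ≡ K → x ≤ n → Out n c g Q → Out x (m ∷ n ∷ c) (n ∸ x ∷ g) Q
      skip : m + n < K → x + m ≤ K → Out m (n ∷ c) g Q → Out x (m ∷ n ∷ c) (addHead (K ∸ (x + m)) g) (m ∷' Q)

    out-total : Bounded K x l → Normal p l → ∃ λ g → ∃ λ Q → Out x l g Q
    out-total [] [] = _ , _ , []
    out-total (le ∷ []) zero = _ , _ , zero
    out-total {x = x} (_∷_ {r = m} le (_∷_ {r = n} le' b)) (cons nm) with m + n ≟ K
    ... | no ne = let g , Q , o = out-total (le' ∷ b) nm in _ , _ , skip (≤∧≢⇒< le' ne) le o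
    out-total {x = x} (_∷_ {r = m} le (_∷_ {r = n} le' [])) (cons zero) | yes e =
      _ , _ , pair e (+-cancelˡ-≤ m x n (subst (m + x ≤_) (sym e) (subst (_≤ K) (+-comm x m) le))) []
    out-total {x = x} (_∷_ {r = m} le (_∷_ {r = n} le' b@(_ ∷ _))) (cons (cons nm)) | yes e = let g , Q , o = out-total b nm in
      _ , _ , pair e (+-cancelˡ-≤ m x n (subst (m + x ≤_) (sym e) (subst (_≤ K) (+-comm x m) le))) o

    out-functional : ∀ {g' Q'} → Out x l g Q → Out x l g' Q' → g ≡ g' × Q ≡ Q'
    out-functional [] [] = refl , refl
    out-functional zero zero = refl , refl
    out-functional (pair e le o) (pair e' le' o') with out-functional o o'
    ... | refl , refl = refl , refl
    out-functional (pair e le o) (skip lt _ _) = ⊥-elim (<⇒≢ lt e)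
    out-functional (skip lt _ _) (pair e le o) = ⊥-elim (<⇒≢ lt e)
    out-functional (skip lt le o) (skip lt' le' o') with out-functional o o'
    ... | refl , refl = refl , refl

    -- When a pair (m, n) is deleted, the entry r behind it takes the place of m, and n + r ≤ K = m
    -- + n gives r ≤ m. So deletions only lower the next entry, from which `out-bounded` follows.
    out-head : Out x (n ∷ c) g Q → Bounded K x (n ∷ c) → headOr0 Q ≤ n
    out-head zero b = z≤n
    out-head (pair e le []) b = z≤n
    out-head (pair e le zero) b = z≤n
    out-head (pair {m = m} {n} e le o@(pair _ _ _)) (_ ∷ _ ∷ b@(le' ∷ _)) =
      ≤-trans (out-head o b) (+-cancelˡ-≤ n _ m (≤-trans le' (≤-reflexive (trans (sym e) (+-comm m n)))))
    out-head (pair {m = m} {n} e le o@(skip _ _ _)) (_ ∷ _ ∷ b@(le' ∷ _)) =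
      ≤-trans (out-head o b) (+-cancelˡ-≤ n _ m (≤-trans le' (≤-reflexive (trans (sym e) (+-comm m n)))))
    out-head (skip {m = m} {Q = Q} _ _ o) b = ≤-reflexive (head-∷' m Q)

    out-head-k : Out x l g Q → headOr0 Q ≤ k
    out-head-k [] = z≤n
    out-head-k zero = z≤n
    out-head-k (pair _ _ o) = out-head-k o
    out-head-k (skip {m = m} {n} {Q = Q} lt _ _) = subst (_≤ k) (sym (head-∷' m Q)) (≤-trans (m≤m+n m n) (≤-pred lt))

    out-bounded : Out x l g Q → Bounded K x l → ∀ y → y + headOr0 Q ≤ k → Bounded k y (Q ++ [ 0 ])
    out-bounded [] b y le = le ∷ []
    out-bounded zero b y le = le ∷ []
    out-bounded (pair _ _ o) (_ ∷ _ ∷ b) y le = out-bounded o b y le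
    out-bounded (skip {m = m} {n} {Q = Q} lt _ o) (_ ∷ b) y le rewrite head-∷' m Q = lem m Q le
      (out-bounded o b m (≤-trans (+-monoʳ-≤ m (out-head o b)) (≤-pred lt)))
      where
      lem : ∀ m Q → y + m ≤ k → Bounded k m (Q ++ [ 0 ]) → Bounded k y ((m ∷' Q) ++ [ 0 ])
      lem zero [] le b = le ∷ []
      lem zero (_ ∷ _) le b = le ∷ b
      lem (suc m) Q le b = le ∷ b

    out-normal : Out x l g Q → Normal (suc y) (Q ++ [ 0 ])
    out-normal [] = zero
    out-normal zero = zero
    out-normal (pair _ _ o) = out-normal o
    out-normal {y = y} (skip {m = m} {Q = Q} _ _ o) = lem m Q (λ y → out-normal {y = y} o)
      where
      lem : ∀ m Q → (∀ y → Normal (suc y) (Q ++ [ 0 ])) → Normal (suc y) ((m ∷' Q) ++ [ 0 ])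
      lem zero [] h = zero
      lem zero (_ ∷ []) h = cons (normal-any (h 0))
      lem zero (_ ∷ _ ∷ _) h = cons (normal-any (h 0))
      lem (suc m) [] h = cons zero
      lem (suc m) (_ ∷ Q) h = cons (h m)

    private
      blank-normal : Normal 0 l → Out x l g Q → g ≡ [] → Q ≡ [] → l ≡ []
      blank-normal [] o eg eQ = refl
      blank-normal (cons nm) (skip {m = m} {g = []} {Q = Q} _ _ o) eg eQ with ∷'-injective m Q 0 [] eQ
      ... | refl , refl with () ← blank-normal nm o refl refl

      -- A first gap 0 leaves no place between `x` and the pair; it decides between `pair` and
      -- `skip` when a scan is inverted.
      late : Out x (m ∷ c) (0 ∷ g) Q → x + m ≡ K
      late = go refl
        where
        go : ∀ {g'} → g' ≡ 0 ∷ g → Out x (m ∷ c) g' Q → x + m ≡ K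
        go e' (pair {m = m} {n} e le o) = trans (cong (_+ m) (≤-antisym le (m∸n≡0⇒m≤n (proj₁ (∷-injective e'))))) (trans (+-comm n m) e)
        go {x = x} e' (skip {m = m} {g = f ∷ g} lt le o) = ≤-antisym le (m∸n≡0⇒m≤n (m+n≡0⇒m≡0 (K ∸ (x + m)) (proj₁ (∷-injective e'))))

      -- A greedy scan never skips an entry that starts a pair.
      pair-skip : ∀ {n' g₀ g₁ Q₁ c'} → m + n ≡ K → x ≤ n → x + m ≤ K → Out n c g₀ Q → Bounded K n c →
        ∀ m' → m' + n' < K → x + m' ≤ K → Out m' (n' ∷ c') g₁ Q₁ → n ∸ x ∷ g₀ ≡ addHead (K ∸ (x + m')) g₁ → Q ≡ m' ∷' Q₁ → ⊥
      pair-skip {m = m} {n} {x = x} {Q = Q} {g₁ = f ∷ g₁} {Q₁} e x≤ le o b m' lt le' o' eg refl =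
        <⇒≢ lt (late (subst (λ f → Out m' _ (f ∷ g₁) Q₁) f≡0 o'))
        where
        m'≤m : m' ≤ m
        m'≤m = +-cancelʳ-≤ n m' m (subst (m' + n ≤_) (sym e) (subst (_≤ K) (+-comm n m') (lem o b)))
          where
          lem : ∀ {c} → Out n c _ (m' ∷' Q₁) → Bounded K n c → n + m' ≤ K
          lem {[]} o b with subst (_≤ 0) (head-∷' m' Q₁) (out-head-[] o)
            where
            out-head-[] : ∀ {g Q} → Out n [] g Q → headOr0 Q ≤ 0
            out-head-[] [] = z≤n
          ... | z≤n = subst (_≤ K) (sym (+-identityʳ n)) (≤-trans (m≤n+m n m) (≤-reflexive e))
          lem {r ∷ c} o b@(le ∷ _) = ≤-trans (+-monoʳ-≤ n (subst (_≤ r) (head-∷' m' Q₁) (out-head o b))) le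
        d : ℕ
        d = K ∸ (x + m')
        f≡0 : f ≡ 0
        f≡0 = n≤0⇒n≡0 (+-cancelˡ-≤ d f 0 (≤-trans (≤-reflexive (sym (proj₁ (∷-injective eg))))
          (subst (n ∸ x ≤_) (sym (+-identityʳ d)) (≤-trans (≤-reflexive n∸x) (∸-monoʳ-≤ K (+-monoʳ-≤ x m'≤m))))))
          where
          n∸x : n ∸ x ≡ K ∸ (x + m)
          n∸x = sym (trans (cong (_∸ (x + m)) (sym e)) (trans (cong (m + n ∸_) (+-comm x m)) ([m+n]∸[m+o]≡n∸o m n x)))

    -- Gaps and remainder determine at each entry whether a pair begins (`pair-skip`), and a pair is
    -- recovered from its gap as n = x + gap and m = K - n. `Normal` fixes the zeros at the end.
    out-injective : Out x l g Q → Out x l' g Q → Bounded K x l → Bounded K x l' → Normal p l → Normal p l' → l ≡ l'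
    out-injective o o' b b' nm nm' = go o o' refl refl b b' nm nm'
      where
      go : ∀ {x p l l' g g' Q Q'} → Out x l g Q → Out x l' g' Q' → g ≡ g' → Q ≡ Q' →
        Bounded K x l → Bounded K x l' → Normal p l → Normal p l' → l ≡ l'
      go [] [] eg eQ b b' nm nm' = refl
      go [] zero eg eQ b b' [] ()
      go zero [] eg eQ b b' () []
      go zero zero eg eQ b b' nm nm' = refl
      go [] o@(skip {m = m} {g = []} {Q = Q} _ _ _) eg eQ b b' [] nm' = sym (blank-normal (normal-any nm') o refl (sym eQ))
      go zero o@(skip {g = []} _ _ _) eg eQ b b' nm nm' with () ← blank-normal (normal-any nm') o refl (sym eQ)
      go o@(skip {g = []} _ _ _) [] eg eQ b b' nm nm' = blank-normal (normal-any nm) o refl eQ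
      go o@(skip {g = []} _ _ _) zero eg eQ b b' nm nm' with () ← blank-normal (normal-any nm) o refl eQ
      go (pair {m = m} {n} e le o) (pair {m = m'} {n = n'} e' le' o') eg refl (_ ∷ _ ∷ b) (_ ∷ _ ∷ b') nm nm'
        with ∷-injective eg
      ... | eh , refl with ∸-cancelʳ-≡ le le' eh
      ... | refl with +-cancelʳ-≡ n m m' (trans e (sym e'))
      ... | refl = cong (λ c → m ∷ n ∷ c) (go o o' refl refl b b' (after nm) (after nm'))
        where
        after : ∀ {p m n c} → Normal p (m ∷ n ∷ c) → Normal n c
        after (cons zero) = []
        after (cons (cons nm)) = nm
      go (pair e le o) (skip {m = m'} lt le' o') eg eQ (b₁ ∷ _ ∷ b) (_ ∷ b') nm nm' = ⊥-elim (pair-skip e le b₁ o b m' lt le' o' eg eQ)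
      go (skip {m = m'} lt le' o') (pair e le o) eg eQ (_ ∷ b') (b₁ ∷ _ ∷ b) nm nm' = ⊥-elim (pair-skip e le b₁ o b m' lt le' o' (sym eg) (sym eQ))
      go {x = x} (skip {m = m} {g = g} {Q = Q} lt le o) (skip {m = m'} {g = g'} {Q = Q'} lt' le' o') eg eQ (_ ∷ b) (_ ∷ b') (cons nm) (cons nm')
        with ∷'-injective m Q m' Q' eQ
      ... | refl , refl = cong (m ∷_) (go o o' (addHead-injective (K ∸ (x + m)) g g' eg) refl b b' nm nm')

    Late : List ℕ → Set
    Late (zero ∷ g) = ⊥
    Late _ = ⊤

    -- Q, whose neighbours have sums less than K, ends with a nonzero entry.
    Inner : List ℕ → Set
    Inner [] = ⊤
    Inner (z ∷ Q) = Bounded k z (Q ++ [ 0 ]) × Normal z (Q ++ [ 0 ])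

    -- The last component is what a preceding `skip` needs: if the first gap is not 0, the new
    -- sequence does not make a pair of sum K with the entry `x`.
    Built : List ℕ → List ℕ → ℕ → ℕ → Set
    Built g Q x p = ∃ λ l → Bounded K x l × Normal p l × Out x l g Q × (Late g → x + headOr0 Q < K → x + headOr0 l < K)

    private
      bounded-suc : Bounded k x l → Bounded K x l
      bounded-suc [] = []
      bounded-suc (le ∷ b) = m≤n⇒m≤1+n le ∷ bounded-suc b

      ∷'-normal : ∀ z Q → Normal z (Q ++ [ 0 ]) → z ∷' Q ≡ z ∷ Q
      ∷'-normal zero [] ()
      ∷'-normal zero (_ ∷ _) nm = refl
      ∷'-normal (suc z) Q nm = refl

      normal-cons : ∀ z Q → Normal z (Q ++ [ 0 ]) → Normal p (z ∷ Q ++ [ 0 ])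
      normal-cons z [] nm = cons nm
      normal-cons z (_ ∷ Q) nm = cons nm

      next≤ : ∀ z Q → Bounded k z (Q ++ [ 0 ]) → z + headOr0 Q ≤ k
      next≤ z [] (le ∷ _) = le
      next≤ z (_ ∷ Q) (le ∷ _) = le

      inner-tail : ∀ z Q → Bounded k z (Q ++ [ 0 ]) → Normal z (Q ++ [ 0 ]) → Inner Q
      inner-tail z [] b nm = tt
      inner-tail z (y ∷ []) (_ ∷ b) (cons nm) = b , nm
      inner-tail z (y ∷ _ ∷ Q) (_ ∷ b) (cons nm) = b , nm

      out-plain : ∀ z Q → x + z ≤ K → Bounded k z (Q ++ [ 0 ]) → Normal z (Q ++ [ 0 ]) → Out x (z ∷ Q ++ [ 0 ]) [] (z ∷ Q)
      out-plain {x = x} z [] le (le' ∷ _) nm = subst (Out x (z ∷ 0 ∷ []) []) (∷'-normal z [] nm) (skip (s≤s le') le zero)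
      out-plain {x = x} z (y ∷ Q) le (le' ∷ b) nm = subst (Out x (z ∷ y ∷ Q ++ [ 0 ]) []) (∷'-normal z (y ∷ Q) nm)
        (skip (s≤s le') le (out-plain y Q (m≤n⇒m≤1+n le') b (tail Q nm)))
        where
        tail : ∀ {z y} Q → Normal z (y ∷ Q ++ [ 0 ]) → Normal y (Q ++ [ 0 ])
        tail [] (cons nm) = nm
        tail (_ ∷ Q) (cons nm) = nm

      out-nonempty : ∀ {f g'} → Out x l g Q → g ≡ f ∷ g' → ∃ λ n → ∃ λ c → l ≡ n ∷ c
      out-nonempty (pair _ _ _) _ = _ , _ , refl
      out-nonempty (skip _ _ _) _ = _ , _ , refl

      -- The gap fits into the room K - x - r before the next entry r, so the pair is (K - q, q)
      -- with q = x + f: its gap is q - x = f, and q + r ≤ K.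
      build-pair : ∀ {f} → (∀ Q x p → x + headOr0 Q ≤ K → Inner Q → Built g Q x p) →
        ∀ Q x p → x + headOr0 Q ≤ K → Inner Q → f ≤ K ∸ (x + headOr0 Q) → Built (f ∷ g) Q x p
      build-pair {g = g} {f} rec Q x p le inn f≤ with rec Q (x + f) (x + f) n+z inn
        where
        n+z : x + f + headOr0 Q ≤ K
        n+z = subst (_≤ K) (trans (+-assoc x (headOr0 Q) f) (trans (cong (x +_) (+-comm (headOr0 Q) f)) (sym (+-assoc x f (headOr0 Q)))))
          (subst (x + headOr0 Q + f ≤_) (m+[n∸m]≡n le) (+-monoʳ-≤ (x + headOr0 Q) f≤))
      ... | l , b , nm , o , _ = K ∸ q ∷ q ∷ l
        , subst (_≤ K) (+-comm (K ∸ q) x) (≤-trans (+-monoʳ-≤ (K ∸ q) (m≤m+n x f)) (≤-reflexive m+n)) ∷ ≤-reflexive m+n ∷ b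
        , normal l (K ∸ q) m+n nm
        , subst (λ f → Out x (K ∸ q ∷ q ∷ l) (f ∷ g) Q) (m+n∸m≡n x f) (pair m+n (m≤m+n x f) o)
        , strict
        where
        q : ℕ
        q = x + f
        m+n : K ∸ q + q ≡ K
        m+n = m∸n+n≡m (≤-trans (+-monoʳ-≤ x f≤) (≤-trans (+-monoʳ-≤ x (∸-monoʳ-≤ K (m≤m+n x (headOr0 Q)))) (≤-reflexive (m+[n∸m]≡n (≤-trans (m≤m+n x _) le)))))
        normal : ∀ {n} l m → m + n ≡ K → Normal n l → Normal p (m ∷ n ∷ l)
        normal [] (suc m) e [] = cons zero
        normal (_ ∷ l) m e nm = cons (cons nm)
        strict : Late (f ∷ g) → x + headOr0 Q < K → x + (K ∸ q) < K
        strict lt _ = positive f refl lt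
          where
          positive : ∀ f' → f ≡ f' → Late (f' ∷ g) → x + (K ∸ q) < K
          positive (suc f') e lt = ≤-trans (+-monoˡ-≤ (K ∸ q) (subst (λ f → suc x ≤ x + f) (sym e) (subst (suc x ≤_) (sym (+-suc x f')) (s≤s (m≤m+n x f')))))
            (≤-reflexive (trans (+-comm q (K ∸ q)) m+n))

      build-skip : ∀ {f} z Q x p → x + z ≤ K → z + headOr0 Q < K → K ∸ (x + z) < f → Built (f ∸ (K ∸ (x + z)) ∷ g) Q z z →
        Built (f ∷ g) (z ∷' Q) x p
      build-skip {g = g} {f} z Q x p le lt d<f (l , b , nm , o , st) with out-nonempty o refl
      ... | n , c , refl = z ∷ n ∷ c , le ∷ b , cons nm
        , subst (λ f → Out x (z ∷ n ∷ c) (f ∷ g) (z ∷' Q)) (m+[n∸m]≡n (<⇒≤ d<f)) (skip (st (late-suc (m<n⇒0<n∸m d<f)) lt) le o)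
        , λ _ → subst (λ h → x + h < K) (head-∷' z Q)
        where
        late-suc : ∀ {f} → 0 < f → Late (f ∷ g)
        late-suc {suc f} _ = tt

      -- While the gap exceeds the room, an entry of `Q` is kept and the room subtracted. Behind the
      -- end of `Q` zeros are kept instead; there f + x, which `n` bounds, falls by K each time.
      build-head : ∀ g f → (∀ Q x p → x + headOr0 Q ≤ K → Inner Q → Built g Q x p) →
        ∀ Q n x p → f + x ≤ n → x + headOr0 Q ≤ K → Inner Q → Built (f ∷ g) Q x p
      build-head g f rec Q n x p fuel le inn with f ≤? K ∸ (x + headOr0 Q)
      build-head g f rec Q n x p fuel le inn | yes f≤ = build-pair rec Q x p le inn f≤
      build-head g f rec (z ∷ Q) n x p fuel le (b , nm) | no f≰ = subst (λ Q → Built (f ∷ g) Q x p) (∷'-normal z Q nm)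
        (build-skip z Q x p le (s≤s (next≤ z Q b)) (≰⇒> f≰)
          (build-head g _ rec Q (f ∸ (K ∸ (x + z)) + z) z z ≤-refl (m≤n⇒m≤1+n (next≤ z Q b)) (inner-tail z Q b nm)))
      build-head g f rec [] zero x p fuel le inn | no f≰ = ⊥-elim (f≰ (≤-trans (≤-trans (m≤m+n f x) fuel) z≤n))
      build-head g f rec [] (suc n) x p fuel le inn | no f≰ = build-skip 0 [] x p le (s≤s z≤n) (≰⇒> f≰)
        (build-head g _ rec [] n 0 0 smaller z≤n tt)
        where
        d : ℕ
        d = K ∸ (x + 0)
        eq : f ∸ d + K ≡ f + x
        eq = trans (cong (f ∸ d +_) (sym (trans (cong (d +_) (sym (+-identityʳ x))) (m∸n+n≡m le)))) (trans (sym (+-assoc (f ∸ d) d x)) (cong (_+ x) (m∸n+n≡m (<⇒≤ (≰⇒> f≰)))))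
        smaller : f ∸ d + 0 ≤ n
        smaller = subst (_≤ n) (sym (+-identityʳ (f ∸ d))) (≤-pred (≤-trans (subst (suc (f ∸ d) ≤_) (trans (sym (+-suc (f ∸ d) k)) eq) (s≤s (m≤m+n (f ∸ d) k))) fuel))

    build : ∀ g Q x p → x + headOr0 Q ≤ K → Inner Q → Built g Q x p
    build [] [] x zero le inn = [] , [] , [] , [] , λ _ lt → lt
    build [] [] x (suc p) le inn = 0 ∷ [] , le ∷ [] , zero , zero , λ _ lt → lt
    build [] (z ∷ Q) x p le (b , nm) = z ∷ Q ++ [ 0 ] , le ∷ bounded-suc b , normal-cons z Q nm , out-plain z Q le b nm , λ _ lt → lt
    build (f ∷ g) Q x p le inn = build-head g f (build g) Q (f + x) x p ≤-refl le inn

    private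
      -- Without the pair the scan resumes from x instead of n, and the n - x places between them
      -- are added to the first gap.
      out-shift : Out n c g Q → x ≤ n → Bounded K n c → Out x c (addHead (n ∸ x) g) Q
      out-shift [] le b = []
      out-shift zero le b = zero
      out-shift {n = n} {x = x} (pair {m = m} {n = n'} {c = c} {g = g} {Q = Q} e le' o) le b =
        subst (λ f → Out x (m ∷ n' ∷ c) (f ∷ g) Q) (sym (+-∸-comm' le le')) (pair e (≤-trans le le') o)
        where
        +-∸-comm' : x ≤ n → n ≤ n' → n ∸ x + (n' ∸ n) ≡ n' ∸ x
        +-∸-comm' x≤n n≤n' = trans (+-comm (n ∸ x) (n' ∸ n)) (trans (sym (+-∸-assoc (n' ∸ n) x≤n)) (cong (_∸ x) (m∸n+n≡m n≤n')))
      out-shift {n = n} {x = x} (skip {m = m} {n = n'} {c = c} {g = g} {Q = Q} lt le' o) le b =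
        subst (λ g → Out x (m ∷ n' ∷ c) g (m ∷' Q)) (trans (cong (λ d → addHead d g) eq) (sym (addHead-+ (n ∸ x) (K ∸ (n + m)) g)))
          (skip lt (≤-trans (+-monoˡ-≤ m le) le') o)
        where
        eq : K ∸ (x + m) ≡ n ∸ x + (K ∸ (n + m))
        eq = sym (trans (+-comm (n ∸ x) _) (trans (sym (+-∸-assoc (K ∸ (n + m)) le)) (trans (cong (_∸ x) (trans (cong (λ z → K ∸ z + n) (+-comm n m)) (trans (cong (_+ n) (sym (∸-+-assoc K m n))) (m∸n+n≡m (m+n≤o⇒m≤o∸n n le')))))
          (trans (∸-+-assoc K m x) (cong (K ∸_) (+-comm m x))))))

    data Padded : List ℕ → Set where
      []   : Padded []
      zero : Padded (0 ∷ [])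
      cons : Padded (n ∷ c) → Padded (m ∷ n ∷ c)

    private
      times-odd : ∀ m u → times m (odd u) ≡ odd (m * u)
      times-odd zero u = refl
      times-odd (suc m) u = trans (cong (odd u xor_) (times-odd m u)) (sym (odd-+ u (m * u)))

      odd-double : ∀ m → odd (m + m) ≡ false
      odd-double m = trans (odd-+ m m) (xor-same (odd m))

      -- Site u + 1 is even exactly if u is odd, so modulo 2 the number of even parts in the pair is
      -- m u + n (u + 1) = K u + n. Here K u + x is the place of the scan before the gap n - x; by
      -- `skip-parity`, skipping an entry preserves this reading modulo 2.
      pair-parity : ∀ m n x u → m + n ≡ K → x ≤ n →
        times m (odd u) xor times n (not (odd u)) ≡ odd (K * u + x) xor odd (n ∸ x)
      pair-parity m n x u e le = trans (cong₂ _xor_ (times-odd m u) (times-odd n (suc u))) (trans (sym (odd-+ (m * u) (n * suc u)))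
        (trans (cong odd (trans (solve 3 (λ m n u → m :* u :+ n :* (con 1 :+ u) := (m :+ n) :* u :+ n) refl m n u)
          (trans (cong₂ (λ K n → K * u + n) e (sym (m+[n∸m]≡n le))) (sym (+-assoc (K * u) x (n ∸ x))))))
          (odd-+ (K * u + x) (n ∸ x))))
        where open +-*-Solver

      skip-parity : ∀ u x m f → x + m ≤ K → odd (K * suc u + m) xor odd f ≡ odd (K * u + x) xor odd (K ∸ (x + m) + f)
      skip-parity u x m f le = trans (cong (_xor odd f) (trans (cong odd eq)
          (trans (odd-+ (K * u + x + d) (m + m)) (trans (cong (odd (K * u + x + d) xor_) (odd-double m)) (trans (xor-comm _ false) (odd-+ (K * u + x) d))))))
        (trans (xor-assoc (odd (K * u + x)) (odd d) (odd f)) (cong (odd (K * u + x) xor_) (sym (odd-+ d f))))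
        where
        open +-*-Solver
        d : ℕ
        d = K ∸ (x + m)
        eq : K * suc u + m ≡ K * u + x + d + (m + m)
        eq = trans (cong (_+ m) (trans (*-suc K u) (cong (_+ K * u) (sym (m+[n∸m]≡n le)))))
          (solve 4 (λ v x d m → x :+ m :+ d :+ v :+ m := v :+ x :+ d :+ (m :+ m)) refl (K * u) x d m)

      head-fits : ∀ {m n} → m + n ≡ K → Bounded K n c → HeadF m c
      head-fits e [] = []
      head-fits {m = m} {n} e (_∷_ {c = c} le b) = +-cancelˡ-≤ n _ m (≤-trans le (≤-reflexive (trans (sym e) (+-comm m n)))) ∷ c

      bounded-weaken : x ≤ n → Bounded K n c → Bounded K x c
      bounded-weaken le [] = []
      bounded-weaken le (le' ∷ b) = ≤-trans (+-monoˡ-≤ _ le) le' ∷ b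

      padded-rest : Padded (m ∷ n ∷ c) → Padded c × (c ≡ [] → n ≡ 0)
      padded-rest (cons zero) = [] , λ _ → refl
      padded-rest (cons (cons p)) = p , λ ()

      strict : x + m ≤ k ⊎ x ≡ 0 → m + n < K → x + m ≤ k
      strict (inj₁ le) lt = le
      strict {m = m} {n = n} (inj₂ refl) lt = ≤-trans (m≤m+n m n) (≤-pred lt)

      out-zero : ∀ {d} → m ≡ 0 → Out m [] g Q → Out x (m ∷ []) (addHead d g) (m ∷' Q)
      out-zero refl [] = zero

    -- Only the first pair is deleted, since parities are compared one pair at a time; its gap is
    -- merged into the next one, which keeps the later partial sums. If nothing is left, the pair
    -- began with K, and this forces a skipped entry before it to be 0.
    out-first : ∀ u {g₀ h} → Out x l g₀ Q → g₀ ≡ h ∷ g → Bounded K x l → Padded l → x + headOr0 l ≤ k ⊎ x ≡ 0 →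
      ∃ λ l₁ → ∃ λ t → DeleteF k t (odd u) x l l₁ × Out x l₁ (addHead h g) Q × Bounded K x l₁ × Padded l₁
        × (l₁ ≡ [] → headOr0 l ≡ K) × t ≡ odd (K * u + x) xor odd h
    out-first {x = x} u (pair {m = m} {n} {c = c} e le o) refl (_ ∷ _ ∷ b) pd hx = c , _
      , pair e refl (inj₂ le) (head-fits e b) , out-shift o le b , bounded-weaken le b , proj₁ (padded-rest pd)
      , (λ c≡[] → trans (sym (trans (cong (m +_) (proj₂ (padded-rest pd) c≡[])) (+-identityʳ m))) e)
      , pair-parity m n x u e le
    out-first {x = x} {g = g} u (skip {m = m} {n = n} {c = c} {g = f ∷ _} {Q = Q} lt le o) refl (le₀ ∷ b) (cons pd) hx
      with out-first (suc u) o refl b pd (inj₁ (≤-pred lt))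
    ... | [] , t , d , o₁ , b₁ , pd₁ , nil , et = m ∷ [] , t , same m≤k d , last (nil refl) o₁ , le₀ ∷ [] , padded (nil refl) , (λ ())
        , trans et (skip-parity u x m f le)
      where
      m≤k : x + m ≤ k
      m≤k = strict hx lt
      m≡0 : n ≡ K → m ≡ 0
      m≡0 e = n≤0⇒n≡0 (+-cancelʳ-≤ K m 0 (subst (λ n → m + n ≤ K) e (<⇒≤ lt)))
      padded : n ≡ K → Padded (m ∷ [])
      padded e = subst (λ m → Padded (m ∷ [])) (sym (m≡0 e)) zero
      last : n ≡ K → Out m [] (addHead f g) Q → Out x (m ∷ []) (addHead (K ∸ (x + m) + f) g) (m ∷' Q)
      last e o = subst (λ g → Out x (m ∷ []) g (m ∷' Q)) (addHead-+ (K ∸ (x + m)) f g) (out-zero (m≡0 e) o)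
    ... | r ∷ l₁ , t , d , o₁ , b₁@(le₁ ∷ _) , pd₁ , nil , et = m ∷ r ∷ l₁ , t , same m≤k d
        , subst (λ g → Out x (m ∷ r ∷ l₁) g (m ∷' Q)) (addHead-+ (K ∸ (x + m)) f g) (skip (s≤s (next d)) le o₁)
        , le₀ ∷ b₁ , cons pd₁ , (λ ()) , trans et (skip-parity u x m f le)
      where
      m≤k : x + m ≤ k
      m≤k = strict hx lt
      next : DeleteF k t (odd (suc u)) m (n ∷ c) (r ∷ l₁) → m + r ≤ k
      next (same le d) = le
      next (pair {n = n₂} e _ _ (le₂ ∷ _)) = ≤-trans (+-monoʳ-≤ m le₂) (≤-pred lt)

    private
      out-strip : Out x l g Q → g ≡ [] → ∃ λ j → l ≡ Q ++ replicate j 0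
      out-strip [] _ = 0 , refl
      out-strip zero _ = 1 , refl
      out-strip (skip {m = m} {g = []} {Q = Q} _ _ o) e with out-strip o refl
      ... | j , eq = lem m Q eq
        where
        lem : ∀ {l} m Q → l ≡ Q ++ replicate j 0 → ∃ λ j → m ∷ l ≡ (m ∷' Q) ++ replicate j 0
        lem zero [] eq = suc j , cong (0 ∷_) eq
        lem zero (_ ∷ _) eq = j , cong (0 ∷_) eq
        lem (suc m) Q eq = j , cong (suc m ∷_) eq

      parities-zeros : ∀ i Q j → parities i (plain (Q ++ replicate j 0)) ≡ parities i (plain Q)
      parities-zeros i Q zero = cong (λ l → parities i (plain l)) (++-identityʳ Q)
      parities-zeros i Q (suc j) = trans (cong (λ l → parities i (plain l)) (sym (++-assoc Q [ 0 ] (replicate j 0))))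
        (trans (parities-zeros i (Q ++ [ 0 ]) j) (trans (cong (parities i) (map-++ (false ,_) Q [ 0 ])) (parities-snoc i (plain Q))))

      bounded-prefix : ∀ Q → Bounded k x (Q ++ [ 0 ]) → Bounded k x Q
      bounded-prefix [] _ = []
      bounded-prefix (_ ∷ Q) (le ∷ b) = le ∷ bounded-prefix Q b

      split-head : ∀ {h t g ts} → t ≡ odd h → Parities false (addHead h g) ts → Parities false (h ∷ g) (t ∷ ts)
      split-head {g = []} e [] = e ∷ []
      split-head {h} {g = f ∷ g} refl (e ∷ p) = refl ∷ (trans e (odd-+ h f) ∷ p)

    -- Induction on the number of pairs: each deletion splits the first parity off the last list.
    -- Once there are no pairs, that list is empty by `parities-bounded`.
    parities-out : Out 0 l g Q → Bounded K 0 l → Padded l →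
      ∃ λ ts → Parities false g ts × parities K (plain l) ≡ parities k (plain Q) ++ [ ts ]
    parities-out {g = g} o b pd = go (length g) refl o b pd
      where
      go : ∀ {g l Q} i → length g ≡ i → Out 0 l g Q → Bounded K 0 l → Padded l →
        ∃ λ ts → Parities false g ts × parities K (plain l) ≡ parities k (plain Q) ++ [ ts ]
      go {[]} {Q = Q} i e o b pd with out-strip o refl
      ... | j , refl = [] , [] , trans (parities-zeros K Q j) (parities-bounded (bounded-prefix Q (out-bounded o b 0 (out-head-k o))))
      go {h ∷ g} (suc i) e o b pd with out-first 0 o refl b pd (inj₂ refl)
      ... | l₁ , t , d , o₁ , b₁ , pd₁ , _ , et with go i (trans (length-addHead h g) (suc-injective e)) o₁ b₁ pd₁ | parities-delete d b b₁
      ... | ts , p , eq | L , E , eq₁ , eq₂ with ∷ʳ-injective L _ (trans (sym eq₂) eq)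
      ... | refl , refl = t ∷ ts , split-head (trans et (cong (λ z → odd z xor odd h) (trans (+-identityʳ (K * 0)) (*-zeroʳ K)))) p , eq₁

  moment : ℕ → List ℕ → ℕ
  moment v [] = 0
  moment v (m ∷ c) = v * m + moment (suc v) c

  moment-suc : ∀ v c → moment (suc v) c ≡ sum c + moment v c
  moment-suc v [] = refl
  moment-suc v (m ∷ c) rewrite moment-suc (suc v) c =
    solve 4 (λ m v s t → m :+ v :* m :+ (s :+ t) := m :+ s :+ (v :* m :+ t)) refl m v (sum c) (moment (suc v) c)
    where open +-*-Solver

  private
    moment-∷' : ∀ v m c → moment v (m ∷' c) ≡ v * m + moment (suc v) c
    moment-∷' v zero [] rewrite *-zeroʳ v = refl
    moment-∷' v zero (_ ∷ _) = refl
    moment-∷' v (suc m) c = refl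

    sum-∷' : ∀ m c → sum (m ∷' c) ≡ m + sum c
    sum-∷' zero [] = refl
    sum-∷' zero (_ ∷ _) = refl
    sum-∷' (suc m) c = refl

    weight-addHead : ∀ d g → weight (addHead d g) ≡ length g * d + weight g
    weight-addHead d [] = refl
    weight-addHead d (f ∷ g) = trans (cong (_+ weight g) (*-distribˡ-+ (suc (length g)) d f)) (+-assoc (suc (length g) * d) _ _)

  sum-out : ∀ k → Out k x l g Q → sum l ≡ sum Q + suc k * length g
  sum-out k [] = sym (*-zeroʳ k)
  sum-out k zero = sym (*-zeroʳ k)
  sum-out k (pair {m = m} {n = n} {g = g} {Q = Q} e _ o) rewrite sum-out k o | *-suc k (length g) =
    trans (sym (+-assoc m n _)) (trans (cong (_+ (sum Q + (length g + k * length g))) e)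
      (solve 4 (λ k s l t → con 1 :+ k :+ (s :+ (l :+ t)) := s :+ (con 1 :+ l :+ (k :+ t))) refl k (sum Q) (length g) (k * length g)))
    where open +-*-Solver
  sum-out k (skip {m = m} {x = x} {g = g} {Q = Q} _ _ o) rewrite sum-out k o | sum-∷' m Q | length-addHead (suc k ∸ (x + m)) g =
    sym (+-assoc m (sum Q) _)

  -- For x = 0 and all gaps 0 the j pairs are (K, 0), two sites apart, which gives K j^2 + j K u,
  -- and the remainder moves by 2j sites. A unit of a gap moves one part of its pair to the next
  -- site, and likewise in each later pair.
  moment-out : ∀ k u → Out k x l g Q → moment (suc u) l
    ≡ moment (suc u) Q + 2 * (length g * sum Q) + suc k * (length g * length g) + weight g + length g * (suc k * u + x)
  moment-out k u [] = sym (trans (+-identityʳ _) (trans (+-identityʳ _) (*-zeroʳ k)))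
  moment-out k u zero rewrite *-zeroʳ u | *-zeroʳ k = refl
  moment-out {x = x} k u (pair {m = m} {n = n} {g = g} {Q = Q} e le o)
    rewrite moment-out k (suc (suc u)) o | moment-suc (suc (suc u)) Q | moment-suc (suc u) Q =
    lem (suc k) (n ∸ x) n e (m+[n∸m]≡n le)
    where
    open +-*-Solver
    lem : ∀ κ h n → m + n ≡ κ → x + h ≡ n →
      suc u * m + (suc (suc u) * n + (sum Q + (sum Q + moment (suc u) Q) + 2 * (length g * sum Q) + κ * (length g * length g) + weight g + length g * (κ * suc (suc u) + n)))
      ≡ moment (suc u) Q + 2 * (suc (length g) * sum Q) + κ * (suc (length g) * suc (length g)) + (suc (length g) * h + weight g) + suc (length g) * (κ * u + x)
    lem _ h _ refl refl = solve 8 (λ u m x h s w j M →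
      (con 1 :+ u) :* m :+ ((con 2 :+ u) :* (x :+ h) :+ (s :+ (s :+ M) :+ con 2 :* (j :* s) :+ (m :+ (x :+ h)) :* (j :* j) :+ w :+ j :* ((m :+ (x :+ h)) :* (con 2 :+ u) :+ (x :+ h))))
      := M :+ con 2 :* ((con 1 :+ j) :* s) :+ (m :+ (x :+ h)) :* ((con 1 :+ j) :* (con 1 :+ j)) :+ ((con 1 :+ j) :* h :+ w) :+ (con 1 :+ j) :* ((m :+ (x :+ h)) :* u :+ x))
      refl u m x h (sum Q) (weight g) (length g) (moment (suc u) Q)
  moment-out {x = x} k u (skip {m = m} {g = g} {Q = Q} lt le o)
    rewrite moment-out k (suc u) o | moment-∷' (suc u) m Q | sum-∷' m Q | length-addHead (suc k ∸ (x + m)) g | weight-addHead (suc k ∸ (x + m)) g =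
    lem (suc k) (suc k ∸ (x + m)) (m+[n∸m]≡n le)
    where
    open +-*-Solver
    lem : ∀ κ d → x + m + d ≡ κ →
      suc u * m + (moment (suc (suc u)) Q + 2 * (length g * sum Q) + κ * (length g * length g) + weight g + length g * (κ * suc u + m))
      ≡ suc u * m + moment (suc (suc u)) Q + 2 * (length g * (m + sum Q)) + κ * (length g * length g) + (length g * d + weight g) + length g * (κ * u + x)
    lem _ d refl = solve 8 (λ u m x d s w j M →
      (con 1 :+ u) :* m :+ (M :+ con 2 :* (j :* s) :+ (x :+ m :+ d) :* (j :* j) :+ w :+ j :* ((x :+ m :+ d) :* (con 1 :+ u) :+ m))
      := (con 1 :+ u) :* m :+ M :+ con 2 :* (j :* (m :+ s)) :+ (x :+ m :+ d) :* (j :* j) :+ (j :* d :+ w) :+ j :* ((x :+ m :+ d) :* u :+ x))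
      refl u m x d (sum Q) (weight g) (length g) (moment (suc (suc u)) Q)

-- Encoding a partition without overlines by gap lists

module Frequencies where
  open import Defs using (headOr0; changes)
  open Counting
  open Models
  open PathWords using (parities-changes)
  open Cells
  open PairDeletion
  open GreedyDeletion

  private
    variable
      k m n p x : ℕ
      c f f' g l Q : List ℕ
      gs gs' : List (List ℕ)

  -- The number of 1-marked parts when nothing is overlined, that is, of clusters; it will be N_1.
  ones : Bool → List ℕ → ℕ
  ones cov [] = 0
  ones cov (zero ∷ c) = ones false c
  ones false (suc a ∷ c) = suc (ones true c)
  ones true (suc a ∷ c) = ones false c

  private
    ones-∷' : ∀ cov m c → ones cov (m ∷' c) ≡ ones cov (m ∷ c)
    ones-∷' cov zero [] = refl
    ones-∷' cov zero (_ ∷ _) = refl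
    ones-∷' cov (suc m) c = refl

    ones-zero : HeadF 0 c → ones true c ≡ ones false c
    ones-zero [] = refl
    ones-zero (z≤n ∷ _) = refl

    head-fits : m + n ≡ k → Bounded k n c → HeadF m c
    head-fits e [] = []
    head-fits {m = m} {n} e (_∷_ {c = c} le b) = +-cancelˡ-≤ n _ m (≤-trans le (≤-reflexive (trans (sym e) (+-comm m n)))) ∷ c

  -- Exactly one site of a pair gets the mark 1, and the next entry finds the same coverage as
  -- without the pair or is 0. The hypothesis on `cov` holds along the scan because only nonempty
  -- sites cover.
  ones-out : ∀ cov → (cov ≡ true → 1 ≤ x) → Out k x l g Q → Bounded (suc k) x l → ones cov l ≡ length g + ones cov Q
  ones-out cov h [] b = refl
  ones-out cov h zero b = refl
  ones-out false h (pair {m = zero} {n = suc n} e le o) (_ ∷ _ ∷ b) =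
    trans (cong suc (ones-zero (head-fits e b))) (cong suc (ones-out false (λ ()) o b))
  ones-out false h (pair {m = suc m} {n = zero} e le o) (_ ∷ _ ∷ b) = cong suc (ones-out false (λ ()) o b)
  ones-out false h (pair {m = suc m} {n = suc n} e le o) (_ ∷ _ ∷ b) = cong suc (ones-out false (λ ()) o b)
  ones-out true h (pair {n = zero} e le o) b = ⊥-elim (<⇒≱ (h refl) le)
  ones-out true h (pair {m = zero} {n = suc n} e le o) (_ ∷ _ ∷ b) = cong suc (ones-out true (λ _ → s≤s z≤n) o b)
  ones-out true h (pair {m = suc m} {n = suc n} e le o) (_ ∷ _ ∷ b) = cong suc (ones-out true (λ _ → s≤s z≤n) o b)
  ones-out {x = x} {k = k} cov h (skip {m = m} {g = g} {Q = Q} _ _ o) (_ ∷ b) rewrite ones-∷' cov m Q | length-addHead (suc k ∸ (x + m)) g = lem cov m refl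
    where
    lem : ∀ cov m' → m' ≡ m → ones cov (m' ∷ _) ≡ length g + ones cov (m' ∷ Q)
    lem cov zero refl = ones-out false (λ ()) o b
    lem false (suc m') refl = trans (cong suc (ones-out true (λ _ → s≤s z≤n) o b)) (sym (+-suc (length g) _))
    lem true (suc m') refl = ones-out false (λ ()) o b

  Valid : ℕ → List ℕ → Set
  Valid k f = Bounded k 0 (f ++ [ 0 ]) × Normal 1 (f ++ [ 0 ])

  -- The pairs with the largest sum are deleted first but belong to the longest clusters, so their
  -- gaps form the last list.
  data Enc : ℕ → List ℕ → List (List ℕ) → Set where
    zero : Enc 0 [] []
    suc  : Out k 0 (f ++ [ 0 ]) g Q → Enc k Q gs → Enc (suc k) f (gs ∷ʳ g)

  private
    valid-padded : ∀ f → Normal p (f ++ [ 0 ]) → Padded k (f ++ [ 0 ])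
    valid-padded [] nm = zero
    valid-padded (_ ∷ []) (cons nm) = cons zero
    valid-padded (_ ∷ a ∷ f) (cons nm) = cons (valid-padded (a ∷ f) nm)

    valid-out : Out k 0 (f ++ [ 0 ]) g Q → Bounded (suc k) 0 (f ++ [ 0 ]) → Valid k Q
    valid-out o b = out-bounded _ o b 0 (out-head-k _ o) , out-normal _ o

    valid-zero : ∀ f → Valid 0 f → f ≡ []
    valid-zero f (b , nm) = go f b nm
      where
      go : ∀ f → Bounded 0 x (f ++ [ 0 ]) → Normal p (f ++ [ 0 ]) → f ≡ []
      go [] b nm = refl
      go {x = x} (a ∷ []) (le ∷ b) (cons nm) with n≤0⇒n≡0 (≤-trans (m≤n+m a x) le)
      go (.0 ∷ []) (le ∷ b) (cons ()) | refl
      go (a ∷ a' ∷ f) (le ∷ b) (cons nm) with () ← go (a' ∷ f) b nm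

  enc-total : ∀ k f → Valid k f → ∃ λ gs → Enc k f gs
  enc-total zero f v with refl ← valid-zero f v = [] , zero
  enc-total (suc k) f (b , nm) with out-total k b nm
  ... | g , Q , o with enc-total k Q (valid-out o b)
  ... | gs , e = gs ∷ʳ g , suc o e

  enc-functional : Enc k f gs → Enc k f gs' → gs ≡ gs'
  enc-functional zero zero = refl
  enc-functional (suc o e) (suc o' e') with out-functional _ o o'
  ... | refl , refl = cong (_∷ʳ _) (enc-functional e e')

  enc-injective : Enc k f gs → Enc k f' gs' → gs ≡ gs' → Valid k f → Valid k f' → f ≡ f'
  enc-injective zero zero _ _ _ = refl
  enc-injective {f = f} {f' = f'} (suc {gs = gs} o e) (suc {gs = gs'} o' e') eq (b , nm) (b' , nm') with ∷ʳ-injective gs gs' eq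
  ... | eq' , refl with enc-injective e e' eq' (valid-out o b) (valid-out o' b')
  ... | refl = ++-cancelʳ [ 0 ] f f' (out-injective _ o o' b b' nm nm')

  enc-surjective : ∀ gs → ∃ λ f → Valid (length gs) f × Enc (length gs) f gs
  enc-surjective gs = go (length gs) gs refl
    where
    unsnoc : ∀ {k} (gs : List (List ℕ)) → length gs ≡ suc k → ∃ λ gs' → ∃ λ g → gs ≡ gs' ∷ʳ g × length gs' ≡ k
    unsnoc (g ∷ []) refl = [] , g , refl , refl
    unsnoc (g ∷ g' ∷ gs) refl with unsnoc (g' ∷ gs) refl
    ... | gs' , h , e , l = g ∷ gs' , h , cong (g ∷_) e , cong suc l
    inner : ∀ Q → Valid k Q → headOr0 Q ≤ k × Inner k Q
    inner [] v = z≤n , tt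
    inner (z ∷ []) (le ∷ b , cons nm) = le , b , nm
    inner (z ∷ _ ∷ Q) (le ∷ b , cons nm) = le , b , nm
    unpad : ∀ l → Normal (suc p) l → ∃ λ f → l ≡ f ++ [ 0 ]
    unpad _ zero = [] , refl
    unpad (m ∷ .0 ∷ []) (cons zero) = m ∷ [] , refl
    unpad (m ∷ n ∷ c ∷ l) (cons nm) with unpad {p = 0} (n ∷ c ∷ l) (normal-any nm)
    ... | f , e = m ∷ f , cong (m ∷_) e
    go : ∀ k gs → length gs ≡ k → ∃ λ f → Valid k f × Enc k f gs
    go zero [] refl = [] , (z≤n ∷ [] , zero) , zero
    go (suc k) gs e with unsnoc gs e
    ... | gs' , g , refl , l with go k gs' l
    ... | Q , v , enc with inner Q v
    ... | le , inn with build k g Q 0 1 (m≤n⇒m≤1+n le) inn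
    ... | l' , b , nm , o , _ with unpad l' nm
    ... | f , refl = f , (b , nm) , suc o enc

  tails-∷ʳ : ∀ gs g → tails (gs ∷ʳ g) ≡ map (_+ length g) (tails gs) ∷ʳ length g
  tails-∷ʳ [] g = cong [_] (+-identityʳ (length g))
  tails-∷ʳ (h ∷ gs) g rewrite tails-∷ʳ gs g = cong (_∷ map (_+ length g) (tails gs) ∷ʳ length g) (trans (cong (length h +_) (head (tails gs))) (sym (+-assoc (length h) _ (length g))))
    where
    head : ∀ ns → headOr0 (map (_+ length g) ns ∷ʳ length g) ≡ headOr0 ns + length g
    head [] = refl
    head (_ ∷ _) = refl

  private
    length-tails : ∀ gs → length (tails gs) ≡ length gs
    length-tails [] = refl
    length-tails (_ ∷ gs) = cong suc (length-tails gs)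

    sum-shift : ∀ j ns → sum (map (_+ j) ns ∷ʳ j) ≡ sum ns + suc (length ns) * j
    sum-shift j [] = refl
    sum-shift j (n ∷ ns) rewrite sum-shift j ns = solve 4 (λ n j s l → n :+ j :+ (s :+ (j :+ l)) := n :+ s :+ (j :+ (j :+ l))) refl n j (sum ns) (length ns * j)
      where open +-*-Solver

    -- A new last list of length j raises all earlier N_i by j and adds an entry j. Expanding the
    -- squares gives the terms of `moment-out`.
    squares-shift : ∀ j ns → sum (map (λ a → a * a) (map (_+ j) ns ∷ʳ j)) ≡ sum (map (λ a → a * a) ns) + 2 * (j * sum ns) + suc (length ns) * (j * j)
    squares-shift j [] = solve 1 (λ j → j :* j :+ con 0 := con 0 :+ con 2 :* (j :* con 0) :+ (j :* j :+ con 0)) refl j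
      where open +-*-Solver
    squares-shift j (n ∷ ns) rewrite squares-shift j ns =
      solve 5 (λ n j q s l → (n :+ j) :* (n :+ j) :+ (q :+ con 2 :* (j :* s) :+ (con 1 :+ l) :* (j :* j))
        := n :* n :+ q :+ con 2 :* (j :* (n :+ s)) :+ (con 2 :+ l) :* (j :* j)) refl n j (sum (map (λ a → a * a) ns)) (sum ns) (length ns)
      where open +-*-Solver

  enc-length : Enc k f gs → length gs ≡ k
  enc-length zero = refl
  enc-length (suc {gs = gs} o e) = trans (length-++ gs) (trans (+-comm (length gs) 1) (cong suc (enc-length e)))

  private
    sum-pad : ∀ f → sum (f ++ [ 0 ]) ≡ sum f
    sum-pad f = trans (sum-++ f [ 0 ]) (+-identityʳ (sum f))

    moment-pad : ∀ v f → moment v (f ++ [ 0 ]) ≡ moment v f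
    moment-pad v [] = trans (+-identityʳ (v * 0)) (*-zeroʳ v)
    moment-pad v (m ∷ f) = cong (v * m +_) (moment-pad (suc v) f)

    ones-pad : ∀ cov f → ones cov (f ++ [ 0 ]) ≡ ones cov f
    ones-pad cov [] = refl
    ones-pad cov (zero ∷ f) = ones-pad false f
    ones-pad false (suc m ∷ f) = cong suc (ones-pad true f)
    ones-pad true (suc m ∷ f) = ones-pad false f

  enc-sum : Enc k f gs → sum f ≡ sum (tails gs)
  enc-sum zero = refl
  enc-sum {suc k} {f} (suc {g = g} {gs = gs} o e) = trans (sym (sum-pad f)) (trans (sum-out k o) (trans (cong (_+ suc k * length g) (enc-sum e))
    (sym (trans (cong sum (tails-∷ʳ gs g)) (trans (sum-shift (length g) (tails gs))
      (cong (λ z → sum (tails gs) + suc z * length g) (trans (length-tails gs) (enc-length e))))))))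

  enc-moment : Enc k f gs → moment 1 f ≡ sum (map (λ a → a * a) (tails gs)) + sum (map weight gs)
  enc-moment zero = refl
  enc-moment {suc k} {f} (suc {g = g} {Q = Q} {gs = gs} o e) = trans (sym (moment-pad 1 f)) (trans (moment-out k 0 o) (trans
    (cong₂ (λ M s → M + 2 * (length g * s) + suc k * (length g * length g) + weight g + length g * (suc k * 0 + 0)) (enc-moment e) (enc-sum e))
    (sym (trans (cong₂ _+_ (trans (cong (λ ns → sum (map (λ a → a * a) ns)) (tails-∷ʳ gs g)) (trans (squares-shift (length g) (tails gs))
          (cong (λ z → sum (map (λ a → a * a) (tails gs)) + 2 * (length g * sum (tails gs)) + suc z * (length g * length g)) (trans (length-tails gs) (enc-length e)))))
        (trans (cong sum (map-++ weight gs [ g ])) (sum-++ (map weight gs) [ weight g ])))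
      (solve 6 (λ q s j κ W w → q :+ con 2 :* (j :* s) :+ κ :* (j :* j) :+ (W :+ (w :+ con 0)) := q :+ W :+ con 2 :* (j :* s) :+ κ :* (j :* j) :+ w :+ j :* (κ :* con 0 :+ con 0)) refl
        (sum (map (λ a → a * a) (tails gs))) (sum (tails gs)) (length g) (suc k) (sum (map weight gs)) (weight g))))))
    where open +-*-Solver

  enc-ones : Enc k f gs → Valid k f → ones false f ≡ headOr0 (tails gs)
  enc-ones zero v = refl
  enc-ones {f = f} (suc {g = g} {gs = gs} o e) (b , _) = trans (sym (ones-pad false f)) (trans (ones-out false (λ ()) o b)
    (trans (cong (length g +_) (enc-ones e (valid-out o b))) (trans (+-comm (length g) _) (sym (trans (cong headOr0 (tails-∷ʳ gs g)) (head (tails gs)))))))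
    where
    head : ∀ ns → headOr0 (map (_+ length g) ns ∷ʳ length g) ≡ headOr0 ns + length g
    head [] = refl
    head (_ ∷ _) = refl

  enc-parities : Enc k f gs → Valid k f → sum (map (changes false) (parities k (plain f))) ≡ sum (map oddCount gs)
  enc-parities zero v = refl
  enc-parities {suc k} {f} (suc {g = g} {Q = Q} {gs = gs} o e) (b , nm) with parities-out k o b (valid-padded f nm)
  ... | ts , p , eq = trans (cong (λ L → sum (map (changes false) L)) (trans (sym (trans (cong (parities (suc k)) (map-++ (false ,_) f [ 0 ])) (parities-snoc (suc k) (plain f)))) eq))
    (trans (cong sum (map-++ (changes false) (parities k (plain Q)) [ ts ])) (trans (sum-++ (map (changes false) (parities k (plain Q))) [ changes false ts ])
    (trans (cong₂ _+_ (enc-parities e (valid-out o b)) (cong (_+ 0) (parities-changes p)))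
    (sym (trans (cong sum (map-++ oddCount gs [ g ])) (sum-++ (map oddCount gs) [ oddCount g ]))))))

-- Overlines as bits on the 1-marked parts

module Overlines where
  open Counting using (bit; weight)
  open Cells
  open PairDeletion
  open GreedyDeletion
  open Frequencies

  private
    variable
      K m n p x y a b : ℕ
      o : Bool
      c c' f : List ℕ
      s s' : List Site

  -- Does the first entry of c move to the previous site under the inverse of
  -- plus, which is greedy from the right?
  moves : List ℕ → Bool
  moves [] = false
  moves (zero ∷ c) = false
  moves (suc a ∷ c) = not (moves c)

  minus : List ℕ → List ℕ
  minus [] = []
  minus (a ∷ c) with moves c
  ... | true = suc a ∷ minus c
  ... | false = a ∸ 1 ∷ minus c

  -- Together with `plus-minus₀` this identifies the image of `plus`: the sequences on which `moves`
  -- is false.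
  moves-plus : ∀ c → moves (plus c) ≡ false
  moves-plus-tail : ∀ a c → ∃ λ g → plus (suc a ∷ c) ≡ a ∷ g × moves g ≡ true
  moves-plus [] = refl
  moves-plus (zero ∷ c) = refl
  moves-plus (suc a ∷ c) with plus (suc a ∷ c) | moves-plus-tail a c
  moves-plus (suc zero ∷ c) | _ | g , refl , e = refl
  moves-plus (suc (suc a) ∷ c) | _ | g , refl , e = cong not e
  moves-plus-tail a [] = _ , refl , refl
  moves-plus-tail a (b ∷ c) = _ , refl , cong not (moves-plus c)

  plus-minus : ∀ a c → moves c ≡ true → plus (suc a ∷ minus c) ≡ a ∷ c
  plus-minus₀ : ∀ c → moves c ≡ false → plus (minus c) ≡ c
  plus-minus a (suc b ∷ c) e with moves c in eq
  ... | false = cong (λ c → a ∷ suc b ∷ c) (plus-minus₀ c eq)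
  plus-minus₀ [] e = refl
  plus-minus₀ (zero ∷ c) e with moves c in eq
  ... | true = plus-minus zero c eq
  ... | false = cong (0 ∷_) (plus-minus₀ c eq)
  plus-minus₀ (suc a ∷ c) e with moves c in eq
  ... | true = plus-minus (suc a) c eq

  ones-moving : ∀ c → moves c ≡ true → suc (ones true c) ≡ ones false c
  ones-still : ∀ c → moves c ≡ false → ones true c ≡ ones false c
  ones-moving (suc a ∷ c) e with moves c in eq
  ... | false = cong suc (sym (ones-still c eq))
  ones-still [] e = refl
  ones-still (zero ∷ c) e = refl
  ones-still (suc a ∷ c) e with moves c in eq
  ... | true = sym (ones-moving c eq)

  ones-plus : ∀ c → ones false (plus c) ≡ ones false c
  ones-plus [] = refl
  ones-plus (zero ∷ c) = ones-plus c
  ones-plus (suc zero ∷ []) = refl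
  ones-plus (suc (suc a) ∷ []) = refl
  ones-plus (suc zero ∷ zero ∷ c) = cong suc (trans (ones-still (plus c) (moves-plus c)) (ones-plus c))
  ones-plus (suc zero ∷ suc b ∷ c) = cong suc (trans (ones-still (plus c) (moves-plus c)) (ones-plus c))
  ones-plus (suc (suc a) ∷ zero ∷ c) = cong suc (ones-plus c)
  ones-plus (suc (suc a) ∷ suc b ∷ c) = cong suc (ones-plus c)

  ones-moved : ∀ cov a c → moves c ≡ true → ones cov (a ∷ c) ≡ ones false c
  ones-moved cov zero c e = refl
  ones-moved false (suc a) c e = ones-moving c e
  ones-moved true (suc a) c e = refl

  sum-plus : ∀ c → sum (plus c) ≡ sum c
  sum-plus [] = refl
  sum-plus (zero ∷ c) = sum-plus c
  sum-plus (suc a ∷ []) = +-suc a 0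
  sum-plus (suc a ∷ b ∷ c) = trans (+-suc a _) (cong (λ z → suc (a + (b + z))) (sum-plus c))

  -- One part of each site with mark 1 moves up by one site.
  moment-plus : ∀ v c → moment v (plus c) ≡ moment v c + ones false c
  moment-plus v [] = refl
  moment-plus v (zero ∷ c) = trans (cong (v * 0 +_) (moment-plus (suc v) c)) (sym (+-assoc (v * 0) _ _))
  moment-plus v (suc a ∷ []) = solve 2 (λ v a → v :* a :+ ((con 1 :+ v) :* con 1 :+ con 0) := v :* (con 1 :+ a) :+ con 0 :+ con 1) refl v a
    where open +-*-Solver
  moment-plus v (suc a ∷ b ∷ c) = trans (cong (λ z → v * a + (suc v * suc b + z)) (moment-plus (suc (suc v)) c))
    (trans (solve 5 (λ v a b M j → v :* a :+ ((con 1 :+ v) :* (con 1 :+ b) :+ (M :+ j)) := v :* (con 1 :+ a) :+ ((con 1 :+ v) :* b :+ M) :+ (con 1 :+ j)) refl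
      v a b (moment (suc (suc v)) c) (ones false c))
      (cong (λ j → v * suc a + (suc v * b + moment (suc (suc v)) c) + suc j) (sym (covered b))))
    where
    open +-*-Solver
    covered : ∀ b → ones true (b ∷ c) ≡ ones false c
    covered zero = refl
    covered (suc b) = refl

  bounded-raise : x ≤ y → Bounded K y c → Bounded K x c
  bounded-raise le [] = []
  bounded-raise le (le' ∷ b) = ≤-trans (+-monoˡ-≤ _ le) le' ∷ b

  bounded-plus : suc y ≤ K → Bounded K y c → Bounded K (suc y) (plus c)
  bounded-plus {y = y} le [] = []
  bounded-plus {y = y} {K} {zero ∷ c} le (_ ∷ b) = subst (λ z → suc z ≤ K) (sym (+-identityʳ y)) le ∷ bounded-raise z≤n (bounded-plus (≤-trans (s≤s z≤n) le) b)
  bounded-plus {y = y} {K} {suc a ∷ []} le (le' ∷ []) =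
    subst (_≤ K) (+-suc y a) le' ∷ subst (_≤ K) (+-comm 1 a) (≤-trans (m≤n+m (suc a) y) le') ∷ []
  bounded-plus {y = y} {K} {suc a ∷ b ∷ c} le (le' ∷ le'' ∷ bd) =
    subst (_≤ K) (+-suc y a) le' ∷ subst (_≤ K) (sym (+-suc a b)) le'' ∷ bounded-plus (≤-trans (s≤s (m≤n+m b a)) le'') bd

  -- The entry a before c after the move.
  after : Bool → ℕ → ℕ
  after true a = suc a
  after false a = a ∸ 1

  minus-∷ : ∀ a c → minus (a ∷ c) ≡ after (moves c) a ∷ minus c
  minus-∷ a c with moves c
  ... | true = refl
  ... | false = refl

  bounded-minus : Bounded K x c → Bounded K (after (moves c) x) (minus c)
  bounded-minus [] = []
  bounded-minus {K} {x} {v ∷ c} (le ∷ b) rewrite minus-∷ v c = fits v le b ∷ bounded-minus b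
    where
    positive : ∀ {c} → moves c ≡ true → Bounded K v c → suc v ≤ K
    positive {suc r ∷ c} _ (le ∷ _) = ≤-trans (subst (suc v ≤_) (sym (+-suc v r)) (s≤s (m≤m+n v r))) le
    fits : ∀ v → x + v ≤ K → Bounded K v c → after (moves (v ∷ c)) x + after (moves c) v ≤ K
    fits zero le b with moves c in eq
    ... | false = ≤-trans (≤-reflexive (+-identityʳ (x ∸ 1))) (≤-trans (m∸n≤m x 1) (≤-trans (m≤m+n x 0) le))
    ... | true = lem x le b eq
      where
      lem : ∀ x → x + 0 ≤ K → Bounded K 0 c → moves c ≡ true → x ∸ 1 + 1 ≤ K
      lem zero le (_∷_ {r = suc r} le' _) e = ≤-trans (s≤s z≤n) le'
      lem (suc x) le b e = subst (_≤ K) (trans (cong suc (+-identityʳ x)) (+-comm 1 x)) le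
    fits (suc v) le b with moves c in eq
    ... | false = subst (_≤ K) (+-suc x v) le
    ... | true = lem x le b eq
      where
      lem : ∀ x → x + suc v ≤ K → Bounded K (suc v) c → moves c ≡ true → x ∸ 1 + suc (suc v) ≤ K
      lem zero le (_∷_ {r = suc r} le' _) e = ≤-trans (s≤s (subst (suc v ≤_) (sym (+-suc v r)) (s≤s (m≤m+n v r)))) le'
      lem (suc x) le b e = subst (_≤ K) (sym (+-suc x (suc v))) le

  -- The tail comes first, so the overlines are removed from right to left and `plus` always acts on
  -- a sequence without overlines.
  unov : List Site → List ℕ
  unov [] = []
  unov ((false , c) ∷ s) = c ∷ unov s
  unov ((true , c) ∷ s) = plus (c ∷ unov s)

  -- Which parts with mark 1 are overlined?
  marks : Bool → List Site → List Bool
  marks cov [] = []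
  marks cov ((o , zero) ∷ s) = marks false s
  marks false ((o , suc c) ∷ s) = o ∷ marks true s
  marks true ((true , suc c) ∷ s) = true ∷ marks true s
  marks true ((false , suc c) ∷ s) = marks false s

  -- The difference conditions site by site. The non-overlined parts of a site and all parts of the
  -- previous one number at most K; the overlined part is exempt from this, but its own site holds
  -- at most K parts.
  data SValid (K : ℕ) : ℕ → List Site → Set where
    []    : SValid K x []
    bare : x + a ≤ K → SValid K a s → SValid K x ((false , a) ∷ s)
    over  : x + a ≤ K → suc a ≤ K → SValid K (suc a) s → SValid K x ((true , suc a) ∷ s)

  unov-bounded : SValid K x s → Bounded K x (unov s)
  unov-bounded [] = []
  unov-bounded (bare le v) = le ∷ unov-bounded v
  unov-bounded {s = (true , suc a) ∷ s} (over le l v) with unov s | unov-bounded v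
  ... | [] | _ = le ∷ ≤-trans (≤-reflexive (+-comm a 1)) l ∷ []
  ... | r ∷ c | le' ∷ b = le ∷ ≤-trans (≤-reflexive (+-suc a r)) le' ∷ bounded-plus (≤-trans (s≤s (m≤n+m r a)) le') b

  length-marks : ∀ cov → SValid K x s → length (marks cov s) ≡ ones cov (unov s)
  length-marks cov [] = refl
  length-marks cov (bare {a = zero} le v) = length-marks false v
  length-marks false (bare {a = suc a} le v) = cong suc (length-marks true v)
  length-marks true (bare {a = suc a} le v) = length-marks false v
  length-marks {s = (true , suc a) ∷ s} cov (over le l v) = trans (lem cov) (cong suc (length-marks true v)) ∙ sym (trans (plus-ones cov) (ones-plus (suc a ∷ unov s)))
    where
    _∙_ : ∀ {A : Set} {x y z : A} → x ≡ y → y ≡ z → x ≡ z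
    _∙_ = trans
    lem : ∀ cov → length (marks cov ((true , suc a) ∷ s)) ≡ suc (length (marks true s))
    lem true = refl
    lem false = refl
    plus-ones : ∀ cov → ones cov (plus (suc a ∷ unov s)) ≡ ones false (plus (suc a ∷ unov s))
    plus-ones cov with plus (suc a ∷ unov s) | moves-plus-tail a (unov s)
    ... | _ | g , refl , e = trans (ones-moved cov a g e) (sym (ones-moved false a g e))

  sizes : List Site → List ℕ
  sizes = map proj₂

  sum-unov : ∀ s → sum (unov s) ≡ sum (sizes s)
  sum-unov [] = refl
  sum-unov ((false , c) ∷ s) = cong (c +_) (sum-unov s)
  sum-unov ((true , c) ∷ s) = trans (sum-plus (c ∷ unov s)) (cong (c +_) (sum-unov s))

  -- Removing an overline moves one part of its own site and one for each later bit, which is the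
  -- position of its bit from the right.
  moment-unov : ∀ v cov → SValid K x s → moment v (unov s) ≡ moment v (sizes s) + weight (map bit (marks cov s))
  moment-unov v cov [] = refl
  moment-unov v cov (bare {a = zero} le h) = trans (cong (v * 0 +_) (moment-unov (suc v) false h)) (sym (+-assoc (v * 0) _ _))
  moment-unov v false (bare {a = suc a} {s = s} le h) rewrite *-zeroʳ (length (map bit (marks true s))) =
    trans (cong (v * suc a +_) (moment-unov (suc v) true h)) (sym (+-assoc (v * suc a) _ _))
  moment-unov v true (bare {a = suc a} le h) = trans (cong (v * suc a +_) (moment-unov (suc v) false h)) (sym (+-assoc (v * suc a) _ _))
  moment-unov {s = (true , suc a) ∷ s} v cov (over le l h) = trans (moment-plus v (suc a ∷ unov s))
    (trans (cong₂ (λ M j → v * suc a + M + suc j) (moment-unov (suc v) true h) (sym (length-marks true h)))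
    (trans (solve 4 (λ u M w j → u :+ (M :+ w) :+ (con 1 :+ j) := u :+ M :+ (con 1 :+ j :+ w)) refl (v * suc a) (moment (suc v) (sizes s)) (weight (map bit (marks true s))) (length (marks true s)))
    (cong (v * suc a + moment (suc v) (sizes s) +_) (lem cov))))
    where
    open +-*-Solver
    lem : ∀ cov → suc (length (marks true s)) + weight (map bit (marks true s)) ≡ weight (map bit (marks cov ((true , suc a) ∷ s)))
    lem true rewrite length-map bit (marks true s) | *-identityʳ (length (marks true s)) = refl
    lem false rewrite length-map bit (marks true s) | *-identityʳ (length (marks true s)) = refl

  parities-unov : ∀ n r → SValid K x s → parities n (r ++ s) ≡ parities n (r ++ plain (unov s))
  parities-unov n r [] = refl
  parities-unov {s = (false , a) ∷ s} n r (bare le v) = trans (cong (parities n) (sym (++-assoc r [ false , a ] s)))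
    (trans (parities-unov n (r ++ [ false , a ]) v) (cong (parities n) (++-assoc r [ false , a ] _)))
  parities-unov {s = (true , suc a) ∷ s} n r (over le l v) = trans (cong (parities n) (sym (++-assoc r [ true , suc a ] s)))
    (trans (parities-unov n (r ++ [ true , suc a ]) v) (trans (cong (parities n) (++-assoc r [ true , suc a ] _)) (parities-unflag n r a (unov s))))

  moves-unov : ∀ {β} → SValid K x s → marks false s ≡ true ∷ β → moves (unov s) ≡ false
  moves-unov (bare {a = zero} le v) e = refl
  moves-unov {s = (true , suc a) ∷ s} (over le l v) e = moves-plus (suc a ∷ unov s)

  data NormalF : List ℕ → Set where
    []   : NormalF []
    last : NormalF (suc a ∷ [])
    cons : NormalF (b ∷ c) → NormalF (a ∷ b ∷ c)

  data NormalS : List Site → Set where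
    []   : NormalS []
    last : NormalS ((o , suc a) ∷ [])
    cons : ∀ {u v} → NormalS (v ∷ s) → NormalS (u ∷ v ∷ s)

  normalF-tail : NormalF (a ∷ c) → NormalF c
  normalF-tail last = []
  normalF-tail (cons nm) = nm

  normalS-tail : ∀ {u} → NormalS (u ∷ s) → NormalS s
  normalS-tail last = []
  normalS-tail (cons nm) = nm

  plus-injective : NormalF c → NormalF c' → plus c ≡ plus c' → c ≡ c'
  plus-injective {[]} {[]} nm nm' e = refl
  plus-injective {[]} {zero ∷ c'} nm nm' ()
  plus-injective {[]} {suc a ∷ []} nm nm' ()
  plus-injective {[]} {suc a ∷ b ∷ c'} nm nm' ()
  plus-injective {zero ∷ c} {[]} nm nm' ()
  plus-injective {suc a ∷ []} {[]} nm nm' ()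
  plus-injective {suc a ∷ b ∷ c} {[]} nm nm' ()
  plus-injective {zero ∷ c} {zero ∷ c'} nm nm' e = cong (0 ∷_) (plus-injective (normalF-tail nm) (normalF-tail nm') (proj₂ (∷-injective e)))
  plus-injective {zero ∷ c} {suc a ∷ c'} nm nm' e with plus (suc a ∷ c') | moves-plus-tail a c'
  ... | _ | g , refl , mv with ∷-injective e
  ... | refl , refl with () ← trans (sym mv) (moves-plus c)
  plus-injective {suc a ∷ c'} {zero ∷ c} nm nm' e with plus (suc a ∷ c') | moves-plus-tail a c'
  ... | _ | g , refl , mv with ∷-injective e
  ... | refl , refl with () ← trans (sym mv) (moves-plus c)
  plus-injective {suc a ∷ []} {suc .a ∷ []} nm nm' refl = refl
  plus-injective {suc a ∷ []} {suc a' ∷ zero ∷ []} nm (cons ()) e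
  plus-injective {suc a ∷ []} {suc a' ∷ b ∷ zero ∷ c'} nm nm' ()
  plus-injective {suc a ∷ []} {suc a' ∷ b ∷ suc d ∷ []} nm nm' ()
  plus-injective {suc a ∷ []} {suc a' ∷ b ∷ suc d ∷ _ ∷ c'} nm nm' ()
  plus-injective {suc a' ∷ zero ∷ []} {suc a ∷ []} (cons ()) nm' e
  plus-injective {suc a' ∷ b ∷ zero ∷ c'} {suc a ∷ []} nm nm' ()
  plus-injective {suc a' ∷ b ∷ suc d ∷ []} {suc a ∷ []} nm nm' ()
  plus-injective {suc a' ∷ b ∷ suc d ∷ _ ∷ c'} {suc a ∷ []} nm nm' ()
  plus-injective {suc a ∷ b ∷ c} {suc a' ∷ b' ∷ c'} nm nm' e with ∷-injective e
  ... | refl , e₁ with ∷-injective e₁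
  ... | refl , e₂ = cong (λ c → suc a ∷ b ∷ c) (plus-injective (normalF-tail (normalF-tail nm)) (normalF-tail (normalF-tail nm')) e₂)

  normal-plus : ∀ {b} → NormalF (b ∷ c) → ∃ λ r → ∃ λ d → plus (b ∷ c) ≡ r ∷ d × NormalF (r ∷ d)
  normal-plus {b = suc a} last = _ , _ , refl , cons last
  normal-plus {b = zero} (cons {c = c} nm) with normal-plus nm
  ... | r , d , e , nm' rewrite e = _ , _ , refl , cons nm'
  normal-plus {b = suc a} (cons {b = b} {c = []} nm) = _ , _ , refl , cons last
  normal-plus {b = suc a} (cons {b = b} {c = _ ∷ c} (cons nm)) with normal-plus nm
  ... | r , d , e , nm' rewrite e = _ , _ , refl , cons (cons nm')

  unov-normal : SValid K x s → NormalS s → NormalF (unov s)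
  unov-normal-∷ : ∀ {u} → SValid K x (u ∷ s) → NormalS (u ∷ s) → ∃ λ r → ∃ λ d → unov (u ∷ s) ≡ r ∷ d × NormalF (r ∷ d)
  unov-normal [] nm = []
  unov-normal {s = u ∷ s} v nm with unov-normal-∷ v nm
  ... | r , d , e , nm' rewrite e = nm'
  unov-normal-∷ (bare le v) last = _ , _ , refl , last
  unov-normal-∷ (over le l v) last = _ , _ , refl , cons last
  unov-normal-∷ (bare {a = a} le v) (cons nm) with unov-normal-∷ v nm
  ... | r , d , e , nm' rewrite e = _ , _ , refl , cons nm'
  unov-normal-∷ (over {a = a} le l v) (cons nm) with unov-normal-∷ v nm
  ... | r , d , e , nm' rewrite e = normal-plus {b = suc a} (cons nm')

  private
    -- Undoing an overline leaves a tail on which `moves` is true, whereas `moves` is false on a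
    -- tail whose first bit is true (`moves-unov`). If the bare site carries a bit of its own, the
    -- bits already differ.
    unov-clash : ∀ cov a s a' → SValid K y s' → plus (suc a ∷ unov s) ≡ a' ∷ unov s' →
      marks cov ((true , suc a) ∷ s) ≡ marks cov ((false , a') ∷ s') → ⊥
    unov-clash cov a s a' v' eu em with plus (suc a ∷ unov s) | moves-plus-tail a (unov s)
    unov-clash true a s zero v' refl em | _ | _ , refl , e with () ← trans (sym e) (moves-unov v' (sym em))
    unov-clash false a s zero v' refl em | _ | _ , refl , e with () ← trans (sym e) (moves-unov v' (sym em))
    unov-clash true a s (suc a') v' refl em | _ | _ , refl , e with () ← trans (sym e) (moves-unov v' (sym em))
    unov-clash false a s (suc a') v' eu () | _ | _

  unov-injective : ∀ cov → SValid K x s → SValid K y s' → NormalS s → NormalS s' → unov s ≡ unov s' → marks cov s ≡ marks cov s' → s ≡ s'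
  unov-injective cov [] [] nm nm' eu em = refl
  unov-injective cov [] (bare le v') nm nm' () em
  unov-injective cov [] (over le l v') nm nm' eu em with unov-normal-∷ (over le l v') nm'
  ... | r , d , e , _ with () ← trans eu e
  unov-injective cov (bare le v) [] nm nm' () em
  unov-injective cov (over le l v) [] nm nm' eu em with unov-normal-∷ (over le l v) nm
  ... | r , d , e , _ with () ← trans (sym e) eu
  unov-injective cov (bare {a = zero} le v) (bare le' v') nm nm' eu em with ∷-injective eu
  ... | refl , eu' = cong (_ ∷_) (unov-injective false v v' (normalS-tail nm) (normalS-tail nm') eu' em)
  unov-injective false (bare {a = suc a} le v) (bare le' v') nm nm' eu em with ∷-injective eu
  ... | refl , eu' = cong (_ ∷_) (unov-injective true v v' (normalS-tail nm) (normalS-tail nm') eu' (proj₂ (∷-injective em)))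
  unov-injective true (bare {a = suc a} le v) (bare le' v') nm nm' eu em with ∷-injective eu
  ... | refl , eu' = cong (_ ∷_) (unov-injective false v v' (normalS-tail nm) (normalS-tail nm') eu' em)
  unov-injective cov (over {a = a} {s = s} le l v) (over {a = a'} {s = s'} le' l' v') nm nm' eu em
    with ∷-injective (plus-injective (normalF-∷ v (normalS-tail nm)) (normalF-∷ v' (normalS-tail nm')) eu)
    where
    normalF-∷ : ∀ {y s a} → SValid K y s → NormalS s → NormalF (suc a ∷ unov s)
    normalF-∷ [] _ = last
    normalF-∷ {s = u ∷ s} v nm with unov-normal-∷ v nm
    ... | r , d , e , nm' rewrite e = cons nm'
  ... | refl , eu' = cong (_ ∷_) (unov-injective true v v' (normalS-tail nm) (normalS-tail nm') eu' (tail cov em))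
    where
    tail : ∀ cov → marks cov ((true , suc a) ∷ s) ≡ marks cov ((true , suc a') ∷ s') → marks true s ≡ marks true s'
    tail true e = proj₂ (∷-injective e)
    tail false e = proj₂ (∷-injective e)
  unov-injective cov (over {a = a} le l v) (bare {a = a'} le' v') nm nm' eu em = ⊥-elim (unov-clash cov a _ a' v' eu em)
  unov-injective cov (bare {a = a'} le' v') (over {a = a} le l v) nm nm' eu em = ⊥-elim (unov-clash cov a _ a' v' (sym eu) (sym em))

  private
    length-minus : ∀ c → length (minus c) ≡ length c
    length-minus [] = refl
    length-minus (a ∷ c) rewrite minus-∷ a c = cong suc (length-minus c)

    Preimage : ℕ → ℕ → Bool → List ℕ → List Bool → Set
    Preimage K x cov l t = ∃ λ s → SValid K x s × unov s ≡ l × marks cov s ≡ t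

  -- Where the tail can give a part back (`moves c`) and the next bit is true, the site is overlined
  -- and the move undone; otherwise it stays bare. The last hypothesis excludes a true bit at an
  -- uncovered site whose tail gives nothing back. The length `i` is the measure, since `minus c` is
  -- not a subterm.
  unov-preimage : ∀ i cov l t → length l ≡ i → Bounded K x l → length t ≡ ones cov l →
    (cov ≡ false → ∀ {t'} → t ≡ true ∷ t' → moves l ≡ false) → Preimage K x cov l t
  unov-preimage i cov [] [] e b et H = [] , [] , refl , refl
  unov-preimage {K} {x} (suc i) cov (a ∷ c) t e (le ∷ b) et H with moves c in eq
  ... | true = bySplit t refl
    where
    bare-case : (∀ {t'} → t ≡ true ∷ t' → ⊥) → Preimage K x cov (a ∷ c) t
    bare-case n = lem cov a t le b et n
      where
      lem : ∀ cov a t → x + a ≤ K → Bounded K a c → length t ≡ ones cov (a ∷ c) → (∀ {t'} → t ≡ true ∷ t' → ⊥) → Preimage K x cov (a ∷ c) t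
      lem cov zero t le b et n with unov-preimage i false c t (suc-injective e) b et (λ _ e → ⊥-elim (n e))
      ... | s , v , eu , em = (false , 0) ∷ s , bare le v , cong (0 ∷_) eu , em
      lem true (suc a) t le b et n with unov-preimage i false c t (suc-injective e) b et (λ _ e → ⊥-elim (n e))
      ... | s , v , eu , em = (false , suc a) ∷ s , bare le v , cong (suc a ∷_) eu , em
      lem false (suc a) (true ∷ t) le b et n = ⊥-elim (n refl)
      lem false (suc a) (false ∷ t) le b et n with unov-preimage i true c t (suc-injective e) b (suc-injective et) (λ ())
      ... | s , v , eu , em = (false , suc a) ∷ s , bare le v , cong (suc a ∷_) eu , cong (false ∷_) em
    bySplit : ∀ t₁ → t ≡ t₁ → Preimage K x cov (a ∷ c) t
    bySplit [] et₁ = bare-case (λ e → case₁ (trans (sym et₁) e))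
      where
      case₁ : ∀ {t'} → _≡_ {A = List Bool} [] (true ∷ t') → ⊥
      case₁ ()
    bySplit (false ∷ t') et₁ = bare-case (λ e → case₁ (trans (sym et₁) e))
      where
      case₁ : ∀ {t''} → _≡_ {A = List Bool} (false ∷ t') (true ∷ t'') → ⊥
      case₁ ()
    bySplit (true ∷ t') refl with unov-preimage {x = suc a} i true (minus c) t' (trans (length-minus c) (suc-injective e))
        (subst (λ m → Bounded K (after m a) (minus c)) eq (bounded-minus b))
        (suc-injective (trans et (trans (ones-moved cov a c eq) (trans (sym (ones-moved false a c eq)) (trans (cong (ones false) (sym (plus-minus a c eq))) (ones-plus (suc a ∷ minus c)))))))
        (λ ())
    ... | s , v , eu , em = (true , suc a) ∷ s , over le (positive b eq) v , trans (cong (λ r → plus (suc a ∷ r)) eu) (plus-minus a c eq) , withMark cov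
      where
      positive : ∀ {c} → Bounded K a c → moves c ≡ true → suc a ≤ K
      positive {suc r ∷ c} (le ∷ _) _ = ≤-trans (subst (suc a ≤_) (sym (+-suc a r)) (s≤s (m≤m+n a r))) le
      withMark : ∀ cov → marks cov ((true , suc a) ∷ s) ≡ true ∷ t'
      withMark true = cong (true ∷_) em
      withMark false = cong (true ∷_) em
  ... | false = lem cov a t le b et H
    where
    lem : ∀ cov a t → x + a ≤ K → Bounded K a c → length t ≡ ones cov (a ∷ c) →
      (cov ≡ false → ∀ {t'} → t ≡ true ∷ t' → moves (a ∷ c) ≡ false) → Preimage K x cov (a ∷ c) t
    lem cov zero t le b et H with unov-preimage i false c t (suc-injective e) b et (λ _ _ → eq)
    ... | s , v , eu , em = (false , 0) ∷ s , bare le v , cong (0 ∷_) eu , em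
    lem true (suc a) t le b et H with unov-preimage i false c t (suc-injective e) b et (λ _ _ → eq)
    ... | s , v , eu , em = (false , suc a) ∷ s , bare le v , cong (suc a ∷_) eu , em
    lem false (suc a) (true ∷ t) le b et H with () ← trans (cong not (sym eq)) (H refl refl)
    lem false (suc a) (false ∷ t) le b et H with unov-preimage i true c t (suc-injective e) b (suc-injective et) (λ ())
    ... | s , v , eu , em = (false , suc a) ∷ s , bare le v , cong (suc a ∷_) eu , cong (false ∷_) em

  infixr 5 _∷ˢ_

  _∷ˢ_ : Site → List Site → List Site
  (o , suc c) ∷ˢ s = (o , suc c) ∷ s
  (o , zero) ∷ˢ [] = []
  (o , zero) ∷ˢ (u ∷ s) = (o , zero) ∷ u ∷ s

  strip : List Site → List Site
  strip [] = []
  strip (u ∷ s) = u ∷ˢ strip s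

  strip-normal : ∀ s → NormalS (strip s)
  strip-normal [] = []
  strip-normal (u ∷ s) = lem u (strip s) (strip-normal s)
    where
    lem : ∀ u s → NormalS s → NormalS (u ∷ˢ s)
    lem (o , suc c) [] nm = last
    lem (o , suc c) (v ∷ s) nm = cons nm
    lem (o , zero) [] nm = []
    lem (o , zero) (v ∷ s) nm = cons nm

  strip-valid : SValid K x s → SValid K x (strip s)
  strip-valid [] = []
  strip-valid (over le l v) = over le l (strip-valid v)
  strip-valid (bare {a = suc a} le v) = bare le (strip-valid v)
  strip-valid (bare {a = zero} {s = s} le v) with strip s | strip-valid v
  ... | [] | v' = []
  ... | u ∷ s' | v' = bare le v'

  marks-strip : ∀ cov s → marks cov (strip s) ≡ marks cov s
  marks-strip cov [] = refl
  marks-strip cov ((o , zero) ∷ s) with strip s | marks-strip false s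
  ... | [] | e = e
  ... | u ∷ s' | e = e
  marks-strip false ((o , suc c) ∷ s) = cong (o ∷_) (marks-strip true s)
  marks-strip true ((true , suc c) ∷ s) = cong (true ∷_) (marks-strip true s)
  marks-strip true ((false , suc c) ∷ s) = marks-strip false s

  private
    zeros : ℕ → List ℕ
    zeros j = replicate j 0

    plus-zeros : ∀ c j → ∃ λ i → plus (c ++ zeros j) ≡ plus c ++ zeros i
    plus-zeros [] zero = 0 , refl
    plus-zeros [] (suc j) with plus-zeros [] j
    ... | i , e = suc i , cong (0 ∷_) e
    plus-zeros (zero ∷ c) j with plus-zeros c j
    ... | i , e = i , cong (0 ∷_) e
    plus-zeros (suc a ∷ []) zero = 0 , refl
    plus-zeros (suc a ∷ []) (suc j) with plus-zeros [] j
    ... | i , e = i , cong (λ r → a ∷ 1 ∷ r) e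
    plus-zeros (suc a ∷ b ∷ c) j with plus-zeros c j
    ... | i , e = i , cong (λ r → a ∷ suc b ∷ r) e

    unov-strip : ∀ s → SValid K x s → ∃ λ i → unov s ≡ unov (strip s) ++ zeros i
    unov-strip [] v = 0 , refl
    unov-strip ((false , zero) ∷ s) (bare le v) with strip s | unov-strip s v
    ... | [] | i , e = suc i , cong (0 ∷_) e
    ... | u ∷ s' | i , e = i , cong (0 ∷_) e
    unov-strip ((false , suc c) ∷ s) (bare le v) with unov-strip s v
    ... | i , e = i , cong (suc c ∷_) e
    unov-strip ((true , suc c) ∷ s) (over le l v) with unov-strip s v
    ... | j , e with plus-zeros (suc c ∷ unov (strip s)) j
    ... | i , e' = i , trans (cong (λ r → plus (suc c ∷ r)) e) e'

    normal-zeros : ∀ c i → NormalF (c ++ zeros i) → c ++ zeros i ≡ c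
    normal-zeros c zero nm = ++-identityʳ c
    normal-zeros [] (suc zero) ()
    normal-zeros [] (suc (suc i)) (cons nm) with () ← normal-zeros [] (suc i) nm
    normal-zeros (a ∷ c) (suc i) nm = cong (a ∷_) (normal-zeros c (suc i) (normalF-tail nm))

  unov-surjective : ∀ cov f t → Bounded K x f → NormalF f → length t ≡ ones cov f →
    (cov ≡ false → ∀ {t'} → t ≡ true ∷ t' → moves f ≡ false) → ∃ λ s → SValid K x s × NormalS s × unov s ≡ f × marks cov s ≡ t
  unov-surjective cov f t b nm et H with unov-preimage (length f) cov f t refl b et H
  ... | s , v , refl , em with unov-strip s v
  ... | i , e = strip s , strip-valid v , strip-normal s
    , sym (trans e (normal-zeros (unov (strip s)) i (subst NormalF e nm))) , trans (marks-strip cov s) em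

-- Toggling the first overline, and the count of site sequences

module FirstOverline where
  open import Defs using (headOr0; changes; rhsCoef; HasCount)
  open Counting
  open Models
  open Cells
  open PairDeletion
  open GreedyDeletion
  open Frequencies
  open Overlines
  open Paths using (firstMark; changes-not; base-cost)

  private
    variable
      K n x : ℕ
      o cov : Bool
      a a⁻ f⁻ p : Maybe Bool
      c : ℕ
      cs cs' : List Cell
      s s' : List Site

  -- Every part that has not received its mark shares its site or the previous
  -- one with a part that has; flags stay only where the previous site has not.
  data Fine : Maybe Bool → List Cell → Set where
    []   : Fine a⁻ []
    cons : (∀ {m} → c ≡ suc m → a ≡ nothing → ∃ λ e → a⁻ ≡ just e) →
           (∀ {m} → o ≡ true → c ≡ suc m → a⁻ ≡ nothing) →
           Fine a cs → Fine a⁻ ((a , o , c) ∷ cs)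

  -- This excludes the default case of `link`, a mark without a chain to extend, whose fresh parity
  -- would not change when all entries are negated.
  linked : ∀ p a → (∀ {m} → c ≡ suc m → a ≡ nothing → ∃ λ e → a⁻ ≡ just e) → (∀ {m} → o ≡ true → c ≡ suc m → a⁻ ≡ nothing) →
    State p cov a⁻ → proj₁ (peel cov o c) ≡ true → ∃ λ e → p ≡ just e ⊎ (p ≡ nothing × a ≡ just e)
  linked (just e) a h h' st b = e , inj₁ refl
  linked nothing (just e) h h' st b = e , inj₂ (refl , refl)
  linked {c = suc c} nothing nothing h h' none b = case proj₂ (h refl refl) of λ ()
  linked {c = suc c} {o = true} nothing nothing h h' used b = case h' refl refl of λ ()
  linked {c = suc c} {o = false} nothing nothing h h' used ()

  fine-step : ∀ ev p cov → Fine a⁻ cs → State p cov a⁻ → Entered cov f⁻ → Fine f⁻ (proj₂ (step ev p cov cs))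
  fine-step ev p cov [] st en = []
  fine-step ev p cov (cons {c = zero} {a = a} h h' fi) st en = cons (λ ()) (λ _ ()) (fine-step (not ev) a false fi (state-link ev false p a) unmarked)
  fine-step ev p false (cons {c = suc zero} {a = a} {o = o} h h' fi) st en with linked {cov = false} p a h h' st refl
  ... | e , inj₁ refl = cons (λ ()) (λ _ ()) (fine-step (not ev) _ true fi (state-link ev true p a) marked)
  ... | e , inj₂ (refl , refl) = cons (λ ()) (λ _ ()) (fine-step (not ev) _ true fi (state-link ev true p a) marked)
  fine-step ev p false (cons {c = suc (suc c)} {a = a} {o = o} h h' fi) st unmarked with linked {cov = false} p a h h' st refl
  ... | e , inj₁ refl = cons (λ _ ()) (λ _ _ → refl) (fine-step (not ev) _ true fi (state-link ev true p a) marked)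
  ... | e , inj₂ (refl , refl) = cons (λ _ ()) (λ _ _ → refl) (fine-step (not ev) _ true fi (state-link ev true p a) marked)
  fine-step ev p true (cons {c = suc c} {a = a} {o = true} h h' fi) st en with linked {cov = true} p a h h' st refl
  ... | e , inj₁ refl = cons (λ _ ()) (λ ()) (fine-step (not ev) _ true fi (state-link ev true p a) marked)
  ... | e , inj₂ (refl , refl) = cons (λ _ ()) (λ ()) (fine-step (not ev) _ true fi (state-link ev true p a) marked)
  fine-step ev p true (cons {c = suc c} {a = a} {o = false} h h' fi) st marked =
    cons (λ _ _ → _ , refl) (λ ()) (fine-step (not ev) a false fi (state-link ev false p a) unmarked)

  fine-step₀ : Fine nothing cs → Fine nothing (proj₂ (step false nothing false cs))
  fine-step₀ fi = fine-step false nothing false fi none unmarked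

  fine-start : ∀ ev V cov s → Entered cov f⁻ → Fine f⁻ (start ev V cov s)
  fine-start ev V cov [] en = []
  fine-start ev V cov ((o , zero) ∷ s) en = cons (λ ()) (λ _ ()) (fine-start (not ev) (o xor V) false s unmarked)
  fine-start ev V false ((o , suc zero) ∷ s) en = cons (λ ()) (λ _ ()) (fine-start (not ev) (o xor V) true s marked)
  fine-start ev V false ((o , suc (suc c)) ∷ s) unmarked = cons (λ _ ()) (λ _ _ → refl) (fine-start (not ev) (o xor V) true s marked)
  fine-start ev V true ((true , suc c) ∷ s) en = cons (λ _ ()) (λ ()) (fine-start (not ev) (not V) true s marked)
  fine-start ev V true ((false , suc c) ∷ s) marked = cons (λ _ _ → _ , refl) (λ ()) (fine-start (not ev) V false s unmarked)

  negate : Cell → Cell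
  negate (a , r) = Maybe.map not a , r

  private
    ends-not : ∀ p → ends (Maybe.map not p) ≡ map not (ends p)
    ends-not (just _) = refl
    ends-not nothing = refl

  link-not : ∀ ev b p a → (b ≡ true → ∃ λ e → p ≡ just e ⊎ (p ≡ nothing × a ≡ just e)) → let E , a' , p' = link ev b p a in
    link ev b (Maybe.map not p) (Maybe.map not a) ≡ (map not E , Maybe.map not a' , Maybe.map not p')
  link-not ev false p a h = cong (_, nothing , _) (ends-not p)
  link-not ev true (just x) a h = cong (λ y → [] , just y , _) (xor-notʳ ev x)
  link-not ev true nothing (just x) h = cong (λ y → [] , just y , _) (xor-notʳ ev x)
  link-not ev true nothing nothing h with h refl
  ... | _ , inj₁ ()
  ... | _ , inj₂ (_ , ())

  step-not : ∀ ev p cov → Fine a⁻ cs → State p cov a⁻ → let E , ds = step ev p cov cs in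
    step ev (Maybe.map not p) cov (map negate cs) ≡ (map not E , map negate ds)
  step-not ev p cov [] st = cong (_, []) (ends-not p)
  step-not ev p cov (cons {c = c} {a = a} {o = o} h h' fi) st
    rewrite link-not ev (proj₁ (peel cov o c)) p a (linked p a h h' st)
    | step-not (not ev) (proj₂ (proj₂ (link ev (proj₁ (peel cov o c)) p a))) (proj₁ (peel cov o c)) fi (state-link ev (proj₁ (peel cov o c)) p a)
    = cong₂ _,_ (sym (map-++ not (proj₁ (link ev (proj₁ (peel cov o c)) p a)) _)) refl

  start-not : ∀ ev V cov s → start ev (not V) cov s ≡ map negate (start ev V cov s)
  start-not ev V cov [] = refl
  start-not ev V cov ((o , c) ∷ s) = cong₂ _∷_ (cong (_, _) (entry (proj₁ (peel cov o c)))) (trans (cong (λ V → start (not ev) V (proj₁ (peel cov o c)) s) (xor-notʳ o V)) (start-not (not ev) (o xor V) _ s))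
    where
    entry : ∀ b → (if b then just (ev xor (o xor not V)) else nothing) ≡ Maybe.map not (if b then just (ev xor (o xor V)) else nothing)
    entry true = cong just (trans (cong (ev xor_) (xor-notʳ o V)) (xor-notʳ ev (o xor V)))
    entry false = refl

  -- Removing the overline from the first nonempty site flips all parities.
  data Lead : List Cell → List Cell → Set where
    zero  : Lead cs cs' → Lead ((nothing , false , 0) ∷ cs) ((nothing , false , 0) ∷ cs')
    first : ∀ {e c} → Lead ((just e , true , suc c) ∷ cs) ((just (not e) , false , suc c) ∷ map negate cs)
    rest  : Lead cs (map negate cs)

  step-lead : ∀ ev → Lead cs cs' → Fine nothing cs → let E , ds = step ev nothing false cs ; E' , ds' = step ev nothing false cs' in
    E' ≡ map not E × Lead ds ds'
  step-lead ev (zero l) (cons _ _ fi) with step-lead (not ev) l fi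
  ... | e , l' = e , zero l'
  step-lead ev (first {e = e} {zero}) (cons h h' fi) with step-not (not ev) nothing true fi used
  ... | eq rewrite eq | xor-notʳ ev e = refl , rest
  step-lead ev (first {e = e} {suc c}) (cons h h' fi) with step-not (not ev) nothing true fi used
  ... | eq rewrite eq | xor-notʳ ev e = refl , first
  step-lead ev rest fi with step-not ev nothing false fi none
  ... | eq rewrite eq = refl , rest

  levels-lead : ∀ n → Lead cs cs' → Fine nothing cs → levels n cs' ≡ map (map not) (levels n cs)
  levels-lead zero l fi = refl
  levels-lead (suc n) l fi with step-lead false l fi
  ... | e , l' = cong₂ _∷_ e (levels-lead n l' (fine-step₀ fi))

  setFirst : Bool → List Site → List Site
  setFirst b [] = []
  setFirst b ((o , zero) ∷ s) = (o , zero) ∷ setFirst b s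
  setFirst b ((o , suc c) ∷ s) = (b , suc c) ∷ s

  start-lead : ∀ ev {x} → SValid K x s → firstMark (marks false s) ≡ true →
    Lead (start ev false false s) (start ev false false (setFirst false s))
  start-lead ev (bare {a = zero} le v) e = zero (start-lead (not ev) v e)
  start-lead ev (over {a = zero} {s = s} le l v) e rewrite start-not (not ev) false true s | xor-notʳ ev false =
    subst (λ cs → Lead ((just (not (ev xor false)) , false , 0) ∷ map negate cs₀) ((just (ev xor false) , false , 0) ∷ cs)) back
      (subst (λ e → Lead ((just (not (ev xor false)) , false , 0) ∷ map negate cs₀) ((just e , false , 0) ∷ map negate (map negate cs₀))) (not-involutive (ev xor false)) rest)
    where
    cs₀ : List Cell
    cs₀ = start (not ev) false true s
    back : map negate (map negate cs₀) ≡ cs₀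
    back = trans (sym (cong (map negate) (start-not (not ev) false true s))) (sym (start-not (not ev) true true s))
  start-lead ev (over {a = suc c} {s = s} le l v) e rewrite start-not (not ev) false true s | xor-notʳ ev false =
    subst (λ cs → Lead ((just (not (ev xor false)) , true , suc c) ∷ map negate cs₀) ((just (ev xor false) , false , suc c) ∷ cs)) back
      (subst (λ e → Lead ((just (not (ev xor false)) , true , suc c) ∷ map negate cs₀) ((just e , false , suc c) ∷ map negate (map negate cs₀))) (not-involutive (ev xor false)) first)
    where
    cs₀ : List Cell
    cs₀ = start (not ev) false true s
    back : map negate (map negate cs₀) ≡ cs₀
    back = trans (sym (cong (map negate) (start-not (not ev) false true s))) (sym (start-not (not ev) true true s))

  index : Bool → List (List Bool) → ℕ
  index b L = sum (map (changes b) L)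

  -- All cluster parities flip together with the parity that precedes them, so the changes remain.
  index-setFirst : ∀ n → SValid K x s → index (firstMark (marks false s)) (parities n s) ≡ index false (parities n (setFirst false s))
  index-setFirst {s = s} n v with firstMark (marks false s) in eq
  ... | true = sym (trans (cong (index false) (levels-lead n (start-lead false v eq) (fine-start false false false s unmarked))) (flips (parities n s)))
    where
    flips : ∀ L → index false (map (map not) L) ≡ index true L
    flips L = cong sum (trans (sym (map-∘ L)) (map-cong (changes-not true) L))
  ... | false = cong (λ s → index false (parities n s)) (unchanged v eq)
    where
    unchanged : ∀ {x s} → SValid K x s → firstMark (marks false s) ≡ false → s ≡ setFirst false s
    unchanged [] e = refl
    unchanged (bare {a = zero} le v) e = cong (_ ∷_) (unchanged v e)
    unchanged (bare {a = suc a} le v) e = refl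

  -- Nothing stands before the first nonempty site, so both cases of `SValid` demand the same: at
  -- most K parts there.
  svalid-setFirst : ∀ b → SValid K 0 s → SValid K 0 (setFirst b s)
  svalid-setFirst b [] = []
  svalid-setFirst b (bare {a = zero} le v) = bare le (svalid-setFirst b v)
  svalid-setFirst true (bare {a = suc a} le v) = over (<⇒≤ le) le v
  svalid-setFirst false (bare {a = suc a} le v) = bare le v
  svalid-setFirst true (over le l v) = over le l v
  svalid-setFirst false (over le l v) = bare l v

  normal-setFirst : ∀ b → NormalS s → NormalS (setFirst b s)
  normal-setFirst b [] = []
  normal-setFirst b last = last
  normal-setFirst {s = (o , zero) ∷ v ∷ s} b (cons nm) = lem v s (normal-setFirst b nm)
    where
    lem : ∀ v s → NormalS (setFirst b (v ∷ s)) → NormalS ((o , zero) ∷ setFirst b (v ∷ s))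
    lem (_ , zero) s nm = cons nm
    lem (_ , suc _) s nm = cons nm
  normal-setFirst {s = (o , suc c) ∷ v ∷ s} b (cons nm) = cons nm

  setMark : Bool → List Bool → List Bool
  setMark b [] = []
  setMark b (_ ∷ t) = b ∷ t

  marks-setFirst : ∀ b s → marks false (setFirst b s) ≡ setMark b (marks false s)
  marks-setFirst b [] = refl
  marks-setFirst b ((o , zero) ∷ s) = marks-setFirst b s
  marks-setFirst b ((o , suc c) ∷ s) = refl

  sizes-setFirst : ∀ b s → sizes (setFirst b s) ≡ sizes s
  sizes-setFirst b [] = refl
  sizes-setFirst b ((o , zero) ∷ s) = cong (0 ∷_) (sizes-setFirst b s)
  sizes-setFirst b ((o , suc c) ∷ s) = refl

  setFirst-setFirst : ∀ b s → SValid K x s → setFirst (firstMark (marks false s)) (setFirst b s) ≡ s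
  setFirst-setFirst b [] v = refl
  setFirst-setFirst b ((o , zero) ∷ s) (bare le v) = cong ((o , zero) ∷_) (setFirst-setFirst b s v)
  setFirst-setFirst b ((o , suc c) ∷ s) v = refl

  setFirst² : ∀ b s → firstMark (marks false s) ≡ false → setFirst false (setFirst b s) ≡ s
  setFirst² b [] e = refl
  setFirst² b ((o , zero) ∷ s) e = cong ((o , zero) ∷_) (setFirst² b s e)
  setFirst² b ((.false , suc c) ∷ s) refl = refl

  private
    valid-normal : ∀ {f p} → Normal (suc p) (f ++ [ 0 ]) → NormalF f
    valid-normal {[]} nm = []
    valid-normal {zero ∷ []} (cons ())
    valid-normal {suc a ∷ []} nm = last
    valid-normal {a ∷ b ∷ f} (cons nm) = cons (valid-normal {b ∷ f} {0} (lem f nm))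
      where
      lem : ∀ f {a} → Normal a (b ∷ f ++ [ 0 ]) → Normal 1 (b ∷ f ++ [ 0 ])
      lem [] nm = normal-any nm
      lem (_ ∷ f) nm = normal-any nm

    normal-valid : ∀ {f p} → NormalF f → Normal (suc p) (f ++ [ 0 ])
    normal-valid [] = zero
    normal-valid last = cons zero
    normal-valid (cons {b = b} {c = []} nm) = cons (normal-any (normal-valid {p = 0} nm))
    normal-valid (cons {b = b} {c = _ ∷ _} nm) = cons (normal-any (normal-valid {p = 0} nm))

    bounded-pad : ∀ f → x ≤ K → Bounded K x f → Bounded K x (f ++ [ 0 ])
    bounded-pad {x = x} {K} [] le [] = subst (_≤ K) (sym (+-identityʳ x)) le ∷ []
    bounded-pad {x = x} (r ∷ f) le (le' ∷ b) = le' ∷ bounded-pad f (≤-trans (m≤n+m r x) le') b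

    bounded-unpad : ∀ f → Bounded K x (f ++ [ 0 ]) → Bounded K x f
    bounded-unpad [] b = []
    bounded-unpad (r ∷ f) (le ∷ b) = le ∷ bounded-unpad f b

  core : List Site → List ℕ
  core s = unov (setFirst false s)

  core-valid : SValid K 0 s → NormalS s → Valid K (core s)
  core-valid v nm = let v' = svalid-setFirst false v in bounded-pad _ z≤n (unov-bounded v') , normal-valid (unov-normal v' (normal-setFirst false nm))

  IsSites : (K l m n : ℕ) → List Site → Set
  IsSites K l m n s = SValid K 0 s × NormalS s × index (firstMark (marks false s)) (parities K s) ≡ l
    × sum (sizes s) ≡ m × moment 1 (sizes s) ≡ n

  private
    Encodes : ℕ → Model → List Site → Set
    Encodes K (β , gs) s = marks false s ≡ β × Enc K (core s) gs

  module _ {K : ℕ} {β : List Bool} {gs : List (List ℕ)} {s : List Site} (v : SValid K 0 s) (nm : NormalS s) (en : Encodes K (β , gs) s) where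
    private
      v' : SValid K 0 (setFirst false s)
      v' = svalid-setFirst false v

      e : Enc K (core s) gs
      e = proj₂ en

    encodes-length : length β ≡ headOr0 (tails gs)
    encodes-length = trans (cong length (sym (proj₁ en))) (trans (sym (trans (cong length (marks-setFirst false s)) (len (marks false s))))
      (trans (length-marks false v') (enc-ones e (core-valid v nm))))
      where
      len : ∀ β → length (setMark false β) ≡ length β
      len [] = refl
      len (_ ∷ β) = refl

    encodes-index : index (firstMark (marks false s)) (parities K s) ≡ sum (map oddCount gs)
    encodes-index = trans (index-setFirst K v) (trans (cong (index false) (parities-unov K [] v')) (enc-parities e (core-valid v nm)))

    encodes-sum : sum (sizes s) ≡ sum (tails gs)
    encodes-sum = trans (cong sum (sym (sizes-setFirst false s))) (trans (sym (sum-unov (setFirst false s))) (enc-sum e))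

    encodes-moment : moment 1 (sizes s) ≡ base (tails gs) + (cost β + sum (map weight gs))
    encodes-moment = +-cancelʳ-≡ (weight (map bit (drop 1 β))) _ _ (trans
      (cong₂ _+_ (cong (moment 1) (sym (sizes-setFirst false s))) (trans (drop-first β) (cong (λ t → weight (map bit t)) (sym (trans (marks-setFirst false s) (cong (setMark false) (proj₁ en)))))))
      (trans (sym (moment-unov 1 false v')) (trans (enc-moment e) (sym (base-cost β (tails gs) (sum (map weight gs)) encodes-length)))))
      where
      drop-first : ∀ β → weight (map bit (drop 1 β)) ≡ weight (map bit (setMark false β))
      drop-first [] = refl
      drop-first (_ ∷ t) rewrite *-zeroʳ (length (map bit t)) = refl

  HasCount-Sites : ∀ K l m n → HasCount (IsSites K l m n) (rhsCoef (suc K) l m n)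
  HasCount-Sites K l m n = HasCount-transfer {P = IsModel K l m n} {Q = IsSites K l m n} (Encodes K)
    (λ { {β , gs} → fwd β gs }) (λ {s} → bwd s) (λ {a} {a'} {s} → injl {a} {a'} {s}) injr (HasCount-Model K l m n)
    where
    fwd : ∀ β gs → IsModel K l m n (β , gs) → ∃ λ s → IsSites K l m n s × Encodes K (β , gs) s
    fwd β gs (refl , eβ , el , em , en) with enc-surjective gs
    -- With the first bit cleared, the condition on `moves` is vacuous; the bit is restored
    -- afterwards by `setFirst`.
    ... | f , (bd , nmf) , enc with unov-surjective {x = 0} false f (setMark false β) (bounded-unpad f bd) (valid-normal nmf)
        (trans (len β) (trans eβ (sym (enc-ones enc (bd , nmf))))) (λ _ e → ⊥-elim (notTrue β e))
      where
      len : ∀ β → length (setMark false β) ≡ length β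
      len [] = refl
      len (_ ∷ β) = refl
      notTrue : ∀ β {t} → setMark false β ≡ true ∷ t → ⊥
      notTrue [] ()
      notTrue (_ ∷ _) ()
    ... | s₀ , v₀ , nm₀ , eu , emk = s₁ , (v , nm , trans (encodes-index v nm encs) el , trans (encodes-sum v nm encs) em , trans (encodes-moment v nm encs) en) , encs
      where
      s₁ : List Site
      s₁ = setFirst (firstMark β) s₀
      v : SValid K 0 s₁
      v = svalid-setFirst (firstMark β) v₀
      nm : NormalS s₁
      nm = normal-setFirst (firstMark β) nm₀
      unmark : ∀ β → setMark (firstMark β) (setMark false β) ≡ β
      unmark [] = refl
      unmark (_ ∷ _) = refl
      firstFalse : ∀ β → firstMark (setMark false β) ≡ false
      firstFalse [] = refl
      firstFalse (_ ∷ _) = refl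
      encs : Encodes K (β , gs) s₁
      encs = trans (marks-setFirst (firstMark β) s₀) (trans (cong (setMark (firstMark β)) emk) (unmark β))
        , subst (λ f → Enc K f gs) (trans (sym eu) (cong unov (sym (setFirst² (firstMark β) s₀ (trans (cong firstMark emk) (firstFalse β)))))) enc
    bwd : ∀ s → IsSites K l m n s → ∃ λ a → IsModel K l m n a × Encodes K a s
    bwd s (v , nm , el , em , en) with enc-total K (core s) (core-valid v nm)
    ... | gs , enc = (marks false s , gs) , (enc-length enc , encodes-length v nm (refl , enc)
        , trans (sym (encodes-index v nm (refl , enc))) el , trans (sym (encodes-sum v nm (refl , enc))) em , trans (sym (encodes-moment v nm (refl , enc))) en) , refl , enc
    injl : ∀ {a a' s} → Encodes K a s → Encodes K a' s → IsModel K l m n a → IsModel K l m n a' → a ≡ a'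
    injl (refl , e) (refl , e') _ _ = cong (_ ,_) (enc-functional e e')
    injr : ∀ {a s s'} → Encodes K a s → Encodes K a s' → IsSites K l m n s → IsSites K l m n s' → s ≡ s'
    injr {s = s} {s'} (em , e) (em' , e') (v , nm , _) (v' , nm' , _) = trans (sym (setFirst-setFirst false s v))
      (trans (cong₂ setFirst (cong firstMark (trans em (sym em')))
        (unov-injective false (svalid-setFirst false v) (svalid-setFirst false v') (normal-setFirst false nm) (normal-setFirst false nm')
          (enc-injective e e' refl (core-valid v nm) (core-valid v' nm'))
          (trans (marks-setFirst false s) (trans (cong (setMark false) (trans em (sym em'))) (sym (marks-setFirst false s'))))))
        (setFirst-setFirst false s' v'))

-- Overpartitions as sequences of sites

module Sites where
  open import Defs using (Part; val; ovl; ovpOK; diffOK; inBkk; count)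
  open Cells using (Site)
  open Overlines using (SValid; []; bare; over; NormalS; last; cons; sizes)
  open GreedyDeletion using (moment)
  open import Data.List.Relation.Unary.All.Properties using (++⁺; replicate⁺)

  private
    variable
      K x v w : ℕ
      o : Bool
      s : List Site

  block : ℕ → Bool → ℕ → List Part
  block v o zero = []
  block v o (suc c) = (v , o) ∷ replicate c (v , false)

  block-false : ∀ v c → block v false c ≡ replicate c (v , false)
  block-false v zero = refl
  block-false v (suc c) = refl

  -- The parts of the sites v, v + 1, …, in front of the smaller parts acc.
  expand : ℕ → List Part → List Site → List Part
  expand v acc [] = acc
  expand v acc ((o , c) ∷ s) = expand (suc v) (block v o c ++ acc) s

  add : ℕ → Bool → List Site → List Site
  add zero o s = s
  add (suc zero) o [] = (o , 1) ∷ []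
  add (suc zero) o ((_ , c) ∷ s) = (o , suc c) ∷ s
  add (suc (suc v)) o [] = (false , 0) ∷ add (suc v) o []
  add (suc (suc v)) o (u ∷ s) = u ∷ add (suc v) o s

  sitesOf : List Part → List Site
  sitesOf = foldr (λ p → add (val p) (ovl p)) []

  Sound : List Site → Set
  Sound = All (λ u → proj₂ u ≡ 0 → proj₁ u ≡ false)

  -- The last site is the w-th one, and nonempty.
  data Top : ℕ → Bool → List Site → Set where
    here  : ∀ {c} → Top 1 o ((o , suc c) ∷ [])
    there : ∀ {u} → Top (suc w) o s → Top (suc (suc w)) o (u ∷ s)

  private
    T-split : ∀ b {c} → T (b ∧ c) → T b × T c
    T-split true h = tt , h

    -- Where a part w or w̄ may be added.
    data Room : ℕ → List Site → Set where
      none  : Room w []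
      under : ∀ {s v o} → Top v o s → v < w → Room w s
      level : ∀ {s} → Top w false s → Room w s

    room-tail : ∀ {u s} → Room (suc (suc w)) (u ∷ s) → Room (suc w) s
    room-tail (under here l) = none
    room-tail (under (there t) (s≤s l)) = under t l
    room-tail (level (there t)) = level t

    expand-add : ∀ w v o acc s → Room (suc w) s → expand v acc (add (suc w) o s) ≡ (v + w , o) ∷ expand v acc s
    expand-add zero v o acc [] r rewrite +-identityʳ v = refl
    expand-add zero v o acc (u ∷ s) (under here (s≤s ()))
    expand-add zero v o acc (u ∷ s) (under (there t) (s≤s ()))
    expand-add zero v o acc (u ∷ []) (level here) rewrite +-identityʳ v = refl
    expand-add (suc w) v o acc [] r rewrite +-suc v w = expand-add w (suc v) o acc [] none
    expand-add (suc w) v o acc ((o' , c) ∷ s) r rewrite +-suc v w = expand-add w (suc v) o (block v o' c ++ acc) s (room-tail r)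

    top-add : ∀ w o s → Room (suc w) s → Top (suc w) o (add (suc w) o s)
    top-add zero o [] r = here
    top-add zero o (u ∷ s) (under here (s≤s ()))
    top-add zero o (u ∷ s) (under (there t) (s≤s ()))
    top-add zero o (u ∷ []) (level here) = here
    top-add (suc w) o [] r = there (top-add w o [] none)
    top-add (suc w) o (u ∷ s) r = there (top-add w o s (room-tail r))

    sound-add : ∀ w o s → Sound s → Sound (add w o s)
    sound-add zero o s h = h
    sound-add (suc zero) o [] h = (λ ()) ∷ []
    sound-add (suc zero) o (u ∷ s) (_ ∷ h) = (λ ()) ∷ h
    sound-add (suc (suc w)) o [] h = (λ _ → refl) ∷ sound-add (suc w) o [] []
    sound-add (suc (suc w)) o (u ∷ s) (h₀ ∷ h) = h₀ ∷ sound-add (suc w) o s h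

  top-normal : Top w o s → NormalS s
  top-normal here = last
  top-normal (there {s = _ ∷ _} t) = cons (top-normal t)

  private
    data Covers : List Part → List Site → Set where
      none : Covers [] []
      some : ∀ {r} → Top w o s → Covers ((w , o) ∷ r) s

    covers-normal : ∀ {r} → Covers r s → NormalS s
    covers-normal none = []
    covers-normal (some t) = top-normal t

    ovpOK-tail : ∀ p r → T (ovpOK (p ∷ r)) → T (ovpOK r)
    ovpOK-tail p [] h = tt
    ovpOK-tail p (q ∷ r) h = proj₂ (T-split ((val q <ᵇ val p) ∨ ((val q ≡ᵇ val p) ∧ not (ovl q))) (proj₂ (T-split (1 ≤ᵇ val p) h)))

    ovpOK-pos : ∀ p r → T (ovpOK (p ∷ r)) → 1 ≤ val p
    ovpOK-pos p [] h = ≤ᵇ⇒≤ 1 (val p) h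
    ovpOK-pos p (q ∷ r) h = ≤ᵇ⇒≤ 1 (val p) (proj₁ (T-split (1 ≤ᵇ val p) h))

    room : ∀ p r → T (ovpOK (p ∷ r)) → Covers r s → Room (val p) s
    room p [] h none = none
    room (w , o) ((v , o') ∷ r) h (some t) with Equivalence.to (T-∨ {v <ᵇ w}) (proj₁ (T-split ((v <ᵇ w) ∨ ((v ≡ᵇ w) ∧ not o')) (proj₂ (T-split (1 ≤ᵇ w) h))))
    ... | inj₁ l = under t (<ᵇ⇒< v w l)
    ... | inj₂ e with T-split (v ≡ᵇ w) e
    ... | e₁ , e₂ with ≡ᵇ⇒≡ v w e₁
    ... | refl = level (lem o' e₂ t)
      where
      lem : ∀ o' → T (not o') → Top w o' s → Top w false s
      lem false _ t = t

    covers : ∀ λs → T (ovpOK λs) → Covers λs (sitesOf λs)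
    covers [] h = none
    covers ((zero , o) ∷ r) h with () ← ovpOK-pos (zero , o) r h
    covers ((suc w , o) ∷ r) h = some (top-add w o (sitesOf r) (room (suc w , o) r h (covers r (ovpOK-tail (suc w , o) r h))))

  normal-sitesOf : ∀ λs → T (ovpOK λs) → NormalS (sitesOf λs)
  normal-sitesOf λs h = covers-normal (covers λs h)

  sound-sitesOf : ∀ λs → Sound (sitesOf λs)
  sound-sitesOf [] = []
  sound-sitesOf (p ∷ r) = sound-add (val p) (ovl p) (sitesOf r) (sound-sitesOf r)

  expand-sitesOf : ∀ λs → T (ovpOK λs) → expand 1 [] (sitesOf λs) ≡ λs
  expand-sitesOf [] h = refl
  expand-sitesOf ((zero , o) ∷ r) h with () ← ovpOK-pos (zero , o) r h
  expand-sitesOf ((suc w , o) ∷ r) h = trans (expand-add w 1 o [] (sitesOf r) (room (suc w , o) r h (covers r (ovpOK-tail (suc w , o) r h))))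
    (cong ((suc w , o) ∷_) (expand-sitesOf r (ovpOK-tail (suc w , o) r h)))

  private
    add-new : ∀ o t → add (suc (length t)) o t ≡ t ++ [ o , 1 ]
    add-new o [] = refl
    add-new o (u ∷ t) = cong (u ∷_) (add-new o t)

    add-last : ∀ o t {o' c} → add (suc (length t)) o (t ++ [ o' , c ]) ≡ t ++ [ o , suc c ]
    add-last o [] = refl
    add-last o (u ∷ t) = cong (u ∷_) (add-last o t)

    add-zero : ∀ w o t → length t ≤ w → add (suc (suc w)) o (t ++ [ false , 0 ]) ≡ add (suc (suc w)) o t
    add-zero w o [] l = refl
    add-zero (suc w) o (u ∷ t) (s≤s l) = cong (u ∷_) (add-zero w o t l)

    sitesOf-block : ∀ o c t acc → add (suc (length t)) false (sitesOf acc) ≡ t ++ [ false , 1 ] → add (suc (length t)) o (sitesOf acc) ≡ t ++ [ o , 1 ] →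
      sitesOf (block (suc (length t)) o (suc c) ++ acc) ≡ t ++ [ o , suc c ]
    sitesOf-block o zero t acc h h' = h'
    sitesOf-block o (suc c) t acc h h' = trans (cong (add (suc (length t)) o) (replicated c))
      (add-last o t)
      where
      replicated : ∀ c → add (suc (length t)) false (sitesOf (replicate c (suc (length t) , false) ++ acc)) ≡ t ++ [ false , suc c ]
      replicated zero = h
      replicated (suc c) = trans (cong (add (suc (length t)) false) (replicated c)) (add-last false t)

    sitesOf-suc : ∀ t acc o c → (∀ w o → length t ≤ w → add (suc w) o (sitesOf acc) ≡ add (suc w) o t) →
      sitesOf (block (suc (length t)) o (suc c) ++ acc) ≡ t ++ [ o , suc c ]
    sitesOf-suc t acc o c h = sitesOf-block o c t acc (trans (h (length t) false ≤-refl) (add-new false t)) (trans (h (length t) o ≤-refl) (add-new o t))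

    -- t is sitesOf acc up to zero sites at the end.
    sitesOf-expand : ∀ t acc u s → (∀ w o → length t ≤ w → add (suc w) o (sitesOf acc) ≡ add (suc w) o t) →
      Sound (u ∷ s) → NormalS (u ∷ s) → sitesOf (expand (suc (length t)) acc (u ∷ s)) ≡ t ++ u ∷ s
    sitesOf-expand t acc (o , suc c) [] h sd nm = sitesOf-suc t acc o c h
    sitesOf-expand t acc (o , suc c) (u ∷ s) h (_ ∷ sd) (cons nm) = trans (cong (λ n → sitesOf (expand (suc n) (block (suc (length t)) o (suc c) ++ acc) (u ∷ s))) (trans (+-comm 1 (length t)) (sym (length-++ t))))
      (trans (sitesOf-expand (t ++ [ o , suc c ]) (block (suc (length t)) o (suc c) ++ acc) u s (λ w o' _ → cong (add (suc w) o') (sitesOf-suc t acc o c h)) sd nm)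
        (++-assoc t _ _))
    sitesOf-expand t acc (o , zero) (u ∷ s) h (h₀ ∷ sd) (cons nm) with h₀ refl
    ... | refl = trans (cong (λ n → sitesOf (expand (suc n) acc (u ∷ s))) (trans (+-comm 1 (length t)) (sym (length-++ t))))
        (trans (sitesOf-expand (t ++ [ false , 0 ]) acc u s padded sd nm) (++-assoc t _ _))
      where
      padded : ∀ w o → length (t ++ [ false , 0 ]) ≤ w → add (suc w) o (sitesOf acc) ≡ add (suc w) o (t ++ [ false , 0 ])
      padded w o l with w | subst (_≤ w) (trans (length-++ t) (+-comm (length t) 1)) l
      ... | suc w | s≤s l' = trans (h (suc w) o (m≤n⇒m≤1+n l')) (sym (add-zero w o t l'))

  expand-injective : ∀ {s s'} → Sound s → Sound s' → NormalS s → NormalS s' → expand 1 [] s ≡ expand 1 [] s' → s ≡ s'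
  expand-injective sd sd' nm nm' e = trans (sym (inverse sd nm)) (trans (cong sitesOf e) (inverse sd' nm'))
    where
    inverse : ∀ {s} → Sound s → NormalS s → sitesOf (expand 1 [] s) ≡ s
    inverse {[]} sd nm = refl
    inverse {u ∷ s} sd nm = sitesOf-expand [] [] u s (λ _ _ _ → refl) sd nm

  sum-block : ∀ v o c acc → sum (map val (block v o c ++ acc)) ≡ v * c + sum (map val acc)
  sum-block v o zero acc rewrite *-zeroʳ v = refl
  sum-block v o (suc c) acc = trans (cong (v +_) (lem c)) (trans (sym (+-assoc v (v * c) _)) (cong (_+ sum (map val acc)) (sym (*-suc v c))))
    where
    lem : ∀ c → sum (map val (replicate c (v , false) ++ acc)) ≡ v * c + sum (map val acc)
    lem zero rewrite *-zeroʳ v = refl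
    lem (suc c) = trans (cong (v +_) (lem c)) (trans (sym (+-assoc v (v * c) _)) (cong (_+ sum (map val acc)) (sym (*-suc v c))))

  sum-expand : ∀ v acc s → sum (map val (expand v acc s)) ≡ moment v (sizes s) + sum (map val acc)
  sum-expand v acc [] = refl
  sum-expand v acc ((o , c) ∷ s) = trans (sum-expand (suc v) (block v o c ++ acc) s)
    (trans (cong (moment (suc v) (sizes s) +_) (sum-block v o c acc))
    (trans (sym (+-assoc (moment (suc v) (sizes s)) (v * c) _)) (cong (_+ sum (map val acc)) (+-comm (moment (suc v) (sizes s)) (v * c)))))

  length-block : ∀ v o c → length (block v o c) ≡ c
  length-block v o zero = refl
  length-block v o (suc c) = cong suc (length-replicate c)

  length-expand : ∀ v acc s → length (expand v acc s) ≡ sum (sizes s) + length acc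
  length-expand v acc [] = refl
  length-expand v acc ((o , c) ∷ s) = trans (length-expand (suc v) (block v o c ++ acc) s)
    (trans (cong (sum (sizes s) +_) (trans (length-++ (block v o c)) (cong (_+ length acc) (length-block v o c))))
    (trans (sym (+-assoc (sum (sizes s)) c _)) (cong (_+ length acc) (+-comm (sum (sizes s)) c))))

  Below : ℕ → List Part → Set
  Below v = All (λ p → val p < v)

  block-values : ∀ v o c → All (λ p → val p ≡ v) (block v o c)
  block-values v o zero = []
  block-values v o (suc c) = refl ∷ replicate⁺ c refl

  below-block : ∀ {v acc} o c → Below v acc → Below (suc v) (block v o c ++ acc)
  below-block {v} o c b = ++⁺ (All.map (λ e → s≤s (≤-reflexive e)) (block-values v o c)) (All.map m≤n⇒m≤1+n b)

  private
    ovpOK-replicate : ∀ v c acc → Below (suc v) acc → T (ovpOK acc) → T (ovpOK (replicate c (suc v , false) ++ acc))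
    ovpOK-replicate v zero acc b h = h
    ovpOK-replicate v (suc zero) [] b h = tt
    ovpOK-replicate v (suc zero) (p ∷ acc) (l ∷ b) h = Equivalence.from T-∧ (Equivalence.from T-∨ (inj₁ (<⇒<ᵇ l)) , h)
    ovpOK-replicate v (suc (suc c)) acc b h = Equivalence.from T-∧ (Equivalence.from T-∨ (inj₂ (Equivalence.from T-∧ (≡⇒≡ᵇ v v refl , tt))) , ovpOK-replicate v (suc c) acc b h)

    ovpOK-block : ∀ v o c acc → Below (suc v) acc → T (ovpOK acc) → T (ovpOK (block (suc v) o c ++ acc))
    ovpOK-block v o zero acc b h = h
    ovpOK-block v o (suc zero) [] b h = tt
    ovpOK-block v o (suc zero) (p ∷ acc) (l ∷ b) h = Equivalence.from T-∧ (Equivalence.from T-∨ (inj₁ (<⇒<ᵇ l)) , h)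
    ovpOK-block v o (suc (suc c)) acc b h = Equivalence.from T-∧ (Equivalence.from T-∨ (inj₂ (Equivalence.from T-∧ (≡⇒≡ᵇ v v refl , tt))) , ovpOK-replicate v (suc c) acc b h)

  ovpOK-expand : ∀ v acc s → Below (suc v) acc → T (ovpOK acc) → T (ovpOK (expand (suc v) acc s))
  ovpOK-expand v acc [] b h = h
  ovpOK-expand v acc ((o , c) ∷ s) b h = ovpOK-expand (suc v) _ s (below-block o c b) (ovpOK-block v o c acc b h)

  private
    apart : Part → List Part → Bool
    apart p [] = true
    apart p (q ∷ _) = (val q + (if ovl p then 1 else 2)) ≤ᵇ val p

    diffOK-∷ : ∀ K p r → diffOK (suc K) (p ∷ r) ≡ apart p (drop K (p ∷ r)) ∧ diffOK (suc K) r
    diffOK-∷ K p r with drop K (p ∷ r)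
    ... | [] = refl
    ... | q ∷ _ = refl

    Close Far : Part → Part → Set
    Close p q = val p < val q + (if ovl p then 1 else 2)
    Far p q = val q + (if ovl p then 1 else 2) ≤ val p

    -- The parts close to `p` come first in the list, so the part at distance K is far from `p` only
    -- if at most K parts are close.
    apart⁻ : ∀ {p} K A R → All (Close p) A → T (apart p (drop K (A ++ R))) → length A ≤ K
    apart⁻ K [] R cl h = z≤n
    apart⁻ {p} zero (q ∷ A) R (l ∷ cl) h = ⊥-elim (<-irrefl refl (≤-trans l (≤ᵇ⇒≤ _ (val p) h)))
    apart⁻ {p} (suc K) (q ∷ A) R (l ∷ cl) h = s≤s (apart⁻ {p} K A R cl h)

    apart⁺ : ∀ {p} K A R → All (Far p) R → length A ≤ K → T (apart p (drop K (A ++ R)))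
    apart⁺ zero [] [] fr l = tt
    apart⁺ zero [] (q ∷ R) (f ∷ fr) l = ≤⇒≤ᵇ f
    apart⁺ (suc K) [] [] fr l = tt
    apart⁺ {p} (suc K) [] (q ∷ R) (f ∷ fr) l = apart⁺ {p} K [] R fr z≤n
    apart⁺ {p} (suc K) (q ∷ A) R fr (s≤s l) = apart⁺ {p} K A R fr l

    -- What a new site v + 1 must know of the parts below it: those equal to v, x in number, stand
    -- in front of the smaller ones.
    Layered : ℕ → ℕ → List Part → Set
    Layered v x acc = ∃ λ A → ∃ λ R → acc ≡ A ++ R × All (λ p → val p ≡ v) A × length A ≡ x × Below v R

    layered-below : ∀ {v x acc} → Layered v x acc → Below (suc v) acc
    layered-below (A , R , refl , eq , _ , b) = ++⁺ (All.map (λ e → s≤s (≤-reflexive e)) eq) (All.map m≤n⇒m≤1+n b)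

    layered-block : ∀ {v x acc} o c → Layered v x acc → Layered (suc v) c (block (suc v) o c ++ acc)
    layered-block {v} o c l = block (suc v) o c , _ , refl , block-values (suc v) o c , length-block (suc v) o c , layered-below l

    diffOK-replicate⁻ : ∀ {v x acc} c → x ≤ K → Layered v x acc → T (diffOK (suc K) (replicate c (suc v , false) ++ acc)) →
      T (diffOK (suc K) acc) × x + c ≤ K
    diffOK-replicate⁻ {K} {x = x} zero le ly h = h , subst (_≤ K) (sym (+-identityʳ x)) le
    diffOK-replicate⁻ {K} {v} {x} (suc c) le ly@(A , R , refl , eq , refl , b) h
      with T-split (apart (suc v , false) (drop K (replicate (suc c) (suc v , false) ++ A ++ R))) (subst T (diffOK-∷ K (suc v , false) _) h)
    ... | h₁ , h₂ = proj₁ (diffOK-replicate⁻ c le ly h₂) , subst (_≤ K) (trans (length-++ (replicate (suc c) (suc v , false))) (trans (cong (_+ length A) (length-replicate (suc c))) (+-comm (suc c) (length A))))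
        (apart⁻ {suc v , false} K (replicate (suc c) (suc v , false) ++ A) R
          (++⁺ (replicate⁺ (suc c) (s≤s (≤-trans (n≤1+n _) (≤-reflexive (+-comm 2 v)))))  (All.map (λ { refl → ≤-reflexive (+-comm 2 v) }) eq))
          (subst (λ r → T (apart (suc v , false) (drop K r))) (sym (++-assoc (replicate (suc c) (suc v , false)) A R)) h₁))

    diffOK-replicate⁺ : ∀ {v x acc} c → Layered v x acc → T (diffOK (suc K) acc) → x + c ≤ K →
      T (diffOK (suc K) (replicate c (suc v , false) ++ acc))
    diffOK-replicate⁺ zero ly h le = h
    diffOK-replicate⁺ {K} {v} {x} (suc c) ly@(A , R , refl , eq , refl , b) h le = subst T (sym (diffOK-∷ K (suc v , false) _))
      (Equivalence.from T-∧ (subst (λ r → T (apart (suc v , false) (drop K r))) (++-assoc (replicate (suc c) (suc v , false)) A R)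
        (apart⁺ {suc v , false} K (replicate (suc c) (suc v , false) ++ A) R (All.map (λ {q} l → subst (_≤ suc v) (+-comm 2 (val q)) (s≤s l)) b)
          (subst (_≤ K) (sym (trans (length-++ (replicate (suc c) (suc v , false))) (trans (cong (_+ length A) (length-replicate (suc c))) (+-comm (suc c) (length A))))) le))
      , diffOK-replicate⁺ c ly h (≤-trans (+-monoʳ-≤ (length A) (n≤1+n c)) le)))

    diffOK-over⁻ : ∀ {v x acc} c → x ≤ K → Layered v x acc → T (diffOK (suc K) (block (suc v) true (suc c) ++ acc)) →
      T (diffOK (suc K) acc) × x + c ≤ K × suc c ≤ K
    diffOK-over⁻ {K} {v} c le ly h
      with T-split (apart (suc v , true) (drop K (block (suc v) true (suc c) ++ _))) (subst T (diffOK-∷ K (suc v , true) _) h)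
    ... | h₁ , h₂ with diffOK-replicate⁻ c le ly h₂
    ... | h₃ , l = h₃ , l , subst (_≤ K) (length-block (suc v) true (suc c))
      (apart⁻ {suc v , true} K (block (suc v) true (suc c)) _ (All.map (λ { refl → ≤-reflexive (+-comm 1 (suc v)) }) (block-values (suc v) true (suc c))) h₁)

    diffOK-over⁺ : ∀ {v x acc} c → Layered v x acc → T (diffOK (suc K) acc) → x + c ≤ K → suc c ≤ K →
      T (diffOK (suc K) (block (suc v) true (suc c) ++ acc))
    diffOK-over⁺ {K} {v} c ly h l l' = subst T (sym (diffOK-∷ K (suc v , true) _))
      (Equivalence.from T-∧ (apart⁺ {suc v , true} K (block (suc v) true (suc c)) _ (All.map (λ {q} l → subst (_≤ suc v) (+-comm 1 (val q)) l) (layered-below ly))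
        (subst (_≤ K) (sym (length-block (suc v) true (suc c))) l') , diffOK-replicate⁺ c ly h l))

    diffOK-drop : ∀ A R → T (diffOK (suc K) (A ++ R)) → T (diffOK (suc K) R)
    diffOK-drop [] R h = h
    diffOK-drop {K} (p ∷ A) R h = diffOK-drop A R (proj₂ (T-split (apart p (drop K (p ∷ A ++ R))) (subst T (diffOK-∷ K p (A ++ R)) h)))

    diffOK-expand : ∀ v acc s → T (diffOK (suc K) (expand v acc s)) → T (diffOK (suc K) acc)
    diffOK-expand v acc [] h = h
    diffOK-expand v acc ((o , c) ∷ s) h = diffOK-drop (block v o c) acc (diffOK-expand (suc v) _ s h)

  -- For a non-overlined part the close parts are those of its own site behind it, itself included,
  -- and of the previous site; for an overlined one only those of its own site.
  diffOK-svalid : ∀ {v x acc} s → x ≤ K → Layered v x acc → Sound s → T (diffOK (suc K) (expand (suc v) acc s)) → SValid K x s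
  diffOK-svalid [] le ly sd h = []
  diffOK-svalid {K} {v} {x} {acc} ((false , c) ∷ s) le ly (_ ∷ sd) h
    with diffOK-replicate⁻ c le ly (subst (λ b → T (diffOK (suc K) (b ++ acc))) (block-false (suc v) c) (diffOK-expand (suc (suc v)) _ s h))
  ... | _ , l = bare l (diffOK-svalid s (m+n≤o⇒n≤o x l) (layered-block false c ly) sd h)
  diffOK-svalid ((true , zero) ∷ s) le ly (h₀ ∷ sd) h with () ← h₀ refl
  diffOK-svalid {v = v} ((true , suc c) ∷ s) le ly (_ ∷ sd) h with diffOK-over⁻ c le ly (diffOK-expand (suc (suc v)) _ s h)
  ... | _ , l , l' = over l l' (diffOK-svalid s l' (layered-block true (suc c) ly) sd h)

  svalid-diffOK : ∀ {v x acc s} → SValid K x s → Layered v x acc → T (diffOK (suc K) acc) → T (diffOK (suc K) (expand (suc v) acc s))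
  svalid-diffOK [] ly h = h
  svalid-diffOK {K} {v} {acc = acc} (bare {a = c} l sv) ly h = svalid-diffOK sv (layered-block false c ly)
    (subst (λ b → T (diffOK (suc K) (b ++ acc))) (sym (block-false (suc v) c)) (diffOK-replicate⁺ c ly h l))
  svalid-diffOK (over {a = c} l l' sv) ly h = svalid-diffOK sv (layered-block true (suc c) ly) (diffOK-over⁺ c ly h l l')

  svalid-sound : ∀ {s} → SValid K x s → Sound s
  svalid-sound [] = []
  svalid-sound (bare l sv) = (λ _ → refl) ∷ svalid-sound sv
  svalid-sound (over l l' sv) = (λ ()) ∷ svalid-sound sv

  count-++ : {A : Set} (p : A → Bool) → ∀ xs ys → count p (xs ++ ys) ≡ count p xs + count p ys
  count-++ p [] ys = refl
  count-++ p (x ∷ xs) ys with p x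
  ... | true = cong suc (count-++ p xs ys)
  ... | false = count-++ p xs ys

  count-none : {A : Set} (p : A → Bool) → ∀ {xs} → All (λ x → p x ≡ false) xs → count p xs ≡ 0
  count-none p [] = refl
  count-none p {x ∷ xs} (e ∷ h) rewrite e = count-none p h

  private
    count-unit : ∀ v acc s → count (λ p → (val p ≡ᵇ 1) ∧ not (ovl p)) (expand (suc (suc v)) acc s) ≡ count (λ p → (val p ≡ᵇ 1) ∧ not (ovl p)) acc
    count-unit v acc [] = refl
    count-unit v acc ((o , c) ∷ s) = trans (count-unit (suc v) _ s) (trans (count-++ _ (block (suc (suc v)) o c) acc)
      (cong (_+ count (λ p → (val p ≡ᵇ 1) ∧ not (ovl p)) acc) (count-none _ (All.map (λ { refl → refl }) (block-values (suc (suc v)) o c)))))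

    few-units : ∀ s → SValid K x s → count (λ p → (val p ≡ᵇ 1) ∧ not (ovl p)) (expand 1 [] s) ≤ K
    few-units [] sv = z≤n
    few-units {K} {x} ((o , c) ∷ s) sv = subst (_≤ K) (sym (count-unit 0 _ s))
      (≤-trans (length-filter _ (block 1 o c ++ [])) (≤-trans (≤-reflexive (trans (cong length (++-identityʳ (block 1 o c))) (length-block 1 o c))) (size sv)))
      where
      size : ∀ {o c s} → SValid K x ((o , c) ∷ s) → c ≤ K
      size (bare l sv) = m+n≤o⇒n≤o x l
      size (over l l' sv) = l'

    nothing-below : Layered 0 0 []
    nothing-below = [] , [] , refl , [] , refl , []

  inBkk-svalid : ∀ s → Sound s → T (inBkk (suc K) (expand 1 [] s)) → SValid K 0 s
  inBkk-svalid {K} s sd h = diffOK-svalid s z≤n nothing-below sd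
    (proj₂ (T-split (count (λ p → (val p ≡ᵇ 1) ∧ not (ovl p)) (expand 1 [] s) ≤ᵇ K) h))

  svalid-inBkk : ∀ {s} → SValid K 0 s → T (inBkk (suc K) (expand 1 [] s))
  svalid-inBkk sv = Equivalence.from T-∧ (≤⇒≤ᵇ (few-units _ sv) , svalid-diffOK sv nothing-below tt)

-- The Gordon marking, site by site

module GordonMarking where
  open import Defs using (Part; val; ovl; MPart; mpart; tag; mval; movl; mark; tagParts; before; insertOrd; increasing; elemᵇ; leastFree; dropMin; markOne; markAll; gordon)
  open Cells using (Site; peel)
  open Sites
  open Overlines using (marks)
  open Paths using (firstMark)
  open import Data.List.Relation.Unary.All.Properties using (++⁺; replicate⁺)
  open import Data.List.Relation.Unary.AllPairs using (AllPairs; []; _∷_)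
  import Data.List.Relation.Unary.AllPairs.Properties as AllPairs
  open import Data.List.Relation.Unary.Unique.Propositional using (Unique)

  private
    variable
      A B : Set

  ≡ᵇ-refl : ∀ n → (n ≡ᵇ n) ≡ true
  ≡ᵇ-refl zero = refl
  ≡ᵇ-refl (suc n) = ≡ᵇ-refl n

  <⇒≡ᵇ-false : ∀ {m n} → m < n → (m ≡ᵇ n) ≡ false
  <⇒≡ᵇ-false {zero} {suc n} l = refl
  <⇒≡ᵇ-false {suc m} {suc n} (s≤s l) = <⇒≡ᵇ-false l

  >⇒≡ᵇ-false : ∀ {m n} → n < m → (m ≡ᵇ n) ≡ false
  >⇒≡ᵇ-false {suc m} {zero} l = refl
  >⇒≡ᵇ-false {suc m} {suc n} (s≤s l) = >⇒≡ᵇ-false l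

  ≥⇒<ᵇ-false : ∀ {m n} → n ≤ m → (m <ᵇ n) ≡ false
  ≥⇒<ᵇ-false {m} {zero} l = refl
  ≥⇒<ᵇ-false {suc m} {suc n} (s≤s l) = ≥⇒<ᵇ-false l

  part : MPart → Part
  part q = mval q , movl q

  Marked : Set
  Marked = Part × ℕ

  untag : MPart → Marked
  untag q = part q , mark q

  ascending : ℕ → List Site → List Part
  ascending v [] = []
  ascending v ((o , c) ∷ s) = block v o c ++ ascending (suc v) s

  private
    beforePart : Part → Part → Bool
    beforePart (a , o) (b , o') = (a <ᵇ b) ∨ ((a ≡ᵇ b) ∧ o ∧ not o')

    insertPart : Part → List Part → List Part
    insertPart x [] = [ x ]
    insertPart x (y ∷ ys) = if beforePart x y then x ∷ y ∷ ys else y ∷ insertPart x ys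

    part-insertOrd : ∀ x ys → map part (insertOrd x ys) ≡ insertPart (part x) (map part ys)
    part-insertOrd x [] = refl
    part-insertOrd x (y ∷ ys) with before x y
    ... | true = refl
    ... | false = cong (part y ∷_) (part-insertOrd x ys)

    part-increasing : ∀ i λs → map part (foldr insertOrd [] (tagParts i λs)) ≡ foldr insertPart [] λs
    part-increasing i [] = refl
    part-increasing i (p ∷ λs) = trans (part-insertOrd (mpart i (val p) (ovl p) 0) (foldr insertOrd [] (tagParts (suc i) λs)))
      (cong (insertPart p) (part-increasing (suc i) λs))

    insert-last : ∀ v ys → Below (suc v) ys → insertPart (v , false) ys ≡ ys ++ [ v , false ]
    insert-last v [] b = refl
    insert-last v (y ∷ ys) (s≤s l ∷ b) rewrite ≥⇒<ᵇ-false l | ∧-zeroʳ (v ≡ᵇ val y) = cong (y ∷_) (insert-last v ys b)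

    insert-over : ∀ v c ys → Below v ys → insertPart (v , true) (ys ++ replicate c (v , false)) ≡ ys ++ (v , true) ∷ replicate c (v , false)
    insert-over v zero [] b = refl
    insert-over v (suc c) [] b rewrite ≥⇒<ᵇ-false (≤-refl {v}) | ≡ᵇ-refl v = refl
    insert-over v c (y ∷ ys) (l ∷ b) rewrite ≥⇒<ᵇ-false (<⇒≤ l) | >⇒≡ᵇ-false l = cong (y ∷_) (insert-over v c ys b)

    replicate-snoc : ∀ c (x : A) → replicate c x ++ [ x ] ≡ x ∷ replicate c x
    replicate-snoc zero x = refl
    replicate-snoc (suc c) x = cong (x ∷_) (replicate-snoc c x)

    insert-replicate : ∀ v c acc ys → foldr insertPart [] acc ≡ ys → Below v ys →
      foldr insertPart [] (replicate c (v , false) ++ acc) ≡ ys ++ replicate c (v , false)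
    insert-replicate v zero acc ys e b = trans e (sym (++-identityʳ ys))
    insert-replicate v (suc c) acc ys e b = trans (cong (insertPart (v , false)) (insert-replicate v c acc ys e b))
      (trans (insert-last v (ys ++ replicate c (v , false)) (++⁺ (All.map m≤n⇒m≤1+n b) (replicate⁺ c ≤-refl)))
      (trans (++-assoc ys _ _) (cong (ys ++_) (replicate-snoc c (v , false)))))

    insert-block : ∀ v o c acc ys → foldr insertPart [] acc ≡ ys → Below v ys →
      foldr insertPart [] (block v o c ++ acc) ≡ ys ++ block v o c
    insert-block v o zero acc ys e b = trans e (sym (++-identityʳ ys))
    insert-block v false (suc c) acc ys e b = insert-replicate v (suc c) acc ys e b
    insert-block v true (suc c) acc ys e b = trans (cong (insertPart (v , true)) (insert-replicate v c acc ys e b)) (insert-over v c ys b)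

    sort-expand : ∀ v acc s ys → foldr insertPart [] acc ≡ ys → Below v ys →
      foldr insertPart [] (expand v acc s) ≡ ys ++ ascending v s
    sort-expand v acc [] ys e b = trans e (sym (++-identityʳ ys))
    sort-expand v acc ((o , c) ∷ s) ys e b = trans (sort-expand (suc v) _ s (ys ++ block v o c) (insert-block v o c acc ys e b)
      (++⁺ (All.map m≤n⇒m≤1+n b) (All.map (λ e → s≤s (≤-reflexive e)) (block-values v o c)))) (++-assoc ys _ _)

    insertOrd-all : {P : MPart → Set} → ∀ {x ys} → P x → All P ys → All P (insertOrd x ys)
    insertOrd-all p [] = p ∷ []
    insertOrd-all {x = x} {y ∷ ys} p (q ∷ h) with before x y
    ... | true = p ∷ q ∷ h
    ... | false = q ∷ insertOrd-all p h

    Apart : MPart → MPart → Set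
    Apart x y = tag x ≢ tag y

    insertOrd-apart : ∀ {x ys} → All (Apart x) ys → AllPairs Apart ys → AllPairs Apart (insertOrd x ys)
    insertOrd-apart [] [] = [] ∷ []
    insertOrd-apart {x} {y ∷ ys} (p ∷ h) (q ∷ k) with before x y
    ... | true = (p ∷ h) ∷ q ∷ k
    ... | false = insertOrd-all (λ e → p (sym e)) q ∷ insertOrd-apart h k

    increasing-apart : ∀ i λs → AllPairs Apart (foldr insertOrd [] (tagParts i λs)) × All (λ q → i ≤ tag q) (foldr insertOrd [] (tagParts i λs))
    increasing-apart i [] = [] , []
    increasing-apart i (p ∷ λs) with increasing-apart (suc i) λs
    ... | u , b = insertOrd-apart (All.map (λ l e → <-irrefl e l) b) u , insertOrd-all ≤-refl (All.map (≤-trans (n≤1+n i)) b)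

    tag-markAll : ∀ λs done xs → map tag (markAll λs done xs) ≡ map tag done ++ map tag xs
    tag-markAll λs done [] = sym (++-identityʳ _)
    tag-markAll λs done (x ∷ xs) = trans (tag-markAll λs _ xs) (trans (cong (_++ map tag xs) (map-++ tag done _)) (++-assoc (map tag done) _ _))

  unique-gordon : ∀ λs → Unique (map tag (gordon λs))
  unique-gordon λs = subst Unique (sym (tag-markAll λs [] (increasing λs))) (AllPairs.map⁺ (proj₁ (increasing-apart 0 λs)))

  -- The marks of a site as bits, the i-th one for the mark i + 1.
  hd : List Bool → Bool
  hd [] = false
  hd (b ∷ _) = b

  tl : List Bool → List Bool
  tl [] = []
  tl (_ ∷ t) = t

  nth : ℕ → List Bool → Bool
  nth zero t = hd t
  nth (suc j) t = nth j (tl t)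

  positions : ℕ → List Bool → List ℕ
  positions i [] = []
  positions i (true ∷ t) = i ∷ positions (suc i) t
  positions i (false ∷ t) = positions (suc i) t

  -- The c smallest marks that are not forbidden.
  fill : ℕ → List Bool → List Bool
  fill zero F = []
  fill (suc c) [] = true ∷ fill c []
  fill (suc c) (false ∷ F) = true ∷ fill c F
  fill (suc c) (true ∷ F) = false ∷ fill (suc c) F

  clear : List Bool → List Bool
  clear [] = []
  clear (true ∷ t) = false ∷ t
  clear (false ∷ t) = false ∷ clear t

  column : Bool → ℕ → List Bool → List Bool
  column o c prev = fill c (if o then clear prev else prev)

  marked : ℕ → List Bool → List Site → List Marked
  marked v prev [] = []
  marked v prev ((o , c) ∷ s) = zip (block v o c) (positions 1 (column o c prev)) ++ marked (suc v) (column o c prev) s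

  mutual
    search : List ℕ → ℕ → ℕ → ℕ
    search = _

    -- Unifying the two sides names the local function of leastFree.
    leastFree-search : ∀ fs → leastFree fs ≡ (if elemᵇ 1 fs then search fs (length fs) 2 else 1)
    leastFree-search fs with length fs | 2
    ... | f | c = refl

  private
    search-least : ∀ fs f c {i} → c ≤ i → (∀ u → 1 ≤ u → u < i → elemᵇ u fs ≡ true) → elemᵇ i fs ≡ false → 1 ≤ c → i ≤ c + f → search fs f c ≡ i
    search-least fs zero c le low e p b = ≤-antisym le (≤-trans b (≤-reflexive (+-identityʳ c)))
    search-least fs (suc f) c {i} le low e p b with m≤n⇒m<n∨m≡n le
    ... | inj₁ l rewrite low c p l = search-least fs f (suc c) l low e (s≤s z≤n) (≤-trans b (≤-reflexive (+-suc c f)))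
    ... | inj₂ refl rewrite e = refl

  leastFree-least : ∀ fs {i} → 1 ≤ i → (∀ u → 1 ≤ u → u < i → elemᵇ u fs ≡ true) → elemᵇ i fs ≡ false → i ≤ suc (length fs) → leastFree fs ≡ i
  leastFree-least fs {suc zero} p low e b = trans (leastFree-search fs) (cong (if_then search fs (length fs) 2 else 1) e)
  leastFree-least fs {suc (suc i)} p low e b = trans (leastFree-search fs) (trans (cong (if_then search fs (length fs) 2 else 1) (low 1 (s≤s z≤n) (s≤s (s≤s z≤n))))
    (search-least fs (length fs) 2 (s≤s (s≤s z≤n)) low e (s≤s z≤n) (m≤n⇒m≤1+n b)))

  private

    trues : List Bool → ℕ
    trues [] = 0
    trues (true ∷ F) = suc (trues F)
    trues (false ∷ F) = trues F

    -- The marks i, i + 1, … that are in fs.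
    Agree : List ℕ → ℕ → List Bool → Set
    Agree fs i [] = ∀ j → i ≤ j → elemᵇ j fs ≡ false
    Agree fs i (b ∷ F) = elemᵇ i fs ≡ b × Agree fs (suc i) F

    agree-ext : ∀ fs fs' i F → (∀ j → i ≤ j → elemᵇ j fs' ≡ elemᵇ j fs) → Agree fs i F → Agree fs' i F
    agree-ext fs fs' i [] h a j l = trans (h j l) (a j l)
    agree-ext fs fs' i (b ∷ F) h (e , a) = trans (h i ≤-refl) e , agree-ext fs fs' (suc i) F (λ j l → h j (<⇒≤ l)) a

    -- State of the search for the least free mark: everything below i is forbidden, `F` describes
    -- the marks from i on, and the bound on i keeps the answer within the fuel of `leastFree`.
    Inv : List ℕ → ℕ → List Bool → Set
    Inv fs i F = 1 ≤ i × (∀ u → 1 ≤ u → u < i → elemᵇ u fs ≡ true) × Agree fs i F × i + trues F ≤ suc (length fs)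

    low-suc : ∀ fs {i} → (∀ u → 1 ≤ u → u < i → elemᵇ u fs ≡ true) → elemᵇ i fs ≡ true → ∀ u → 1 ≤ u → u < suc i → elemᵇ u fs ≡ true
    low-suc fs low e u p (s≤s l) with m≤n⇒m<n∨m≡n l
    ... | inj₁ l' = low u p l'
    ... | inj₂ refl = e

    inv-skip : ∀ {fs i F} → Inv fs i (true ∷ F) → Inv fs (suc i) F
    inv-skip {fs} {i} {F} (p , low , (e , a) , b) = s≤s z≤n , low-suc fs low e , a , subst (_≤ suc (length fs)) (+-suc i (trues F)) b

    elem-mid : ∀ j xs i ys → elemᵇ j ((xs ++ [ i ]) ++ ys) ≡ (i ≡ᵇ j) ∨ elemᵇ j (xs ++ ys)
    elem-mid j [] i ys = refl
    elem-mid j (x ∷ xs) i ys = trans (cong ((x ≡ᵇ j) ∨_) (elem-mid j xs i ys)) (lem (x ≡ᵇ j) (i ≡ᵇ j))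
      where
      lem : ∀ a b {c} → a ∨ b ∨ c ≡ b ∨ a ∨ c
      lem false b = refl
      lem true b = sym (∨-zeroʳ b)

    inv-used : ∀ {xs ys i} F F' → Inv (xs ++ ys) i F → Agree (xs ++ ys) (suc i) F' → trues F' ≡ trues F → Inv ((xs ++ [ i ]) ++ ys) (suc i) F'
    inv-used {xs} {ys} {i} F F' (p , low , _ , b) a e = s≤s z≤n
      , low-suc ((xs ++ [ i ]) ++ ys) (λ u q l → trans (elem-mid u xs i ys) (trans (cong ((i ≡ᵇ u) ∨_) (low u q l)) (∨-zeroʳ _)))
          (trans (elem-mid i xs i ys) (cong (_∨ elemᵇ i (xs ++ ys)) (≡ᵇ-refl i)))
      , agree-ext (xs ++ ys) _ (suc i) F' (λ j l → trans (elem-mid j xs i ys) (cong (_∨ elemᵇ j (xs ++ ys)) (<⇒≡ᵇ-false l))) a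
      , s≤s (subst₂' (cong (i +_) (sym e)) (lengths xs) b)
      where
      subst₂' : ∀ {a b c d} → a ≡ b → c ≡ d → a ≤ c → b ≤ d
      subst₂' refl refl l = l
      lengths : ∀ xs → suc (length (xs ++ ys)) ≡ length ((xs ++ [ i ]) ++ ys)
      lengths [] = refl
      lengths (x ∷ xs) = cong suc (lengths xs)

    elem-positions : ∀ j i F → j < i → elemᵇ j (positions i F) ≡ false
    elem-positions j i [] l = refl
    elem-positions j i (true ∷ F) l rewrite >⇒≡ᵇ-false l = elem-positions j (suc i) F (m≤n⇒m≤1+n l)
    elem-positions j i (false ∷ F) l = elem-positions j (suc i) F (m≤n⇒m≤1+n l)

    agree-positions : ∀ i F → Agree (positions i F) i F
    agree-positions i [] j l = refl
    agree-positions i (true ∷ F) rewrite ≡ᵇ-refl i = refl , agree-ext (positions (suc i) F) (i ∷ positions (suc i) F) (suc i) F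
      (λ j l → cong (_∨ elemᵇ j (positions (suc i) F)) (<⇒≡ᵇ-false l)) (agree-positions (suc i) F)
    agree-positions i (false ∷ F) = elem-positions i (suc i) F ≤-refl , agree-positions (suc i) F

    length-positions : ∀ i F → length (positions i F) ≡ trues F
    length-positions i [] = refl
    length-positions i (true ∷ F) = cong suc (length-positions (suc i) F)
    length-positions i (false ∷ F) = length-positions (suc i) F

    trues-fill : ∀ c F → trues (fill c F) ≡ c
    trues-fill zero F = refl
    trues-fill (suc c) [] = cong suc (trues-fill c [])
    trues-fill (suc c) (false ∷ F) = cong suc (trues-fill c F)
    trues-fill (suc c) (true ∷ F) = trues-fill (suc c) F

    inv-positions : ∀ F → Inv (positions 1 F) 1 F
    inv-positions F = s≤s z≤n , (λ { (suc _) _ (s≤s ()) }) , agree-positions 1 F , s≤s (≤-reflexive (sym (length-positions 1 F)))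

    foldr-⊓ : ∀ x i t → x < i → foldr _⊓_ x (positions i t) ≡ x
    foldr-⊓ x i [] l = refl
    foldr-⊓ x i (true ∷ t) l = trans (cong (i ⊓_) (foldr-⊓ x (suc i) t (m≤n⇒m≤1+n l))) (m≥n⇒m⊓n≡n (<⇒≤ l))
    foldr-⊓ x i (false ∷ t) l = foldr-⊓ x (suc i) t (m≤n⇒m≤1+n l)

    dropMin-positions : ∀ i t → dropMin (positions i t) ≡ positions i (clear t)
    dropMin-positions i [] = refl
    dropMin-positions i (true ∷ t) rewrite foldr-⊓ i (suc i) t ≤-refl | ≡ᵇ-refl i = refl
    dropMin-positions i (false ∷ t) = dropMin-positions (suc i) t

    hasBar : List Part → ℕ → Bool
    hasBar λs v = any (λ p → (val p ≡ᵇ v) ∧ ovl p) λs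

    same prev : ℕ → List Marked → List ℕ
    same v done = map proj₂ (filterᵇ (λ d → val (proj₁ d) ≡ᵇ v) done)
    prev v done = map proj₂ (filterᵇ (λ d → suc (val (proj₁ d)) ≡ᵇ v) done)

    barred : List Part → ℕ → List Marked → List ℕ
    barred λs v done = if hasBar λs v then dropMin (prev v done) else prev v done

    markList : List Part → List Marked → List Part → List Marked
    markList λs done [] = done
    markList λs done (p ∷ ps) = markList λs (done ++ [ p , leastFree (same (val p) done ++ barred λs (val p) done) ]) ps

    map-filter : {C : Set} (f : B → C) (g : A → B) (P : B → Bool) → ∀ xs → map f (filterᵇ P (map g xs)) ≡ map (f ∘ g) (filterᵇ (P ∘ g) xs)
    map-filter f g P [] = refl
    map-filter f g P (x ∷ xs) with P (g x)
    ... | true = cong (f (g x) ∷_) (map-filter f g P xs)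
    ... | false = map-filter f g P xs

    untag-markAll : ∀ λs done xs → map untag (markAll λs done xs) ≡ markList λs (map untag done) (map part xs)
    untag-markAll λs done [] = refl
    untag-markAll λs done (x ∷ xs) = trans (untag-markAll λs (done ++ [ markOne λs done x ]) xs)
      (cong (λ d → markList λs d (map part xs)) (trans (map-++ untag done _) (cong (λ m → map untag done ++ [ part x , m ])
        (cong leastFree (cong₂ (λ S P → S ++ (if hasBar λs (mval x) then dropMin P else P))
          (sym (map-filter proj₂ untag (λ d → val (proj₁ d) ≡ᵇ mval x) done)) (sym (map-filter proj₂ untag (λ d → suc (val (proj₁ d)) ≡ᵇ mval x) done)))))))

    same-snoc : ∀ v p m done → val p ≡ v → same v (done ++ [ p , m ]) ≡ same v done ++ [ m ]
    same-snoc v p m [] refl rewrite ≡ᵇ-refl v = refl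
    same-snoc v p m (d ∷ done) e with val (proj₁ d) ≡ᵇ v
    ... | true = cong (proj₂ d ∷_) (same-snoc v p m done e)
    ... | false = same-snoc v p m done e

    prev-snoc : ∀ v p m done → val p ≡ v → prev v (done ++ [ p , m ]) ≡ prev v done
    prev-snoc v p m [] refl rewrite >⇒≡ᵇ-false (≤-refl {suc v}) = refl
    prev-snoc v p m (d ∷ done) e with suc (val (proj₁ d)) ≡ᵇ v
    ... | true = cong (proj₂ d ∷_) (prev-snoc v p m done e)
    ... | false = prev-snoc v p m done e

    mark-block : ∀ λs v done ps rest i F {B} → All (λ p → val p ≡ v) ps → barred λs v done ≡ B → Inv (same v done ++ B) i F →
      markList λs done (ps ++ rest) ≡ markList λs (done ++ zip ps (positions i (fill (length ps) F))) rest
    mark-free : ∀ λs v done p ps rest i F F' {B} → val p ≡ v → All (λ p → val p ≡ v) ps → barred λs v done ≡ B → Inv (same v done ++ B) i F →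
      elemᵇ i (same v done ++ B) ≡ false → Agree (same v done ++ B) (suc i) F' → trues F' ≡ trues F →
      markList λs done (p ∷ ps ++ rest) ≡ markList λs (done ++ (p , i) ∷ zip ps (positions (suc i) (fill (length ps) F'))) rest
    mark-block λs v done [] rest i F h eb inv = cong (λ d → markList λs d rest) (sym (++-identityʳ done))
    mark-block λs v done (p ∷ ps) rest i (true ∷ F) h eb inv = mark-block λs v done (p ∷ ps) rest (suc i) F h eb (inv-skip inv)
    mark-block λs v done (p ∷ ps) rest i [] (e ∷ h) eb inv@(_ , _ , a , _) =
      mark-free λs v done p ps rest i [] [] e h eb inv (a i ≤-refl) (λ j l → a j (<⇒≤ l)) refl
    mark-block λs v done (p ∷ ps) rest i (false ∷ F) (e ∷ h) eb inv@(_ , _ , (e' , a) , _) =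
      mark-free λs v done p ps rest i (false ∷ F) F e h eb inv e' a refl
    mark-free λs v done p ps rest i F F' {B} refl h refl inv@(p≥ , low , _ , b) e' a et
      rewrite leastFree-least (same v done ++ B) p≥ low e' (m+n≤o⇒m≤o i b) =
      trans (mark-block λs v (done ++ [ p , i ]) ps rest (suc i) F' h
          (cong (λ P → if hasBar λs v then dropMin P else P) (prev-snoc v p i done refl))
          (subst (λ S → Inv (S ++ B) (suc i) F') (sym (same-snoc v p i done refl)) (inv-used {same v done} F F' inv a et)))
        (cong (λ d → markList λs d rest) (++-assoc done _ _))

    -- hasBar tells which of the nonempty sites v, v + 1, … have an overlined part.
    data Bars (λs : List Part) : ℕ → List Site → Set where
      []  : ∀ {v} → Bars λs v []
      _∷_ : ∀ {v o c s} → (∀ {m} → c ≡ suc m → hasBar λs v ≡ o) → Bars λs (suc v) s → Bars λs v ((o , c) ∷ s)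

    hasBar-++ : ∀ v xs ys → hasBar (xs ++ ys) v ≡ hasBar xs v ∨ hasBar ys v
    hasBar-++ v [] ys = refl
    hasBar-++ v (x ∷ xs) ys = trans (cong (((val x ≡ᵇ v) ∧ ovl x) ∨_) (hasBar-++ v xs ys)) (sym (∨-assoc ((val x ≡ᵇ v) ∧ ovl x) _ _))

    hasBar-none : ∀ v xs → All (λ p → (val p ≡ᵇ v) ≡ false) xs → hasBar xs v ≡ false
    hasBar-none v [] h = refl
    hasBar-none v (x ∷ xs) (e ∷ h) rewrite e = hasBar-none v xs h

    hasBar-expand : ∀ u v acc s → u < v → hasBar (expand v acc s) u ≡ hasBar acc u
    hasBar-expand u v acc [] l = refl
    hasBar-expand u v acc ((o , c) ∷ s) l = trans (hasBar-expand u (suc v) _ s (m≤n⇒m≤1+n l)) (trans (hasBar-++ u (block v o c) acc)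
      (cong (_∨ hasBar acc u) (hasBar-none u (block v o c) (All.map (λ { refl → >⇒≡ᵇ-false l }) (block-values v o c)))))

    hasBar-block : ∀ v o c acc → Below v acc → hasBar (block v o (suc c) ++ acc) v ≡ o
    hasBar-block v o c acc b = trans (cong (λ e → (e ∧ o) ∨ hasBar (replicate c (v , false) ++ acc) v) (≡ᵇ-refl v)) (trans (cong (o ∨_)
      (trans (hasBar-++ v (replicate c (v , false)) acc) (cong₂ _∨_ (unbarred c) (hasBar-none v acc (All.map <⇒≡ᵇ-false b))))) (∨-identityʳ o))
      where
      unbarred : ∀ c → hasBar (replicate c (v , false)) v ≡ false
      unbarred zero = refl
      unbarred (suc c) rewrite ∧-zeroʳ (v ≡ᵇ v) = unbarred c

    bars-expand : ∀ v acc s → Below v acc → Bars (expand v acc s) v s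
    bars-expand v acc [] b = []
    bars-expand v acc ((o , zero) ∷ s) b = (λ ()) ∷ bars-expand (suc v) _ s (below-block o 0 b)
    bars-expand v acc ((o , suc c) ∷ s) b = (λ _ → trans (hasBar-expand v (suc v) _ s ≤-refl) (hasBar-block v o c acc b)) ∷ bars-expand (suc v) _ s (below-block o (suc c) b)

    marks-++ : (P : Marked → Bool) → ∀ xs ys → map proj₂ (filterᵇ P (xs ++ ys)) ≡ map proj₂ (filterᵇ P xs) ++ map proj₂ (filterᵇ P ys)
    marks-++ P [] ys = refl
    marks-++ P (x ∷ xs) ys with P x
    ... | true = cong (proj₂ x ∷_) (marks-++ P xs ys)
    ... | false = marks-++ P xs ys

    marks-none : (P : Marked → Bool) → ∀ xs → All (λ d → P d ≡ false) xs → map proj₂ (filterᵇ P xs) ≡ []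
    marks-none P [] h = refl
    marks-none P (x ∷ xs) (e ∷ h) rewrite e = marks-none P xs h

    marks-zip : (P : Marked → Bool) → ∀ ps ms → All (λ p → ∀ m → P (p , m) ≡ true) ps → length ps ≡ length ms → map proj₂ (filterᵇ P (zip ps ms)) ≡ ms
    marks-zip P [] [] h e = refl
    marks-zip P (p ∷ ps) (m ∷ ms) (t ∷ h) e rewrite t m = cong (m ∷_) (marks-zip P ps ms h (suc-injective e))

    all-zip : {Q : A → Set} → ∀ {ps} (ms : List B) → All Q ps → All (λ d → Q (proj₁ d)) (zip ps ms)
    all-zip ms [] = []
    all-zip [] (q ∷ h) = []
    all-zip (m ∷ ms) (q ∷ h) = q ∷ all-zip ms h

    length-column : ∀ v o c t → length (block v o c) ≡ length (positions 1 (column o c t))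
    length-column v o c t = trans (length-block v o c) (sym (trans (length-positions 1 (column o c t)) (trues-fill c _)))

    mark-site : ∀ λs v o c t done rest → (∀ {m} → c ≡ suc m → hasBar λs v ≡ o) → prev v done ≡ positions 1 t → same v done ≡ [] →
      markList λs done (block v o c ++ rest) ≡ markList λs (done ++ zip (block v o c) (positions 1 (column o c t))) rest
    mark-site λs v o zero t done rest hb ep es = cong (λ d → markList λs d rest) (sym (++-identityʳ done))
    mark-site λs v o (suc c) t done rest hb ep es = trans (mark-block λs v done (block v o (suc c)) rest 1 F (block-values v o (suc c)) barred≡
        (subst (λ S → Inv (S ++ positions 1 F) 1 F) (sym es) (inv-positions F)))
      (cong (λ n → markList λs (done ++ zip (block v o (suc c)) (positions 1 (fill n F))) rest) (length-block v o (suc c)))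
      where
      F : List Bool
      F = if o then clear t else t
      barred≡ : barred λs v done ≡ positions 1 F
      barred≡ rewrite hb refl | ep = lem o
        where
        lem : ∀ o → (if o then dropMin (positions 1 t) else positions 1 t) ≡ positions 1 (if o then clear t else t)
        lem true = dropMin-positions 1 t
        lem false = refl

    mark-sites : ∀ λs v t done s → Bars λs v s → prev v done ≡ positions 1 t → All (λ d → val (proj₁ d) < v) done →
      markList λs done (ascending v s) ≡ done ++ marked v t s
    mark-sites λs v t done [] bars ep b = sym (++-identityʳ done)
    mark-sites λs v t done ((o , c) ∷ s) (hb ∷ bars) ep b = trans (mark-site λs v o c t done (ascending (suc v) s) hb ep (marks-none _ done (All.map <⇒≡ᵇ-false b)))
      (trans (mark-sites λs (suc v) (column o c t) (done ++ new) s bars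
          (trans (marks-++ _ done new) (cong₂ _++_ (marks-none _ done (All.map <⇒≡ᵇ-false b))
            (marks-zip _ (block v o c) (positions 1 (column o c t)) (All.map (λ { refl _ → ≡ᵇ-refl v }) (block-values v o c)) (length-column v o c t))))
          (++⁺ (All.map m≤n⇒m≤1+n b) (all-zip _ (All.map (λ e → s≤s (≤-reflexive e)) (block-values v o c)))))
        (++-assoc done new _))
      where
      new : List Marked
      new = zip (block v o c) (positions 1 (column o c t))

  untag-gordon : ∀ s → map untag (gordon (expand 1 [] s)) ≡ marked 1 [] s
  untag-gordon s = trans (untag-markAll (expand 1 [] s) [] (increasing (expand 1 [] s)))
    (trans (cong (markList (expand 1 [] s) []) (trans (part-increasing 0 (expand 1 [] s)) (sort-expand 1 [] s [] refl [])))
    (mark-sites (expand 1 [] s) 1 [] [] s (bars-expand 1 [] s []) refl []))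

  length-gordon : ∀ λs → length (gordon λs) ≡ length λs
  length-gordon λs = trans (sym (length-map untag (gordon λs))) (trans (cong length (untag-markAll λs [] (increasing λs)))
    (trans (lengths (map part (increasing λs)) []) (trans (cong length (part-increasing 0 λs)) (sorted λs))))
    where
    lengths : ∀ ps done → length (markList λs done ps) ≡ length done + length ps
    lengths [] done = sym (+-identityʳ _)
    lengths (p ∷ ps) done = trans (lengths ps _) (trans (cong (_+ length ps) (trans (length-++ done) (+-comm (length done) 1))) (sym (+-suc (length done) _)))
    insert : ∀ x ys → length (insertPart x ys) ≡ suc (length ys)
    insert x [] = refl
    insert x (y ∷ ys) with beforePart x y
    ... | true = refl
    ... | false = cong suc (insert x ys)
    sorted : ∀ λs → length (foldr insertPart [] λs) ≡ length λs
    sorted [] = refl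
    sorted (p ∷ λs) = trans (insert p (foldr insertPart [] λs)) (cong suc (sorted λs))

  row : ℕ → List Marked → List ℕ
  row j ms = map (λ d → val (proj₁ d)) (filterᵇ (λ d → proj₂ d ≡ᵇ j) ms)

  row-++ : ∀ j xs ys → row j (xs ++ ys) ≡ row j xs ++ row j ys
  row-++ j [] ys = refl
  row-++ j (x ∷ xs) ys with proj₂ x ≡ᵇ j
  ... | true = cong (val (proj₁ x) ∷_) (row-++ j xs ys)
  ... | false = row-++ j xs ys

  occupied : ℕ → List Bool → List ℕ
  occupied v [] = []
  occupied v (true ∷ bs) = v ∷ occupied (suc v) bs
  occupied v (false ∷ bs) = occupied (suc v) bs

  columns : List Bool → List Site → List (List Bool)
  columns prev [] = []
  columns prev ((o , c) ∷ s) = column o c prev ∷ columns (column o c prev) s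

  private
    single : ℕ → Bool → List ℕ
    single v true = [ v ]
    single v false = []

    row-none : ∀ j i ps t → j < i → row j (zip ps (positions i t)) ≡ []
    row-none j i [] t l = refl
    row-none j i (p ∷ ps) [] l = refl
    row-none j i (p ∷ ps) (true ∷ t) l rewrite >⇒≡ᵇ-false l = row-none j (suc i) ps t (m≤n⇒m≤1+n l)
    row-none j i (p ∷ ps) (false ∷ t) l = row-none j (suc i) (p ∷ ps) t (m≤n⇒m≤1+n l)

    row-zip : ∀ v j i ps t → All (λ p → val p ≡ v) ps → length ps ≡ length (positions i t) → row (i + j) (zip ps (positions i t)) ≡ single v (nth j t)
    row-zip v j i [] [] h e = cong (single v) (sym (nth-[] j))
      where
      nth-[] : ∀ j → nth j [] ≡ false
      nth-[] zero = refl
      nth-[] (suc j) = nth-[] j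
    row-zip v zero i [] (false ∷ t) h e = refl
    row-zip v (suc j) i [] (false ∷ t) h e = row-zip v j (suc i) [] t h e
    row-zip v zero i (p ∷ ps) (true ∷ t) (refl ∷ h) e rewrite +-identityʳ i | ≡ᵇ-refl i = cong (val p ∷_) (row-none i (suc i) ps t ≤-refl)
    row-zip v (suc j) i (p ∷ ps) (true ∷ t) (refl ∷ h) e rewrite +-suc i j | <⇒≡ᵇ-false (s≤s (m≤m+n i j)) = row-zip v j (suc i) ps t h (suc-injective e)
    row-zip v zero i (p ∷ ps) (false ∷ t) h e rewrite +-identityʳ i = row-none i (suc i) (p ∷ ps) t ≤-refl
    row-zip v (suc j) i (p ∷ ps) (false ∷ t) h e rewrite +-suc i j = row-zip v j (suc i) (p ∷ ps) t h e

  row-marked : ∀ j v t s → row (suc j) (marked v t s) ≡ occupied v (map (nth j) (columns t s))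
  row-marked j v t [] = refl
  row-marked j v t ((o , c) ∷ s) = trans (row-++ (suc j) (zip (block v o c) (positions 1 (column o c t))) _)
    (trans (cong₂ _++_ (row-zip v j 1 (block v o c) (column o c t) (block-values v o c) (length-column v o c t)) (row-marked j (suc v) (column o c t) s))
    (lem (nth j (column o c t))))
    where
    lem : ∀ b {bs} → single v b ++ occupied (suc v) bs ≡ occupied v (b ∷ bs)
    lem true = refl
    lem false = refl

  -- The sites with the least free mark, and the parts without this mark.
  shed : Bool → List Site → List Bool × List Site
  shed cov [] = [] , []
  shed cov ((o , c) ∷ s) =
    let b , r = peel cov o c
        bs , s' = shed b s
    in b ∷ bs , r ∷ s'

  shedRow : ℕ → List Site → List Bool
  shedRow zero s = proj₁ (shed false s)
  shedRow (suc j) s = shedRow j (proj₂ (shed false s))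

  -- An overline frees only the smallest mark of the previous site (`clear`). So the flag is spent
  -- when the previous site has the current mark, and is carried on to the larger marks when it has
  -- not.
  column-peel : ∀ o c t → let b , (o' , c') = peel (hd t) o c in hd (column o c t) ≡ b × tl (column o c t) ≡ column o' c' (tl t)
  column-peel o zero t = refl , refl
  column-peel false (suc zero) [] = refl , refl
  column-peel true (suc zero) [] = refl , refl
  column-peel false (suc (suc c)) [] = refl , refl
  column-peel true (suc (suc c)) [] = refl , refl
  column-peel false (suc zero) (false ∷ t) = refl , refl
  column-peel true (suc zero) (false ∷ t) = refl , refl
  column-peel false (suc (suc c)) (false ∷ t) = refl , refl
  column-peel true (suc (suc c)) (false ∷ t) = refl , refl
  column-peel true (suc c) (true ∷ t) = refl , refl
  column-peel false (suc c) (true ∷ t) = refl , refl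

  columns-hd : ∀ t s → map hd (columns t s) ≡ proj₁ (shed (hd t) s)
  columns-hd t [] = refl
  columns-hd t ((o , c) ∷ s) with column-peel o c t
  ... | e , _ = cong₂ _∷_ e (trans (columns-hd (column o c t) s) (cong (λ b → proj₁ (shed b s)) e))

  columns-tl : ∀ t s → map tl (columns t s) ≡ columns (tl t) (proj₂ (shed (hd t) s))
  columns-tl t [] = refl
  columns-tl t ((o , c) ∷ s) with column-peel o c t
  ... | e , e' = cong₂ _∷_ e' (trans (columns-tl (column o c t) s) (cong₂ columns e' (cong (λ b → proj₂ (shed b s)) e)))

  nth-columns : ∀ j s → map (nth j) (columns [] s) ≡ shedRow j s
  nth-columns zero s = columns-hd [] s
  nth-columns (suc j) s = trans (map-∘ (columns [] s)) (trans (cong (map (nth j)) (columns-tl [] s)) (nth-columns j (proj₂ (shed false s))))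

  row-gordon : ∀ j s → row (suc j) (map untag (gordon (expand 1 [] s))) ≡ occupied 1 (shedRow j s)
  row-gordon j s = trans (cong (row (suc j)) (untag-gordon s)) (trans (row-marked j 1 [] s) (cong (occupied 1) (nth-columns j s)))

  -- If the previous site has mark 1, this is its smallest mark and hence free for the overlined
  -- part. Consequently a cluster contains an overlined part only as its first one.
  overlined-marked : ∀ v t s → All (λ d → ovl (proj₁ d) ≡ true → proj₂ d ≡ 1) (marked v t s)
  overlined-marked v t [] = []
  overlined-marked v t ((o , c) ∷ s) = ++⁺ (site o c t) (overlined-marked (suc v) (column o c t) s)
    where
    plain : ∀ c ms → All (λ d → ovl (proj₁ d) ≡ true → proj₂ d ≡ 1) (zip (replicate c (v , false)) ms)
    plain zero ms = []
    plain (suc c) [] = []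
    plain (suc c) (m ∷ ms) = (λ ()) ∷ plain c ms
    site : ∀ o c t → All (λ d → ovl (proj₁ d) ≡ true → proj₂ d ≡ 1) (zip (block v o c) (positions 1 (column o c t)))
    site o zero t = []
    site false (suc c) t = plain (suc c) (positions 1 (column false (suc c) t))
    site true (suc c) [] = (λ _ → refl) ∷ plain c _
    site true (suc c) (true ∷ t) = (λ _ → refl) ∷ plain c _
    site true (suc c) (false ∷ t) = (λ _ → refl) ∷ plain c _

  firstOverlined : List Marked → Bool
  firstOverlined [] = false
  firstOverlined (d ∷ _) = ovl (proj₁ d)

  first-marked : ∀ v s → firstOverlined (marked v [] s) ≡ firstMark (marks false s) × (∀ {d ms} → marked v [] s ≡ d ∷ ms → proj₂ d ≡ 1)
  first-marked v [] = refl , λ ()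
  first-marked v ((o , zero) ∷ s) = first-marked (suc v) s
  first-marked v ((false , suc c) ∷ s) = refl , λ { refl → refl }
  first-marked v ((true , suc c) ∷ s) = refl , λ { refl → refl }

-- The cluster decomposition as chains, level by level

module Clusters where
  open import Defs using (Part; ovl; MPart; tag; mval; movl; mark; removeTag; extend; decomp; clusters; Vcount; clusterEven; clusterStartParity; clusterRIndex; clusterFullIndex; changes; isEvenℕ; count; gordon)
  open Counting using (odd)
  open Parity using (odd-+; isEvenℕ-odd; oddℤ-minus)
  open Cells using (Site; Cell; peel; ends; link; step; start; levels; parities; State; none; state-link)
  open FirstOverline using (Fine; []; cons; linked; fine-step₀; fine-start; index)
  open PairDeletion using (unmarked)
  open Sites
  open GordonMarking hiding (marked)
  open Overlines using (marks)
  open Paths using (firstMark)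
  open import Data.Integer using (+_)
  open import Data.List.Relation.Unary.All.Properties using (++⁻ʳ) renaming (map⁻ to all-map⁻)
  open import Data.List.Relation.Unary.AllPairs using (AllPairs; []; _∷_)
  import Data.List.Relation.Unary.AllPairs.Properties as AllPairs

  even : ℕ → Bool
  even n = not (odd n)

  near : ℕ → ℕ → Bool
  near v b = (b ≡ᵇ v) ∨ (b ≡ᵇ suc v)

  pick : ℕ → List ℕ → Maybe (ℕ × List ℕ)
  pick v [] = nothing
  pick v (b ∷ R) = if near v b then just (b , R) else Maybe.map (λ (b' , R') → b' , b ∷ R') (pick v R)

  -- A chain is given by its last value and its parity; a finished one by its
  -- number of extensions and its parity.
  ext : ℕ → Bool → List (List ℕ) → (ℕ × Bool) × List (List ℕ)
  ext v e [] = (0 , e) , []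
  ext v e (R ∷ Rs) with pick v R
  ... | nothing = (0 , e) , R ∷ Rs
  ... | just (b , R') = let (n , e') , Rs' = ext b (even b xor e) Rs in (suc n , e') , R' ∷ Rs'

  chains : List (ℕ × Bool) → List (List ℕ) → List (ℕ × Bool)
  chains [] Rs = []
  chains ((v , e) ∷ R) Rs = let x , Rs' = ext v e Rs in x ∷ chains R Rs'

  match : List (ℕ × Bool) → List ℕ → List Bool × List (ℕ × Bool)
  match [] R = [] , []
  match ((v , e) ∷ S) R with pick v R
  ... | nothing = let E , M = match S R in e ∷ E , M
  ... | just (b , R') = let E , M = match S R' in E , (b , even b xor e) ∷ M

  select : ℕ → List (ℕ × Bool) → List Bool
  select r X = map proj₂ (filterᵇ (λ x → proj₁ x ≡ᵇ r) X)

  -- The decomposition completes a cluster before it begins the next, whereas `match` extends all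
  -- chains by one mark. Both orders agree, because what a chain takes from a row depends only on
  -- what the chains before it took from that row.
  select-ended : ∀ S R Rs → select 0 (chains S (R ∷ Rs)) ≡ proj₁ (match S R)
  select-ended [] R Rs = refl
  select-ended ((v , e) ∷ S) R Rs with pick v R
  ... | nothing = cong (e ∷_) (select-ended S R Rs)
  ... | just (b , R') = select-ended S R' (proj₂ (ext b (even b xor e) Rs))

  select-extended : ∀ r S R Rs → select (suc r) (chains S (R ∷ Rs)) ≡ select r (chains (proj₂ (match S R)) Rs)
  select-extended r [] R Rs = refl
  select-extended r ((v , e) ∷ S) R Rs with pick v R
  ... | nothing = select-extended r S R Rs
  ... | just (b , R') with ext b (even b xor e) Rs
  ... | (n , e') , Rs' with n ≡ᵇ r
  ... | true = cong (e' ∷_) (select-extended r S R' Rs')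
  ... | false = select-extended r S R' Rs'

  pend : ℕ → Maybe Bool → List (ℕ × Bool)
  pend v (just x) = [ v , x ]
  pend v nothing = []

  entries : ℕ → List Cell → List (ℕ × Bool)
  entries v [] = []
  entries v ((a , _) ∷ cs) = pend v a ++ entries (suc v) cs

  rests : List Cell → List Site
  rests = map proj₂

  rests-step : ∀ ev p cov cs → rests (proj₂ (step ev p cov cs)) ≡ proj₂ (shed cov (rests cs))
  rests-step ev p cov [] = refl
  rests-step ev p cov ((a , o , c) ∷ cs) = cong (_ ∷_) (rests-step (not ev) _ (proj₁ (peel cov o c)) cs)

  rests-start : ∀ ev V cov s → rests (start ev V cov s) ≡ proj₂ (shed cov s)
  rests-start ev V cov [] = refl
  rests-start ev V cov ((o , c) ∷ s) = cong (_ ∷_) (rests-start (not ev) (o xor V) (proj₁ (peel cov o c)) s)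

  private
    near-next : ∀ v → near v (suc v) ≡ true
    near-next v rewrite ≡ᵇ-refl v = ∨-zeroʳ (suc v ≡ᵇ v)

    near-same : ∀ v → near v v ≡ true
    near-same v rewrite ≡ᵇ-refl v = refl

    pick-far : ∀ v w bs → suc v < w → pick v (occupied w bs) ≡ nothing
    pick-far v w [] l = refl
    pick-far v w (true ∷ bs) l rewrite >⇒≡ᵇ-false (<⇒≤ l) | >⇒≡ᵇ-false l | pick-far v (suc w) bs (m≤n⇒m≤1+n l) = refl
    pick-far v w (false ∷ bs) l = pick-far v (suc w) bs (m≤n⇒m≤1+n l)

    match-far : ∀ v p w bs S → suc v < w → match (pend v p ++ S) (occupied w bs) ≡ (ends p ++ proj₁ (match S (occupied w bs)) , proj₂ (match S (occupied w bs)))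
    match-far v nothing w bs S l = refl
    match-far v (just x) w bs S l rewrite pick-far v w bs l = refl

    match-near : ∀ v x b R S → near v b ≡ true → match ((v , x) ∷ S) (b ∷ R) ≡ (proj₁ (match S R) , (b , even b xor x) ∷ proj₂ (match S R))
    match-near v x b R S e rewrite e = refl

  -- A chain reaches only its own site and the next, so at most the pending chain and the one of the
  -- present site compete for a mark, and the pending one comes first. `Fine` ensures that every
  -- mark is taken.
  step-match : ∀ v p cov {a⁻} cs → Fine a⁻ cs → State p cov a⁻ →
    match (pend v p ++ entries (suc v) cs) (occupied (suc v) (proj₁ (shed cov (rests cs))))
      ≡ (proj₁ (step (even (suc v)) p cov cs) , entries (suc v) (proj₂ (step (even (suc v)) p cov cs)))
  step-match v nothing cov [] fi st = refl
  step-match v (just x) cov [] fi st = refl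
  step-match v p cov ((a , o , c) ∷ cs) (cons h h' fi) st = site (proj₁ (peel cov o c)) refl
    where
    bs : List Bool
    bs = proj₁ (shed (proj₁ (peel cov o c)) (rests cs))
    next : ∀ p' → State p' (proj₁ (peel cov o c)) a → match (pend (suc v) p' ++ entries (suc (suc v)) cs) (occupied (suc (suc v)) bs)
      ≡ (proj₁ (step (even (suc (suc v))) p' (proj₁ (peel cov o c)) cs) , entries (suc (suc v)) (proj₂ (step (even (suc (suc v))) p' (proj₁ (peel cov o c)) cs)))
    next p' st' = step-match (suc v) p' (proj₁ (peel cov o c)) cs fi st'
    site : ∀ b → proj₁ (peel cov o c) ≡ b → match (pend v p ++ pend (suc v) a ++ entries (suc (suc v)) cs) (occupied (suc v) (proj₁ (peel cov o c) ∷ bs))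
      ≡ (proj₁ (step (even (suc v)) p cov ((a , o , c) ∷ cs)) , entries (suc v) (proj₂ (step (even (suc v)) p cov ((a , o , c) ∷ cs))))
    site false eq with linked p a h h' st | next a (subst (λ b → State a b a) (sym eq) (state-link false false p a))
    ... | _ | e rewrite eq = trans (match-far v p (suc (suc v)) (proj₁ (shed false (rests cs))) (pend (suc v) a ++ entries (suc (suc v)) cs) ≤-refl) (cong (λ m → ends p ++ proj₁ m , proj₂ m) e)
    site true eq = used-mark p a (linked p a h h' st eq) (next _ (subst (λ b → State (proj₂ (proj₂ (link (even (suc v)) true p a))) b a) (sym eq) (state-link (even (suc v)) true p a)))
      where
      used-mark : ∀ p a → (∃ λ e → p ≡ just e ⊎ (p ≡ nothing × a ≡ just e)) →
        match (pend (suc v) (proj₂ (proj₂ (link (even (suc v)) true p a))) ++ entries (suc (suc v)) cs) (occupied (suc (suc v)) bs)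
          ≡ (proj₁ (step (even (suc (suc v))) (proj₂ (proj₂ (link (even (suc v)) true p a))) (proj₁ (peel cov o c)) cs)
            , entries (suc (suc v)) (proj₂ (step (even (suc (suc v))) (proj₂ (proj₂ (link (even (suc v)) true p a))) (proj₁ (peel cov o c)) cs))) →
        match (pend v p ++ pend (suc v) a ++ entries (suc (suc v)) cs) (occupied (suc v) (proj₁ (peel cov o c) ∷ bs))
          ≡ (proj₁ (step (even (suc v)) p cov ((a , o , c) ∷ cs)) , entries (suc v) (proj₂ (step (even (suc v)) p cov ((a , o , c) ∷ cs))))
      used-mark (just x) a _ e rewrite eq = trans (match-near v x (suc v) _ (pend (suc v) a ++ entries (suc (suc v)) cs) (near-next v))
        (cong (λ m → proj₁ m , (suc v , even (suc v) xor x) ∷ proj₂ m) e)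
      used-mark nothing (just x) _ e rewrite eq = trans (match-near (suc v) x (suc v) _ (entries (suc (suc v)) cs) (near-same v))
        (cong (λ m → proj₁ m , (suc v , even (suc v) xor x) ∷ proj₂ m) e)
      used-mark nothing nothing (_ , inj₁ ()) e
      used-mark nothing nothing (_ , inj₂ (_ , ())) e

  rows : ℕ → List Site → List (List ℕ)
  rows zero s = []
  rows (suc N) s = occupied 1 (proj₁ (shed false s)) ∷ rows N (proj₂ (shed false s))

  applyUpTo-cong : {A : Set} {f g : ℕ → A} → (∀ n → f n ≡ g n) → ∀ n → applyUpTo f n ≡ applyUpTo g n
  applyUpTo-cong h zero = refl
  applyUpTo-cong h (suc n) = cong₂ _∷_ (h 0) (applyUpTo-cong (h ∘ suc) n)

  select-levels : ∀ K N cs → K ≤ N → Fine nothing cs → applyUpTo (λ r → select r (chains (entries 1 cs) (rows N (rests cs)))) K ≡ levels K cs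
  select-levels zero N cs l fi = refl
  select-levels (suc K) (suc N) cs (s≤s l) fi with step-match 0 nothing false cs fi none
  ... | e = cong₂ _∷_ (trans (select-ended (entries 1 cs) R Rs) (cong proj₁ e))
    (trans (applyUpTo-cong (λ r → trans (select-extended r (entries 1 cs) R Rs)
        (cong₂ (λ S s → select r (chains S (rows N s))) (cong proj₂ e) (sym (rests-step false nothing false cs)))) K)
      (select-levels K N (proj₂ (step false nothing false cs)) l (fine-step₀ fi)))
    where
    R : List ℕ
    R = occupied 1 (proj₁ (shed false (rests cs)))
    Rs : List (List ℕ)
    Rs = rows N (proj₂ (shed false (rests cs)))

  private
    Apart : MPart → MPart → Set
    Apart x y = tag x ≢ tag y

    data Found (P : MPart → Bool) (q : MPart) : List MPart → Set where
      found : ∀ xs ys → All (λ x → P x ≡ false) xs → P q ≡ true → Found P q (xs ++ q ∷ ys)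

    find-just : ∀ P rem {q} → findᵇ P rem ≡ just q → Found P q rem
    find-just P (x ∷ xs) e with P x in eq
    find-just P (x ∷ xs) refl | true = found [] xs [] eq
    ... | false with find-just P xs e
    ... | found as bs h p = found (x ∷ as) bs (eq ∷ h) p

    find-nothing : (P : MPart → Bool) → ∀ rem → findᵇ P rem ≡ nothing → All (λ x → P x ≡ false) rem
    find-nothing P [] e = []
    find-nothing P (x ∷ xs) e with P x in eq
    ... | false = eq ∷ find-nothing P xs e

    differ : ∀ {m n} → m ≢ n → (m ≡ᵇ n) ≡ false
    differ {zero} {zero} h = ⊥-elim (h refl)
    differ {zero} {suc n} h = refl
    differ {suc m} {zero} h = refl
    differ {suc m} {suc n} h = differ (h ∘ cong suc)

    delete : {A : Set} {Q : A → Set} → ∀ xs {q ys} → All Q (xs ++ q ∷ ys) → All Q (xs ++ ys)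
    delete [] (_ ∷ h) = h
    delete (x ∷ xs) (p ∷ h) = p ∷ delete xs h

    delete-apart : ∀ xs {q ys} → AllPairs Apart (xs ++ q ∷ ys) → AllPairs Apart (xs ++ ys)
    delete-apart [] (_ ∷ u) = u
    delete-apart (x ∷ xs) (a ∷ u) = delete xs a ∷ delete-apart xs u

    removeTag-found : ∀ xs {q ys} → AllPairs Apart (xs ++ q ∷ ys) → removeTag (tag q) (xs ++ q ∷ ys) ≡ xs ++ ys
    removeTag-found [] {q} u rewrite ≡ᵇ-refl (tag q) = refl
    removeTag-found (x ∷ xs) (a ∷ u) rewrite differ (All.head (++⁻ʳ xs a)) = cong (x ∷_) (removeTag-found xs u)

    rowOf : ℕ → List MPart → List ℕ
    rowOf j rem = map mval (filterᵇ (λ q → mark q ≡ᵇ j) rem)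

    rowOf-other : ∀ j xs {q ys} → (mark q ≡ᵇ j) ≡ false → rowOf j (xs ++ q ∷ ys) ≡ rowOf j (xs ++ ys)
    rowOf-other j [] e rewrite e = refl
    rowOf-other j (x ∷ xs) e with mark x ≡ᵇ j
    ... | true = cong (mval x ∷_) (rowOf-other j xs e)
    ... | false = rowOf-other j xs e

    pick-found : ∀ j v xs {q ys} → All (λ x → ((mark x ≡ᵇ j) ∧ near v (mval x)) ≡ false) xs → ((mark q ≡ᵇ j) ∧ near v (mval q)) ≡ true →
      pick v (rowOf j (xs ++ q ∷ ys)) ≡ just (mval q , rowOf j (xs ++ ys))
    pick-found j v [] {q} h e with mark q ≡ᵇ j
    ... | true rewrite e = refl
    pick-found j v (x ∷ xs) {q} {ys} (h₀ ∷ h) e with mark x ≡ᵇ j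
    ... | true rewrite h₀ | pick-found j v xs {q} {ys} h e = refl
    ... | false = pick-found j v xs h e

    pick-none : ∀ j v xs → All (λ x → ((mark x ≡ᵇ j) ∧ near v (mval x)) ≡ false) xs → pick v (rowOf j xs) ≡ nothing
    pick-none j v [] h = refl
    pick-none j v (x ∷ xs) (h₀ ∷ h) with mark x ≡ᵇ j
    ... | true rewrite h₀ | pick-none j v xs h = refl
    ... | false = pick-none j v xs h

    rowsOf : ℕ → ℕ → List MPart → List (List ℕ)
    rowsOf r zero rem = []
    rowsOf r (suc N) rem = rowOf (suc r) rem ∷ rowsOf (suc r) N rem

    rowsOf-other : ∀ r N xs {q ys} → mark q ≤ r → rowsOf r N (xs ++ q ∷ ys) ≡ rowsOf r N (xs ++ ys)
    rowsOf-other r zero xs l = refl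
    rowsOf-other r (suc N) xs l = cong₂ _∷_ (rowOf-other (suc r) xs (<⇒≡ᵇ-false (s≤s l))) (rowsOf-other (suc r) N xs (m≤n⇒m≤1+n l))

    ext-[] : ∀ r N v e → ext v e (rowsOf r N []) ≡ ((0 , e) , rowsOf r N [])
    ext-[] r zero v e = refl
    ext-[] r (suc N) v e = refl

    evens : List MPart → Bool
    evens c = odd (count (λ x → isEvenℕ (mval x)) c)

    evens-∷ : ∀ q c → evens (q ∷ c) ≡ even (mval q) xor evens c
    evens-∷ q c with isEvenℕ (mval q) | isEvenℕ-odd (mval q)
    ... | true | e rewrite sym e = refl
    ... | false | e rewrite sym e = refl

    -- What extraction of a cluster must leave intact for the next one: `kept` protects the rows of
    -- marks up to r, in particular the starting parts, and `higher` says that only the first part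
    -- of a cluster has mark 1.
    record Extends (r N v : ℕ) (e : Bool) (rem : List MPart) (result : List MPart × List MPart) : Set₁ where
      field
        extended : ext v e (rowsOf r N rem) ≡ ((length (proj₁ result) , e xor evens (proj₁ result)) , rowsOf r N (proj₂ result))
        kept     : ∀ j → j ≤ r → rowOf j (proj₂ result) ≡ rowOf j rem
        apart    : AllPairs Apart (proj₂ result)
        shorter  : length (proj₂ result) ≤ length rem
        subset   : {Q : MPart → Set} → All Q rem → All Q (proj₁ result) × All Q (proj₂ result)
        higher   : All (λ q → r < mark q) (proj₁ result)
    open Extends

    stop : ∀ r N v e rem → ext v e (rowsOf r N rem) ≡ ((0 , e) , rowsOf r N rem) → AllPairs Apart rem → Extends r N v e rem ([] , rem)
    stop r N v e rem eq u = record { extended = trans eq (cong (λ e → (0 , e) , rowsOf r N rem) (sym (xor-identityʳ e))) ; kept = λ _ _ → refl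
      ; apart = u ; shorter = ≤-refl ; subset = [] ,_ ; higher = [] }

    ∧-true : ∀ a {b} → a ∧ b ≡ true → a ≡ true
    ∧-true true _ = refl

    length-delete : ∀ (xs : List MPart) {q ys} → suc (length (xs ++ ys)) ≡ length (xs ++ q ∷ ys)
    length-delete [] = refl
    length-delete (x ∷ xs) = cong suc (length-delete xs)

    ≡ᵇ-true : ∀ {m n} → (m ≡ᵇ n) ≡ true → m ≡ n
    ≡ᵇ-true {m} {n} e = ≡ᵇ⇒≡ m n (subst Data.Bool.T (sym e) _)

    extend-extends : ∀ f r N v e rem → length rem ≤ f → AllPairs Apart rem → All (λ q → mark q ≤ r + N) rem → Extends r N v e rem (extend f r v rem)
    extend-extends zero r N v e [] l u b = stop r N v e [] (ext-[] r N v e) u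
    extend-extends (suc f) r N v e rem l u b with findᵇ (λ q → (mark q ≡ᵇ suc r) ∧ ((mval q ≡ᵇ v) ∨ (mval q ≡ᵇ suc v))) rem in eq
    extend-extends (suc f) r zero v e rem l u b | nothing = stop r zero v e rem refl u
    extend-extends (suc f) r (suc N) v e rem l u b | nothing = stop r (suc N) v e rem
      (lem (pick-none (suc r) v rem (find-nothing _ rem eq))) u
      where
      lem : pick v (rowOf (suc r) rem) ≡ nothing → ext v e (rowsOf r (suc N) rem) ≡ ((0 , e) , rowsOf r (suc N) rem)
      lem e rewrite e = refl
    ... | just q with find-just _ rem eq
    extend-extends (suc f) r zero v e _ l u b | just q | found xs ys h p with All.head (++⁻ʳ xs b)
    ... | l' rewrite ≡ᵇ-true {mark q} (∧-true _ p) | +-identityʳ r = ⊥-elim (<-irrefl refl l')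
    extend-extends (suc f) r (suc N) v e _ l u b | just q | found xs ys h p
      rewrite removeTag-found xs {q} {ys} u
      with extend f (suc r) (mval q) (xs ++ ys)
        | extend-extends f (suc r) N (mval q) (even (mval q) xor e) (xs ++ ys)
            (≤-pred (subst (_≤ suc f) (sym (length-delete xs {q} {ys})) l)) (delete-apart xs u) (All.map (λ {x} → subst (mark x ≤_) (+-suc r N)) (delete xs b))
    ... | more , rem' | ih = record
      { extended = taken
      ; kept = λ j j≤r → trans (kept ih j (m≤n⇒m≤1+n j≤r)) (sym (rowOf-other j xs (trans (cong (_≡ᵇ j) mark≡) (>⇒≡ᵇ-false (s≤s j≤r)))))
      ; apart = apart ih
      ; shorter = ≤-trans (shorter ih) (≤-trans (n≤1+n _) (≤-reflexive (length-delete xs {q} {ys})))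
      ; subset = λ k → All.head (++⁻ʳ xs k) ∷ proj₁ (subset ih (delete xs k)) , proj₂ (subset ih (delete xs k))
      ; higher = ≤-reflexive (sym mark≡) ∷ All.map (≤-trans (n≤1+n _)) (higher ih)
      }
      where
      mark≡ : mark q ≡ suc r
      mark≡ = ≡ᵇ-true (∧-true _ p)
      taken : ext v e (rowsOf r (suc N) (xs ++ q ∷ ys)) ≡ ((suc (length more) , e xor evens (q ∷ more)) , rowsOf r (suc N) rem')
      taken rewrite pick-found (suc r) v xs {q} {ys} h p | rowsOf-other (suc r) N xs {q} {ys} (≤-reflexive mark≡) | extended ih | kept ih (suc r) ≤-refl | evens-∷ q more
        = cong (λ x → (suc (length more) , x) , rowOf (suc r) (xs ++ ys) ∷ rowsOf (suc r) N rem')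
            (trans (cong (_xor evens more) (xor-comm (even (mval q)) e)) (xor-assoc e (even (mval q)) (evens more)))

    info : List Part → List MPart → ℕ × Bool
    info λs [] = 0 , false
    info λs (q ∷ c) = length c , clusterEven λs (q ∷ c)

    initial : List Part → ℕ → ℕ × Bool
    initial λs v = v , even v xor odd (Vcount λs v)

    clusterEven-∷ : ∀ λs q c → clusterEven λs (q ∷ c) ≡ (even (mval q) xor odd (Vcount λs (mval q))) xor evens c
    clusterEven-∷ λs q c = trans (oddℤ-minus (+ count (λ x → isEvenℕ (mval x)) (q ∷ c)) (Vcount λs (mval q)))
      (trans (cong (_xor odd (Vcount λs (mval q))) (evens-∷ q c))
      (trans (xor-assoc (even (mval q)) (evens c) _) (trans (cong (even (mval q) xor_) (xor-comm (evens c) _)) (sym (xor-assoc (even (mval q)) _ (evens c))))))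

    rowOf-none : ∀ j xs → All (λ x → (mark x ≡ᵇ j) ≡ false) xs → rowOf j xs ≡ []
    rowOf-none j [] h = refl
    rowOf-none j (x ∷ xs) (e ∷ h) rewrite e = rowOf-none j xs h

    rowOf-first : ∀ j xs {q ys} → All (λ x → (mark x ≡ᵇ j) ≡ false) xs → (mark q ≡ᵇ j) ≡ true → rowOf j (xs ++ q ∷ ys) ≡ mval q ∷ rowOf j (xs ++ ys)
    rowOf-first j [] h e rewrite e = refl
    rowOf-first j (x ∷ xs) (h₀ ∷ h) e rewrite h₀ = rowOf-first j xs h e

    decomp-chains : ∀ λs f N rem → length rem ≤ f → AllPairs Apart rem → All (λ q → mark q ≤ suc N) rem →
      map (info λs) (decomp f rem) ≡ chains (map (initial λs) (rowOf 1 rem)) (rowsOf 1 N rem)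
    decomp-chains λs zero N [] l u b = refl
    decomp-chains λs (suc f) N rem l u b with findᵇ (λ q → mark q ≡ᵇ 1) rem in eq
    ... | nothing rewrite rowOf-none 1 rem (find-nothing _ rem eq) = refl
    ... | just q with find-just _ rem eq
    decomp-chains λs (suc f) N _ l u b | just q | found xs ys h p
      rewrite removeTag-found xs {q} {ys} u | rowOf-first 1 xs {q} {ys} h p | rowsOf-other 1 N xs {q} {ys} (≤-reflexive (≡ᵇ-true p))
      with extend (length (xs ++ q ∷ ys)) 1 (mval q) (xs ++ ys)
        | extend-extends (length (xs ++ q ∷ ys)) 1 N (mval q) (even (mval q) xor odd (Vcount λs (mval q))) (xs ++ ys)
            (≤-trans (n≤1+n _) (≤-reflexive (length-delete xs {q} {ys}))) (delete-apart xs u) (delete xs b)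
    ... | more , rem' | ex rewrite extended ex =
      cong₂ _∷_ (cong (length more ,_) (clusterEven-∷ λs q more))
        (trans (decomp-chains λs f N rem' (≤-trans (shorter ex) (≤-pred (subst (_≤ suc f) (sym (length-delete xs {q} {ys})) l))) (apart ex) (proj₂ (subset ex (delete xs b))))
          (cong (λ R → chains (map (initial λs) R) (rowsOf 1 N rem')) (kept ex 1 ≤-refl)))

    select-decomp : ∀ λs f r rem → map (clusterEven λs) (filterᵇ (λ c → length c ≡ᵇ suc r) (decomp f rem)) ≡ select r (map (info λs) (decomp f rem))
    select-decomp λs zero r rem = refl
    select-decomp λs (suc f) r rem with findᵇ (λ q → mark q ≡ᵇ 1) rem
    ... | nothing = refl
    ... | just q with extend (length rem) 1 (mval q) (removeTag (tag q) rem)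
    ... | more , rem' with length more ≡ᵇ r
    ... | true = cong (clusterEven λs (q ∷ more) ∷_) (select-decomp λs f r rem')
    ... | false = select-decomp λs f r rem'

    any-false : (P : MPart → Bool) → ∀ xs → All (λ x → P x ≡ false) xs → any P xs ≡ false
    any-false P [] h = refl
    any-false P (x ∷ xs) (e ∷ h) rewrite e = any-false P xs h

    -- The first cluster begins with the first part, and its other parts have marks above 1, so none
    -- of them is overlined.
    start-decomp : ∀ f N rem → length rem ≤ f → AllPairs Apart rem → All (λ q → mark q ≤ suc N) rem → (∀ {q r} → rem ≡ q ∷ r → mark q ≡ 1) →
      All (λ q → movl q ≡ true → mark q ≡ 1) rem → clusterStartParity (decomp f rem) ≡ firstOverlined (map untag rem)
    start-decomp zero N [] l u b h o = refl
    start-decomp (suc f) N [] l u b h o = refl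
    start-decomp (suc f) N (q ∷ rem) (s≤s l) (_ ∷ u) (_ ∷ b) h (_ ∷ o) rewrite h refl | ≡ᵇ-refl (tag q)
      with extend (suc (length rem)) 1 (mval q) rem | extend-extends (suc (length rem)) 1 N (mval q) true rem (n≤1+n _) u b
    ... | more , rem' | ex = trans (cong (movl q ∨_) (any-false movl more (All.zipWith (λ { {x} (k , m) → plainMark (movl x) k m }) (proj₁ (subset ex o) , higher ex)))) (∨-identityʳ (movl q))
      where
      plainMark : ∀ {m} b → (b ≡ true → m ≡ 1) → 1 < m → b ≡ false
      plainMark false k m = refl
      plainMark true k m with k refl
      plainMark true k (s≤s ()) | refl

    mark-bound : ∀ rem → ∃ λ B → All (λ q → mark q ≤ B) rem
    mark-bound [] = 0 , []
    mark-bound (q ∷ rem) with mark-bound rem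
    ... | B , b = mark q + B , m≤m+n (mark q) B ∷ All.map (λ l → ≤-trans l (m≤n+m B (mark q))) b

    rowsOf-gordon : ∀ s₀ i N s → (∀ j → shedRow j s ≡ shedRow (i + j) s₀) →
      rowsOf i N (gordon (expand 1 [] s₀)) ≡ rows N s
    rowsOf-gordon s₀ i zero s h = refl
    rowsOf-gordon s₀ i (suc N) s h = cong₂ _∷_
      (trans (rowOf-row (suc i)) (trans (row-gordon i s₀) (cong (occupied 1) (sym (trans (h 0) (cong (λ j → shedRow j s₀) (+-identityʳ i)))))))
      (rowsOf-gordon s₀ (suc i) N (proj₂ (shed false s)) (λ j → trans (h (suc j)) (cong (λ j → shedRow j s₀) (+-suc i j))))
      where
      rowOf-row : ∀ j → rowOf j (gordon (expand 1 [] s₀)) ≡ row j (map untag (gordon (expand 1 [] s₀)))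
      rowOf-row j = lem (gordon (expand 1 [] s₀))
        where
        lem : ∀ g → rowOf j g ≡ row j (map untag g)
        lem [] = refl
        lem (q ∷ g) with mark q ≡ᵇ j
        ... | true = cong (mval q ∷_) (lem g)
        ... | false = lem g

    count-cong : {A : Set} (p q : A → Bool) → ∀ {xs} → All (λ x → p x ≡ q x) xs → count p xs ≡ count q xs
    count-cong p q [] = refl
    count-cong p q {x ∷ xs} (e ∷ h) rewrite e with q x
    ... | true = cong suc (count-cong p q h)
    ... | false = count-cong p q h

    Vcount-expand : ∀ u v acc s → u < v → Vcount (expand v acc s) u ≡ Vcount acc u
    Vcount-expand u v acc [] l = refl
    Vcount-expand u v acc ((o , c) ∷ s) l = trans (Vcount-expand u (suc v) _ s (m≤n⇒m≤1+n l)) (trans (count-++ _ (block v o c) acc)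
      (cong (_+ Vcount acc u) (count-none _ (All.map (λ { {p} refl → trans (cong (ovl p ∧_) (above l)) (∧-zeroʳ (ovl p)) }) (block-values v o c)))))
      where
      above : ∀ {m n} → n < m → (m ≤ᵇ n) ≡ false
      above {suc m} {n} (s≤s l) = ≥⇒<ᵇ-false l

    overlines-block : ∀ v o c acc → (c ≡ 0 → o ≡ false) → odd (count ovl (block v o c ++ acc)) ≡ o xor odd (count ovl acc)
    overlines-block v o zero acc h rewrite h refl = refl
    overlines-block v o (suc c) acc h = trans (cong odd (count-++ ovl (block v o (suc c)) acc)) (trans (odd-+ (count ovl (block v o (suc c))) (count ovl acc))
      (cong (_xor odd (count ovl acc)) (flag o)))
      where
      none-left : ∀ c → count ovl (replicate c (v , false)) ≡ 0
      none-left zero = refl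
      none-left (suc c) = none-left c
      flag : ∀ o → odd (count ovl (block v o (suc c))) ≡ o
      flag true rewrite none-left c = refl
      flag false rewrite none-left c = refl

    Vcount-below : ∀ {v} acc → Below (suc v) acc → Vcount acc v ≡ count ovl acc
    Vcount-below acc b = count-cong _ ovl (All.map (λ { {p} (s≤s l) → trans (cong (ovl p ∧_) (within l)) (∧-true-right (ovl p)) }) b)
      where
      within : ∀ {m n} → m ≤ n → (m ≤ᵇ n) ≡ true
      within {zero} l = refl
      within {suc zero} (s≤s l) = refl
      within {suc (suc m)} {suc n} (s≤s l) = within {suc m} l
      ∧-true-right : ∀ b → b ∧ true ≡ b
      ∧-true-right true = refl
      ∧-true-right false = refl

    entries-start : ∀ v cov acc s → Below v acc → Sound s →
      map (initial (expand v acc s)) (occupied v (proj₁ (shed cov s))) ≡ entries v (start (even v) (odd (count ovl acc)) cov s)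
    entries-start v cov acc [] b sd = refl
    entries-start v cov acc ((o , c) ∷ s) b (h ∷ sd) rewrite sym (overlines-block v o c acc h)
      with proj₁ (peel cov o c) | entries-start (suc v) (proj₁ (peel cov o c)) (block v o c ++ acc) s (below-block o c b) sd
    ... | false | ih = ih
    ... | true | ih = cong₂ _∷_ (cong (λ n → v , even v xor odd n) (trans (Vcount-expand v (suc v) _ s ≤-refl) (Vcount-below _ (below-block o c b)))) ih

  clusterFullIndex-expand : ∀ K s → Sound s → clusterFullIndex (suc K) (expand 1 [] s) ≡ index (firstMark (marks false s)) (parities K s)
  clusterFullIndex-expand K s sd = cong sum (trans (sym (map-∘ (upTo K))) (trans (map-upTo (λ r → clusterRIndex λs (suc r)) K)
    (trans (applyUpTo-cong (λ r → cong₂ changes start≡ (trans (select-decomp λs (length λs) r g) (cong (select r) chains≡))) K)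
    (trans (sym (map-applyUpTo _ (changes (firstMark (marks false s))) K))
      (cong (map (changes (firstMark (marks false s)))) (select-levels K N cs (m≤m+n K B) (fine-start false false false s unmarked)))))))
    where
    λs : List Part
    λs = expand 1 [] s
    g : List MPart
    g = gordon λs
    cs : List Cell
    cs = start false false false s
    B N : ℕ
    B = proj₁ (mark-bound g)
    -- Enough rows to hold all marks and to cover the K indices.
    N = K + B
    fuel : length g ≤ length λs
    fuel = ≤-reflexive (length-gordon λs)
    distinct : AllPairs Apart g
    distinct = AllPairs.map⁻ (unique-gordon λs)
    bound : All (λ q → mark q ≤ suc N) g
    bound = All.map (λ l → ≤-trans l (≤-trans (m≤n+m B K) (n≤1+n N))) (proj₂ (mark-bound g))
    start≡ : clusterStartParity (clusters λs) ≡ firstMark (marks false s)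
    start≡ = trans (start-decomp (length λs) N g fuel distinct bound
        (λ { e → proj₂ (first-marked 1 s) (trans (sym (untag-gordon s)) (cong (map untag) e)) })
        (all-map⁻ (subst (All _) (sym (untag-gordon s)) (overlined-marked 1 [] s))))
      (trans (cong firstOverlined (untag-gordon s)) (proj₁ (first-marked 1 s)))
    firstRow : rowOf 1 g ≡ occupied 1 (proj₁ (shed false s))
    firstRow = proj₁ (∷-injective (rowsOf-gordon s 0 1 s (λ _ → refl)))
    chains≡ : map (info λs) (decomp (length λs) g) ≡ chains (entries 1 cs) (rows N (rests cs))
    chains≡ = trans (decomp-chains λs (length λs) N g fuel distinct bound)
      (cong₂ chains (trans (cong (map (initial λs)) firstRow) (entries-start 1 false [] s [] sd))
        (trans (rowsOf-gordon s 1 N (proj₂ (shed false s)) (λ _ → refl)) (cong (rows N) (sym (rests-start false false false s)))))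

-- The count of overpartitions, and the theorem

open Counting using (HasCount-map)
open GreedyDeletion using (moment)
open Overlines using (sizes)
open FirstOverline using (IsSites; HasCount-Sites)
open Sites
open Clusters using (clusterFullIndex-expand)
open Paths using (HasCount-GPath)

HasCount-TOvp : ∀ K l m n → HasCount (TOvp (suc K) l m n) (rhsCoef (suc K) l m n)
HasCount-TOvp K l m n = HasCount-map (expand 1 []) from to
  (λ { e (v , nm , _) (v' , nm' , _) → expand-injective (svalid-sound v) (svalid-sound v') nm nm' e })
  (HasCount-Sites K l m n)
  where
  sum≡ : ∀ s → sum (map val (expand 1 [] s)) ≡ moment 1 (sizes s)
  sum≡ s = trans (sum-expand 1 [] s) (+-identityʳ (moment 1 (sizes s)))
  length≡ : ∀ s → length (expand 1 [] s) ≡ sum (sizes s)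
  length≡ s = trans (length-expand 1 [] s) (+-identityʳ _)
  from : ∀ {s} → IsSites K l m n s → TOvp (suc K) l m n (expand 1 [] s)
  from {s} (v , nm , el , em , en) = (ovpOK-expand 0 [] s [] tt , trans (sum≡ s) en) , svalid-inBkk v
    , trans (length≡ s) em , trans (clusterFullIndex-expand K s (svalid-sound v)) el
  to : ∀ {λs} → TOvp (suc K) l m n λs → ∃ λ s → IsSites K l m n s × expand 1 [] s ≡ λs
  to {λs} ((ok , en) , bk , em , el) with sitesOf λs | expand-sitesOf λs ok | normal-sitesOf λs ok | sound-sitesOf λs
  ... | s | refl | nm | sd = s , (inBkk-svalid s sd bk , nm , trans (sym (clusterFullIndex-expand K s sd)) el
    , trans (sym (length≡ s)) em , trans (sym (sum≡ s)) en) , refl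

theorem1p7 : (k : ℕ) → 1 ≤ k → (l m n : ℕ) →
  HasCount (GPath k l m n) (rhsCoef k l m n)
    × HasCount (TOvp k l m n) (rhsCoef k l m n)
theorem1p7 (suc K) (s≤s _) l m n = HasCount-GPath K l m n , HasCount-TOvp K l m n
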